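{- Let $p$ be a prime, $q=p^n$ with $n\ge 1$, and let $S\subseteq \mathbb{F}_q$ with $\#S>2$. Then there exists a minimal value set polynomial $F\in\mathbb{F}_q[x]$ with $V_F=S$ if and only if $$S=a\cdot \mathcal{U}^v+b$$ for some $a,b,\mathcal{U},v,k$ such that: (i) $a,b\in\mathbb{F}_q$ with $a\neq 0$; (ii) $k\ge 1$ and $\mathcal{U}$ is an $\mathbb{F}_{p^k}$-subspace of $\mathbb{F}_q$ with $1\in\mathcal{U}$; (iii) $v$ is a positive integer dividing $p^k-1$.
   Context: For $F\in\mathbb{F}_q[x]$, the value set is $V_F=\{F(\alpha):\alpha\in\mathbb{F}_q\}$. A polynomial $F\in\mathbb{F}_q[x]$ of positive degree is a minimal value set polynomial (MVSP) over $\mathbb{F}_q$ if $\#V_F=\lfloor (q-1)/\deg F\rfloor+1$ (equivalently $\#V_F=\lceil q/\deg F\rceil$). For a nonempty subset $\mathcal{U}\subseteq\mathbb{F}_q$ and an integer $v\ge 1$, $\mathcal{U}^v=\{u^v: u\in\mathcal{U}\}$, and $a\cdot\mathcal{U}^v+b=\{a w+b: w\in\mathcal{U}^v\}$. Saying that $\mathcal{U}$ is an $\mathbb{F}_{p^k}$-subspace of $\mathbb{F}_q$ presupposes that $\mathbb{F}_{p^k}$ is a subfield of $\mathbb{F}_q$ (i.e. $k\mid n$). -}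

module Defs where

open import Algebra.Bundles using (CommutativeRing)
import Algebra.Properties.Semiring.Exp as Exp
open import Data.Fin.Base using (Fin)
import Data.Fin.Properties as Fin
open import Data.Fin.Subset using (Subset; ∣_∣; ⊤) renaming (_∈_ to _∈ᶠ_)
open import Data.Fin.Subset.Properties using () renaming (_∈?_ to _∈ᶠ?_)
open import Data.List.Base using (List; []; _∷_)
open import Data.Nat.Base as ℕ using (ℕ; zero; suc; NonZero)
open import Data.Nat.DivMod using (_/_)
open import Data.Product.Base using (Σ-syntax; ∃-syntax; _×_)
open import Data.Vec.Base using (tabulate)
open import Function.Bundles using (Inverse)
open import Level using (Level; _⊔_) renaming (suc to lsuc)
open import Relation.Binary.PropositionalEquality as ≡ using (_≡_)
open import Relation.Nullary.Decidable using (⌊_⌋; _×-dec_)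
open import Relation.Nullary.Negation using (¬_)

record FiniteField (c ℓ : Level) (q : ℕ) : Set (lsuc (c ⊔ ℓ)) where
  field
    commutativeRing : CommutativeRing c ℓ

  open CommutativeRing commutativeRing public

  field
    1≉0         : ¬ (1# ≈ 0#)
    invertible  : ∀ x → ¬ (x ≈ 0#) → ∃[ y ] x * y ≈ 1#
    enumeration : Inverse setoid (≡.setoid (Fin q))

  index : Carrier → Fin q
  index = Inverse.to enumeration

  element : Fin q → Carrier
  element = Inverse.from enumeration

module Over {c ℓ : Level} {q : ℕ} (K : FiniteField c ℓ q) where

  open FiniteField K
  open Exp semiring using (_^_)

  -- A subset of the field is a subset of the index set Fin q, transported
  -- along the enumeration. Hence membership is decidable and respects _≈_,
  -- equality of subsets is _≡_, and cardinality is the library's ∣_∣.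

  infix 4 _∈_

  _∈_ : Carrier → Subset q → Set
  x ∈ U = index x ∈ᶠ U

  image : (Carrier → Carrier) → Subset q → Subset q
  image f U = tabulate λ i →
    ⌊ Fin.any? (λ j → (j ∈ᶠ? U) ×-dec (i Fin.≟ index (f (element j)))) ⌋

  powers : Subset q → ℕ → Subset q
  powers U v = image (λ u → u ^ v) U

  affine : Carrier → Subset q → Carrier → Subset q
  affine a W b = image (λ w → a * w + b) W

  -- Coefficient lists, constant term first; trailing zeros are allowed, so
  -- one polynomial has many representatives. coeff, HasDegree and eval do
  -- not depend on the representative.

  Poly : Set c
  Poly = List Carrier

  coeff : Poly → ℕ → Carrier
  coeff []       _       = 0#
  coeff (a ∷ _)  zero    = a
  coeff (_ ∷ as) (suc i) = coeff as i

  eval : Poly → Carrier → Carrier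
  eval []       x = 0#
  eval (a ∷ as) x = a + x * eval as x

  HasDegree : Poly → ℕ → Set ℓ
  HasDegree F d = ¬ (coeff F d ≈ 0#) × (∀ i → d ℕ.< i → coeff F i ≈ 0#)

  valueSet : Poly → Subset q
  valueSet F = image (eval F) ⊤

  IsMVSP : Poly → Set ℓ
  IsMVSP F = Σ[ d ∈ ℕ ] Σ[ d≢0 ∈ NonZero d ]
    HasDegree F d × ∣ valueSet F ∣ ≡ _/_ (q ℕ.∸ 1) d {{d≢0}} ℕ.+ 1

  record IsSubfield (L : Subset q) : Set (c ⊔ ℓ) where
    field
      0∈        : 0# ∈ L
      1∈        : 1# ∈ L
      +-closed  : ∀ {x y} → x ∈ L → y ∈ L → x + y ∈ L
      -‿closed  : ∀ {x} → x ∈ L → - x ∈ L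
      *-closed  : ∀ {x y} → x ∈ L → y ∈ L → x * y ∈ L
      ⁻¹-closed : ∀ {x y} → x ∈ L → x * y ≈ 1# → y ∈ L

  record IsSubspace (L U : Subset q) : Set c where
    field
      0∈       : 0# ∈ U
      +-closed : ∀ {x y} → x ∈ U → y ∈ U → x + y ∈ U
      *-closed : ∀ {s x} → s ∈ L → x ∈ U → s * x ∈ U

  -- U is an 𝔽_m-subspace: a finite field has at most one subfield with m
  -- elements, so quantifying over L existentially picks out "the" 𝔽_m.
  IsSubspaceOver𝔽 : ℕ → Subset q → Set (c ⊔ ℓ)
  IsSubspaceOver𝔽 m U = ∃[ L ] IsSubfield L × ∣ L ∣ ≡ m × IsSubspace L U

{-# OPTIONS --safe #-}
module Submission where

open import Algebra.Bundles using (CommutativeRing; RawRing)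
open import Level using (_⊔_) renaming (suc to lsuc)
open import Data.Product.Base using (_,_; _×_; ∃-syntax; proj₁; proj₂)
open import Relation.Nullary.Decidable using (Dec)
open import Relation.Nullary.Negation using (¬_; contradiction)
open import Algebra.Structures using (IsCommutativeRing)
open import Data.Fin.Base using (Fin)
open import Data.Nat.Base as ℕ using (ℕ; zero; suc; z≤n; s≤s)
open import Data.Nat.Primality using (Prime)
open import Relation.Binary.PropositionalEquality as ≡ using (_≡_; _≢_)
open import Defs using (FiniteField; module FiniteField; module Over)
open import Data.Fin.Subset using (Subset; ∣_∣)
open import Function.Bundles using (_⇔_)

-- Let T be the monic polynomial whose roots are the values of F, d = deg F and s = deg T. As F is a minimal value
-- set polynomial, T(F) = (X^q − X) H with (s − 1) d < q, hence deg H < d, and an identity between polynomials in F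
-- whose coefficients have degree below d may be compared digit by digit in base F. Comparing the derivatives
-- gives, after a translation of F and T, that T(F) = κ (X^q − X) F′. From there one descends: at level K, with
-- P = p^K, there are polynomials with a^P + x b^P = f(F), a + x^(q/P) b = G(F) and κ f + T f′ = κ G^P. Digit
-- comparison shows that b F^r, (a − g F) F^r and y^r (G − g y) are p-th powers for suitable g and r, which leads to level
-- K + 1. The descent ends when G is linear, and then T has one of two shapes: either T = t y + c y^s, or
-- z T(z^v) = z^v A(z) with A additive. In the first case the nonzero roots of T are a coset of the group of
-- (s − 1)-st roots of unity, that is, v-th powers. In the second case the sets {z : T(β z^v) = 0} are kernels of linearised
-- polynomials; their average size over β is so large that one of them is a subspace U of the largest possible
-- dimension, and the set of values is β U^v.
--
-- Conversely, the polynomial A with root set U is linearised and right-divides X^q − X with respect to composition,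
-- X^q − X = B ∘ A. Then A ∘ B = X^q − X as well, so U is the set of values of B, whose degree is q / #U, and
-- F = a B^v + b is the required polynomial.

-- The descent computes a p-adic expansion. If the value set is to be a translate of β U^v, every
-- level must add one base-p digit `r` to `w`, and w + 1 approaches 1/v. Neither v nor the exponents
-- of T are known in advance. The number v appears as the inverse of w + 1 modulo p^K at the first
-- stop, that is, when a nonzero g must be split off for the first time; from then on degree
-- estimates force v (w + 1) ≡ 1 modulo each further power of p. They concern the quotient Q = b^v /
-- F^t, whose degree is so small that F Q′ = c F′Q is possible only for c = 0.
--
-- Two obstacles shape the details. Divided by F, the polynomial F′b leaves a remainder C₀, which
-- disturbs the comparison when w = 0; it is removed by translating F or excluded by degrees, and so
-- the shape of T is found only up to translation. And at the end nothing says that the order k of p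
-- modulo v divides n: the field fixed by z ↦ z^(p^k) has p^gcd(k, n) elements, and only the size of
-- a large kernel excludes a proper divisor of k.

-- Commutative rings: a solver with integer coefficients, multiples of one, the Frobenius map.

module RingTools {c ℓ} (R : CommutativeRing c ℓ) where

  open import Level using (0ℓ)
  import Data.Nat.Properties as ℕ
  open import Data.Nat.Divisibility using (_∣_; divides; ∣⇒≤; m∣m*n)
  open import Data.Nat.Combinatorics using (_C_; nCn≡1; k![n∸k]!∣n!; nCk≡n!/k![n-k]!; nCk≡nC[n∸k])
  open import Data.Nat.Primality using (euclidsLemma; prime⇒nonZero; prime⇒nonTrivial)
  open import Data.Nat.DivMod using (m*[n/m]≡n)
  open import Data.Integer.Base as ℤ using (ℤ; +_; -[1+_])
  import Data.Integer.Properties as ℤ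
  import Data.Sign.Base as Sign
  open import Data.Fin.Base as Fin using (Fin; toℕ)
  import Data.Fin.Properties as Fin
  open import Data.Maybe.Base using (Maybe; just; nothing)
  open import Data.Sum.Base using (inj₁; inj₂)
  open import Relation.Nullary.Decidable using (yes; no)

  open CommutativeRing R public
    renaming (zero to *-zero) hiding (_≉_)
  open import Algebra.Properties.Semiring.Exp semiring public
    using (_^_; ^-congˡ; ^-homo-*; ^-assocʳ)
  open import Algebra.Properties.CommutativeSemiring.Exp commutativeSemiring public
    using (^-distrib-*)
  open import Algebra.Properties.Semiring.Mult semiring
    using (×-homo-+; ×1-homo-*) renaming (_×_ to infixr 8 _·_)
  open import Algebra.Properties.Semiring.Mult.TCOptimised semiring
    using (1+×) renaming (_×_ to _×′_; ×-homo-+ to ×′-homo-+; ×1-homo-* to ×′1-homo-*)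
  open import Algebra.Properties.Ring ring public
    using (-‿distribˡ-*; -‿distribʳ-*)
  open import Algebra.Properties.Group +-group public
    using () renaming (⁻¹-involutive to -‿involutive; ε⁻¹≈ε to -0≈0)
  open import Algebra.Properties.AbelianGroup +-abelianGroup
    using (⁻¹-∙-comm)
  open import Algebra.Solver.Ring.AlmostCommutativeRing
    using (_-Raw-AlmostCommutative⟶_; fromCommutativeRing)
  open import Relation.Binary.Reasoning.Setoid setoid public

  infix 4 _≉_
  _≉_ : Carrier → Carrier → Set ℓ
  x ≉ y = ¬ (x ≈ y)

  -- The multiple `_×′_` makes `1 ×′ 1#` equal to `1#` by computation, so that `con (+ 1)` in a
  -- solved equation is `1#` itself. The multiples `ι` of the binomial theorem end in a summand
  -- `0#`, which is why `ι 1` is entered as a sum in solver calls.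
  ⟦_⟧ℤ : ℤ → Carrier
  ⟦ + n ⟧ℤ      = n ×′ 1#
  ⟦ -[1+ n ] ⟧ℤ = - (suc n ×′ 1#)

  private

    neg-homo : ∀ i → ⟦ ℤ.- i ⟧ℤ ≈ - ⟦ i ⟧ℤ
    neg-homo (+ zero)   = sym -0≈0
    neg-homo (+ suc n)  = refl
    neg-homo (-[1+ n ]) = sym (-‿involutive _)

    [x+y]-[x+z] : ∀ x y z → y - z ≈ (x + y) - (x + z)
    [x+y]-[x+z] x y z = sym (begin
      (x + y) + - (x + z)     ≈⟨ +-congˡ (⁻¹-∙-comm x z) ⟨
      (x + y) + (- x + - z)   ≈⟨ +-congʳ (+-comm x y) ⟩
      (y + x) + (- x + - z)   ≈⟨ +-assoc y x _ ⟩
      y + (x + (- x + - z))   ≈⟨ +-congˡ (+-assoc x _ _) ⟨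
      y + ((x + - x) + - z)   ≈⟨ +-congˡ (+-congʳ (-‿inverseʳ x)) ⟩
      y + (0# + - z)          ≈⟨ +-congˡ (+-identityˡ _) ⟩
      y + - z                 ∎)

    ⊖-homo : ∀ m n → ⟦ m ℤ.⊖ n ⟧ℤ ≈ (m ×′ 1#) - (n ×′ 1#)
    ⊖-homo m zero = sym (trans (+-congˡ -0≈0) (+-identityʳ _))
    ⊖-homo zero (suc n) = sym (+-identityˡ _)
    ⊖-homo (suc m) (suc n) = begin
      ⟦ suc m ℤ.⊖ suc n ⟧ℤ              ≡⟨ ≡.cong ⟦_⟧ℤ (ℤ.[1+m]⊖[1+n]≡m⊖n m n) ⟩
      ⟦ m ℤ.⊖ n ⟧ℤ                      ≈⟨ ⊖-homo m n ⟩
      (m ×′ 1#) - (n ×′ 1#)             ≈⟨ [x+y]-[x+z] 1# _ _ ⟩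
      (1# + m ×′ 1#) - (1# + n ×′ 1#)   ≈⟨ +-cong (1+× m 1#) (-‿cong (1+× n 1#)) ⟨
      (suc m ×′ 1#) - (suc n ×′ 1#)     ∎

    add-homo : ∀ i j → ⟦ i ℤ.+ j ⟧ℤ ≈ ⟦ i ⟧ℤ + ⟦ j ⟧ℤ
    add-homo (+ m)    (+ n)    = ×′-homo-+ 1# m n
    add-homo (+ m)    -[1+ n ] = ⊖-homo m (suc n)
    add-homo -[1+ m ] (+ n)    = trans (⊖-homo n (suc m)) (+-comm _ _)
    add-homo -[1+ m ] -[1+ n ] = begin
      - (suc (suc (m ℕ.+ n)) ×′ 1#)           ≡⟨ ≡.cong (λ k → - (suc k ×′ 1#)) (≡.sym (ℕ.+-suc m n)) ⟩
      - ((suc m ℕ.+ suc n) ×′ 1#)             ≈⟨ -‿cong (×′-homo-+ 1# (suc m) (suc n)) ⟩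
      - (suc m ×′ 1# + suc n ×′ 1#)           ≈⟨ ⁻¹-∙-comm _ _ ⟨
      - (suc m ×′ 1#) + - (suc n ×′ 1#)       ∎

    ◃-pos : ∀ n → ⟦ Sign.+ ℤ.◃ n ⟧ℤ ≈ n ×′ 1#
    ◃-pos zero    = refl
    ◃-pos (suc n) = refl

    ◃-neg : ∀ n → ⟦ Sign.- ℤ.◃ n ⟧ℤ ≈ - (n ×′ 1#)
    ◃-neg zero    = sym -0≈0
    ◃-neg (suc n) = refl

    mul-homo : ∀ i j → ⟦ i ℤ.* j ⟧ℤ ≈ ⟦ i ⟧ℤ * ⟦ j ⟧ℤ
    mul-homo (+ m)    (+ n)    = trans (◃-pos (m ℕ.* n)) (×′1-homo-* m n)
    mul-homo (+ m)    -[1+ n ] = begin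
      _                                ≈⟨ ◃-neg (m ℕ.* suc n) ⟩
      - ((m ℕ.* suc n) ×′ 1#)          ≈⟨ -‿cong (×′1-homo-* m (suc n)) ⟩
      - ((m ×′ 1#) * (suc n ×′ 1#))    ≈⟨ -‿distribʳ-* _ _ ⟩
      (m ×′ 1#) * - (suc n ×′ 1#)      ∎
    mul-homo -[1+ m ] (+ n)    = begin
      _                                ≈⟨ ◃-neg (suc m ℕ.* n) ⟩
      - ((suc m ℕ.* n) ×′ 1#)          ≈⟨ -‿cong (×′1-homo-* (suc m) n) ⟩
      - ((suc m ×′ 1#) * (n ×′ 1#))    ≈⟨ -‿distribˡ-* _ _ ⟩
      - (suc m ×′ 1#) * (n ×′ 1#)      ∎
    mul-homo -[1+ m ] -[1+ n ] = begin
      _                                     ≈⟨ ◃-pos (suc m ℕ.* suc n) ⟩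
      (suc m ℕ.* suc n) ×′ 1#               ≈⟨ ×′1-homo-* (suc m) (suc n) ⟩
      (suc m ×′ 1#) * (suc n ×′ 1#)         ≈⟨ -‿involutive _ ⟨
      - (- ((suc m ×′ 1#) * (suc n ×′ 1#))) ≈⟨ -‿cong (-‿distribʳ-* _ _) ⟩
      - ((suc m ×′ 1#) * - (suc n ×′ 1#))   ≈⟨ -‿distribˡ-* _ _ ⟩
      - (suc m ×′ 1#) * - (suc n ×′ 1#)     ∎

    ℤ-rawRing : RawRing 0ℓ 0ℓ
    ℤ-rawRing = record
      { Carrier = ℤ ; _≈_ = _≡_ ; _+_ = ℤ._+_ ; _*_ = ℤ._*_ ; -_ = ℤ.-_
      ; 0# = ℤ.0ℤ ; 1# = ℤ.1ℤ }

    ℤ⟶R : ℤ-rawRing -Raw-AlmostCommutative⟶ fromCommutativeRing R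
    ℤ⟶R = record
      { ⟦_⟧ = ⟦_⟧ℤ ; +-homo = add-homo ; *-homo = mul-homo ; -‿homo = neg-homo
      ; 0-homo = refl ; 1-homo = refl }

    ℤ-dec : ∀ i j → Maybe (⟦ i ⟧ℤ ≈ ⟦ j ⟧ℤ)
    ℤ-dec i j with i ℤ.≟ j
    ... | yes ≡.refl = just refl
    ... | no _       = nothing

  open import Algebra.Solver.Ring ℤ-rawRing (fromCommutativeRing R) ℤ⟶R ℤ-dec public
    using (solve; _:=_; _:+_; _:*_; _:-_; :-_; _:^_; con)

  ι : ℕ → Carrier
  ι n = n · 1#

  ι-homo-+ : ∀ m n → ι (m ℕ.+ n) ≈ ι m + ι n
  ι-homo-+ = ×-homo-+ 1#

  ι-homo-* : ∀ m n → ι (m ℕ.* n) ≈ ι m * ι n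
  ι-homo-* = ×1-homo-*

  ι1≈1 : ι 1 ≈ 1#
  ι1≈1 = +-identityʳ 1#

  ·≈ι* : ∀ n x → n · x ≈ ι n * x
  ·≈ι* zero    x = sym (zeroˡ x)
  ·≈ι* (suc n) x = trans (+-cong (sym (*-identityˡ x)) (·≈ι* n x)) (sym (distribʳ x 1# (ι n)))

  x-y≈0⇒x≈y : ∀ {x y} → x - y ≈ 0# → x ≈ y
  x-y≈0⇒x≈y {x} {y} e = begin
    x           ≈⟨ solve 2 (λ x y → x := (x :- y) :+ y) refl x y ⟩
    (x - y) + y ≈⟨ +-congʳ e ⟩
    0# + y      ≈⟨ +-identityˡ y ⟩
    y           ∎

  x≈y⇒x-y≈0 : ∀ {x y} → x ≈ y → x - y ≈ 0#
  x≈y⇒x-y≈0 {x} {y} e = trans (+-congʳ e) (-‿inverseʳ y)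

  0^ : ∀ n → 1 ℕ.≤ n → 0# ^ n ≈ 0#
  0^ (suc n) _ = zeroˡ _

  1^ : ∀ n → 1# ^ n ≈ 1#
  1^ zero    = refl
  1^ (suc n) = trans (*-identityˡ _) (1^ n)

  ^-swap : ∀ x m n → (x ^ m) ^ n ≈ (x ^ n) ^ m
  ^-swap x m n = trans (^-assocʳ x m n) (trans (reflexive (≡.cong (x ^_) (ℕ.*-comm m n))) (sym (^-assocʳ x n m)))

  module Char {p : ℕ} (pr : Prime p) (char : ι p ≈ 0#) where

    open import Algebra.Properties.CommutativeSemiring.Binomial commutativeSemiring
      using (theorem; binomialTerm)
    open import Algebra.Properties.Semiring.Sum semiring using (sum)

    private instance
      p≢0 : ℕ.NonZero p
      p≢0 = prime⇒nonZero pr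

    ι-∣ : ∀ {n} → p ∣ n → ι n ≈ 0#
    ι-∣ (divides k ≡.refl) = trans (ι-homo-* k p) (trans (*-congˡ char) (zeroʳ _))

    private

      p∤k! : ∀ k → k ℕ.< p → ¬ (p ∣ (k ℕ.!))
      p∤k! zero    k<p d = ℕ.<⇒≱ (ℕ.nonTrivial⇒n>1 p {{prime⇒nonTrivial pr}}) (∣⇒≤ d)
      p∤k! (suc k) k<p d with euclidsLemma (suc k) (k ℕ.!) pr d
      ... | inj₁ e = ℕ.<⇒≱ k<p (∣⇒≤ e)
      ... | inj₂ e = p∤k! k (ℕ.<-trans (ℕ.n<1+n k) k<p) e

      p∣p! : p ∣ (p ℕ.!)
      p∣p! = helper p {{p≢0}}
        where
        helper : ∀ n .{{_ : ℕ.NonZero n}} → n ∣ (n ℕ.!)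
        helper (suc n) = m∣m*n _

      -- `p` divides p! = k! (p - k)! C(p, k) but neither of the two smaller factorials.
      p∣pCk : ∀ k → 1 ℕ.≤ k → k ℕ.< p → p ∣ p C k
      p∣pCk k 1≤k k<p with euclidsLemma _ (p C k) pr (≡.subst (p ∣_) p!≡ p∣p!)
        where
        instance _ = ℕ._!*_!≢0 k (p ℕ.∸ k)
        p!≡ : (p ℕ.!) ≡ ((k ℕ.!) ℕ.* ((p ℕ.∸ k) ℕ.!)) ℕ.* (p C k)
        p!≡ = ≡.trans (≡.sym (m*[n/m]≡n (k![n∸k]!∣n! (ℕ.<⇒≤ k<p))))
                (≡.cong ((k ℕ.!) ℕ.* ((p ℕ.∸ k) ℕ.!) ℕ.*_) (≡.sym (nCk≡n!/k![n-k]! (ℕ.<⇒≤ k<p))))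
      ... | inj₂ e = e
      ... | inj₁ e with euclidsLemma (k ℕ.!) _ pr e
      ...   | inj₁ e′ = contradiction e′ (p∤k! k k<p)
      ...   | inj₂ e′ = contradiction e′ (p∤k! (p ℕ.∸ k) (ℕ.∸-monoʳ-< 1≤k (ℕ.<⇒≤ k<p)))

      last-sum : ∀ {n} (t : Fin (suc n) → Carrier) → (∀ i → toℕ i ℕ.< n → t i ≈ 0#) →
                 sum t ≈ t (Fin.fromℕ n)
      last-sum {zero}  t _ = +-identityʳ _
      last-sum {suc n} t z = begin
        t Fin.zero + sum (λ i → t (Fin.suc i)) ≈⟨ +-congʳ (z Fin.zero (s≤s z≤n)) ⟩
        0# + sum (λ i → t (Fin.suc i))         ≈⟨ +-identityˡ _ ⟩
        sum (λ i → t (Fin.suc i))              ≈⟨ last-sum (λ i → t (Fin.suc i)) (λ i i<n → z (Fin.suc i) (s≤s i<n)) ⟩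
        t (Fin.fromℕ (suc n))                  ∎

      nC0 : ∀ n → n C 0 ≡ 1
      nC0 n = ≡.trans (nCk≡nC[n∸k] {0} {n} z≤n) (nCn≡1 n)

      -- The exponent is a variable equal to `p`, so that it can be matched as a successor; only the
      -- two outer binomial terms survive.
      frob : ∀ n → n ≡ p → ∀ x y → (x + y) ^ n ≈ x ^ n + y ^ n
      frob zero e with () ← ≡.subst ℕ.NonZero (≡.sym e) p≢0
      frob (suc n) e x y = begin
        (x + y) ^ suc n                 ≈⟨ theorem (suc n) x y ⟩
        sum term                        ≈⟨ +-cong first rest ⟩
        y ^ suc n + x ^ suc n           ≈⟨ +-comm _ _ ⟩
        x ^ suc n + y ^ suc n           ∎
        where
        term : Fin (suc (suc n)) → Carrier
        term = binomialTerm x y (suc n)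
        first : term Fin.zero ≈ y ^ suc n
        first = begin
          (suc n C 0) · (1# * y ^ suc n) ≡⟨ ≡.cong (_· (1# * y ^ suc n)) (nC0 (suc n)) ⟩
          1 · (1# * y ^ suc n)           ≈⟨ +-identityʳ _ ⟩
          1# * y ^ suc n                 ≈⟨ *-identityˡ _ ⟩
          y ^ suc n                      ∎
        lastTerm : term (Fin.fromℕ (suc n)) ≈ x ^ suc n
        lastTerm = begin
          term (Fin.fromℕ (suc n))
            ≡⟨⟩
          (suc n C toℕ (Fin.fromℕ (suc n))) · (x ^ toℕ (Fin.fromℕ (suc n)) * y ^ (suc n ℕ.∸ toℕ (Fin.fromℕ (suc n))))
            ≡⟨ ≡.cong₂ (λ a b → (suc n C a) · (x ^ a * y ^ b)) (Fin.toℕ-fromℕ (suc n))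
                 (≡.trans (≡.cong (suc n ℕ.∸_) (Fin.toℕ-fromℕ (suc n))) (ℕ.n∸n≡0 (suc n))) ⟩
          (suc n C suc n) · (x ^ suc n * 1#) ≡⟨ ≡.cong (_· (x ^ suc n * 1#)) (nCn≡1 (suc n)) ⟩
          1 · (x ^ suc n * 1#)               ≈⟨ +-identityʳ _ ⟩
          x ^ suc n * 1#                     ≈⟨ *-identityʳ _ ⟩
          x ^ suc n                          ∎
        rest : sum (λ i → term (Fin.suc i)) ≈ x ^ suc n
        rest = trans (last-sum (λ i → term (Fin.suc i)) middle) lastTerm
          where
          middle : ∀ i → toℕ i ℕ.< n → term (Fin.suc i) ≈ 0#
          middle i i<n = begin
            term (Fin.suc i)                   ≈⟨ ·≈ι* (suc n C suc (toℕ i)) _ ⟩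
            ι (suc n C suc (toℕ i)) * _        ≈⟨ *-congʳ (ι-∣ (≡.subst (λ m → p ∣ m C suc (toℕ i)) (≡.sym e)
                                                     (p∣pCk (suc (toℕ i)) (s≤s z≤n) (≡.subst (suc (toℕ i) ℕ.<_) e (s≤s i<n))))) ⟩
            0# * _                             ≈⟨ zeroˡ _ ⟩
            0#                                 ∎

    frobenius : ∀ x y → (x + y) ^ p ≈ x ^ p + y ^ p
    frobenius = frob p ≡.refl

    frobenius^ : ∀ k x y → (x + y) ^ (p ℕ.^ k) ≈ x ^ (p ℕ.^ k) + y ^ (p ℕ.^ k)
    frobenius^ zero x y = trans (*-identityʳ _) (sym (+-cong (*-identityʳ x) (*-identityʳ y)))
    frobenius^ (suc k) x y = begin
      (x + y) ^ (p ℕ.* p ℕ.^ k)                       ≈⟨ ^-assocʳ (x + y) p (p ℕ.^ k) ⟨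
      ((x + y) ^ p) ^ (p ℕ.^ k)                       ≈⟨ ^-congˡ (p ℕ.^ k) (frobenius x y) ⟩
      (x ^ p + y ^ p) ^ (p ℕ.^ k)                     ≈⟨ frobenius^ k (x ^ p) (y ^ p) ⟩
      (x ^ p) ^ (p ℕ.^ k) + (y ^ p) ^ (p ℕ.^ k)       ≈⟨ +-cong (^-assocʳ x p _) (^-assocʳ y p _) ⟩
      x ^ (p ℕ.* p ℕ.^ k) + y ^ (p ℕ.* p ℕ.^ k)       ∎

    -- Additivity at x + (- x) = 0 gives this without computing the sign of (-1)^P, so p = 2 is no
    -- exception.
    frobenius-neg : ∀ k x → (- x) ^ (p ℕ.^ k) ≈ - (x ^ (p ℕ.^ k))
    frobenius-neg k x = begin
      (- x) ^ P                       ≈⟨ solve 2 (λ a b → a := (b :+ a) :- b) refl _ _ ⟩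
      (x ^ P + (- x) ^ P) - x ^ P     ≈⟨ +-congʳ (frobenius^ k x (- x)) ⟨
      (x + - x) ^ P - x ^ P           ≈⟨ +-congʳ (trans (^-congˡ P (-‿inverseʳ x)) (0^ P (ℕ.m^n>0 p k))) ⟩
      0# - x ^ P                      ≈⟨ +-identityˡ _ ⟩
      - (x ^ P)                       ∎
      where P = p ℕ.^ k

    frobenius-sub : ∀ k x y → (x - y) ^ (p ℕ.^ k) ≈ x ^ (p ℕ.^ k) - y ^ (p ℕ.^ k)
    frobenius-sub k x y = trans (frobenius^ k x (- y)) (+-congˡ (frobenius-neg k y))

-- Polynomials as coefficient lists: ring structure, derivative, evaluation, composition.

module Polynomials {c ℓ} (R : CommutativeRing c ℓ) where

  import Data.Nat.Properties as ℕ
  open import Data.List.Base using (List; []; _∷_; map)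
  open RingTools R

  Poly : Set c
  Poly = List Carrier

  coeff : Poly → ℕ → Carrier
  coeff []       _       = 0#
  coeff (a ∷ _)  zero    = a
  coeff (_ ∷ as) (suc i) = coeff as i

  infix 4 _≋_
  -- A record rather than a function type, so that the two polynomials can be inferred from a proof.
  -- Coefficientwise equality ignores trailing zeros.
  record _≋_ (f g : Poly) : Set ℓ where
    constructor mk
    field at : ∀ i → coeff f i ≈ coeff g i
  open _≋_ public

  ≋-refl : ∀ {f} → f ≋ f
  ≋-refl = mk λ _ → refl

  ≋-sym : ∀ {f g} → f ≋ g → g ≋ f
  ≋-sym e = mk λ i → sym (at e i)

  ≋-trans : ∀ {f g h} → f ≋ g → g ≋ h → f ≋ h
  ≋-trans e e′ = mk λ i → trans (at e i) (at e′ i)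

  ∷-cong : ∀ {a b f g} → a ≈ b → f ≋ g → a ∷ f ≋ b ∷ g
  ∷-cong e e′ = mk λ { zero → e ; (suc i) → at e′ i }

  tail-cong : ∀ {a b f g} → a ∷ f ≋ b ∷ g → f ≋ g
  tail-cong e = mk λ i → at e (suc i)

  0∷[]≋[] : ∀ {a} → a ≈ 0# → a ∷ [] ≋ []
  0∷[]≋[] e = mk λ { zero → e ; (suc i) → refl }

  scale : Carrier → Poly → Poly
  scale a f = map (a *_) f

  infixl 6 _+ₚ_
  infixl 7 _*ₚ_

  opaque

    _+ₚ_ : Poly → Poly → Poly
    []      +ₚ g       = g
    (a ∷ f) +ₚ []      = a ∷ f
    (a ∷ f) +ₚ (b ∷ g) = (a + b) ∷ (f +ₚ g)

    -ₚ_ : Poly → Poly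
    -ₚ f = map -_ f

    _*ₚ_ : Poly → Poly → Poly
    []      *ₚ g = []
    (a ∷ f) *ₚ g = scale a g +ₚ (0# ∷ f *ₚ g)

    coeff-+ : ∀ f g i → coeff (f +ₚ g) i ≈ coeff f i + coeff g i
    coeff-+ []      g       i       = sym (+-identityˡ _)
    coeff-+ (a ∷ f) []      i       = sym (+-identityʳ _)
    coeff-+ (a ∷ f) (b ∷ g) zero    = refl
    coeff-+ (a ∷ f) (b ∷ g) (suc i) = coeff-+ f g i

    coeff-neg : ∀ f i → coeff (-ₚ f) i ≈ - coeff f i
    coeff-neg []      i       = sym -0≈0
    coeff-neg (a ∷ f) zero    = refl
    coeff-neg (a ∷ f) (suc i) = coeff-neg f i

    coeff-scale : ∀ a f i → coeff (scale a f) i ≈ a * coeff f i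
    coeff-scale a []      i       = sym (zeroʳ a)
    coeff-scale a (b ∷ f) zero    = refl
    coeff-scale a (b ∷ f) (suc i) = coeff-scale a f i

    private

      +ₚ-cong : ∀ {f f′ g g′} → f ≋ f′ → g ≋ g′ → f +ₚ g ≋ f′ +ₚ g′
      +ₚ-cong {f} {f′} {g} {g′} e e′ = mk λ i →
        trans (coeff-+ f g i) (trans (+-cong (at e i) (at e′ i)) (sym (coeff-+ f′ g′ i)))

      +ₚ-assoc : ∀ f g h → (f +ₚ g) +ₚ h ≋ f +ₚ (g +ₚ h)
      +ₚ-assoc f g h = mk λ i → begin
        coeff ((f +ₚ g) +ₚ h) i                ≈⟨ trans (coeff-+ (f +ₚ g) h i) (+-congʳ (coeff-+ f g i)) ⟩
        (coeff f i + coeff g i) + coeff h i    ≈⟨ +-assoc _ _ _ ⟩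
        coeff f i + (coeff g i + coeff h i)    ≈⟨ trans (coeff-+ f (g +ₚ h) i) (+-congˡ (coeff-+ g h i)) ⟨
        coeff (f +ₚ (g +ₚ h)) i                ∎

      +ₚ-comm : ∀ f g → f +ₚ g ≋ g +ₚ f
      +ₚ-comm f g = mk λ i → trans (coeff-+ f g i) (trans (+-comm _ _) (sym (coeff-+ g f i)))

      +ₚ-identityʳ : ∀ f → f +ₚ [] ≋ f
      +ₚ-identityʳ f = mk λ i → trans (coeff-+ f [] i) (+-identityʳ _)

      -ₚ-cong : ∀ {f g} → f ≋ g → -ₚ f ≋ -ₚ g
      -ₚ-cong {f} {g} e = mk λ i → trans (coeff-neg f i) (trans (-‿cong (at e i)) (sym (coeff-neg g i)))

      +ₚ-identityˡ : ∀ f → [] +ₚ f ≋ f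
      +ₚ-identityˡ f = ≋-refl

      +ₚ-inverseʳ : ∀ f → f +ₚ -ₚ f ≋ []
      +ₚ-inverseʳ f = mk λ i → trans (coeff-+ f (-ₚ f) i) (trans (+-congˡ (coeff-neg f i)) (-‿inverseʳ _))

      scale-cong : ∀ {a b f g} → a ≈ b → f ≋ g → scale a f ≋ scale b g
      scale-cong {a} {b} {f} {g} e e′ = mk λ i →
        trans (coeff-scale a f i) (trans (*-cong e (at e′ i)) (sym (coeff-scale b g i)))

      scale-0 : ∀ {a} f → a ≈ 0# → scale a f ≋ []
      scale-0 {a} f e = mk λ i → trans (coeff-scale a f i) (trans (*-congʳ e) (zeroˡ _))

      scale-+ : ∀ a f g → scale a (f +ₚ g) ≋ scale a f +ₚ scale a g
      scale-+ a f g = mk λ i → begin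
        coeff (scale a (f +ₚ g)) i           ≈⟨ trans (coeff-scale a (f +ₚ g) i) (*-congˡ (coeff-+ f g i)) ⟩
        a * (coeff f i + coeff g i)          ≈⟨ distribˡ a _ _ ⟩
        a * coeff f i + a * coeff g i        ≈⟨ +-cong (coeff-scale a f i) (coeff-scale a g i) ⟨
        coeff (scale a f) i + coeff (scale a g) i ≈⟨ coeff-+ (scale a f) (scale a g) i ⟨
        coeff (scale a f +ₚ scale a g) i     ∎

      +-scale : ∀ a b f → scale (a + b) f ≋ scale a f +ₚ scale b f
      +-scale a b f = mk λ i → begin
        coeff (scale (a + b) f) i            ≈⟨ coeff-scale (a + b) f i ⟩
        (a + b) * coeff f i                  ≈⟨ distribʳ _ a b ⟩
        a * coeff f i + b * coeff f i        ≈⟨ +-cong (coeff-scale a f i) (coeff-scale b f i) ⟨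
        coeff (scale a f) i + coeff (scale b f) i ≈⟨ coeff-+ (scale a f) (scale b f) i ⟨
        coeff (scale a f +ₚ scale b f) i     ∎

      scale-scale : ∀ a b f → scale a (scale b f) ≋ scale (a * b) f
      scale-scale a b f = mk λ i → trans (coeff-scale a (scale b f) i)
        (trans (*-congˡ (coeff-scale b f i)) (trans (sym (*-assoc a b _)) (sym (coeff-scale (a * b) f i))))

      0∷-+ : ∀ f g → (0# ∷ f) +ₚ (0# ∷ g) ≋ 0# ∷ (f +ₚ g)
      0∷-+ f g = ∷-cong (+-identityˡ 0#) ≋-refl

      interchange : ∀ f g h k → (f +ₚ g) +ₚ (h +ₚ k) ≋ (f +ₚ h) +ₚ (g +ₚ k)
      interchange f g h k = mk λ i → begin
        coeff ((f +ₚ g) +ₚ (h +ₚ k)) i ≈⟨ trans (coeff-+ (f +ₚ g) (h +ₚ k) i) (+-cong (coeff-+ f g i) (coeff-+ h k i)) ⟩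
        (coeff f i + coeff g i) + (coeff h i + coeff k i)
          ≈⟨ solve 4 (λ a b c d → (a :+ b) :+ (c :+ d) := (a :+ c) :+ (b :+ d)) refl _ _ _ _ ⟩
        (coeff f i + coeff h i) + (coeff g i + coeff k i)
          ≈⟨ trans (coeff-+ (f +ₚ h) (g +ₚ k) i) (+-cong (coeff-+ f h i) (coeff-+ g k i)) ⟨
        coeff ((f +ₚ h) +ₚ (g +ₚ k)) i ∎

      *ₚ-distribʳ : ∀ h f g → (f +ₚ g) *ₚ h ≋ f *ₚ h +ₚ g *ₚ h
      *ₚ-distribʳ h []      g       = ≋-refl
      *ₚ-distribʳ h (a ∷ f) []      = ≋-sym (+ₚ-identityʳ _)
      *ₚ-distribʳ h (a ∷ f) (b ∷ g) =
        ≋-trans (+ₚ-cong (+-scale a b h) (≋-trans (∷-cong refl (*ₚ-distribʳ h f g)) (≋-sym (0∷-+ (f *ₚ h) (g *ₚ h)))))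
                (interchange (scale a h) (scale b h) (0# ∷ f *ₚ h) (0# ∷ g *ₚ h))

      *ₚ-distribˡ : ∀ f g h → f *ₚ (g +ₚ h) ≋ f *ₚ g +ₚ f *ₚ h
      *ₚ-distribˡ []      g h = ≋-refl
      *ₚ-distribˡ (a ∷ f) g h =
        ≋-trans (+ₚ-cong (scale-+ a g h) (≋-trans (∷-cong refl (*ₚ-distribˡ f g h)) (≋-sym (0∷-+ (f *ₚ g) (f *ₚ h)))))
                (interchange (scale a g) (scale a h) (0# ∷ f *ₚ g) (0# ∷ f *ₚ h))

      zero-*ₚ : ∀ f g → f ≋ [] → f *ₚ g ≋ []
      zero-*ₚ []      g e = ≋-refl
      zero-*ₚ (a ∷ f) g e =
        ≋-trans (+ₚ-cong (scale-0 g (at e 0)) (∷-cong refl (zero-*ₚ f g (mk λ i → at e (suc i)))))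
                (0∷[]≋[] refl)

      *ₚ-congʳ : ∀ {f f′} g → f ≋ f′ → f *ₚ g ≋ f′ *ₚ g
      *ₚ-congʳ {[]}    {f′}     g e = ≋-sym (zero-*ₚ f′ g (≋-sym e))
      *ₚ-congʳ {a ∷ f} {[]}     g e = zero-*ₚ (a ∷ f) g e
      *ₚ-congʳ {a ∷ f} {b ∷ f′} g e =
        +ₚ-cong (scale-cong {f = g} (at e 0) ≋-refl) (∷-cong refl (*ₚ-congʳ g (tail-cong e)))

      *ₚ-congˡ : ∀ f {g g′} → g ≋ g′ → f *ₚ g ≋ f *ₚ g′
      *ₚ-congˡ []      e = ≋-refl
      *ₚ-congˡ (a ∷ f) e = +ₚ-cong (scale-cong refl e) (∷-cong refl (*ₚ-congˡ f e))

      *ₚ-[] : ∀ f → f *ₚ [] ≋ []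
      *ₚ-[] []      = ≋-refl
      *ₚ-[] (a ∷ f) = ≋-trans (∷-cong refl (*ₚ-[] f)) (0∷[]≋[] refl)

      *ₚ-∷ : ∀ f b g → f *ₚ (b ∷ g) ≋ scale b f +ₚ (0# ∷ f *ₚ g)
      *ₚ-∷ []      b g = ≋-sym (0∷[]≋[] refl)
      *ₚ-∷ (a ∷ f) b g = ∷-cong (trans (+-identityʳ _) (trans (*-comm a b) (sym (+-identityʳ _))))
        (≋-trans (+ₚ-cong (≋-refl {scale a g}) (*ₚ-∷ f b g))
          (≋-trans (≋-sym (+ₚ-assoc (scale a g) (scale b f) _))
            (≋-trans (+ₚ-cong (+ₚ-comm (scale a g) (scale b f)) ≋-refl) (+ₚ-assoc (scale b f) (scale a g) _))))

      *ₚ-comm : ∀ f g → f *ₚ g ≋ g *ₚ f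
      *ₚ-comm []      g = ≋-sym (*ₚ-[] g)
      *ₚ-comm (a ∷ f) g = ≋-trans (+ₚ-cong (≋-refl {scale a g}) (∷-cong refl (*ₚ-comm f g))) (≋-sym (*ₚ-∷ g a f))

      scale-*ₚ : ∀ a f g → scale a f *ₚ g ≋ scale a (f *ₚ g)
      scale-*ₚ a []      g = ≋-refl
      scale-*ₚ a (b ∷ f) g =
        ≋-trans (+ₚ-cong (≋-sym (scale-scale a b g)) (∷-cong (sym (zeroʳ a)) (scale-*ₚ a f g)))
                (≋-sym (scale-+ a (scale b g) (0# ∷ f *ₚ g)))

      0∷-*ₚ : ∀ f g → (0# ∷ f) *ₚ g ≋ 0# ∷ f *ₚ g
      0∷-*ₚ f g = +ₚ-cong (scale-0 g refl) (≋-refl {0# ∷ f *ₚ g})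

      *ₚ-assoc : ∀ f g h → (f *ₚ g) *ₚ h ≋ f *ₚ (g *ₚ h)
      *ₚ-assoc []      g h = ≋-refl
      *ₚ-assoc (a ∷ f) g h =
        ≋-trans (*ₚ-distribʳ h (scale a g) (0# ∷ f *ₚ g))
                (+ₚ-cong (scale-*ₚ a g h) (≋-trans (0∷-*ₚ (f *ₚ g) h) (∷-cong refl (*ₚ-assoc f g h))))

      *ₚ-identityˡ : ∀ f → (1# ∷ []) *ₚ f ≋ f
      *ₚ-identityˡ f = mk λ i → begin
        coeff (scale 1# f +ₚ (0# ∷ [])) i             ≈⟨ coeff-+ (scale 1# f) (0# ∷ []) i ⟩
        coeff (scale 1# f) i + coeff (0# ∷ []) i      ≈⟨ +-cong (trans (coeff-scale 1# f i) (*-identityˡ _)) (at (0∷[]≋[] refl) i) ⟩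
        coeff f i + 0#                                ≈⟨ +-identityʳ _ ⟩
        coeff f i                                     ∎

  polyRing : CommutativeRing c ℓ
  polyRing = record
    { Carrier = Poly
    ; _≈_ = _≋_
    ; _+_ = _+ₚ_
    ; _*_ = _*ₚ_
    ; -_ = -ₚ_
    ; 0# = []
    ; 1# = 1# ∷ []
    ; isCommutativeRing = record
      { isRing = record
        { +-isAbelianGroup = record
          { isGroup = record
            { isMonoid = record
              { isSemigroup = record
                { isMagma = record
                  { isEquivalence = record { refl = ≋-refl ; sym = ≋-sym ; trans = ≋-trans }
                  ; ∙-cong = +ₚ-cong }
                ; assoc = +ₚ-assoc }
              ; identity = +ₚ-identityˡ , +ₚ-identityʳ }
            ; inverse = (λ f → ≋-trans (+ₚ-comm (-ₚ f) f) (+ₚ-inverseʳ f)) , +ₚ-inverseʳ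
            ; ⁻¹-cong = -ₚ-cong }
          ; comm = +ₚ-comm }
        ; *-cong = λ {f} {f′} {g} {g′} e e′ → ≋-trans (*ₚ-congʳ g e) (*ₚ-congˡ f′ e′)
        ; *-assoc = *ₚ-assoc
        ; *-identity = *ₚ-identityˡ , λ f → ≋-trans (*ₚ-comm f (1# ∷ [])) (*ₚ-identityˡ f)
        ; distrib = *ₚ-distribˡ , *ₚ-distribʳ }
      ; *-comm = *ₚ-comm }
    }

  module P = RingTools polyRing

  C : Carrier → Poly
  C a = a ∷ []

  𝕏 : Poly
  𝕏 = 0# ∷ 1# ∷ []

  C-cong : ∀ {a b} → a ≈ b → C a ≋ C b
  C-cong e = ∷-cong e ≋-refl

  opaque
    unfolding _+ₚ_
    C-+ : ∀ a b → C (a + b) ≋ C a +ₚ C b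
    C-+ a b = ≋-refl

    C-* : ∀ a b → C (a * b) ≋ C a *ₚ C b
    C-* a b = ∷-cong (sym (+-identityʳ _)) ≋-refl

  C-0 : C 0# ≋ []
  C-0 = 0∷[]≋[] refl

  opaque
    unfolding _+ₚ_
    ∷-*ₚ : ∀ a f g → (a ∷ f) *ₚ g ≋ scale a g +ₚ (0# ∷ f *ₚ g)
    ∷-*ₚ a f g = ≋-refl

    scale≋C* : ∀ a f → scale a f ≋ C a *ₚ f
    scale≋C* a f = ≋-sym (≋-trans (+ₚ-cong (≋-refl {scale a f}) C-0) (+ₚ-identityʳ _))

  coeff-C* : ∀ a f i → coeff (C a *ₚ f) i ≈ a * coeff f i
  coeff-C* a f i = trans (sym (at (scale≋C* a f) i)) (coeff-scale a f i)

  coeff-sub : ∀ f g i → coeff (f P.- g) i ≈ coeff f i - coeff g i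
  coeff-sub f g i = trans (coeff-+ f (-ₚ g) i) (+-congˡ (coeff-neg g i))

  opaque
    unfolding _+ₚ_
    0∷≋𝕏* : ∀ f → 0# ∷ f ≋ 𝕏 *ₚ f
    0∷≋𝕏* f = ≋-sym (≋-trans (0∷-*ₚ (1# ∷ []) f) (∷-cong refl (*ₚ-identityˡ f)))

    ∷≋C+𝕏* : ∀ a f → a ∷ f ≋ C a +ₚ 𝕏 *ₚ f
    ∷≋C+𝕏* a f = ≋-trans (∷-cong (sym (+-identityʳ a)) ≋-refl) (+ₚ-cong {C a} ≋-refl (0∷≋𝕏* f))

  opaque
    unfolding _+ₚ_
    deriv : Poly → Poly
    deriv []      = []
    deriv (a ∷ f) = f +ₚ (0# ∷ deriv f)

    coeff-deriv : ∀ f i → coeff (deriv f) i ≈ ι (suc i) * coeff f (suc i)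
    coeff-deriv []      i       = sym (zeroʳ _)
    coeff-deriv (a ∷ f) zero    = begin
      coeff (f +ₚ (0# ∷ deriv f)) 0   ≈⟨ coeff-+ f _ 0 ⟩
      coeff f 0 + 0#                  ≈⟨ solve 1 (λ x → x :+ con (+ 0) := (con (+ 1) :+ con (+ 0)) :* x) refl _ ⟩
      ι 1 * coeff f 0                 ∎
      where open import Data.Integer.Base using (+_)
    coeff-deriv (a ∷ f) (suc i) = begin
      coeff (f +ₚ (0# ∷ deriv f)) (suc i)               ≈⟨ coeff-+ f _ (suc i) ⟩
      coeff f (suc i) + coeff (deriv f) i               ≈⟨ +-congˡ (coeff-deriv f i) ⟩
      coeff f (suc i) + ι (suc i) * coeff f (suc i)     ≈⟨ +-congʳ (*-identityˡ _) ⟨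
      1# * coeff f (suc i) + ι (suc i) * coeff f (suc i) ≈⟨ distribʳ _ 1# (ι (suc i)) ⟨
      ι (suc (suc i)) * coeff f (suc i)                 ∎

  deriv-cong : ∀ {f g} → f ≋ g → deriv f ≋ deriv g
  deriv-cong {f} {g} e = mk λ i → trans (coeff-deriv f i) (trans (*-congˡ (at e (suc i))) (sym (coeff-deriv g i)))

  deriv-+ : ∀ f g → deriv (f +ₚ g) ≋ deriv f +ₚ deriv g
  deriv-+ f g = mk λ i → begin
    coeff (deriv (f +ₚ g)) i                        ≈⟨ trans (coeff-deriv (f +ₚ g) i) (*-congˡ (coeff-+ f g (suc i))) ⟩
    ι (suc i) * (coeff f (suc i) + coeff g (suc i)) ≈⟨ distribˡ _ _ _ ⟩
    _                                               ≈⟨ +-cong (coeff-deriv f i) (coeff-deriv g i) ⟨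
    coeff (deriv f) i + coeff (deriv g) i           ≈⟨ coeff-+ (deriv f) (deriv g) i ⟨
    coeff (deriv f +ₚ deriv g) i                    ∎

  deriv-neg : ∀ f → deriv (-ₚ f) ≋ -ₚ deriv f
  deriv-neg f = mk λ i → begin
    coeff (deriv (-ₚ f)) i           ≈⟨ trans (coeff-deriv (-ₚ f) i) (*-congˡ (coeff-neg f (suc i))) ⟩
    ι (suc i) * - coeff f (suc i)    ≈⟨ -‿distribʳ-* _ _ ⟨
    - (ι (suc i) * coeff f (suc i))  ≈⟨ -‿cong (coeff-deriv f i) ⟨
    - coeff (deriv f) i              ≈⟨ coeff-neg (deriv f) i ⟨
    coeff (-ₚ deriv f) i             ∎

  deriv-sub : ∀ f g → deriv (f P.- g) ≋ deriv f P.- deriv g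
  deriv-sub f g = ≋-trans (deriv-+ f (-ₚ g)) (P.+-congˡ {deriv f} (deriv-neg g))

  opaque
    unfolding deriv
    deriv-[] : deriv [] ≋ []
    deriv-[] = ≋-refl

    deriv-C : ∀ a → deriv (C a) ≋ []
    deriv-C a = C-0

  deriv-C* : ∀ a f → deriv (C a *ₚ f) ≋ C a *ₚ deriv f
  deriv-C* a f = mk λ i → begin
    coeff (deriv (C a *ₚ f)) i         ≈⟨ trans (coeff-deriv (C a *ₚ f) i) (*-congˡ (coeff-C* a f (suc i))) ⟩
    ι (suc i) * (a * coeff f (suc i))  ≈⟨ solve 3 (λ i a f → i :* (a :* f) := a :* (i :* f)) refl _ _ _ ⟩
    a * (ι (suc i) * coeff f (suc i))  ≈⟨ *-congˡ (coeff-deriv f i) ⟨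
    a * coeff (deriv f) i              ≈⟨ coeff-C* a (deriv f) i ⟨
    coeff (C a *ₚ deriv f) i           ∎

  opaque
    unfolding deriv
    deriv-∷ : ∀ a f → deriv (a ∷ f) ≋ f +ₚ 𝕏 *ₚ deriv f
    deriv-∷ a f = +ₚ-cong {f} ≋-refl (0∷≋𝕏* (deriv f))

    deriv-𝕏 : deriv 𝕏 ≋ P.1#
    deriv-𝕏 = ∷-cong (+-identityʳ 1#) (0∷[]≋[] refl)

  deriv-𝕏* : ∀ f → deriv (𝕏 *ₚ f) ≋ f +ₚ 𝕏 *ₚ deriv f
  deriv-𝕏* f = ≋-trans (deriv-cong (≋-sym (0∷≋𝕏* f))) (deriv-∷ 0# f)

  deriv-* : ∀ f g → deriv (f *ₚ g) ≋ deriv f *ₚ g +ₚ f *ₚ deriv g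
  deriv-* [] g = P.begin
    deriv ([] *ₚ g)                      P.≈⟨ deriv-cong (P.zeroˡ g) ⟩
    deriv []                             P.≈⟨ deriv-[] ⟩
    []                                   P.≈⟨ P.trans (P.+-cong (P.trans (P.*-congʳ deriv-[]) (P.zeroˡ g)) (P.zeroˡ (deriv g))) (P.+-identityˡ []) ⟨
    deriv [] *ₚ g +ₚ [] *ₚ deriv g       P.∎
  deriv-* (a ∷ f) g = P.begin
    deriv ((a ∷ f) *ₚ g)
      P.≈⟨ deriv-cong (P.trans (P.*-congʳ (∷≋C+𝕏* a f)) (P.solve 4 (λ a f g X → (a P.:+ X P.:* f) P.:* g
             P.:= a P.:* g P.:+ X P.:* (f P.:* g)) P.refl (C a) f g 𝕏)) ⟩
    deriv (C a *ₚ g +ₚ 𝕏 *ₚ (f *ₚ g))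
      P.≈⟨ P.trans (deriv-+ (C a *ₚ g) (𝕏 *ₚ (f *ₚ g))) (P.+-cong (deriv-C* a g) (deriv-𝕏* (f *ₚ g))) ⟩
    C a *ₚ deriv g +ₚ (f *ₚ g +ₚ 𝕏 *ₚ deriv (f *ₚ g))
      P.≈⟨ P.+-congˡ {C a *ₚ deriv g} (P.+-congˡ {f *ₚ g} (P.*-congˡ {𝕏} (deriv-* f g))) ⟩
    C a *ₚ deriv g +ₚ (f *ₚ g +ₚ 𝕏 *ₚ (deriv f *ₚ g +ₚ f *ₚ deriv g))
      P.≈⟨ P.solve 6 (λ a f g X f′ g′ → a P.:* g′ P.:+ (f P.:* g P.:+ X P.:* (f′ P.:* g P.:+ f P.:* g′))
             P.:= (f P.:+ X P.:* f′) P.:* g P.:+ (a P.:+ X P.:* f) P.:* g′) P.refl (C a) f g 𝕏 (deriv f) (deriv g) ⟩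
    (f +ₚ 𝕏 *ₚ deriv f) *ₚ g +ₚ (C a +ₚ 𝕏 *ₚ f) *ₚ deriv g
      P.≈⟨ P.+-cong (P.*-congʳ (deriv-∷ a f)) (P.*-congʳ (∷≋C+𝕏* a f)) ⟨
    deriv (a ∷ f) *ₚ g +ₚ (a ∷ f) *ₚ deriv g P.∎

  deriv-^ : ∀ f n → deriv (f P.^ suc n) ≋ P.ι (suc n) *ₚ (f P.^ n *ₚ deriv f)
  deriv-^ f zero = P.begin
    deriv (f *ₚ P.1#)                    P.≈⟨ deriv-cong (P.*-identityʳ f) ⟩
    deriv f                              P.≈⟨ P.*-identityˡ _ ⟨
    P.1# *ₚ deriv f                      P.≈⟨ P.*-identityˡ _ ⟨
    P.1# *ₚ (P.1# *ₚ deriv f)            P.≈⟨ P.*-congʳ P.ι1≈1 ⟨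
    P.ι 1 *ₚ (P.1# *ₚ deriv f)           P.∎
  deriv-^ f (suc n) = P.begin
    deriv (f *ₚ f P.^ suc n)
      P.≈⟨ deriv-* f (f P.^ suc n) ⟩
    deriv f *ₚ f P.^ suc n +ₚ f *ₚ deriv (f P.^ suc n)
      P.≈⟨ P.+-congˡ {deriv f *ₚ f P.^ suc n} (P.*-congˡ {f} (deriv-^ f n)) ⟩
    deriv f *ₚ (f *ₚ f P.^ n) +ₚ f *ₚ (P.ι (suc n) *ₚ (f P.^ n *ₚ deriv f))
      P.≈⟨ P.solve 4 (λ f f′ g i → f′ P.:* (f P.:* g) P.:+ f P.:* (i P.:* (g P.:* f′))
             P.:= (P.con (+ 1) P.:+ i) P.:* ((f P.:* g) P.:* f′)) P.refl f (deriv f) (f P.^ n) (P.ι (suc n)) ⟩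
    P.ι (suc (suc n)) *ₚ (f P.^ suc n *ₚ deriv f) P.∎
    where open import Data.Integer.Base using (+_)

  P-ι≋C : ∀ n → P.ι n ≋ C (ι n)
  P-ι≋C zero    = P.sym C-0
  P-ι≋C (suc n) = P.trans (P.+-congˡ (P-ι≋C n)) (P.sym (C-+ 1# (ι n)))

  -- Evaluation along a homomorphism of the coefficient ring covers at once the values in the ring
  -- and, through the constant polynomials, composition.
  record Hom {c′ ℓ′} (A : CommutativeRing c′ ℓ′) : Set (c ⊔ ℓ ⊔ c′ ⊔ ℓ′) where
    private module A = CommutativeRing A
    field
      φ : Carrier → A.Carrier
      φ-cong : ∀ {x y} → x ≈ y → φ x A.≈ φ y
      φ-0 : φ 0# A.≈ A.0#
      φ-1 : φ 1# A.≈ A.1#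
      φ-+ : ∀ x y → φ (x + y) A.≈ φ x A.+ φ y
      φ-* : ∀ x y → φ (x * y) A.≈ φ x A.* φ y

  idHom : Hom R
  idHom = record { φ = λ x → x ; φ-cong = λ e → e ; φ-0 = refl ; φ-1 = refl
                 ; φ-+ = λ _ _ → refl ; φ-* = λ _ _ → refl }

  constHom : Hom polyRing
  constHom = record { φ = C ; φ-cong = C-cong ; φ-0 = C-0 ; φ-1 = P.refl
                    ; φ-+ = C-+ ; φ-* = C-* }

  module Evaluation {c′ ℓ′} {A : CommutativeRing c′ ℓ′} (hom : Hom A) where

    private module A = RingTools A
    open Hom hom

    eval : Poly → A.Carrier → A.Carrier
    eval []       x = A.0#
    eval (a ∷ as) x = φ a A.+ x A.* eval as x

    eval-zero : ∀ f x → f ≋ [] → eval f x A.≈ A.0#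
    eval-zero []      x e = A.refl
    eval-zero (a ∷ f) x e = A.trans (A.+-cong (A.trans (φ-cong (at e 0)) φ-0)
      (A.trans (A.*-congˡ (eval-zero f x (mk λ i → at e (suc i)))) (A.zeroʳ x))) (A.+-identityˡ A.0#)

    eval-congˡ : ∀ f {x y} → x A.≈ y → eval f x A.≈ eval f y
    eval-congˡ []      e = A.refl
    eval-congˡ (a ∷ f) e = A.+-congˡ (A.*-cong e (eval-congˡ f e))

    eval-cong : ∀ {f g} x → f ≋ g → eval f x A.≈ eval g x
    eval-cong {[]}    {g}     x e = A.sym (eval-zero g x (≋-sym e))
    eval-cong {a ∷ f} {[]}    x e = eval-zero (a ∷ f) x e
    eval-cong {a ∷ f} {b ∷ g} x e = A.+-cong (φ-cong (at e 0)) (A.*-congˡ (eval-cong x (tail-cong e)))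

    eval-C : ∀ a x → eval (C a) x A.≈ φ a
    eval-C a x = A.trans (A.+-congˡ (A.zeroʳ x)) (A.+-identityʳ _)

    eval-𝕏 : ∀ x → eval 𝕏 x A.≈ x
    eval-𝕏 x = A.begin
      φ 0# A.+ x A.* (φ 1# A.+ x A.* A.0#) A.≈⟨ A.+-cong φ-0 (A.*-congˡ (A.+-cong φ-1 (A.zeroʳ x))) ⟩
      A.0# A.+ x A.* (A.1# A.+ A.0#)       A.≈⟨ A.+-identityˡ _ ⟩
      x A.* (A.1# A.+ A.0#)                A.≈⟨ A.*-congˡ (A.+-identityʳ _) ⟩
      x A.* A.1#                           A.≈⟨ A.*-identityʳ x ⟩
      x                                    A.∎

    opaque
      unfolding _+ₚ_
      eval-+ : ∀ f g x → eval (f +ₚ g) x A.≈ eval f x A.+ eval g x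
      eval-+ []      g       x = A.sym (A.+-identityˡ _)
      eval-+ (a ∷ f) []      x = A.sym (A.+-identityʳ _)
      eval-+ (a ∷ f) (b ∷ g) x = A.begin
        φ (a + b) A.+ x A.* eval (f +ₚ g) x
          A.≈⟨ A.+-cong (φ-+ a b) (A.*-congˡ (eval-+ f g x)) ⟩
        (φ a A.+ φ b) A.+ x A.* (eval f x A.+ eval g x)
          A.≈⟨ A.solve 5 (λ a b x f g → (a A.:+ b) A.:+ x A.:* (f A.:+ g) A.:= (a A.:+ x A.:* f) A.:+ (b A.:+ x A.:* g))
                 A.refl (φ a) (φ b) x (eval f x) (eval g x) ⟩
        (φ a A.+ x A.* eval f x) A.+ (φ b A.+ x A.* eval g x) A.∎

      eval-scale : ∀ a f x → eval (scale a f) x A.≈ φ a A.* eval f x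
      eval-scale a []      x = A.sym (A.zeroʳ _)
      eval-scale a (b ∷ f) x = A.begin
        φ (a * b) A.+ x A.* eval (scale a f) x
          A.≈⟨ A.+-cong (φ-* a b) (A.*-congˡ (eval-scale a f x)) ⟩
        φ a A.* φ b A.+ x A.* (φ a A.* eval f x)
          A.≈⟨ A.solve 4 (λ a b x f → a A.:* b A.:+ x A.:* (a A.:* f) A.:= a A.:* (b A.:+ x A.:* f)) A.refl _ _ _ _ ⟩
        φ a A.* (φ b A.+ x A.* eval f x) A.∎

      eval-* : ∀ f g x → eval (f *ₚ g) x A.≈ eval f x A.* eval g x
      eval-* []      g x = A.sym (A.zeroˡ _)
      eval-* (a ∷ f) g x = A.begin
        eval (scale a g +ₚ (0# ∷ f *ₚ g)) x
          A.≈⟨ eval-+ (scale a g) (0# ∷ f *ₚ g) x ⟩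
        eval (scale a g) x A.+ (φ 0# A.+ x A.* eval (f *ₚ g) x)
          A.≈⟨ A.+-cong (eval-scale a g x) (A.trans (A.+-cong φ-0 (A.*-congˡ (eval-* f g x))) (A.+-identityˡ _)) ⟩
        φ a A.* eval g x A.+ x A.* (eval f x A.* eval g x)
          A.≈⟨ A.solve 4 (λ a x f g → a A.:* g A.:+ x A.:* (f A.:* g) A.:= (a A.:+ x A.:* f) A.:* g) A.refl _ _ _ _ ⟩
        (φ a A.+ x A.* eval f x) A.* eval g x A.∎

    eval-neg : ∀ f x → eval (-ₚ f) x A.≈ A.- eval f x
    eval-neg f x = A.begin
      eval (-ₚ f) x
        A.≈⟨ A.solve 2 (λ a b → a A.:= (a A.:+ b) A.:- b) A.refl _ (eval f x) ⟩
      (eval (-ₚ f) x A.+ eval f x) A.- eval f x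
        A.≈⟨ A.+-congʳ (A.trans (A.sym (eval-+ (-ₚ f) f x)) (eval-zero ((-ₚ f) +ₚ f) x (P.-‿inverseˡ f))) ⟩
      A.0# A.- eval f x
        A.≈⟨ A.+-identityˡ _ ⟩
      A.- eval f x A.∎

    eval-sub : ∀ f g x → eval (f P.- g) x A.≈ eval f x A.- eval g x
    eval-sub f g x = A.trans (eval-+ f (-ₚ g) x) (A.+-congˡ (eval-neg g x))

    eval-^ : ∀ f n x → eval (f P.^ n) x A.≈ eval f x A.^ n
    eval-^ f zero    x = A.trans (eval-C 1# x) φ-1
    eval-^ f (suc n) x = A.trans (eval-* f (f P.^ n) x) (A.*-congˡ (eval-^ f n x))

  open Evaluation idHom public
  open Evaluation constHom public
    renaming ( eval to comp; eval-zero to comp-zero; eval-congˡ to comp-congˡ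
             ; eval-cong to comp-cong; eval-C to comp-C; eval-𝕏 to comp-𝕏
             ; eval-+ to comp-+; eval-scale to comp-scale; eval-* to comp-*
             ; eval-neg to comp-neg; eval-sub to comp-sub; eval-^ to comp-^ )

  deriv-comp : ∀ g f → deriv (comp g f) ≋ comp (deriv g) f *ₚ deriv f
  deriv-comp []      f = P.trans deriv-[] (P.sym (P.trans (P.*-congʳ (comp-zero (deriv []) f deriv-[])) (P.zeroˡ (deriv f))))
  deriv-comp (a ∷ g) f = P.begin
    deriv (C a +ₚ f *ₚ comp g f)
      P.≈⟨ P.trans (deriv-+ (C a) (f *ₚ comp g f)) (P.trans (P.+-cong (deriv-C a) (deriv-* f (comp g f))) (P.+-identityˡ _)) ⟩
    deriv f *ₚ comp g f +ₚ f *ₚ deriv (comp g f)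
      P.≈⟨ P.+-congˡ {deriv f *ₚ comp g f} (P.*-congˡ {f} (deriv-comp g f)) ⟩
    deriv f *ₚ comp g f +ₚ f *ₚ (comp (deriv g) f *ₚ deriv f)
      P.≈⟨ P.solve 4 (λ f f′ g g′ → f′ P.:* g P.:+ f P.:* (g′ P.:* f′) P.:= (g P.:+ f P.:* g′) P.:* f′)
             P.refl f (deriv f) (comp g f) (comp (deriv g) f) ⟩
    (comp g f +ₚ f *ₚ comp (deriv g) f) *ₚ deriv f
      P.≈⟨ P.*-congʳ {deriv f} (P.+-congˡ {comp g f} (P.trans (comp-* 𝕏 (deriv g) f) (P.*-congʳ (comp-𝕏 f)))) ⟨
    (comp g f +ₚ comp (𝕏 *ₚ deriv g) f) *ₚ deriv f
      P.≈⟨ P.*-congʳ {deriv f} (P.trans (comp-cong f (deriv-∷ a g)) (comp-+ g (𝕏 *ₚ deriv g) f)) ⟨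
    comp (deriv (a ∷ g)) f *ₚ deriv f P.∎

  eval-comp : ∀ g f x → eval (comp g f) x ≈ eval g (eval f x)
  eval-comp []      f x = refl
  eval-comp (a ∷ g) f x = begin
    eval (C a +ₚ f *ₚ comp g f) x                ≈⟨ eval-+ (C a) (f *ₚ comp g f) x ⟩
    eval (C a) x + eval (f *ₚ comp g f) x        ≈⟨ +-cong (eval-C a x) (trans (eval-* f (comp g f) x) (*-congˡ (eval-comp g f x))) ⟩
    a + eval f x * eval g (eval f x)             ∎

  coeff-𝕏^* : ∀ m f i → coeff (𝕏 P.^ m *ₚ f) (m ℕ.+ i) ≈ coeff f i
  coeff-𝕏^* zero    f i = at (*ₚ-identityˡ f) i
  coeff-𝕏^* (suc m) f i = trans (at (P.trans (P.*-assoc 𝕏 (𝕏 P.^ m) f) (P.sym (0∷≋𝕏* (𝕏 P.^ m *ₚ f)))) (suc (m ℕ.+ i)))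
                                (coeff-𝕏^* m f i)

  coeff-𝕏^*-< : ∀ m f i → i ℕ.< m → coeff (𝕏 P.^ m *ₚ f) i ≈ 0#
  coeff-𝕏^*-< (suc m) f zero    _         = at (P.trans (P.*-assoc 𝕏 (𝕏 P.^ m) f) (P.sym (0∷≋𝕏* (𝕏 P.^ m *ₚ f)))) 0
  coeff-𝕏^*-< (suc m) f (suc i) (s≤s i<m) =
    trans (at (P.trans (P.*-assoc 𝕏 (𝕏 P.^ m) f) (P.sym (0∷≋𝕏* (𝕏 P.^ m *ₚ f)))) (suc i)) (coeff-𝕏^*-< m f i i<m)

-- Divisibility and comaximality in a commutative ring.

module CoprimeElements {c ℓ} (R : CommutativeRing c ℓ) where

  import Data.Nat.Properties as ℕ
  open import Data.Integer.Base using (+_)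
  open RingTools R

  infix 4 _∣ᵣ_
  _∣ᵣ_ : Carrier → Carrier → Set (c ⊔ ℓ)
  x ∣ᵣ y = ∃[ k ] x * k ≈ y

  ∣ᵣ-trans : ∀ {x y z} → x ∣ᵣ y → y ∣ᵣ z → x ∣ᵣ z
  ∣ᵣ-trans (k , e) (l , e′) = k * l , trans (sym (*-assoc _ k l)) (trans (*-congʳ e) e′)

  ∣ᵣ-resp : ∀ {x y z} → y ≈ z → x ∣ᵣ y → x ∣ᵣ z
  ∣ᵣ-resp e (k , e′) = k , trans e′ e

  ∣ᵣ-mul : ∀ {x y z w} → x ∣ᵣ y → z ∣ᵣ w → x * z ∣ᵣ y * w
  ∣ᵣ-mul {x} {y} {z} {w} (k , e) (l , e′) = k * l , trans
    (solve 4 (λ x z k l → (x :* z) :* (k :* l) := (x :* k) :* (z :* l)) refl x z k l) (*-cong e e′)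

  ∣ᵣ-pow : ∀ {x y} n → x ∣ᵣ y → x ^ n ∣ᵣ y ^ n
  ∣ᵣ-pow zero    d = 1# , *-identityʳ 1#
  ∣ᵣ-pow (suc n) d = ∣ᵣ-mul d (∣ᵣ-pow n d)

  -- Comaximality: in an arbitrary commutative ring this form of coprimality passes to products and
  -- powers and permits cancellation in a divisibility.
  Coprime : Carrier → Carrier → Set (c ⊔ ℓ)
  Coprime x y = ∃[ u ] ∃[ v ] u * x + v * y ≈ 1#

  coprime-sym : ∀ {x y} → Coprime x y → Coprime y x
  coprime-sym (u , v , e) = v , u , trans (+-comm _ _) e

  coprime-* : ∀ {x y z} → Coprime x y → Coprime x z → Coprime x (y * z)
  coprime-* {x} {y} {z} (u , v , e) (u′ , v′ , e′) =
    u * u′ * x + u * v′ * z + v * u′ * y , v * v′ , (begin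
      (u * u′ * x + u * v′ * z + v * u′ * y) * x + v * v′ * (y * z)
        ≈⟨ solve 7 (λ x y z u v u′ v′ → (u :* u′ :* x :+ u :* v′ :* z :+ v :* u′ :* y) :* x :+ v :* v′ :* (y :* z)
             := (u :* x :+ v :* y) :* (u′ :* x :+ v′ :* z)) refl x y z u v u′ v′ ⟩
      (u * x + v * y) * (u′ * x + v′ * z)  ≈⟨ *-cong e e′ ⟩
      1# * 1#                              ≈⟨ *-identityˡ 1# ⟩
      1#                                   ∎)

  coprime-^ʳ : ∀ {x y} n → Coprime x y → Coprime x (y ^ n)
  coprime-^ʳ {x} zero c = 0# , 1# , trans (+-congʳ (zeroˡ x)) (trans (+-identityˡ _) (*-identityˡ 1#))
  coprime-^ʳ (suc n) c = coprime-* c (coprime-^ʳ n c)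

  coprime-^ : ∀ {x y} m n → Coprime x y → Coprime (x ^ m) (y ^ n)
  coprime-^ m n c = coprime-^ʳ n (coprime-sym (coprime-^ʳ m (coprime-sym c)))

  coprime-∣ : ∀ {x y z} → Coprime x y → x ∣ᵣ y * z → x ∣ᵣ z
  coprime-∣ {x} {y} {z} (u , v , e) (k , e′) = u * z + v * k , (begin
    x * (u * z + v * k)          ≈⟨ solve 5 (λ x z u v k → x :* (u :* z :+ v :* k) := u :* x :* z :+ v :* (x :* k)) refl x z u v k ⟩
    u * x * z + v * (x * k)      ≈⟨ +-congˡ (*-congˡ e′) ⟩
    u * x * z + v * (y * z)      ≈⟨ solve 5 (λ x y z u v → u :* x :* z :+ v :* (y :* z) := (u :* x :+ v :* y) :* z) refl x y z u v ⟩
    (u * x + v * y) * z          ≈⟨ trans (*-congʳ e) (*-identityˡ z) ⟩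
    z                            ∎)

record DecidableField c ℓ : Set (lsuc (c ⊔ ℓ)) where
  field
    commutativeRing : CommutativeRing c ℓ
  open CommutativeRing commutativeRing using (Carrier; _≈_; _*_; 0#; 1#)
  field
    ≈-dec  : ∀ x y → Dec (x ≈ y)
    1≉0    : ¬ (1# ≈ 0#)
    invert : ∀ x → ¬ (x ≈ 0#) → ∃[ y ] x * y ≈ 1#

-- Polynomials over a field with decidable equality: degree, division, gcd, digits in base F.

module OverField {c ℓ} (K : DecidableField c ℓ) where

  open DecidableField K public
  import Data.Nat.Properties as ℕ
  open import Data.Integer.Base using (+_)
  open import Data.List.Base using ([]; _∷_)
  open import Data.Sum.Base using (_⊎_; inj₁; inj₂)
  open import Relation.Nullary.Decidable using (yes; no; map′; _×-dec_)
  open RingTools commutativeRing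
  open Polynomials commutativeRing public
  module PP = Polynomials polyRing
  module D = CoprimeElements polyRing

  *-cancel-0 : ∀ {x y} → x ≉ 0# → x * y ≈ 0# → y ≈ 0#
  *-cancel-0 {x} {y} x≉0 e with invert x x≉0
  ... | x⁻¹ , e′ = begin
    y               ≈⟨ *-identityˡ y ⟨
    1# * y          ≈⟨ *-congʳ e′ ⟨
    (x * x⁻¹) * y   ≈⟨ solve 3 (λ x i y → (x :* i) :* y := i :* (x :* y)) refl x x⁻¹ y ⟩
    x⁻¹ * (x * y)   ≈⟨ trans (*-congˡ e) (zeroʳ _) ⟩
    0#              ∎

  *-≉0 : ∀ {x y} → x ≉ 0# → y ≉ 0# → x * y ≉ 0#
  *-≉0 x≉0 y≉0 e = y≉0 (*-cancel-0 x≉0 e)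

  ^-≉0 : ∀ {x} n → x ≉ 0# → x ^ n ≉ 0#
  ^-≉0 zero    x≉0 = 1≉0
  ^-≉0 (suc n) x≉0 = *-≉0 x≉0 (^-≉0 n x≉0)

  zero? : ∀ f → Dec (f ≋ [])
  zero? []      = yes ≋-refl
  zero? (a ∷ f) = map′ (λ { (e , e′) → ≋-trans (∷-cong e e′) (0∷[]≋[] refl) })
                       (λ e → at e 0 , mk (λ i → at e (suc i)))
                       (≈-dec a 0# ×-dec zero? f)

  infix 4 _<°_ _≋0̸
  _≋0̸ : Poly → Set ℓ
  f ≋0̸ = ¬ (f ≋ [])

  -- Unlike a bound on `deg`, this holds for the zero polynomial with every `m`, so that sums and
  -- cancellations need no case distinction.
  _<°_ : Poly → ℕ → Set ℓ
  f <° m = ∀ i → m ℕ.≤ i → coeff f i ≈ 0#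

  opaque

    -- The degree, with junk value 0 for the zero polynomial.
    deg : Poly → ℕ
    deg [] = 0
    deg (a ∷ f) with zero? f
    ... | yes _ = 0
    ... | no  _ = suc (deg f)

    <°deg : ∀ f → f <° suc (deg f)
    <°deg [] i _ = refl
    <°deg (a ∷ f) i lt with zero? f
    <°deg (a ∷ f) (suc i) lt       | yes e = at e i
    <°deg (a ∷ f) (suc i) (s≤s lt) | no _  = <°deg f i lt

    lead≉0 : ∀ f → f ≋0̸ → coeff f (deg f) ≉ 0#
    lead≉0 [] ne e = ne ≋-refl
    lead≉0 (a ∷ f) ne e with zero? f
    ... | yes z = ne (≋-trans (∷-cong e z) (0∷[]≋[] refl))
    ... | no nz = lead≉0 f nz e

    deg-zero : ∀ f → f ≋ [] → deg f ≡ 0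
    deg-zero []      z = ≡.refl
    deg-zero (a ∷ f) z with zero? f
    ... | yes _ = ≡.refl
    ... | no nz = contradiction (mk (λ i → at z (suc i))) nz

  coeff≉0⇒≋0̸ : ∀ {f i} → coeff f i ≉ 0# → f ≋0̸
  coeff≉0⇒≋0̸ {i = i} ne e = ne (at e i)

  <°⇒deg< : ∀ {f m} → f ≋0̸ → f <° m → deg f ℕ.< m
  <°⇒deg< {f} {m} ne lt with m ℕ.≤? deg f
  ... | yes m≤ = contradiction (lt (deg f) m≤) (lead≉0 f ne)
  ... | no m≰  = ℕ.≰⇒> m≰

  deg<⇒<° : ∀ {f m} → deg f ℕ.< m → f <° m
  deg<⇒<° {f} lt i m≤i = <°deg f i (ℕ.≤-trans lt m≤i)

  coeff≉0⇒≤deg : ∀ {f i} → coeff f i ≉ 0# → i ℕ.≤ deg f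
  coeff≉0⇒≤deg {f} {i} ne with i ℕ.≤? deg f
  ... | yes le = le
  ... | no nle = contradiction (<°deg f i (ℕ.≰⇒> nle)) ne

  deg-unique : ∀ {f m} → coeff f m ≉ 0# → f <° suc m → deg f ≡ m
  deg-unique {f} ne lt = ℕ.≤-antisym (ℕ.≤-pred (<°⇒deg< (coeff≉0⇒≋0̸ {f} ne) lt)) (coeff≉0⇒≤deg {f} ne)

  ≋0̸-cong : ∀ {f g} → f ≋ g → f ≋0̸ → g ≋0̸
  ≋0̸-cong e ne z = ne (≋-trans e z)

  <°-cong : ∀ {f g m} → f ≋ g → f <° m → g <° m
  <°-cong e lt i le = trans (sym (at e i)) (lt i le)

  <°-mono : ∀ f {m n} → m ℕ.≤ n → f <° m → f <° n
  <°-mono f le lt i n≤i = lt i (ℕ.≤-trans le n≤i)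

  <°0⇒≋[] : ∀ {f} → f <° 0 → f ≋ []
  <°0⇒≋[] lt = mk λ i → lt i z≤n

  deg-cong : ∀ {f g} → f ≋ g → deg f ≡ deg g
  deg-cong {f} {g} e with zero? f
  ... | no nz  = ≡.sym (deg-unique (λ z → lead≉0 f nz (trans (at e _) z)) (<°-cong e (<°deg f)))
  ... | yes z = ≡.trans (deg-zero f z) (≡.sym (deg-zero g (≋-trans (≋-sym e) z)))

  <°-+ : ∀ {f g m} → f <° m → g <° m → f +ₚ g <° m
  <°-+ {f} {g} lt lt′ i le = trans (coeff-+ f g i) (trans (+-cong (lt i le) (lt′ i le)) (+-identityˡ 0#))

  <°-neg : ∀ {f m} → f <° m → -ₚ f <° m
  <°-neg {f} lt i le = trans (coeff-neg f i) (trans (-‿cong (lt i le)) -0≈0)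

  <°-sub : ∀ {f g m} → f <° m → g <° m → f P.- g <° m
  <°-sub lt lt′ = <°-+ lt (<°-neg lt′)

  <°-C* : ∀ {f m} a → f <° m → C a *ₚ f <° m
  <°-C* {f} a lt i le = trans (coeff-C* a f i) (trans (*-congˡ (lt i le)) (zeroʳ a))

  -- Arbitrary bounds take the place of the degrees: with the degrees themselves this computes the
  -- leading coefficient, with larger bounds it shows that the higher coefficients vanish.
  coeff-*-top : ∀ f g {m n} → f <° suc m → g <° suc n → coeff (f *ₚ g) (m ℕ.+ n) ≈ coeff f m * coeff g n
  coeff-*-top []      g lt lt′ = trans (at (P.zeroˡ g) _) (sym (zeroˡ _))
  coeff-*-top (a ∷ f) g {zero} {n} lt lt′ = begin
    coeff ((a ∷ f) *ₚ g) n  ≈⟨ at (P.*-congʳ {g} (∷-cong refl (<°0⇒≋[] {f} (λ i _ → lt (suc i) (s≤s z≤n))))) n ⟩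
    coeff (C a *ₚ g) n      ≈⟨ coeff-C* a g n ⟩
    a * coeff g n           ∎
  coeff-*-top (a ∷ f) g {suc m} {n} lt lt′ = begin
    coeff ((a ∷ f) *ₚ g) (suc (m ℕ.+ n))
      ≈⟨ trans (at (∷-*ₚ a f g) (suc (m ℕ.+ n))) (coeff-+ (scale a g) (0# ∷ f *ₚ g) (suc (m ℕ.+ n))) ⟩
    coeff (scale a g) (suc (m ℕ.+ n)) + coeff (f *ₚ g) (m ℕ.+ n)
      ≈⟨ +-cong (trans (coeff-scale a g _) (trans (*-congˡ (lt′ _ (s≤s (ℕ.m≤n+m n m)))) (zeroʳ a)))
                (coeff-*-top f g (λ i le → lt (suc i) (s≤s le)) lt′) ⟩
    0# + coeff f m * coeff g n  ≈⟨ +-identityˡ _ ⟩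
    coeff f m * coeff g n       ∎

  <°-* : ∀ f g {m n} → f <° suc m → g <° suc n → f *ₚ g <° suc (m ℕ.+ n)
  <°-* f g {m} {n} lt lt′ i le =
    trans (reflexive (≡.cong (coeff (f *ₚ g)) (≡.sym (ℕ.m∸n+n≡m le′))))
      (trans (coeff-*-top f g (<°-mono f (s≤s (ℕ.m+n≤o⇒m≤o∸n m (ℕ.<⇒≤ le))) lt) lt′)
        (trans (*-congʳ (lt _ (ℕ.m+n≤o⇒m≤o∸n (suc m) le))) (zeroˡ _)))
    where
    le′ : n ℕ.≤ i
    le′ = ℕ.≤-trans (ℕ.m≤n+m n (suc m)) le

  *ₚ-≋0̸ : ∀ {f g} → f ≋0̸ → g ≋0̸ → f *ₚ g ≋0̸
  *ₚ-≋0̸ {f} {g} nf ng e = *-≉0 (lead≉0 f nf) (lead≉0 g ng)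
    (trans (sym (coeff-*-top f g (<°deg f) (<°deg g))) (at e _))

  deg-* : ∀ {f g} → f ≋0̸ → g ≋0̸ → deg (f *ₚ g) ≡ deg f ℕ.+ deg g
  deg-* {f} {g} nf ng = deg-unique
    (λ e → *-≉0 (lead≉0 f nf) (lead≉0 g ng) (trans (sym (coeff-*-top f g (<°deg f) (<°deg g))) e))
    (<°-* f g (<°deg f) (<°deg g))

  1≋0̸ : P.1# ≋0̸
  1≋0̸ e = 1≉0 (at e 0)

  ^ₚ-≋0̸ : ∀ {f} n → f ≋0̸ → f P.^ n ≋0̸
  ^ₚ-≋0̸ zero    nf = 1≋0̸
  ^ₚ-≋0̸ (suc n) nf = *ₚ-≋0̸ nf (^ₚ-≋0̸ n nf)

  deg-1 : deg P.1# ≡ 0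
  deg-1 = deg-unique {P.1#} 1≉0 λ { (suc i) _ → refl }

  deg-^ : ∀ {f} n → f ≋0̸ → deg (f P.^ n) ≡ n ℕ.* deg f
  deg-^ zero nf = deg-1
  deg-^ {f} (suc n) nf = ≡.trans (deg-* nf (^ₚ-≋0̸ n nf)) (≡.cong (deg f ℕ.+_) (deg-^ n nf))

  *ₚ-cancel-0 : ∀ {f g} → f ≋0̸ → f *ₚ g ≋ [] → g ≋ []
  *ₚ-cancel-0 {f} {g} nf e with zero? g
  ... | yes z = z
  ... | no nz = contradiction e (*ₚ-≋0̸ nf nz)

  *ₚ-cancelˡ : ∀ {f g h} → f ≋0̸ → f *ₚ g ≋ f *ₚ h → g ≋ h
  *ₚ-cancelˡ {f} {g} {h} nf e = P.x-y≈0⇒x≈y (*ₚ-cancel-0 nf (P.begin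
    f *ₚ (g P.- h)         P.≈⟨ P.solve 3 (λ f g h → f P.:* (g P.:- h) P.:= f P.:* g P.:- f P.:* h) P.refl f g h ⟩
    f *ₚ g P.- f *ₚ h      P.≈⟨ P.x≈y⇒x-y≈0 e ⟩
    []                     P.∎))

  deg-deriv : ∀ {f} → deriv f ≋0̸ → deg (deriv f) ℕ.< deg f
  deg-deriv {f} ne = coeff≉0⇒≤deg {f} (λ z → lead≉0 (deriv f) ne (trans (coeff-deriv f _) (trans (*-congˡ z) (zeroʳ _))))

  <°-deriv : ∀ {f m} → f <° suc m → deriv f <° m
  <°-deriv {f} lt i le = trans (coeff-deriv f i) (trans (*-congˡ (lt (suc i) (s≤s le))) (zeroʳ _))

  +-dominant : ∀ {f g} → f <° deg g → g ≋0̸ → (f +ₚ g ≋0̸) × deg (f +ₚ g) ≡ deg g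
  +-dominant {f} {g} lt ng = coeff≉0⇒≋0̸ {f +ₚ g} top , deg-unique {f +ₚ g} top
      (<°-+ {f} {g} (<°-mono f (ℕ.n≤1+n _) lt) (<°deg g))
    where
    top : coeff (f +ₚ g) (deg g) ≉ 0#
    top e = lead≉0 g ng (begin
      coeff g (deg g)                     ≈⟨ +-identityˡ _ ⟨
      0# + coeff g (deg g)                ≈⟨ +-congʳ (lt (deg g) ℕ.≤-refl) ⟨
      coeff f (deg g) + coeff g (deg g)   ≈⟨ coeff-+ f g _ ⟨
      coeff (f +ₚ g) (deg g)              ≈⟨ e ⟩
      0#                                  ∎)

  deg≥1⇒≋0̸ : ∀ {f} → 1 ℕ.≤ deg f → f ≋0̸
  deg≥1⇒≋0̸ {f} le e with () ← ≡.subst (1 ℕ.≤_) (deg-zero f e) le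

  <°-C : ∀ a → C a <° 1
  <°-C a (suc i) _ = refl

  comp-≋0̸×deg : ∀ g {f} → 1 ℕ.≤ deg f → g ≋0̸ → (comp g f ≋0̸) × deg (comp g f) ≡ deg g ℕ.* deg f
  comp-≋0̸×deg [] 1≤d ng = contradiction P.refl ng
  comp-≋0̸×deg (a ∷ g) {f} 1≤d ng with zero? g
  ... | yes z = ≋0̸-cong (≋-sym Ca≋) na
              , ≡.trans (deg-cong Ca≋) (≡.trans (deg-unique {C a} {0} (λ e → na (0∷[]≋[] e)) λ { (suc i) _ → refl })
                  (≡.sym (≡.cong (ℕ._* deg f) (deg-unique {a ∷ g} {0} (λ e → na (0∷[]≋[] e)) λ { (suc i) _ → at z i }))))
    where
    na : C a ≋0̸
    na e = ng (≋-trans (∷-cong (at e 0) z) (0∷[]≋[] refl))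
    Ca≋ : comp (a ∷ g) f ≋ C a
    Ca≋ = P.trans (P.+-congˡ (P.trans (P.*-congˡ (comp-zero g f z)) (P.zeroʳ f))) (P.+-identityʳ (C a))
  ... | no nz with comp-≋0̸×deg g 1≤d nz
  ...   | nc , e = proj₁ dom , ≡.trans (proj₂ dom) (≡.trans deg≡ (≡.cong (ℕ._* deg f) (≡.sym deg-∷)))
    where
    nf = deg≥1⇒≋0̸ 1≤d
    deg-∷ : deg (a ∷ g) ≡ suc (deg g)
    deg-∷ = deg-unique {a ∷ g} (lead≉0 g nz) λ { (suc i) (s≤s le) → <°deg g i le }
    deg≡ : deg (f *ₚ comp g f) ≡ deg f ℕ.+ deg g ℕ.* deg f
    deg≡ = ≡.trans (deg-* nf nc) (≡.cong (deg f ℕ.+_) e)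
    dom = +-dominant {C a} (<°-mono (C a) (≡.subst (1 ℕ.≤_) (≡.sym deg≡) (ℕ.≤-trans 1≤d (ℕ.m≤m+n _ _))) (<°-C a)) (*ₚ-≋0̸ nf nc)

  comp-≋0̸ : ∀ g {f} → 1 ℕ.≤ deg f → g ≋0̸ → comp g f ≋0̸
  comp-≋0̸ g 1≤d ng = proj₁ (comp-≋0̸×deg g 1≤d ng)

  deg-comp : ∀ g {f} → 1 ℕ.≤ deg f → g ≋0̸ → deg (comp g f) ≡ deg g ℕ.* deg f
  deg-comp g 1≤d ng = proj₂ (comp-≋0̸×deg g 1≤d ng)

  comp-injective : ∀ g h {f} → 1 ℕ.≤ deg f → comp g f ≋ comp h f → g ≋ h
  comp-injective g h {f} 1≤d e with zero? (g P.- h)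
  ... | yes z = P.x-y≈0⇒x≈y z
  ... | no nz = contradiction (P.trans (comp-sub g h f) (P.x≈y⇒x-y≈0 e)) (comp-≋0̸ (g P.- h) 1≤d nz)

  -- The coefficients of `D` are the digits. If the part divisible by F were nonzero, it would have
  -- degree at least deg F and the lowest digit could not cancel it. So it vanishes, the lowest
  -- digit vanishes, and the recursion goes on with the remaining digits.
  digits-zero : ∀ D {F} → 1 ℕ.≤ deg F → (∀ i → PP.coeff D i <° deg F) → PP.eval D F ≋ [] →
                ∀ i → PP.coeff D i ≋ []
  digits-zero [] 1≤d lt e i = ≋-refl
  digits-zero (a ∷ D) {F} 1≤d lt e with zero? (PP.eval D F)
  ... | yes z = λ { zero    → P.trans (P.sym (P.trans (P.+-congˡ (P.trans (P.*-congˡ z) (P.zeroʳ F))) (P.+-identityʳ a))) e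
                  ; (suc i) → digits-zero D 1≤d (λ i → lt (suc i)) z i }
  ... | no nz = contradiction e (proj₁ (+-dominant {a} (<°-mono a le (lt 0)) (*ₚ-≋0̸ nF nz)))
    where
    nF = deg≥1⇒≋0̸ 1≤d
    le : deg F ℕ.≤ deg (F *ₚ PP.eval D F)
    le = ≡.subst (deg F ℕ.≤_) (≡.sym (deg-* nF nz)) (ℕ.m≤m+n _ _)

  divMod : ∀ F → F ≋0̸ → ∀ f → ∃[ Q ] ∃[ r ] f ≋ Q *ₚ F +ₚ r × r <° deg F
  divMod F nF [] = [] , [] , P.sym (P.trans (P.+-identityʳ _) (P.zeroˡ F)) , λ _ _ → refl
  divMod F nF (a ∷ f) with divMod F nF f
  ... | Q , r , e , lt = 𝕏 *ₚ Q +ₚ C c′ , (a ∷ r) P.- C c′ *ₚ F , eq , lt′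
    where
    d = deg F
    l⁻¹ = proj₁ (invert (coeff F d) (lead≉0 F nF))
    c′ = coeff (a ∷ r) d * l⁻¹
    eq : a ∷ f ≋ (𝕏 *ₚ Q +ₚ C c′) *ₚ F +ₚ ((a ∷ r) P.- C c′ *ₚ F)
    eq = P.begin
      a ∷ f                                   P.≈⟨ ∷≋C+𝕏* a f ⟩
      C a +ₚ 𝕏 *ₚ f                           P.≈⟨ P.+-congˡ (P.*-congˡ e) ⟩
      C a +ₚ 𝕏 *ₚ (Q *ₚ F +ₚ r)
        P.≈⟨ P.solve 6 (λ a X Q F r c → a P.:+ X P.:* (Q P.:* F P.:+ r)
             P.:= (X P.:* Q P.:+ c) P.:* F P.:+ ((a P.:+ X P.:* r) P.:- c P.:* F)) P.refl (C a) 𝕏 Q F r (C c′) ⟩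
      (𝕏 *ₚ Q +ₚ C c′) *ₚ F +ₚ ((C a +ₚ 𝕏 *ₚ r) P.- C c′ *ₚ F)
                                              P.≈⟨ P.+-congˡ (P.+-congʳ (∷≋C+𝕏* a r)) ⟨
      (𝕏 *ₚ Q +ₚ C c′) *ₚ F +ₚ ((a ∷ r) P.- C c′ *ₚ F) P.∎
    shifted : a ∷ r <° suc d
    shifted (suc i) (s≤s le) = lt i le
    lt′ : (a ∷ r) P.- C c′ *ₚ F <° d
    lt′ i d≤i with ℕ.m≤n⇒m<n∨m≡n d≤i
    ... | inj₁ d<i = <°-sub {a ∷ r} {C c′ *ₚ F} shifted (<°-C* c′ (<°deg F)) i d<i
    ... | inj₂ ≡.refl = begin
      coeff ((a ∷ r) P.- C c′ *ₚ F) d                ≈⟨ trans (coeff-sub (a ∷ r) (C c′ *ₚ F) d) (+-congˡ (-‿cong (coeff-C* c′ F d))) ⟩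
      coeff (a ∷ r) d - coeff (a ∷ r) d * l⁻¹ * coeff F d
        ≈⟨ solve 3 (λ x i l → x :- x :* i :* l := x :- x :* (l :* i)) refl _ _ _ ⟩
      coeff (a ∷ r) d - coeff (a ∷ r) d * (coeff F d * l⁻¹)
        ≈⟨ +-congˡ (-‿cong (*-congˡ (proj₂ (invert (coeff F d) (lead≉0 F nF))))) ⟩
      coeff (a ∷ r) d - coeff (a ∷ r) d * 1#         ≈⟨ solve 1 (λ x → x :- x :* con (+ 1) := con (+ 0)) refl _ ⟩
      0#                                             ∎

  record GCD (h k : Poly) : Set (c ⊔ ℓ) where
    field
      g z u α β : Poly
      g≋0̸ : g ≋0̸
      h≋ : h ≋ g *ₚ z
      k≋ : k ≋ g *ₚ u
      bezout : D.Coprime z u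

  -- Euclid's algorithm, with a degree bound for the second argument as fuel. The disjunction
  -- carried along ensures that the last divisor is nonzero.
  gcdₚ : ∀ h k → h ≋0̸ → GCD h k
  gcdₚ h k nh = go (suc (deg k)) h k (<°deg k) (inj₁ nh)
    where
    go : ∀ m h k → k <° m → (h ≋0̸) ⊎ (k ≋0̸) → GCD h k
    go m h k lt ne with zero? k
    go m h k lt (inj₂ nk) | yes z = contradiction z nk
    go m h k lt (inj₁ nh) | yes z = record
      { g = h ; z = P.1# ; u = [] ; α = P.1# ; β = [] ; g≋0̸ = nh
      ; h≋ = P.sym (P.*-identityʳ h) ; k≋ = P.trans z (P.sym (P.zeroʳ h))
      ; bezout = P.1# , [] , P.trans (P.+-cong (P.*-identityˡ _) (P.zeroʳ [])) (P.+-identityʳ _) }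
    go zero    h k lt ne | no nk = contradiction (<°0⇒≋[] lt) nk
    go (suc m) h k lt ne | no nk with divMod k nk h
    ... | Q , r , e , lt′ with go m k r (<°-mono r (ℕ.≤-pred (<°⇒deg< nk lt)) lt′) (inj₁ nk)
    ...   | G = record
      { g = g ; z = Q *ₚ z +ₚ u ; u = z ; α = β ; β = α P.- Q *ₚ β ; g≋0̸ = g≋0̸
      ; h≋ = P.begin
          h                            P.≈⟨ e ⟩
          Q *ₚ k +ₚ r                  P.≈⟨ P.+-cong (P.*-congˡ h≋) k≋ ⟩
          Q *ₚ (g *ₚ z) +ₚ g *ₚ u      P.≈⟨ P.solve 4 (λ Q g z u → Q P.:* (g P.:* z) P.:+ g P.:* u P.:= g P.:* (Q P.:* z P.:+ u)) P.refl Q g z u ⟩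
          g *ₚ (Q *ₚ z +ₚ u)           P.∎
      ; k≋ = h≋
      ; bezout = proj₁ (proj₂ bezout) , proj₁ bezout P.- Q *ₚ proj₁ (proj₂ bezout) , P.trans
          (P.solve 5 (λ s t Q z u → t P.:* (Q P.:* z P.:+ u) P.:+ (s P.:- Q P.:* t) P.:* z P.:= s P.:* z P.:+ t P.:* u) P.refl
            (proj₁ bezout) (proj₁ (proj₂ bezout)) Q z u)
          (proj₂ (proj₂ bezout)) }
      where open GCD G

  -- R is squarefree because R′ = −1, so R contributes less than one P-th power.
  root-∣ : ∀ {h k R} P j → j ℕ.< P → deriv R ≋ P.- P.1# → h ≋0̸ → R ≋0̸ →
           h P.^ P D.∣ᵣ k P.^ P *ₚ R P.^ j → h D.∣ᵣ k
  root-∣ {h} {k} {R} P j j<P R′ nh nR (Y , e) = u *ₚ s , (P.begin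
      h *ₚ (u *ₚ s)          P.≈⟨ P.*-congʳ h≋ ⟩
      (g *ₚ z) *ₚ (u *ₚ s)   P.≈⟨ P.solve 4 (λ g z u s → (g P.:* z) P.:* (u P.:* s) P.:= (g P.:* u) P.:* (z P.:* s)) P.refl g z u s ⟩
      (g *ₚ u) *ₚ (z *ₚ s)   P.≈⟨ P.*-cong (P.sym k≋) zs≋1 ⟩
      k *ₚ P.1#              P.≈⟨ P.*-identityʳ k ⟩
      k                      P.∎)
    where
    open GCD (gcdₚ h k nh)
    nz : z ≋0̸
    nz z0 = nh (P.trans h≋ (P.trans (P.*-congˡ z0) (P.zeroʳ g)))
    -- z^P divides R^j
    z∣ : z P.^ P D.∣ᵣ R P.^ j
    z∣ = D.coprime-∣ (D.coprime-^ P P bezout) (Y , *ₚ-cancelˡ (^ₚ-≋0̸ P g≋0̸) (P.begin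
      g P.^ P *ₚ (z P.^ P *ₚ Y)         P.≈⟨ P.*-assoc _ _ Y ⟨
      (g P.^ P *ₚ z P.^ P) *ₚ Y         P.≈⟨ P.*-congʳ (P.^-distrib-* g z P) ⟨
      (g *ₚ z) P.^ P *ₚ Y               P.≈⟨ P.*-congʳ (P.^-congˡ P h≋) ⟨
      h P.^ P *ₚ Y                      P.≈⟨ e ⟩
      k P.^ P *ₚ R P.^ j                P.≈⟨ P.*-congʳ (P.trans (P.^-congˡ P k≋) (P.^-distrib-* g u P)) ⟩
      (g P.^ P *ₚ u P.^ P) *ₚ R P.^ j   P.≈⟨ P.*-assoc _ _ _ ⟩
      g P.^ P *ₚ (u P.^ P *ₚ R P.^ j)   P.∎))
    -- the common factor c of z and R is a unit
    module G = GCD (gcdₚ z R nz)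
    c′ = G.g
    c-coprime : D.Coprime c′ G.u
    -- Let c be the common factor and R = c u. As R has derivative -1, the product rule for c u is a
    -- Bézout identity for c and u.
    c-coprime = P.- deriv G.u , P.- deriv c′ , (P.begin
      (P.- deriv G.u) *ₚ c′ +ₚ (P.- deriv c′) *ₚ G.u
        P.≈⟨ P.solve 4 (λ c u c′ u′ → (P.:- u′) P.:* c P.:+ (P.:- c′) P.:* u P.:= P.:- (c′ P.:* u P.:+ c P.:* u′)) P.refl c′ G.u (deriv c′) (deriv G.u) ⟩
      P.- (deriv c′ *ₚ G.u +ₚ c′ *ₚ deriv G.u)  P.≈⟨ P.-‿cong (deriv-* c′ G.u) ⟨
      P.- deriv (c′ *ₚ G.u)                     P.≈⟨ P.-‿cong (P.trans (deriv-cong (P.sym G.k≋)) R′) ⟩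
      P.- (P.- P.1#)                            P.≈⟨ P.-‿involutive P.1# ⟩
      P.1#                                      P.∎)
    cP∣ : c′ P.^ P D.∣ᵣ R P.^ j
    cP∣ = D.∣ᵣ-trans (D.∣ᵣ-pow P (G.z , P.sym G.h≋)) z∣
    c∣1 : c′ D.∣ᵣ P.1#
    c∣1 = D.coprime-∣ (D.coprime-^ʳ j c-coprime) (D.∣ᵣ-resp (P.sym (P.*-identityʳ _)) c∣u^j)
      where
      i = P ℕ.∸ suc j
      P≡ : P ≡ j ℕ.+ suc i
      P≡ = ≡.trans (≡.sym (ℕ.m+[n∸m]≡n j<P)) (≡.sym (ℕ.+-suc j i))
      W = proj₁ cP∣
      c∣u^j : c′ D.∣ᵣ G.u P.^ j
      -- c^P divides R^j = c^j u^j, and j < P leaves at least one factor c after the cancellation of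
      -- c^j.
      c∣u^j = c′ P.^ i *ₚ W , *ₚ-cancelˡ (^ₚ-≋0̸ j G.g≋0̸) (P.begin
        c′ P.^ j *ₚ (c′ *ₚ (c′ P.^ i *ₚ W))   P.≈⟨ P.solve 4 (λ a c i w → a P.:* (c P.:* (i P.:* w)) P.:= (a P.:* (c P.:* i)) P.:* w) P.refl _ c′ _ W ⟩
        (c′ P.^ j *ₚ c′ P.^ suc i) *ₚ W       P.≈⟨ P.*-congʳ (P.^-homo-* c′ j (suc i)) ⟨
        c′ P.^ (j ℕ.+ suc i) *ₚ W             P.≡⟨ ≡.cong (λ n → c′ P.^ n *ₚ W) P≡ ⟨
        c′ P.^ P *ₚ W                         P.≈⟨ proj₂ cP∣ ⟩
        R P.^ j                               P.≈⟨ P.trans (P.^-congˡ j G.k≋) (P.^-distrib-* c′ G.u j) ⟩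
        c′ P.^ j *ₚ G.u P.^ j                 P.∎)
    zR-coprime : D.Coprime z R
    zR-coprime = c⁻¹ *ₚ s , c⁻¹ *ₚ t , (P.begin
      (c⁻¹ *ₚ s) *ₚ z +ₚ (c⁻¹ *ₚ t) *ₚ R  P.≈⟨ P.+-cong (P.*-congˡ G.h≋) (P.*-congˡ G.k≋) ⟩
      (c⁻¹ *ₚ s) *ₚ (c′ *ₚ G.z) +ₚ (c⁻¹ *ₚ t) *ₚ (c′ *ₚ G.u)
        P.≈⟨ P.solve 6 (λ i s t c z u → (i P.:* s) P.:* (c P.:* z) P.:+ (i P.:* t) P.:* (c P.:* u) P.:= (c P.:* i) P.:* (s P.:* z P.:+ t P.:* u)) P.refl c⁻¹ s t c′ G.z G.u ⟩
      (c′ *ₚ c⁻¹) *ₚ (s *ₚ G.z +ₚ t *ₚ G.u)  P.≈⟨ P.*-cong (proj₂ c∣1) (proj₂ (proj₂ G.bezout)) ⟩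
      P.1# *ₚ P.1#                        P.≈⟨ P.*-identityˡ _ ⟩
      P.1#                                P.∎)
      where
      c⁻¹ = proj₁ c∣1
      s = proj₁ G.bezout
      t = proj₁ (proj₂ G.bezout)
    z^P∣1 : z P.^ P D.∣ᵣ P.1#
    z^P∣1 = D.coprime-∣ (D.coprime-^ P j zR-coprime) (D.∣ᵣ-resp (P.sym (P.*-identityʳ _)) z∣)
    z∣1 : z D.∣ᵣ P.1#
    z∣1 = D.∣ᵣ-trans (z P.^ ℕ.pred P , P.reflexive (≡.cong (z P.^_) (ℕ.suc-pred P {{ℕ.>-nonZero (ℕ.≤-<-trans z≤n j<P)}}))) z^P∣1
    s = proj₁ z∣1
    zs≋1 : z *ₚ s ≋ P.1#
    zs≋1 = proj₂ z∣1

  deg-𝕏-C : ∀ α → deg (𝕏 P.- C α) ≡ 1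
  deg-𝕏-C α = deg-unique (λ e → 1≉0 (trans (sym top) e))
    λ { (suc (suc i)) _ → trans (coeff-sub 𝕏 (C α) (suc (suc i))) (-‿inverseʳ 0#) ; (suc zero) (s≤s ()) }
    where
    top : coeff (𝕏 P.- C α) 1 ≈ 1#
    top = trans (coeff-sub 𝕏 (C α) 1) (trans (+-congˡ -0≈0) (+-identityʳ 1#))

  𝕏-C≋0̸ : ∀ α → 𝕏 P.- C α ≋0̸
  𝕏-C≋0̸ α = deg≥1⇒≋0̸ (ℕ.≤-reflexive (≡.sym (deg-𝕏-C α)))

  eval-𝕏-C : ∀ α x → eval (𝕏 P.- C α) x ≈ x - α
  eval-𝕏-C α x = trans (eval-sub 𝕏 (C α) x) (+-cong (eval-𝕏 x) (-‿cong (eval-C α x)))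

  root-factor : ∀ {f α} → f ≋0̸ → eval f α ≈ 0# →
                ∃[ g ] f ≋ (𝕏 P.- C α) *ₚ g × g ≋0̸ × deg f ≡ suc (deg g)
  root-factor {f} {α} nf e with quotient f
    where
    quotient : ∀ f → ∃[ g ] f ≋ (𝕏 P.- C α) *ₚ g +ₚ C (eval f α)
    quotient [] = [] , P.sym (P.trans (P.+-cong (P.zeroʳ _) C-0) (P.+-identityˡ []))
    quotient (a ∷ f) with quotient f
    ... | g , eq = C (eval f α) +ₚ 𝕏 *ₚ g , (P.begin
      a ∷ f                                               P.≈⟨ P.trans (∷≋C+𝕏* a f) (P.+-congˡ (P.*-congˡ eq)) ⟩
      C a +ₚ 𝕏 *ₚ ((𝕏 P.- C α) *ₚ g +ₚ C (eval f α))
        P.≈⟨ P.solve 5 (λ a X α g e → a P.:+ X P.:* ((X P.:- α) P.:* g P.:+ e)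
             P.:= (X P.:- α) P.:* (e P.:+ X P.:* g) P.:+ (a P.:+ α P.:* e)) P.refl (C a) 𝕏 (C α) g (C (eval f α)) ⟩
      (𝕏 P.- C α) *ₚ (C (eval f α) +ₚ 𝕏 *ₚ g) +ₚ (C a +ₚ C α *ₚ C (eval f α))
        P.≈⟨ P.+-congˡ (P.trans (P.+-congˡ (P.sym (C-* α _))) (P.sym (C-+ a _))) ⟩
      (𝕏 P.- C α) *ₚ (C (eval f α) +ₚ 𝕏 *ₚ g) +ₚ C (eval (a ∷ f) α) P.∎)
  ... | g , eq = g , f≋ , ng , ≡.trans (deg-cong f≋) (≡.trans (deg-* (𝕏-C≋0̸ α) ng) (≡.cong (ℕ._+ deg g) (deg-𝕏-C α)))
    where
    f≋ : f ≋ (𝕏 P.- C α) *ₚ g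
    f≋ = P.trans eq (P.trans (P.+-congˡ (P.trans (C-cong e) C-0)) (P.+-identityʳ _))
    ng : g ≋0̸
    ng z = nf (P.trans f≋ (P.trans (P.*-congˡ z) (P.zeroʳ _)))

-- Counting the elements of a finite set that satisfy a decidable predicate.

module Count where

  open import Data.Nat.Base as ℕ using (_+_; _*_; _≤_; _<_)
  import Data.Nat.Properties as ℕ
  open import Data.Bool.Base using (if_then_else_)
  open import Data.Fin.Base as Fin using (Fin; zero; suc)
  import Data.Fin.Properties as Fin
  open import Data.Fin.Permutation using (Permutation; _⟨$⟩ʳ_)
  open import Data.Fin.Subset using (inside; outside)
  open import Data.Fin.Subset.Properties using (_∈?_)
  open import Data.Vec.Base using (_∷_; []; there)
  open import Data.Vec.Relation.Unary.Any using ()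
  open import Level using (Level)
  open import Relation.Unary using (Pred; Decidable)
  open import Relation.Nullary.Decidable using (yes; no; does; _×-dec_; ¬?)
  open import Relation.Binary.PropositionalEquality
  open import Algebra.Properties.CommutativeMonoid.Sum ℕ.+-0-commutativeMonoid
    using (sum; ∑-comm; ∑-distrib-+; sum-permute; sum-cong-≗)
  open import Algebra.Properties.Semiring.Sum ℕ.+-*-semiring using (*-distribˡ-sum)

  private variable
    ℓ ℓ′ : Level
    m n : ℕ

  𝟙 : {A : Set ℓ} → Dec A → ℕ
  𝟙 d = if does d then 1 else 0

  𝟙-yes : {A : Set ℓ} (d : Dec A) → A → 𝟙 d ≡ 1
  𝟙-yes (yes _) a = refl
  𝟙-yes (no ¬a) a = contradiction a ¬a

  𝟙-no : {A : Set ℓ} (d : Dec A) → ¬ A → 𝟙 d ≡ 0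
  𝟙-no (yes a) ¬a = contradiction a ¬a
  𝟙-no (no _)  ¬a = refl

  𝟙-mono : {A : Set ℓ} {B : Set ℓ′} (d : Dec A) (e : Dec B) → (A → B) → 𝟙 d ≤ 𝟙 e
  𝟙-mono (no _)  e f = z≤n
  𝟙-mono (yes a) e f = ℕ.≤-reflexive (sym (𝟙-yes e (f a)))

  sum-mono : ∀ {f g : Fin n → ℕ} → (∀ i → f i ≤ g i) → sum f ≤ sum g
  sum-mono {zero}  le = z≤n
  sum-mono {suc n} le = ℕ.+-mono-≤ (le zero) (sum-mono (λ i → le (suc i)))

  sum-zero : ∀ {f : Fin n → ℕ} → (∀ i → f i ≡ 0) → sum f ≡ 0
  sum-zero {zero}  z = refl
  sum-zero {suc n} z = cong₂ _+_ (z zero) (sum-zero (λ i → z (suc i)))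

  sum-single : ∀ {f : Fin n → ℕ} a → (∀ i → i ≢ a → f i ≡ 0) → sum f ≡ f a
  sum-single {suc n} {f} zero z =
    trans (cong (f zero +_) (sum-zero (λ i → z (suc i) λ ()))) (ℕ.+-identityʳ _)
  sum-single {suc n} {f} (suc a) z =
    trans (cong (_+ sum (λ i → f (suc i))) (z zero λ ()))
          (sum-single a (λ i i≢a → z (suc i) λ e → i≢a (Fin.suc-injective e)))

  sum-const : ∀ n c → sum {n} (λ _ → c) ≡ n * c
  sum-const zero    c = refl
  sum-const (suc n) c = cong (c +_) (sum-const n c)

  -- As a sum of indicators, so that invariance under permutations and double counting become
  -- properties of finite sums.
  # : {P : Pred (Fin n) ℓ} → Decidable P → ℕ
  # P? = sum (λ i → 𝟙 (P? i))

  #-mono : {P : Pred (Fin n) ℓ} {Q : Pred (Fin n) ℓ′} (P? : Decidable P) (Q? : Decidable Q) →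
           (∀ i → P i → Q i) → # P? ≤ # Q?
  #-mono P? Q? f = sum-mono (λ i → 𝟙-mono (P? i) (Q? i) (f i))

  #-cong : {P : Pred (Fin n) ℓ} {Q : Pred (Fin n) ℓ′} (P? : Decidable P) (Q? : Decidable Q) →
           (∀ i → P i → Q i) → (∀ i → Q i → P i) → # P? ≡ # Q?
  #-cong P? Q? f g = ℕ.≤-antisym (#-mono P? Q? f) (#-mono Q? P? g)

  #-empty : {P : Pred (Fin n) ℓ} (P? : Decidable P) → (∀ i → ¬ P i) → # P? ≡ 0
  #-empty P? e = sum-zero (λ i → 𝟙-no (P? i) (e i))

  #-full : {P : Pred (Fin n) ℓ} (P? : Decidable P) → (∀ i → P i) → # P? ≡ n
  #-full {n} P? e = trans (sum-cong-≗ (λ i → 𝟙-yes (P? i) (e i))) (trans (sum-const n 1) (ℕ.*-identityʳ n))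

  #-unique : {P : Pred (Fin n) ℓ} (P? : Decidable P) → ∀ a → P a → (∀ i → P i → i ≡ a) → # P? ≡ 1
  #-unique P? a Pa u = trans (sum-single a (λ i i≢a → 𝟙-no (P? i) (λ Pi → i≢a (u i Pi)))) (𝟙-yes (P? a) Pa)

  #-permute : {P : Pred (Fin n) ℓ} (P? : Decidable P) (π : Permutation n n) →
              # P? ≡ # (λ i → P? (π ⟨$⟩ʳ i))
  #-permute P? π = sum-permute (λ i → 𝟙 (P? i)) π

  #<⇒∃ : {P : Pred (Fin n) ℓ} {Q : Pred (Fin n) ℓ′} (P? : Decidable P) (Q? : Decidable Q) →
         # P? < # Q? → ∃[ i ] Q i × ¬ P i
  #<⇒∃ P? Q? lt with Fin.any? (λ i → Q? i ×-dec ¬? (P? i))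
  ... | yes e = e
  ... | no ne = contradiction (#-mono Q? P? sub) (ℕ.<⇒≱ lt)
    where
    sub : ∀ i → _ → _
    sub i Qi with P? i
    ... | yes Pi = Pi
    ... | no ¬Pi = contradiction (i , Qi , ¬Pi) ne

  #>0⇒∃ : {P : Pred (Fin n) ℓ} (P? : Decidable P) → 0 < # P? → ∃[ i ] P i
  #>0⇒∃ P? lt with Fin.any? P?
  ... | yes e = e
  ... | no ne = contradiction (#-empty P? (λ i Pi → ne (i , Pi))) (λ e → ℕ.<⇒≢ lt (sym e))

  #-full-subset : {P : Pred (Fin n) ℓ} {Q : Pred (Fin n) ℓ′} (P? : Decidable P) (Q? : Decidable Q) →
                  (∀ i → P i → Q i) → # Q? ≤ # P? → ∀ i → Q i → P i
  #-full-subset P? Q? f le i Qi with P? i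
  ... | yes Pi = Pi
  ... | no ¬Pi = contradiction le (ℕ.<⇒≱ (strict i (λ j → 𝟙-mono (P? j) (Q? j) (f j))
                   (ℕ.≤-reflexive (trans (cong suc (𝟙-no (P? i) ¬Pi)) (sym (𝟙-yes (Q? i) Qi))))))
    where
    strict : ∀ {n} {f g : Fin n → ℕ} i → (∀ j → f j ≤ g j) → f i < g i → sum f < sum g
    strict zero    le lt = ℕ.+-mono-<-≤ lt (sum-mono (λ j → le (suc j)))
    strict (suc i) le lt = ℕ.+-mono-≤-< (le zero) (strict i (λ j → le (suc j)) lt)

  ∣∣≡# : (U : Subset n) → ∣ U ∣ ≡ # (_∈? U)
  ∣∣≡# []            = refl
  ∣∣≡# (inside ∷ U)  = cong suc (trans (∣∣≡# U) (#-cong (_∈? U) (λ i → suc i ∈? (inside ∷ U)) (λ _ → there) λ { _ (there e) → e }))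
  ∣∣≡# (outside ∷ U) = trans (∣∣≡# U) (#-cong (_∈? U) (λ i → suc i ∈? (outside ∷ U)) (λ _ → there) λ { _ (there e) → e })

  module Fibres {P : Pred (Fin m) ℓ} (P? : Decidable P) (f : Fin m → Fin n) where

    fibre? : ∀ y → Decidable (λ x → P x × f x ≡ y)
    fibre? y x = P? x ×-dec (f x Fin.≟ y)

    #-fibres : # P? ≡ sum (λ y → # (fibre? y))
    #-fibres = trans (sum-cong-≗ pointwise) (∑-comm (λ x y → 𝟙 (fibre? y x)))
      where
      pointwise : ∀ x → 𝟙 (P? x) ≡ sum (λ y → 𝟙 (fibre? y x))
      pointwise x = sym (trans (sum-single (f x) (λ y y≢ → 𝟙-no (fibre? y x) (λ (_ , e) → y≢ (sym e))))
        (ℕ.≤-antisym (𝟙-mono (fibre? (f x) x) (P? x) proj₁) (𝟙-mono (P? x) (fibre? (f x) x) (_, refl))))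

    module _ {Q : Pred (Fin n) ℓ′} (Q? : Decidable Q) (v : ℕ) where

      #-fibres-≤ : (∀ x → P x → Q (f x)) → (∀ y → Q y → # (fibre? y) ≤ v) → # P? ≤ v * # Q?
      #-fibres-≤ PQ le = ℕ.≤-trans (ℕ.≤-reflexive #-fibres)
        (ℕ.≤-trans (sum-mono bound) (ℕ.≤-reflexive (sym (*-distribˡ-sum v (λ i → 𝟙 (Q? i))))))
        where
        bound : ∀ y → # (fibre? y) ≤ v * 𝟙 (Q? y)
        bound y with Q? y
        ... | yes Qy = ℕ.≤-trans (le y Qy) (ℕ.≤-reflexive (sym (ℕ.*-identityʳ v)))
        ... | no ¬Qy = ℕ.≤-trans (ℕ.≤-reflexive (#-empty (fibre? y) λ x (Px , e) → ¬Qy (subst Q e (PQ x Px)))) z≤n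

      #-fibres-≥ : (∀ y → Q y → v ≤ # (fibre? y)) → v * # Q? ≤ # P?
      #-fibres-≥ le = ℕ.≤-trans (ℕ.≤-reflexive (*-distribˡ-sum v (λ i → 𝟙 (Q? i))))
        (ℕ.≤-trans (sum-mono bound) (ℕ.≤-reflexive (sym #-fibres)))
        where
        bound : ∀ y → v * 𝟙 (Q? y) ≤ # (fibre? y)
        bound y with Q? y
        ... | yes Qy = ℕ.≤-trans (ℕ.≤-reflexive (ℕ.*-identityʳ v)) (le y Qy)
        ... | no _   = ℕ.≤-trans (ℕ.≤-reflexive (ℕ.*-zeroʳ v)) z≤n

-- Inequalities between the degrees that occur in the descent.

module DegreeBounds where

  open import Data.Nat.Base
  open import Data.Nat.Properties
  open import Data.Nat.Tactic.RingSolver using (solve-∀)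
  open import Relation.Binary.PropositionalEquality
  open ≤-Reasoning

  -- Applied with P₁ = p^i₀, with d and d′ the degrees of F and F′, and with Q the degree of the
  -- cofactor in b^v = F^t Q: deg F′Q stays below d. If d ≤ d′ + Q, then P₁ v Q ≤ P₁ P Q < d would
  -- turn the first bound into P₁ d < 2 d.
  small-contradiction : ∀ P₁ P v d d′ Q → 2 ≤ P₁ → v ≤ P → P₁ * (d + v * d′) < d + P₁ * (v * d) →
                        P₁ * (P * Q) < d → ¬ (d ≤ d′ + Q)
  small-contradiction P₁ P v d d′ Q 2≤P₁ v≤P fb fq le = <-irrefl refl (begin-strict
    P₁ * d + P₁ * (v * d′)              ≡⟨ *-distribˡ-+ P₁ d (v * d′) ⟨
    P₁ * (d + v * d′)                   <⟨ fb ⟩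
    d + P₁ * (v * d)                    ≤⟨ +-monoʳ-≤ d (*-monoʳ-≤ P₁ (*-monoʳ-≤ v le)) ⟩
    d + P₁ * (v * (d′ + Q))             ≡⟨ eq₁ d P₁ v d′ Q ⟩
    (d + P₁ * (v * Q)) + P₁ * (v * d′)  ≤⟨ +-monoˡ-≤ (P₁ * (v * d′)) (+-monoʳ-≤ d (≤-trans (*-monoʳ-≤ P₁ (*-monoˡ-≤ Q v≤P)) (<⇒≤ fq))) ⟩
    (d + d) + P₁ * (v * d′)             ≤⟨ +-monoˡ-≤ (P₁ * (v * d′)) (≤-trans (≤-reflexive (cong (d +_) (sym (+-identityʳ d)))) (*-monoˡ-≤ d 2≤P₁)) ⟩
    P₁ * d + P₁ * (v * d′)              ∎)
    where
    eq₁ : ∀ d P₁ v d′ Q → d + P₁ * (v * (d′ + Q)) ≡ (d + P₁ * (v * Q)) + P₁ * (v * d′)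
    eq₁ = solve-∀

  t<v : ∀ {v w t P} → v * suc w ≡ suc (t * P) → suc w < P → t < v
  t<v {v} {w} {t} {P} e W<P = ≰⇒> λ v≤t → <-irrefl refl (begin-strict
    t * P       <⟨ n<1+n (t * P) ⟩
    suc (t * P) ≡⟨ e ⟨
    v * suc w   ≤⟨ *-mono-≤ v≤t (<⇒≤ W<P) ⟩
    t * P       ∎)

  -- Here A = deg a and m = deg f, and d′ < A is what a stop yields. Multiply v d ≤ d + v d′ by p P,
  -- replace P (d′ + 1) by m d and then p v m by p t P + P: what is left excludes v ≥ t + 2.
  stop-v≤ : ∀ p P v d d′ A m t → 1 ≤ p → 1 ≤ P → 1 ≤ v → d′ < A → P * A ≤ m * d →
            p * (v * m) ≤ p * (t * P) + P → v * d ≤ d + v * d′ → v ≤ suc t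
  stop-v≤ p P v d d′ A m t 1≤p 1≤P 1≤v d′<A PA≤ pvm≤ vd≤ = ≮⇒≥ λ t+2≤v → <-irrefl refl (begin-strict
    (P * p * (suc t) * d + p * P * d)              <⟨ m<m+n _ (*-mono-≤ (*-mono-≤ 1≤P 1≤p) 1≤v) ⟩
    (P * p * (suc t) * d + p * P * d) + P * p * v  ≡⟨ eq₁ P p t d v ⟩
    P * p * (suc (suc t) * d) + P * p * v          ≤⟨ +-monoˡ-≤ (P * p * v) (*-monoʳ-≤ (P * p) (*-monoˡ-≤ d t+2≤v)) ⟩
    P * p * (v * d) + P * p * v                    ≤⟨ +-monoˡ-≤ (P * p * v) (*-monoʳ-≤ (P * p) vd≤) ⟩
    P * p * (d + v * d′) + P * p * v               ≡⟨ eq₂ P p d v d′ ⟩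
    P * p * d + p * v * (P * suc d′)               ≤⟨ +-monoʳ-≤ (P * p * d) (*-monoʳ-≤ (p * v) (≤-trans (*-monoʳ-≤ P d′<A) PA≤)) ⟩
    P * p * d + p * v * (m * d)                    ≡⟨ eq₃ P p d v m ⟩
    P * p * d + (p * (v * m)) * d                  ≤⟨ +-monoʳ-≤ (P * p * d) (*-monoˡ-≤ d pvm≤) ⟩
    P * p * d + (p * (t * P) + P) * d              ≡⟨ eq₄ P p d t ⟩
    P * p * (suc t) * d + 1 * P * d                ≤⟨ +-monoʳ-≤ (P * p * (suc t) * d) (*-monoˡ-≤ d (*-monoˡ-≤ P 1≤p)) ⟩
    P * p * (suc t) * d + p * P * d                ∎)
    where
    eq₁ : ∀ P p t d v → (P * p * (suc t) * d + p * P * d) + P * p * v ≡ P * p * (suc (suc t) * d) + P * p * v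
    eq₁ = solve-∀
    eq₂ : ∀ P p d v d′ → P * p * (d + v * d′) + P * p * v ≡ P * p * d + p * v * (P * suc d′)
    eq₂ = solve-∀
    eq₃ : ∀ P p d v m → P * p * d + p * v * (m * d) ≡ P * p * d + (p * (v * m)) * d
    eq₃ = solve-∀
    eq₄ : ∀ P p d t → P * p * d + (p * (t * P) + P) * d ≡ P * p * (suc t) * d + 1 * P * d
    eq₄ = solve-∀

  -- This becomes the field `slope` at the first stop, where A = deg a and W = deg f: the estimate P
  -- (d′ + 1) ≤ W d is multiplied by v, and v W = t P + 1 with t + 1 = v.
  first-bound : ∀ P v d d′ A W t → 1 ≤ P → d′ < A → P * A ≤ W * d → v * W ≡ suc (t * P) → v ≡ suc t →
                P * (d + v * d′) < d + P * (v * d)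
  first-bound P v d d′ A W t 1≤P d′<A PA≤ vW refl = begin-strict
    P * (d + v * d′)            <⟨ m<m+n _ (*-mono-≤ 1≤P (s≤s (z≤n {t}))) ⟩
    P * (d + v * d′) + P * v    ≡⟨ eq₁ P d v d′ ⟩
    P * d + v * (P * suc d′)    ≤⟨ +-monoʳ-≤ (P * d) (*-monoʳ-≤ v (≤-trans (*-monoʳ-≤ P d′<A) PA≤)) ⟩
    P * d + v * (W * d)         ≡⟨ cong (P * d +_) (sym (*-assoc v W d)) ⟩
    P * d + v * W * d           ≡⟨ cong (λ x → P * d + x * d) vW ⟩
    P * d + suc (t * P) * d     ≡⟨ eq₂ P d t ⟩
    d + P * (suc t * d)         ∎
    where
    eq₁ : ∀ P d v d′ → P * (d + v * d′) + P * v ≡ P * d + v * (P * suc d′)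
    eq₁ = solve-∀
    eq₂ : ∀ P d t → P * d + suc (t * P) * d ≡ d + P * (suc t * d)
    eq₂ = solve-∀

  -- For a linear G with v ≥ t + 2; A = deg a, m = deg f and Q is the degree of the cofactor. From d
  -- < Q + A one gets p P v d ≤ p v P A + p v P Q, where the first term is at most (p t P + P) d and
  -- the second is below P d, since v p ≤ P₁ P. This is too little for v ≥ t + 2.
  large-contradiction : ∀ p P P₁ v d A Q m t → 1 ≤ p → 1 ≤ P → p ≤ P → v ≤ P₁ → P * A ≤ m * d →
                        p * (v * m) ≤ p * (t * P) + P → suc (suc t) ≤ v → P₁ * (P * Q) < d → ¬ (d < Q + A)
  large-contradiction p P P₁ v d A Q m t 1≤p 1≤P p≤P v≤P₁ PA≤ pvm≤ t+2≤v fq lt = <-irrefl refl (begin-strict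
    (p * (t * P) + P) * d + P * d            ≤⟨ +-monoʳ-≤ ((p * (t * P) + P) * d) (≤-reflexive (sym (*-identityˡ (P * d)))) ⟩
    (p * (t * P) + P) * d + 1 * (P * d)      ≤⟨ +-monoˡ-≤ (1 * (P * d)) (*-monoˡ-≤ d (+-monoʳ-≤ (p * (t * P)) (≤-trans (≤-reflexive (sym (*-identityˡ P))) (*-monoˡ-≤ P 1≤p)))) ⟩
    (p * (t * P) + p * P) * d + 1 * (P * d)  ≤⟨ +-monoʳ-≤ ((p * (t * P) + p * P) * d) (*-monoˡ-≤ (P * d) 1≤p) ⟩
    (p * (t * P) + p * P) * d + p * (P * d)  ≡⟨ eq₁ p t P d ⟩
    P * (p * (suc (suc t) * d))              ≤⟨ *-monoʳ-≤ P (*-monoʳ-≤ p (*-monoˡ-≤ d t+2≤v)) ⟩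
    P * (p * (v * d))                        ≤⟨ *-monoʳ-≤ P (*-monoʳ-≤ p (*-monoʳ-≤ v (<⇒≤ lt))) ⟩
    P * (p * (v * (Q + A)))                  ≡⟨ eq₂ P p v Q A ⟩
    p * v * (P * A) + P * ((v * p) * Q)      ≤⟨ +-mono-≤ (*-monoʳ-≤ (p * v) PA≤) (*-monoʳ-≤ P (*-monoˡ-≤ Q (*-mono-≤ v≤P₁ p≤P))) ⟩
    p * v * (m * d) + P * ((P₁ * P) * Q)     ≡⟨ cong₂ _+_ (eq₃ p v m d) (cong (P *_) (*-assoc P₁ P Q)) ⟩
    p * (v * m) * d + P * (P₁ * (P * Q))     <⟨ +-mono-≤-< (*-monoˡ-≤ d pvm≤) (*-monoʳ-< P {{>-nonZero 1≤P}} fq) ⟩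
    (p * (t * P) + P) * d + P * d            ∎)
    where
    eq₁ : ∀ p t P d → (p * (t * P) + p * P) * d + p * (P * d) ≡ P * (p * (suc (suc t) * d))
    eq₁ = solve-∀
    eq₂ : ∀ P p v Q A → P * (p * (v * (Q + A))) ≡ p * v * (P * A) + P * ((v * p) * Q)
    eq₂ = solve-∀
    eq₃ : ∀ p v m d → p * v * (m * d) ≡ p * (v * m) * d
    eq₃ = solve-∀

  v≤d : ∀ {v d d′} → v * d ≤ d + v * d′ → d′ < d → v ≤ d
  v≤d {v} {d} {d′} vd≤ d′<d = +-cancelʳ-≤ (v * d′) v d (begin
    v + v * d′   ≡⟨ *-suc v d′ ⟨
    v * suc d′   ≤⟨ *-monoʳ-≤ v d′<d ⟩
    v * d        ≤⟨ vd≤ ⟩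
    d + v * d′   ∎)

  -- At level n one has P = q, and s + w = q for linear G. Then v q = v (w + 1) + v (s - 1) ≤ t q +
  -- 1 + (s - 1) d ≤ (t + 1) q.
  last-level : ∀ {v w t s d q} → 1 ≤ q → v * suc w ≡ suc (t * q) → s + w ≡ q → 1 ≤ s → pred s * d < q → v ≤ d → v ≤ suc t
  last-level {v} {w} {t} {suc s} {d} {q} 1≤q vW sw _ sd<q v≤d = *-cancelʳ-≤ v (suc t) q {{>-nonZero 1≤q}} (begin
    v * q                    ≡⟨ cong (v *_) sw ⟨
    v * (suc s + w)          ≡⟨ eq₁ v s w ⟩
    v * suc w + v * s        ≡⟨ cong (_+ v * s) vW ⟩
    suc (t * q) + v * s      ≤⟨ +-monoʳ-≤ (suc (t * q)) (*-monoˡ-≤ s v≤d) ⟩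
    suc (t * q) + d * s      ≡⟨ eq₂ t q d s ⟩
    t * q + suc (s * d)      ≤⟨ +-monoʳ-≤ (t * q) sd<q ⟩
    t * q + q                ≡⟨ +-comm (t * q) q ⟩
    suc t * q                ∎)
    where
    eq₁ : ∀ v s w → v * (suc s + w) ≡ v * suc w + v * s
    eq₁ = solve-∀
    eq₂ : ∀ t q d s → suc (t * q) + d * s ≡ t * q + suc (s * d)
    eq₂ = solve-∀

  -- For linear G, y^w T is a combination of f and y^P. An exponent w + j + 1 there, with v-fold t P
  -- + E, becomes the exponent j + 1 of T, with v j + 1 = E.
  exponent : ∀ {v w t P j E} → v * suc w ≡ suc (t * P) → v * (w + suc j) ≡ t * P + E → suc (v * j) ≡ E
  exponent {v} {w} {t} {P} {j} {E} vW e = +-cancelˡ-≡ (t * P) (suc (v * j)) E (begin-equality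
    t * P + suc (v * j)    ≡⟨ +-suc (t * P) (v * j) ⟩
    suc (t * P) + v * j    ≡⟨ cong (_+ v * j) vW ⟨
    v * suc w + v * j      ≡⟨ eq v w j ⟩
    v * (w + suc j)        ≡⟨ e ⟩
    t * P + E              ∎)
    where
    eq : ∀ v w j → v * suc w + v * j ≡ v * (w + suc j)
    eq = solve-∀

  -- If w + 1 inverts v modulo P, then w + 1 + r P inverts v modulo p P: `r` is the next base-p
  -- digit of 1/v.
  next-vW : ∀ {v w t t₊ r p P} → v * suc w ≡ suc (t * P) → t + v * r ≡ t₊ * p →
            v * suc (w + r * P) ≡ suc (t₊ * (p * P))
  next-vW {v} {w} {t} {t₊} {r} {p} {P} vW e = begin-equality
    v * suc (w + r * P)          ≡⟨ eq₁ v w r P ⟩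
    v * suc w + v * r * P        ≡⟨ cong (_+ v * r * P) vW ⟩
    suc (t * P) + v * r * P      ≡⟨ eq₂ v r t P ⟩
    suc ((t + v * r) * P)        ≡⟨ cong (λ x → suc (x * P)) e ⟩
    suc (t₊ * p * P)             ≡⟨ cong suc (*-assoc t₊ p P) ⟩
    suc (t₊ * (p * P))           ∎
    where
    eq₁ : ∀ v w r P → v * suc (w + r * P) ≡ v * suc w + v * r * P
    eq₁ = solve-∀
    eq₂ : ∀ v r t P → suc (t * P) + v * r * P ≡ suc ((t + v * r) * P)
    eq₂ = solve-∀

  next-exponent : ∀ {v t t₊ r p P m E} → t + v * r ≡ t₊ * p → v * m ≡ t * P + E →
                  v * (r * P + m) ≡ t₊ * (p * P) + E
  next-exponent {v} {t} {t₊} {r} {p} {P} {m} {E} e vm = begin-equality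
    v * (r * P + m)          ≡⟨ eq₁ v r P m ⟩
    v * r * P + v * m        ≡⟨ cong (v * r * P +_) vm ⟩
    v * r * P + (t * P + E)  ≡⟨ eq₂ v r t P E ⟩
    (t + v * r) * P + E      ≡⟨ cong (λ x → x * P + E) e ⟩
    t₊ * p * P + E           ≡⟨ cong (_+ E) (*-assoc t₊ p P) ⟩
    t₊ * (p * P) + E         ∎
    where
    eq₁ : ∀ v r P m → v * (r * P + m) ≡ v * r * P + v * m
    eq₁ = solve-∀
    eq₂ : ∀ v r t P E → v * r * P + (t * P + E) ≡ (t + v * r) * P + E
    eq₂ = solve-∀

  -- The degree equation behind b^v = F^t Q.
  Q-degree : ∀ {P v w t d d′ B Q} → P * B ≡ w * d + d′ → v * B ≡ t * d + Q → v * suc w ≡ suc (t * P) →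
             P * Q + v * d ≡ d + v * d′
  Q-degree {P} {v} {w} {t} {d} {d′} {B} {Q} PB vB vW = +-cancelˡ-≡ (P * (t * d)) (P * Q + v * d) (d + v * d′) (begin-equality
    P * (t * d) + (P * Q + v * d)     ≡⟨ eq₁ P t d Q v ⟩
    P * (t * d + Q) + v * d           ≡⟨ cong (λ x → P * x + v * d) vB ⟨
    P * (v * B) + v * d               ≡⟨ eq₂ P v B d ⟩
    v * (P * B) + v * d               ≡⟨ cong (λ x → v * x + v * d) PB ⟩
    v * (w * d + d′) + v * d          ≡⟨ eq₃ v w d d′ ⟩
    v * suc w * d + v * d′            ≡⟨ cong (λ x → x * d + v * d′) vW ⟩
    suc (t * P) * d + v * d′          ≡⟨ eq₄ t P d v d′ ⟩
    P * (t * d) + (d + v * d′)        ∎)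
    where
    eq₁ : ∀ P t d Q v → P * (t * d) + (P * Q + v * d) ≡ P * (t * d + Q) + v * d
    eq₁ = solve-∀
    eq₂ : ∀ P v B d → P * (v * B) + v * d ≡ v * (P * B) + v * d
    eq₂ = solve-∀
    eq₃ : ∀ v w d d′ → v * (w * d + d′) + v * d ≡ v * suc w * d + v * d′
    eq₃ = solve-∀
    eq₄ : ∀ t P d v d′ → suc (t * P) * d + v * d′ ≡ P * (t * d) + (d + v * d′)
    eq₄ = solve-∀

  Q-small : ∀ {P₁ P v d d′ Q} → P₁ * (d + v * d′) < d + P₁ * (v * d) → P * Q + v * d ≡ d + v * d′ → P₁ * (P * Q) < d
  Q-small {P₁} {P} {v} {d} {d′} {Q} fb e = +-cancelʳ-< (P₁ * (v * d)) (P₁ * (P * Q)) d (begin-strict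
    P₁ * (P * Q) + P₁ * (v * d)    ≡⟨ *-distribˡ-+ P₁ (P * Q) (v * d) ⟨
    P₁ * (P * Q + v * d)           ≡⟨ cong (P₁ *_) e ⟩
    P₁ * (d + v * d′)              <⟨ fb ⟩
    d + P₁ * (v * d)               ∎)

-- Finite fields with p^n elements: Fermat, Frobenius, p-th roots, roots of polynomials.

-- The field is carried by `Fin q` itself with propositional equality: its elements serve as
-- summation indices, equality is decidable, and translations and dilations are permutations of the
-- index set.
record GaloisData : Set where
  field
    p n : ℕ
    pr  : Prime p
    n≥1 : 1 ℕ.≤ n

  q : ℕ
  q = p ℕ.^ n

  field
    {add mul} : Fin q → Fin q → Fin q
    {neg}     : Fin q → Fin q
    {zer one} : Fin q
    isCommutativeRing : IsCommutativeRing _≡_ add mul neg zer one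
    1≢0    : one ≢ zer
    invert : ∀ x → x ≢ zer → ∃[ y ] mul x y ≡ one

  𝔽 : CommutativeRing _ _
  𝔽 = record { isCommutativeRing = isCommutativeRing }

module GaloisField (𝔾 : GaloisData) where

  open GaloisData 𝔾 public using (p; n; pr; n≥1; q; 1≢0; invert; 𝔽)

  import Data.Nat.Properties as ℕ
  open import Data.Nat.Divisibility as ℕ∣ using (_∣_; divides; _∣?_)
  import Data.Nat.Coprimality as Coprimality
  open import Data.Nat.GCD using (module Bézout)
  open import Data.Nat.Primality using (prime⇒nonZero; prime⇒irreducible; prime⇒nonTrivial)
  import Data.Fin.Properties as Fin
  open import Data.Fin.Permutation using (Permutation; permutation)
  open import Data.List.Base using (List; []; _∷_; length; drop)
  open import Data.List.Properties using () renaming (length-drop to length-drop′)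
  open import Data.Sum.Base using (inj₁; inj₂)
  open import Relation.Unary using (Pred; Decidable)
  open import Relation.Nullary.Decidable using (yes; no; ¬?)
  open import Level using (Level)

  open RingTools 𝔽 public hiding (Carrier; _≈_; isCommutativeRing; refl; sym; trans; reflexive)

  decidableField : DecidableField _ _
  decidableField = record { commutativeRing = 𝔽 ; ≈-dec = Fin._≟_ ; 1≉0 = 1≢0 ; invert = invert }

  open OverField decidableField public
    hiding (commutativeRing; ≈-dec; 1≉0; invert)
  open Count public

  p≥2 : 2 ℕ.≤ p
  p≥2 = ℕ.nonTrivial⇒n>1 p {{prime⇒nonTrivial pr}}

  instance
    p-nonZero : ℕ.NonZero p
    p-nonZero = prime⇒nonZero pr

  q≡p*q/p : q ≡ p ℕ.* p ℕ.^ ℕ.pred n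
  q≡p*q/p = ≡.cong (p ℕ.^_) (≡.sym (ℕ.suc-pred n {{ℕ.>-nonZero n≥1}}))

  q≥2 : 2 ℕ.≤ q
  q≥2 = ≡.subst (2 ℕ.≤_) (≡.sym q≡p*q/p) (ℕ.≤-trans p≥2 (ℕ.m≤m*n p _ {{ℕ.m^n≢0 p (ℕ.pred n)}}))

  private
    module Sum where
      open import Algebra.Properties.CommutativeMonoid.Sum +-commutativeMonoid public
        using (sum; sum-permute; ∑-distrib-+; sum-replicate)
    module Prod where
      open import Algebra.Properties.CommutativeMonoid.Sum *-commutativeMonoid public
        using (sum; sum-permute; ∑-distrib-+; sum-cong-≗)

  translation : Fin q → Permutation q q
  translation a = permutation (_+_ a) (λ x → x + (- a))
    (λ x → ≡.trans (+-comm a _) (≡.trans (+-assoc x _ a) (≡.trans (≡.cong (x +_) (-‿inverseˡ a)) (+-identityʳ x))))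
    (λ x → ≡.trans (≡.cong (_+ (- a)) (+-comm a x)) (≡.trans (+-assoc x a _) (≡.trans (≡.cong (x +_) (-‿inverseʳ a)) (+-identityʳ x))))

  dilation : ∀ a → a ≢ 0# → Permutation q q
  dilation a a≢0 = permutation (_*_ a) (_*_ a⁻¹)
    (λ x → ≡.trans (≡.sym (*-assoc a a⁻¹ x)) (≡.trans (≡.cong (_* x) aa⁻¹) (*-identityˡ x)))
    (λ x → ≡.trans (≡.sym (*-assoc a⁻¹ a x)) (≡.trans (≡.cong (_* x) (≡.trans (*-comm a⁻¹ a) aa⁻¹)) (*-identityˡ x)))
    where
    a⁻¹ = proj₁ (invert a a≢0)
    aa⁻¹ = proj₂ (invert a a≢0)

  -- x ↦ 1 + x permutes the field, so the sum of all elements equals itself plus q times one.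
  ι-q : ι q ≡ 0#
  ι-q = begin
    ι q                               ≡⟨ Sum.sum-replicate q {1#} ⟨
    Sum.sum {q} (λ _ → 1#)            ≡⟨ solve 2 (λ a b → a := (a :+ b) :- b) ≡.refl _ Σx ⟩
    (Sum.sum {q} (λ _ → 1#) + Σx) + (- Σx)
      ≡⟨ ≡.cong (_+ (- Σx)) (≡.trans (≡.sym (Sum.∑-distrib-+ {q} (λ _ → 1#) (λ x → x))) (≡.sym (Sum.sum-permute (λ x → x) (translation 1#)))) ⟩
    Σx + (- Σx)                       ≡⟨ -‿inverseʳ Σx ⟩
    0#                                ∎
    where Σx = Sum.sum {q} (λ x → x)

  ι-p : ι p ≡ 0#
  ι-p with ι p Fin.≟ 0#
  ... | yes e = e
  ... | no ne = contradiction (≡.trans (≡.sym (ι-^ n)) ι-q) (^-≉0 n ne)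
    where
    ι-^ : ∀ m → ι (p ℕ.^ m) ≡ ι p ^ m
    ι-^ zero    = ι1≈1
    ι-^ (suc m) = ≡.trans (ι-homo-* p (p ℕ.^ m)) (≡.cong (ι p *_) (ι-^ m))

  module Frob = Char pr ι-p
  module FrobP = P.Char pr (P.trans (P-ι≋C p) (P.trans (C-cong ι-p) C-0))

  -- If p did not divide j, a Bézout identity for j and p would express 1 by means of ι j = 0 and ι
  -- p = 0.
  ι≡0⇒p∣ : ∀ j → ι j ≡ 0# → p ∣ j
  ι≡0⇒p∣ j e with p ∣? j
  ... | yes d = d
  ... | no nd with Coprimality.coprime-Bézout {j} {p} coprime
    where
    coprime : Coprimality.Coprime j p
    coprime (d∣j , d∣p) with prime⇒irreducible pr d∣p
    ... | inj₁ d≡1   = d≡1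
    ... | inj₂ ≡.refl = contradiction d∣j nd
  ...   | Bézout.+- x y eq = contradiction (begin
            1#                        ≡⟨ ≡.trans (≡.cong (ι 1 +_) (≡.trans (≡.cong (ι y *_) ι-p) (zeroʳ _))) (≡.trans (+-identityʳ _) ι1≈1) ⟨
            ι 1 + ι y * ι p           ≡⟨ ≡.trans (ι-homo-+ 1 (y ℕ.* p)) (≡.cong (ι 1 +_) (ι-homo-* y p)) ⟨
            ι (1 ℕ.+ y ℕ.* p)         ≡⟨ ≡.cong ι eq ⟩
            ι (x ℕ.* j)               ≡⟨ ≡.trans (ι-homo-* x j) (≡.trans (≡.cong (ι x *_) e) (zeroʳ _)) ⟩
            0#                        ∎) 1≢0
  ...   | Bézout.-+ x y eq = contradiction (begin
            1#                        ≡⟨ ≡.trans (≡.cong (ι 1 +_) (≡.trans (≡.cong (ι x *_) e) (zeroʳ _))) (≡.trans (+-identityʳ _) ι1≈1) ⟨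
            ι 1 + ι x * ι j           ≡⟨ ≡.trans (ι-homo-+ 1 (x ℕ.* j)) (≡.cong (ι 1 +_) (ι-homo-* x j)) ⟨
            ι (1 ℕ.+ x ℕ.* j)         ≡⟨ ≡.cong ι eq ⟩
            ι (y ℕ.* p)               ≡⟨ ≡.trans (ι-homo-* y p) (≡.trans (≡.cong (ι y *_) ι-p) (zeroʳ _)) ⟩
            0#                        ∎) 1≢0

  private variable
    ℓ : Level

  -- Multiplication by a permutes H, so the product Π of the elements of H satisfies Π = a^#H Π.
  a^#H≡1 : {H : Pred (Fin q) ℓ} (H? : Decidable H) → (∀ x → H x → x ≢ 0#) →
           ∀ a → a ≢ 0# → (∀ x → H x → H (a * x)) → (∀ x → H (a * x) → H x) → a ^ # H? ≡ 1#
  a^#H≡1 {H = H} H? nz a a≢0 stable stable′ = x-y≈0⇒x≈y (*-cancel-0 ΠH≢0 (begin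
      ΠH * (a ^ # H? + (- 1#))      ≡⟨ solve 2 (λ x y → x :* (y :- con (+ 1)) := y :* x :- x) ≡.refl ΠH (a ^ # H?) ⟩
      a ^ # H? * ΠH + (- ΠH)        ≡⟨ ≡.cong (_+ (- ΠH)) shift ⟨
      ΠH + (- ΠH)                   ≡⟨ -‿inverseʳ ΠH ⟩
      0#                            ∎))
    where
    open import Data.Integer.Base using (+_)
    sel : ∀ {A : Set _} → Dec A → Fin q → Fin q
    sel (yes _) x = x
    sel (no _)  x = 1#
    ΠH = Prod.sum (λ x → sel (H? x) x)
    ΠH≢0 : ΠH ≢ 0#
    ΠH≢0 = prod≢0 (λ x → sel (H? x) x) factor
      where
      factor : ∀ x → sel (H? x) x ≢ 0#
      factor x with H? x
      ... | yes h = nz x h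
      ... | no _  = 1≢0
      prod≢0 : ∀ {m} (f : Fin m → Fin q) → (∀ i → f i ≢ 0#) → Prod.sum f ≢ 0#
      prod≢0 {zero}  f ne = 1≢0
      prod≢0 {suc m} f ne = *-≉0 (ne Fin.zero) (prod≢0 (λ i → f (Fin.suc i)) (λ i → ne (Fin.suc i)))
    pow : ∀ {m} {A : Pred (Fin m) _} (A? : Decidable A) → Prod.sum (λ i → sel (A? i) a) ≡ a ^ # A?
    pow {zero}  A? = ≡.refl
    pow {suc m} A? with A? Fin.zero
    ... | yes _ = ≡.cong (a *_) (pow (λ i → A? (Fin.suc i)))
    ... | no _  = ≡.trans (*-identityˡ _) (pow (λ i → A? (Fin.suc i)))
    pointwise : ∀ x → sel (H? (a * x)) (a * x) ≡ sel (H? x) a * sel (H? x) x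
    pointwise x with H? (a * x) | H? x
    ... | yes _ | yes _ = ≡.refl
    ... | no _  | no _  = ≡.sym (*-identityˡ 1#)
    ... | yes h | no ¬h = contradiction (stable′ x h) ¬h
    ... | no ¬h | yes h = contradiction (stable x h) ¬h
    shift : ΠH ≡ a ^ # H? * ΠH
    shift = begin
      ΠH                                                    ≡⟨ Prod.sum-permute (λ x → sel (H? x) x) (dilation a a≢0) ⟩
      Prod.sum (λ x → sel (H? (a * x)) (a * x))             ≡⟨ Prod.sum-cong-≗ pointwise ⟩
      Prod.sum (λ x → sel (H? x) a * sel (H? x) x)          ≡⟨ Prod.∑-distrib-+ (λ x → sel (H? x) a) (λ x → sel (H? x) x) ⟩
      Prod.sum (λ x → sel (H? x) a) * ΠH                    ≡⟨ ≡.cong (_* ΠH) (pow H?) ⟩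
      a ^ # H? * ΠH                                         ∎

  _≢0? : Decidable (_≢ 0#)
  x ≢0? = ¬? (x Fin.≟ 0#)

  #-remove : {P : Pred (Fin q) ℓ} (P? : Decidable P) → ∀ a → P a →
             (P?′ : Decidable (λ x → P x × x ≢ a)) → # P? ≡ suc (# P?′)
  #-remove P? a Pa P?′ = go
    where
    open import Algebra.Properties.CommutativeMonoid.Sum ℕ.+-0-commutativeMonoid
      using (∑-distrib-+; sum-cong-≗)
    pointwise : ∀ x → 𝟙 (P? x) ≡ 𝟙 (x Fin.≟ a) ℕ.+ 𝟙 (P?′ x)
    pointwise x with x Fin.≟ a
    ... | yes ≡.refl = ≡.trans (𝟙-yes (P? x) Pa) (≡.cong suc (≡.sym (𝟙-no (P?′ x) λ (_ , ne) → ne ≡.refl)))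
    ... | no x≢a = ℕ.≤-antisym (𝟙-mono (P? x) (P?′ x) (_, x≢a)) (𝟙-mono (P?′ x) (P? x) proj₁)
    go : # P? ≡ suc (# P?′)
    go = ≡.trans (sum-cong-≗ pointwise) (≡.trans (∑-distrib-+ (λ x → 𝟙 (x Fin.≟ a)) (λ x → 𝟙 (P?′ x)))
      (≡.cong (ℕ._+ # P?′) (#-unique (Fin._≟ a) a ≡.refl (λ _ e → e))))

  #≢0 : suc (# _≢0?) ≡ q
  #≢0 = ≡.trans (≡.cong suc (#-cong _≢0? (λ x → ⊤×? x) (λ _ ne → _ , ne) (λ _ → proj₂)))
          (≡.trans (≡.sym (#-remove (λ _ → yes tt) 0# tt ⊤×?)) (#-full (λ _ → yes tt) (λ _ → tt)))
    where
    open import Data.Unit.Base using (⊤; tt)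
    open import Relation.Nullary.Decidable using (_×-dec_)
    ⊤×? : Decidable (λ x → ⊤ × x ≢ 0#)
    ⊤×? x = yes tt ×-dec ¬? (x Fin.≟ 0#)

  fermat : ∀ x → x ^ q ≡ x
  fermat x with x Fin.≟ 0#
  ... | yes ≡.refl = 0^ q (ℕ.<⇒≤ q≥2)
  ... | no x≢0 = ≡.trans (≡.cong (x ^_) (≡.sym #≢0)) (≡.trans (≡.cong (x *_)
          (a^#H≡1 _≢0? (λ _ ne → ne) x x≢0 (λ y → *-≉0 x≢0) (λ y ne e → ne (≡.trans (≡.cong (x *_) e) (zeroʳ x)))))
          (*-identityʳ x))

  -- The p^k-th root, provided k ≤ n.
  root : ℕ → Fin q → Fin q
  root k x = x ^ (p ℕ.^ (n ℕ.∸ k))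

  root-^ : ∀ {k} → k ℕ.≤ n → ∀ x → root k x ^ (p ℕ.^ k) ≡ x
  root-^ {k} k≤n x = ≡.trans (^-assocʳ x (p ℕ.^ (n ℕ.∸ k)) (p ℕ.^ k)) (≡.trans (≡.cong (x ^_)
    (≡.trans (≡.sym (ℕ.^-distribˡ-+-* p (n ℕ.∸ k) k)) (≡.cong (p ℕ.^_) (ℕ.m∸n+n≡m k≤n)))) (fermat x))

  p-th-root : ∀ x → ∃[ y ] y ^ p ≡ x
  p-th-root x = root 1 x , ≡.trans (≡.cong (root 1 x ^_) (≡.sym (ℕ.*-identityʳ p))) (root-^ n≥1 x)

  C-^ : ∀ a k → C (a ^ k) ≋ C a P.^ k
  C-^ a zero    = P.refl
  C-^ a (suc k) = P.trans (C-* a (a ^ k)) (P.*-congˡ (C-^ a k))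

  -- The vanishing derivative kills every coefficient whose index is prime to p. The list is read in
  -- blocks of length p, and the entry at the head of a block has a p-th root by Fermat's theorem.
  poly-p-th-root : ∀ f → deriv f ≋ [] → ∃[ h ] h P.^ p ≋ f
  poly-p-th-root f f′ = go (length f) f ℕ.≤-refl vanish
    where
    vanish : ∀ i → ¬ (p ∣ i) → coeff f i ≡ 0#
    vanish zero    nd = contradiction (p ℕ∣.∣0) nd
    vanish (suc i) nd = *-cancel-0 (λ e → nd (ι≡0⇒p∣ (suc i) e)) (≡.trans (≡.sym (coeff-deriv f i)) (at f′ i))
    coeff-drop : ∀ m f i → coeff (drop m f) i ≡ coeff f (m ℕ.+ i)
    coeff-drop zero    f       i = ≡.refl
    coeff-drop (suc m) []      i = ≡.refl
    coeff-drop (suc m) (a ∷ f) i = coeff-drop m f i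
    length-drop : ∀ a f m → suc (length f) ℕ.≤ suc m → length (drop p (a ∷ f)) ℕ.≤ m
    length-drop a f m (s≤s le) = ≡.subst (λ k → length (drop k (a ∷ f)) ℕ.≤ m) (ℕ.suc-pred p)
      (≡.subst (ℕ._≤ m) (≡.sym (length-drop′ (ℕ.pred p) f)) (ℕ.≤-trans (ℕ.m∸n≤m (length f) (ℕ.pred p)) le))
    go : ∀ m f → length f ℕ.≤ m → (∀ i → ¬ (p ∣ i) → coeff f i ≡ 0#) → ∃[ h ] h P.^ p ≋ f
    go m [] le v = [] , P.0^ p (ℕ.<⇒≤ p≥2)
    go (suc m) (a ∷ f) le v with go m (drop p (a ∷ f)) (length-drop a f m le) vanish-drop
      where
      vanish-drop : ∀ i → ¬ (p ∣ i) → coeff (drop p (a ∷ f)) i ≡ 0#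
      vanish-drop i nd = ≡.trans (coeff-drop p (a ∷ f) i) (v (p ℕ.+ i) (λ d → nd (ℕ∣.∣m+n∣m⇒∣n d ℕ∣.∣-refl)))
    ... | h , e = C b +ₚ 𝕏 *ₚ h , (P.begin
        (C b +ₚ 𝕏 *ₚ h) P.^ p                         P.≈⟨ FrobP.frobenius (C b) (𝕏 *ₚ h) ⟩
        C b P.^ p +ₚ (𝕏 *ₚ h) P.^ p                   P.≈⟨ P.+-cong (P.trans (P.sym (C-^ b p)) (C-cong (proj₂ (p-th-root a)))) (P.^-distrib-* 𝕏 h p) ⟩
        C a +ₚ 𝕏 P.^ p *ₚ h P.^ p                     P.≈⟨ P.+-congˡ (P.*-congˡ e) ⟩
        C a +ₚ 𝕏 P.^ p *ₚ drop p (a ∷ f)              P.≈⟨ mk split ⟩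
        a ∷ f                                         P.∎)
      where
      b = proj₁ (p-th-root a)
      X^p*drop = 𝕏 P.^ p *ₚ drop p (a ∷ f)
      split : ∀ i → coeff (C a +ₚ X^p*drop) i ≡ coeff (a ∷ f) i
      split zero = ≡.trans (coeff-+ (C a) X^p*drop 0) (≡.trans (≡.cong (a +_) (coeff-𝕏^*-< p _ 0 (ℕ.<⇒≤ p≥2))) (+-identityʳ a))
      split (suc i) = ≡.trans (coeff-+ (C a) X^p*drop (suc i)) (≡.trans (+-identityˡ _) (case (suc i ℕ.<? p)))
        where
        case : Dec (suc i ℕ.< p) → coeff X^p*drop (suc i) ≡ coeff (a ∷ f) (suc i)
        case (yes lt) = ≡.trans (coeff-𝕏^*-< p _ (suc i) lt) (≡.sym (v (suc i) (λ d → ℕ.<⇒≱ lt (ℕ∣.∣⇒≤ d))))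
        case (no nlt) = ≡.subst (λ j → coeff X^p*drop j ≡ coeff (a ∷ f) j) (ℕ.m+[n∸m]≡n (ℕ.≮⇒≥ nlt))
          (≡.trans (coeff-𝕏^* p _ (suc i ℕ.∸ p)) (coeff-drop p (a ∷ f) (suc i ℕ.∸ p)))

  -- By Frobenius the difference of the two powers is the power of f - g.
  ^p-injective : ∀ k {f g} → f P.^ (p ℕ.^ k) ≋ g P.^ (p ℕ.^ k) → f ≋ g
  ^p-injective k {f} {g} e with zero? (f P.- g)
  ... | yes z = P.x-y≈0⇒x≈y z
  ... | no nz = contradiction (P.trans (FrobP.frobenius-sub k f g) (P.x≈y⇒x-y≈0 e)) (^ₚ-≋0̸ (p ℕ.^ k) nz)

  open import Data.Integer.Base using () renaming (+_ to pos)
  open import Data.List.Base using (List; []; _∷_; map)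
  open import Data.Sum.Base using (_⊎_; inj₁; inj₂)
  open import Relation.Nullary.Decidable using (yes; no)

  C≋0̸ : ∀ {a} → a ≢ 0# → C a ≋0̸
  C≋0̸ a≢0 e = a≢0 (at e 0)

  C*-cancel : ∀ {a f} → f ≋0̸ → C a *ₚ f ≋ [] → a ≡ 0#
  C*-cancel {a} nf e with a Fin.≟ 0#
  ... | yes z = z
  ... | no nz = contradiction e (*ₚ-≋0̸ (C≋0̸ nz) nf)

  C*C* : ∀ a b f → C a *ₚ (C b *ₚ f) ≋ C (a * b) *ₚ f
  C*C* a b f = P.trans (P.sym (P.*-assoc (C a) (C b) f)) (P.*-congʳ (P.sym (C-* a b)))

  C-zero* : ∀ {a} f → a ≡ 0# → C a *ₚ f ≋ []
  C-zero* f e = P.trans (P.*-congʳ (P.trans (C-cong e) C-0)) (P.zeroˡ f)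

  C-neg : ∀ a → C (- a) ≋ P.- C a
  C-neg a = mk λ { zero → ≡.sym (coeff-neg (C a) 0) ; (suc i) → ≡.sym (≡.trans (coeff-neg (C a) (suc i)) -0≈0) }

  C-sub : ∀ a b → C (a - b) ≋ C a P.- C b
  C-sub a b = P.trans (C-+ a (- b)) (P.+-congˡ (C-neg b))

  C-inv : ∀ {a} (a≢0 : a ≢ 0#) f → C (proj₁ (invert a a≢0)) *ₚ (C a *ₚ f) ≋ f
  C-inv {a} a≢0 f = P.trans (C*C* _ a f) (P.trans (P.*-congʳ (C-cong (≡.trans (*-comm _ a) (proj₂ (invert a a≢0))))) (P.*-identityˡ f))

  C*-cancelˡ : ∀ {a f g} → a ≢ 0# → C a *ₚ f ≋ C a *ₚ g → f ≋ g
  C*-cancelˡ a≢0 = *ₚ-cancelˡ (C≋0̸ a≢0)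

  deg-C* : ∀ {a f} → a ≢ 0# → f ≋0̸ → deg (C a *ₚ f) ≡ deg f
  deg-C* {a} {f} a≢0 nf = ≡.trans (deg-* (C≋0̸ a≢0) nf) (≡.cong (ℕ._+ deg f) (deg-unique {C a} a≢0 λ { (suc i) _ → ≡.refl }))

  deriv-p^ : ∀ f K → 1 ℕ.≤ K → deriv (f P.^ (p ℕ.^ K)) ≋ []
  deriv-p^ f (suc K) _ = P.begin
    deriv (f P.^ P)                                       P.≡⟨ ≡.cong (λ m → deriv (f P.^ m)) (≡.sym (ℕ.suc-pred P)) ⟩
    deriv (f P.^ suc (ℕ.pred P))                          P.≈⟨ deriv-^ f (ℕ.pred P) ⟩
    P.ι (suc (ℕ.pred P)) *ₚ (f P.^ ℕ.pred P *ₚ deriv f)   P.≡⟨ ≡.cong (λ m → P.ι m *ₚ (f P.^ ℕ.pred P *ₚ deriv f)) (ℕ.suc-pred P) ⟩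
    P.ι P *ₚ (f P.^ ℕ.pred P *ₚ deriv f)                  P.≈⟨ P.*-congʳ (P.trans (P-ι≋C P) (P.trans (C-cong (Frob.ι-∣ (m∣m*n (p ℕ.^ K)))) C-0)) ⟩
    [] *ₚ (f P.^ ℕ.pred P *ₚ deriv f)                     P.≈⟨ P.zeroˡ _ ⟩
    []                                                    P.∎
    where
    open import Data.Nat.Divisibility using (m∣m*n)
    P = p ℕ.^ suc K
    instance
      P≢0 : ℕ.NonZero P
      P≢0 = ℕ.m^n≢0 p (suc K)

  -- f (f^m)′ = m f^m f′, without the truncated exponent m − 1.
  f*deriv-^ : ∀ f m → f *ₚ deriv (f P.^ m) ≋ C (ι m) *ₚ (f P.^ m *ₚ deriv f)
  f*deriv-^ f zero = P.trans (P.trans (P.*-congˡ (deriv-C 1#)) (P.zeroʳ f)) (P.sym (C-zero* _ ≡.refl))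
  f*deriv-^ f (suc m) = P.begin
    f *ₚ deriv (f P.^ suc m)                              P.≈⟨ P.*-congˡ (P.trans (deriv-^ f m) (P.*-congʳ (P-ι≋C (suc m)))) ⟩
    f *ₚ (C (ι (suc m)) *ₚ (f P.^ m *ₚ deriv f))          P.≈⟨ P.solve 4 (λ f c g f′ → f P.:* (c P.:* (g P.:* f′)) P.:= c P.:* ((f P.:* g) P.:* f′)) P.refl f _ _ _ ⟩
    C (ι (suc m)) *ₚ (f P.^ suc m *ₚ deriv f)             P.∎

  -- The hypothesis says that `A` differentiates like U^c. Multiplication by U^r with r + c = 0 in
  -- the field therefore gives derivative zero, and by `poly-p-th-root` a p-th power.
  euler : ∀ U A c r → U ≋0̸ → U *ₚ deriv A ≋ C c *ₚ (deriv U *ₚ A) → ι r + c ≡ 0# → deriv (A *ₚ U P.^ r) ≋ []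
  euler U A c r nU e r+c = *ₚ-cancel-0 nU (P.begin
    U *ₚ deriv (A *ₚ U P.^ r)
      P.≈⟨ P.*-congˡ (deriv-* A (U P.^ r)) ⟩
    U *ₚ (deriv A *ₚ U P.^ r +ₚ A *ₚ deriv (U P.^ r))
      P.≈⟨ P.solve 5 (λ U A′ V A V′ → U P.:* (A′ P.:* V P.:+ A P.:* V′) P.:= (U P.:* A′) P.:* V P.:+ A P.:* (U P.:* V′)) P.refl U _ _ A _ ⟩
    (U *ₚ deriv A) *ₚ U P.^ r +ₚ A *ₚ (U *ₚ deriv (U P.^ r))
      P.≈⟨ P.+-cong (P.*-congʳ e) (P.*-congˡ (f*deriv-^ U r)) ⟩
    (C c *ₚ (deriv U *ₚ A)) *ₚ U P.^ r +ₚ A *ₚ (C (ι r) *ₚ (U P.^ r *ₚ deriv U))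
      P.≈⟨ P.solve 5 (λ c U′ A V r → (c P.:* (U′ P.:* A)) P.:* V P.:+ A P.:* (r P.:* (V P.:* U′)) P.:= (r P.:+ c) P.:* (V P.:* U′ P.:* A)) P.refl (C c) (deriv U) A (U P.^ r) (C (ι r)) ⟩
    (C (ι r) +ₚ C c) *ₚ (U P.^ r *ₚ deriv U *ₚ A)
      P.≈⟨ P.*-congʳ (P.trans (P.sym (C-+ (ι r) c)) (P.trans (C-cong r+c) C-0)) ⟩
    [] *ₚ (U P.^ r *ₚ deriv U *ₚ A)
      P.≈⟨ P.zeroˡ _ ⟩
    [] P.∎)

  -- The hypothesis admits only exponents j with ι j = c, and then X A′ = c A; the factor `deriv 𝕏`
  -- is kept to match the form required by `euler`.
  euler-𝕏 : ∀ A c → (∀ j → (ι j - c) * coeff A j ≡ 0#) → 𝕏 *ₚ deriv A ≋ C c *ₚ (deriv 𝕏 *ₚ A)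
  euler-𝕏 A c e = P.trans (mk pointwise) (P.*-congˡ (P.sym (P.trans (P.*-congʳ deriv-𝕏) (P.*-identityˡ A))))
    where
    lem : ∀ j → ι j * coeff A j ≡ c * coeff A j
    lem j = x-y≈0⇒x≈y (≡.trans (solve 3 (λ i c a → i :* a :- c :* a := (i :- c) :* a) ≡.refl (ι j) c (coeff A j)) (e j))
    pointwise : ∀ j → coeff (𝕏 *ₚ deriv A) j ≡ coeff (C c *ₚ A) j
    pointwise zero    = ≡.trans (≡.sym (at (0∷≋𝕏* (deriv A)) 0)) (≡.trans (≡.sym (zeroˡ _)) (≡.trans (lem 0) (≡.sym (coeff-C* c A 0))))
    pointwise (suc j) = ≡.trans (≡.sym (at (0∷≋𝕏* (deriv A)) (suc j))) (≡.trans (coeff-deriv A j) (≡.trans (lem (suc j)) (≡.sym (coeff-C* c A (suc j)))))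

  𝕏≋0̸ : 𝕏 ≋0̸
  𝕏≋0̸ e = 1≢0 (at e 1)

  deg-𝕏 : deg 𝕏 ≡ 1
  deg-𝕏 = deg-unique {𝕏} {1} 1≢0 λ { (suc (suc i)) _ → ≡.refl ; (suc zero) (s≤s ()) }

  deg-𝕏^ : ∀ m → deg (𝕏 P.^ m) ≡ m
  deg-𝕏^ m = ≡.trans (deg-^ m 𝕏≋0̸) (≡.trans (≡.cong (m ℕ.*_) deg-𝕏) (ℕ.*-identityʳ m))

  coeff-𝕏^ : ∀ m → coeff (𝕏 P.^ m) m ≡ 1#
  coeff-𝕏^ m = ≡.trans (≡.sym (at (P.*-identityʳ (𝕏 P.^ m)) m)) (≡.trans (≡.cong (coeff (𝕏 P.^ m *ₚ P.1#)) (≡.sym (ℕ.+-identityʳ m))) (coeff-𝕏^* m P.1# 0))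

  coeff-𝕏^-≢ : ∀ m i → i ≢ m → coeff (𝕏 P.^ m) i ≡ 0#
  coeff-𝕏^-≢ m i i≢m = ≡.trans (≡.sym (at (P.*-identityʳ (𝕏 P.^ m)) i)) (case (i ℕ.<? m))
    where
    case : Dec (i ℕ.< m) → coeff (𝕏 P.^ m *ₚ P.1#) i ≡ 0#
    case (yes lt) = coeff-𝕏^*-< m P.1# i lt
    case (no nlt) = ≡.trans (≡.cong (coeff (𝕏 P.^ m *ₚ P.1#)) (≡.sym (ℕ.m+[n∸m]≡n (ℕ.≮⇒≥ nlt))))
      (≡.trans (coeff-𝕏^* m P.1# (i ℕ.∸ m)) (positive (i ℕ.∸ m) (ℕ.m<n⇒0<n∸m (ℕ.≤∧≢⇒< (ℕ.≮⇒≥ nlt) (λ e → i≢m (≡.sym e))))))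
      where
      positive : ∀ k → 0 ℕ.< k → coeff P.1# k ≡ 0#
      positive (suc k) _ = ≡.refl

  -- The Wronskian: for nonzero `b` it vanishes exactly when a / b has derivative zero.
  wr : Poly → Poly → Poly
  wr a b = deriv a *ₚ b P.- a *ₚ deriv b

  wr-<° : ∀ a b → wr a b <° deg a ℕ.+ deg b
  wr-<° a b = <°-sub {deriv a *ₚ b} {a *ₚ deriv b} left right
    where
    left : deriv a *ₚ b <° deg a ℕ.+ deg b
    left with zero? (deriv a)
    ... | yes z = <°-cong {[]} (P.sym (P.trans (P.*-congʳ z) (P.zeroˡ b))) (λ _ _ → ≡.refl)
    ... | no nz = <°-mono (deriv a *ₚ b) (ℕ.+-monoˡ-≤ (deg b) (deg-deriv nz)) (<°-* (deriv a) b (<°deg (deriv a)) (<°deg b))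
    right : a *ₚ deriv b <° deg a ℕ.+ deg b
    right with zero? (deriv b)
    ... | yes z = <°-cong {[]} (P.sym (P.trans (P.*-congˡ z) (P.zeroʳ a))) (λ _ _ → ≡.refl)
    ... | no nz = <°-mono (a *ₚ deriv b) (≡.subst (ℕ._≤ deg a ℕ.+ deg b) (ℕ.+-suc (deg a) _) (ℕ.+-monoʳ-≤ (deg a) (deg-deriv nz)))
                    (<°-* a (deriv b) (<°deg a) (<°deg (deriv b)))

  #-roots : ∀ f → f ≋0̸ → # (λ x → eval f x Fin.≟ 0#) ℕ.≤ deg f
  #-roots f nf = go (deg f) f nf ≡.refl
    where
    go : ∀ m f → f ≋0̸ → deg f ≡ m → # (λ x → eval f x Fin.≟ 0#) ℕ.≤ m
    go m f nf e = case (Fin.any? (λ x → eval f x Fin.≟ 0#))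
      where
      open import Algebra.Properties.CommutativeMonoid.Sum ℕ.+-0-commutativeMonoid using (∑-distrib-+)
      𝟙≤1 : ∀ {A : Set} (d : Dec A) → 𝟙 d ℕ.≤ 1
      𝟙≤1 (yes _) = ℕ.≤-refl
      𝟙≤1 (no _)  = z≤n
      remove : ∀ m {f} {α} → (∃[ g ] f ≋ (𝕏 P.- C α) *ₚ g × g ≋0̸ × deg f ≡ suc (deg g)) → deg f ≡ m →
               # (λ x → eval f x Fin.≟ 0#) ℕ.≤ m
      remove zero (g , f≋ , ng , dg) e = contradiction (≡.trans (≡.sym dg) e) λ ()
      remove (suc m) {f} {α} (g , f≋ , ng , dg) e = ℕ.≤-trans (sum-mono pointwise)
        (ℕ.≤-trans (ℕ.≤-reflexive (≡.trans (∑-distrib-+ (λ x → 𝟙 (x Fin.≟ α)) (λ x → 𝟙 (eval g x Fin.≟ 0#)))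
          (≡.cong (ℕ._+ # (λ x → eval g x Fin.≟ 0#)) (#-unique (Fin._≟ α) α ≡.refl (λ _ e → e)))))
          (s≤s (go m g ng (ℕ.suc-injective (≡.trans (≡.sym dg) e)))))
        where
        root-g : ∀ x → x ≢ α → eval f x ≡ 0# → eval g x ≡ 0#
        root-g x x≢α r = *-cancel-0 (λ e → x≢α (x-y≈0⇒x≈y e))
          (≡.trans (≡.sym (≡.trans (eval-* (𝕏 P.- C α) g x) (≡.cong (_* eval g x) (eval-𝕏-C α x))))
            (≡.trans (≡.sym (eval-cong x f≋)) r))
        pointwise : ∀ x → 𝟙 (eval f x Fin.≟ 0#) ℕ.≤ 𝟙 (x Fin.≟ α) ℕ.+ 𝟙 (eval g x Fin.≟ 0#)
        pointwise x = split (x Fin.≟ α)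
          where
          split : (d : Dec (x ≡ α)) → 𝟙 (eval f x Fin.≟ 0#) ℕ.≤ 𝟙 d ℕ.+ 𝟙 (eval g x Fin.≟ 0#)
          split (yes _)  = ℕ.≤-trans (𝟙≤1 (eval f x Fin.≟ 0#)) (s≤s z≤n)
          split (no x≢α) = 𝟙-mono (eval f x Fin.≟ 0#) (eval g x Fin.≟ 0#) (root-g x x≢α)
      case : Dec (∃[ x ] eval f x ≡ 0#) → # (λ x → eval f x Fin.≟ 0#) ℕ.≤ m
      case (no none)     = ℕ.≤-trans (ℕ.≤-reflexive (#-empty (λ x → eval f x Fin.≟ 0#) (λ x r → none (x , r)))) z≤n
      case (yes (α , r)) = remove m (root-factor {f} nf r) e

  opaque

    𝕏q-𝕏 : Poly
    𝕏q-𝕏 = 𝕏 P.^ q P.- 𝕏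

    𝕏q-𝕏≡ : 𝕏q-𝕏 ≋ 𝕏 P.^ q P.- 𝕏
    𝕏q-𝕏≡ = P.refl

  private
    dominant : (P.- 𝕏 +ₚ 𝕏 P.^ q ≋0̸) × deg (P.- 𝕏 +ₚ 𝕏 P.^ q) ≡ deg (𝕏 P.^ q)
    dominant = +-dominant {P.- 𝕏} {𝕏 P.^ q}
      (≡.subst (P.- 𝕏 <°_) (≡.sym (deg-𝕏^ q)) (<°-neg {𝕏} (<°-mono 𝕏 q≥2 (≡.subst (λ m → 𝕏 <° suc m) deg-𝕏 (<°deg 𝕏)))))
      (^ₚ-≋0̸ q 𝕏≋0̸)

    swapped : 𝕏q-𝕏 ≋ P.- 𝕏 +ₚ 𝕏 P.^ q
    swapped = P.trans 𝕏q-𝕏≡ (P.+-comm (𝕏 P.^ q) (P.- 𝕏))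

  𝕏q-𝕏≋0̸ : 𝕏q-𝕏 ≋0̸
  𝕏q-𝕏≋0̸ = ≋0̸-cong (P.sym swapped) (proj₁ dominant)

  deg-𝕏q-𝕏 : deg 𝕏q-𝕏 ≡ q
  deg-𝕏q-𝕏 = ≡.trans (deg-cong swapped) (≡.trans (proj₂ dominant) (deg-𝕏^ q))

  deriv-𝕏q-𝕏 : deriv 𝕏q-𝕏 ≋ P.- P.1#
  deriv-𝕏q-𝕏 = P.trans (deriv-cong 𝕏q-𝕏≡) (P.trans (deriv-sub (𝕏 P.^ q) 𝕏)
    (P.trans (P.+-cong (deriv-p^ 𝕏 n n≥1) (P.-‿cong deriv-𝕏)) (P.+-identityˡ (P.- P.1#))))

  eval-𝕏q-𝕏 : ∀ x → eval 𝕏q-𝕏 x ≡ 0#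
  eval-𝕏q-𝕏 x = ≡.trans (eval-cong x 𝕏q-𝕏≡) (≡.trans (eval-sub (𝕏 P.^ q) 𝕏 x) (x≈y⇒x-y≈0
    (≡.trans (eval-^ 𝕏 q x) (≡.trans (^-congˡ q (eval-𝕏 x)) (≡.trans (fermat x) (≡.sym (eval-𝕏 x)))))))

  vanishing-small⇒zero : ∀ f → (∀ x → eval f x ≡ 0#) → f <° q → f ≋ []
  vanishing-small⇒zero f e f<q = case (zero? f)
    where
    case : Dec (f ≋ []) → f ≋ []
    case (yes z) = z
    case (no nf) = contradiction (ℕ.≤-trans (ℕ.≤-reflexive (≡.sym (#-full (λ x → eval f x Fin.≟ 0#) e)))
                    (#-roots f nf)) (ℕ.<⇒≱ (<°⇒deg< nf f<q))

  vanishing⇒𝕏q-𝕏∣ : ∀ f → (∀ x → eval f x ≡ 0#) → ∃[ h ] f ≋ 𝕏q-𝕏 *ₚ h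
  vanishing⇒𝕏q-𝕏∣ f e = divided (divMod 𝕏q-𝕏 𝕏q-𝕏≋0̸ f)
    where
    divided : (∃[ Q ] ∃[ r ] f ≋ Q *ₚ 𝕏q-𝕏 +ₚ r × r <° deg 𝕏q-𝕏) → ∃[ h ] f ≋ 𝕏q-𝕏 *ₚ h
    divided (Q , r , f≋ , r<) = Q , P.trans f≋ (P.trans (P.+-congˡ r≋0) (P.trans (P.+-identityʳ _) (P.*-comm Q 𝕏q-𝕏)))
      where
      vanish : ∀ x → eval r x ≡ 0#
      vanish x = ≡.trans (≡.sym (+-identityˡ _)) (≡.trans
        (≡.cong (_+ eval r x) (≡.sym (≡.trans (eval-* Q 𝕏q-𝕏 x) (≡.trans (≡.cong (eval Q x *_) (eval-𝕏q-𝕏 x)) (zeroʳ _)))))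
        (≡.trans (≡.sym (eval-+ (Q *ₚ 𝕏q-𝕏) r x)) (≡.trans (≡.sym (eval-cong x f≋)) (e x))))
      r≋0 : r ≋ []
      r≋0 = vanishing-small⇒zero r vanish (≡.subst (r <°_) deg-𝕏q-𝕏 r<)

  -- Comparison of digits in base F.

  quotient-<° : ∀ {F f Q r} → F ≋0̸ → f ≋ Q *ₚ F +ₚ r → r <° deg F → f <° deg F ℕ.+ deg F → Q <° deg F
  quotient-<° {F} {f} {Q} {r} nF e r< f< = case (zero? Q)
    where
    case : Dec (Q ≋ []) → Q <° deg F
    case (yes z) = <°-cong {[]} (P.sym z) (λ _ _ → ≡.refl)
    case (no nQ) = deg<⇒<° {Q} (ℕ.+-cancelʳ-< (deg F) (deg Q) (deg F) (≡.subst (ℕ._< deg F ℕ.+ deg F) deg-f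
        (<°⇒deg< (≋0̸-cong (P.sym f≋) (proj₁ dominant′)) f<)))
      where
      f≋ : f ≋ r +ₚ Q *ₚ F
      f≋ = P.trans e (P.+-comm _ r)
      dominant′ : (r +ₚ Q *ₚ F ≋0̸) × deg (r +ₚ Q *ₚ F) ≡ deg (Q *ₚ F)
      dominant′ = +-dominant {r} {Q *ₚ F} (<°-mono r (≡.subst (deg F ℕ.≤_) (≡.sym (deg-* nQ nF)) (ℕ.m≤n+m _ _)) r<) (*ₚ-≋0̸ nQ nF)
      deg-f : deg f ≡ deg Q ℕ.+ deg F
      deg-f = ≡.trans (deg-cong f≋) (≡.trans (proj₂ dominant′) (deg-* nQ nF))

  -- The relation a + Z b = G(F) with Z′ = 0 gives G′(F) F′b − G(F) b′ = a′b − ab′,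
  -- and both sides can be compared digit by digit in base F.
  record Relation (F : Poly) : Set where
    constructor relation
    field
      1≤d             : 1 ℕ.≤ deg F
      {a b Z G C₀ C₁} : Poly
      rel             : a +ₚ Z *ₚ b ≋ comp G F
      Z′              : deriv Z ≋ []
      b<d             : b <° deg F
      C₀<d            : C₀ <° deg F
      F′b             : deriv F *ₚ b ≋ C₁ *ₚ F +ₚ C₀
      wr<2d           : wr a b <° deg F ℕ.+ deg F
      s₁≥2            : 2 ℕ.≤ deg G

  module Comparison {F : Poly} (ρ : Relation F) where
    open Relation ρ

    private
      d = deg F
      s₁ = deg G
      nF : F ≋0̸
      nF = deg≥1⇒≋0̸ 1≤d
      g = coeff G
      h : ℕ → Fin q
      h j = ι j * g j

    F′b<2d : deriv F *ₚ b <° d ℕ.+ d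
    F′b<2d = <°-mono (deriv F *ₚ b) (ℕ.≤-trans (ℕ.≤-reflexive (≡.sym (ℕ.+-suc (ℕ.pred d) (ℕ.pred d))))
                (ℕ.+-mono-≤ (ℕ.pred[n]≤n {d}) (ℕ.≤-reflexive (ℕ.suc-pred d {{ℕ.>-nonZero 1≤d}}))))
              (<°-* (deriv F) b (<°-deriv {F} (<°-mono F (s≤s (ℕ.≤-reflexive (≡.sym (ℕ.suc-pred d {{ℕ.>-nonZero 1≤d}})))) (<°deg F)))
                (≡.subst (b <°_) (≡.sym (ℕ.suc-pred d {{ℕ.>-nonZero 1≤d}})) b<d))

    C₁<d : C₁ <° d
    C₁<d = quotient-<° {F} {deriv F *ₚ b} {C₁} {C₀} nF F′b C₀<d F′b<2d

    private
      wrDiv = divMod F nF (wr a b)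

    E₁ E₀ : Poly
    E₁ = proj₁ wrDiv
    E₀ = proj₁ (proj₂ wrDiv)

    wr≋ : wr a b ≋ E₁ *ₚ F +ₚ E₀
    wr≋ = proj₁ (proj₂ (proj₂ wrDiv))

    E₀<d : E₀ <° d
    E₀<d = proj₂ (proj₂ (proj₂ wrDiv))

    E₁<d : E₁ <° d
    E₁<d = quotient-<° {F} {wr a b} {E₁} {E₀} nF wr≋ E₀<d wr<2d

    wr<d⇒E₁≋0 : wr a b <° d → E₁ ≋ []
    wr<d⇒E₁≋0 lt = case (zero? E₁)
      where
      case : Dec (E₁ ≋ []) → E₁ ≋ []
      case (yes z) = z
      case (no nE) = contradiction (<°⇒deg< (proj₁ dominant′) (<°-cong (P.trans wr≋ (P.+-comm _ E₀)) lt))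
              (ℕ.≤⇒≯ (≡.subst (d ℕ.≤_) (≡.sym (≡.trans (proj₂ dominant′) (deg-* nE nF))) (ℕ.m≤n+m _ _)))
        where
        dominant′ : (E₀ +ₚ E₁ *ₚ F ≋0̸) × deg (E₀ +ₚ E₁ *ₚ F) ≡ deg (E₁ *ₚ F)
        dominant′ = +-dominant {E₀} {E₁ *ₚ F} (<°-mono E₀ (≡.subst (d ℕ.≤_) (≡.sym (deg-* nE nF)) (ℕ.m≤n+m _ _)) E₀<d) (*ₚ-≋0̸ nE nF)

    derived : deriv a +ₚ Z *ₚ deriv b ≋ comp (deriv G) F *ₚ deriv F
    derived = P.begin
      deriv a +ₚ Z *ₚ deriv b                          P.≈⟨ P.+-congˡ (P.trans (P.+-congʳ (P.trans (P.*-congʳ Z′) (P.zeroˡ b))) (P.+-identityˡ _)) ⟨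
      deriv a +ₚ (deriv Z *ₚ b +ₚ Z *ₚ deriv b)        P.≈⟨ P.trans (deriv-+ a (Z *ₚ b)) (P.+-congˡ (deriv-* Z b)) ⟨
      deriv (a +ₚ Z *ₚ b)                              P.≈⟨ P.trans (deriv-cong rel) (deriv-comp G F) ⟩
      comp (deriv G) F *ₚ deriv F                      P.∎

    private
      lift : Poly → List Poly
      lift = map C

      eval-lift : ∀ g → PP.eval (lift g) F ≋ comp g F
      eval-lift []      = P.refl
      eval-lift (x ∷ g) = P.+-congˡ (P.*-congˡ (eval-lift g))

      coeff-lift : ∀ g j → PP.coeff (lift g) j ≋ C (coeff g j)
      coeff-lift []      j       = P.sym C-0
      coeff-lift (x ∷ g) zero    = P.refl
      coeff-lift (x ∷ g) (suc j) = coeff-lift g j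

      b′ = deriv b
      -- `D` lists the digits of G′(F) F′b - G(F) b′ - (a′b - ab′) once F′b and the Wronskian have
      -- been divided by F with remainder. Each digit has degree below d and the total is zero, so
      -- all digits vanish.
      D₁ D : List Poly
      D₁ = PP.scale C₀ (lift (deriv G)) PP.+ₚ ([] ∷ PP.scale C₁ (lift (deriv G)))
      D = (D₁ PP.+ₚ PP.scale (P.- b′) (lift G)) PP.+ₚ ((P.- E₀) ∷ (P.- E₁) ∷ [])

      eval-D : PP.eval D F ≋ []
      eval-D = P.begin
        PP.eval D F
          P.≈⟨ P.trans (PP.eval-+ (D₁ PP.+ₚ PP.scale (P.- b′) (lift G)) ((P.- E₀) ∷ (P.- E₁) ∷ []) F)
                 (P.+-congʳ (P.trans (PP.eval-+ D₁ (PP.scale (P.- b′) (lift G)) F)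
                   (P.+-cong (P.trans (PP.eval-+ (PP.scale C₀ (lift (deriv G))) ([] ∷ PP.scale C₁ (lift (deriv G))) F)
                       (P.+-cong (PP.eval-scale C₀ (lift (deriv G)) F) (P.+-congˡ (P.*-congˡ (PP.eval-scale C₁ (lift (deriv G)) F)))))
                     (PP.eval-scale (P.- b′) (lift G) F)))) ⟩
        ((C₀ *ₚ PP.eval (lift (deriv G)) F +ₚ ([] +ₚ F *ₚ (C₁ *ₚ PP.eval (lift (deriv G)) F))) +ₚ (P.- b′) *ₚ PP.eval (lift G) F)
          +ₚ ((P.- E₀) +ₚ F *ₚ ((P.- E₁) +ₚ F *ₚ []))
          P.≈⟨ P.+-congʳ (P.+-cong (P.+-cong (P.*-congˡ (eval-lift (deriv G))) (P.+-congˡ (P.*-congˡ (P.*-congˡ (eval-lift (deriv G))))))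
                 (P.*-congˡ (P.trans (eval-lift G) (P.sym rel)))) ⟩
        ((C₀ *ₚ G′F +ₚ ([] +ₚ F *ₚ (C₁ *ₚ G′F))) +ₚ (P.- b′) *ₚ (a +ₚ Z *ₚ b)) +ₚ ((P.- E₀) +ₚ F *ₚ ((P.- E₁) +ₚ F *ₚ []))
          P.≈⟨ P.solve 9 (λ C₀ C₁ G′F F b′ a Zb E₀ E₁ →
                 ((C₀ P.:* G′F P.:+ (P.con (pos 0) P.:+ F P.:* (C₁ P.:* G′F))) P.:+ (P.:- b′) P.:* (a P.:+ Zb)) P.:+ ((P.:- E₀) P.:+ F P.:* ((P.:- E₁) P.:+ F P.:* P.con (pos 0)))
                 P.:= G′F P.:* (C₁ P.:* F P.:+ C₀) P.:- b′ P.:* (a P.:+ Zb) P.:- (E₁ P.:* F P.:+ E₀)) P.refl C₀ C₁ G′F F b′ a (Z *ₚ b) E₀ E₁ ⟩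
        G′F *ₚ (C₁ *ₚ F +ₚ C₀) P.- b′ *ₚ (a +ₚ Z *ₚ b) P.- (E₁ *ₚ F +ₚ E₀)
          P.≈⟨ P.+-cong (P.+-congʳ (P.trans (P.*-congˡ (P.sym F′b)) (P.trans (P.sym (P.*-assoc G′F (deriv F) b)) (P.*-congʳ (P.sym derived))))) (P.-‿cong (P.sym wr≋)) ⟩
        (deriv a +ₚ Z *ₚ b′) *ₚ b P.- b′ *ₚ (a +ₚ Z *ₚ b) P.- wr a b
          P.≈⟨ P.solve 5 (λ a a′ Z b b′ → (a′ P.:+ Z P.:* b′) P.:* b P.:- b′ P.:* (a P.:+ Z P.:* b) P.:- (a′ P.:* b P.:- a P.:* b′) P.:= P.con (pos 0)) P.refl a (deriv a) Z b b′ ⟩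
        [] P.∎
        where G′F = comp (deriv G) F

      G′-coeff : ∀ j → C (coeff (deriv G) j) ≋ C (h (suc j))
      G′-coeff j = C-cong (coeff-deriv G j)

      coeff-D₀ : PP.coeff D 0 ≋ C₀ *ₚ C (h 1) P.- b′ *ₚ C (g 0) P.- E₀
      coeff-D₀ = P.begin
        PP.coeff D 0
          P.≈⟨ P.trans (PP.coeff-+ (D₁ PP.+ₚ PP.scale (P.- b′) (lift G)) _ 0) (P.+-congʳ (P.trans (PP.coeff-+ D₁ (PP.scale (P.- b′) (lift G)) 0)
                 (P.+-cong (P.trans (PP.coeff-+ (PP.scale C₀ (lift (deriv G))) _ 0) (P.+-congʳ (P.trans (PP.coeff-scale C₀ (lift (deriv G)) 0) (P.*-congˡ (P.trans (coeff-lift (deriv G) 0) (G′-coeff 0))))))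
                   (P.trans (PP.coeff-scale (P.- b′) (lift G) 0) (P.*-congˡ (coeff-lift G 0)))))) ⟩
        ((C₀ *ₚ C (h 1) +ₚ []) +ₚ (P.- b′) *ₚ C (g 0)) +ₚ (P.- E₀)
          P.≈⟨ P.solve 5 (λ C₀ h b′ g E → ((C₀ P.:* h P.:+ P.con (pos 0)) P.:+ (P.:- b′) P.:* g) P.:+ (P.:- E) P.:= C₀ P.:* h P.:- b′ P.:* g P.:- E) P.refl C₀ (C (h 1)) b′ (C (g 0)) E₀ ⟩
        C₀ *ₚ C (h 1) P.- b′ *ₚ C (g 0) P.- E₀ P.∎

      E₁-at : ℕ → Poly
      E₁-at zero    = E₁
      E₁-at (suc j) = []

      coeff-D-suc : ∀ j → PP.coeff D (suc j) ≋ C₀ *ₚ C (h (suc (suc j))) +ₚ C₁ *ₚ C (h (suc j)) P.- b′ *ₚ C (g (suc j)) P.- E₁-at j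
      coeff-D-suc j = P.begin
        PP.coeff D (suc j)
          P.≈⟨ P.trans (PP.coeff-+ (D₁ PP.+ₚ PP.scale (P.- b′) (lift G)) _ (suc j)) (P.+-cong (P.trans (PP.coeff-+ D₁ (PP.scale (P.- b′) (lift G)) (suc j))
                 (P.+-cong (P.trans (PP.coeff-+ (PP.scale C₀ (lift (deriv G))) _ (suc j))
                     (P.+-cong (P.trans (PP.coeff-scale C₀ (lift (deriv G)) (suc j)) (P.*-congˡ (P.trans (coeff-lift (deriv G) (suc j)) (G′-coeff (suc j)))))
                               (P.trans (PP.coeff-scale C₁ (lift (deriv G)) j) (P.*-congˡ (P.trans (coeff-lift (deriv G) j) (G′-coeff j))))))
                   (P.trans (PP.coeff-scale (P.- b′) (lift G) (suc j)) (P.*-congˡ (coeff-lift G (suc j)))))) (E j)) ⟩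
        ((C₀ *ₚ C (h (suc (suc j))) +ₚ C₁ *ₚ C (h (suc j))) +ₚ (P.- b′) *ₚ C (g (suc j))) +ₚ (P.- E₁-at j)
          P.≈⟨ P.solve 4 (λ u b′ g E → (u P.:+ (P.:- b′) P.:* g) P.:+ (P.:- E) P.:= u P.:- b′ P.:* g P.:- E) P.refl (C₀ *ₚ C (h (suc (suc j))) +ₚ C₁ *ₚ C (h (suc j))) b′ (C (g (suc j))) (E₁-at j) ⟩
        C₀ *ₚ C (h (suc (suc j))) +ₚ C₁ *ₚ C (h (suc j)) P.- b′ *ₚ C (g (suc j)) P.- E₁-at j P.∎
        where
        E : ∀ j → PP.coeff ((P.- E₀) ∷ (P.- E₁) ∷ []) (suc j) ≋ P.- E₁-at j
        E zero    = P.refl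
        E (suc j) = P.sym P.-0≈0

      C*<° : ∀ {f m} x → f <° m → f *ₚ C x <° m
      C*<° {f} x lt = <°-cong {C x *ₚ f} (P.*-comm (C x) f) (<°-C* {f} x lt)

      b′<d : b′ <° d
      b′<d = <°-mono b′ (ℕ.pred[n]≤n {d}) (<°-deriv {b} (≡.subst (b <°_) (≡.sym (ℕ.suc-pred d {{ℕ.>-nonZero 1≤d}})) b<d))

      D<d : ∀ j → PP.coeff D j <° d
      D<d zero = <°-cong (P.sym coeff-D₀) (<°-sub {C₀ *ₚ C (h 1) P.- b′ *ₚ C (g 0)} {E₀} (<°-sub {C₀ *ₚ C (h 1)} (C*<° (h 1) C₀<d) (C*<° (g 0) b′<d)) E₀<d)
      D<d (suc j) = <°-cong (P.sym (coeff-D-suc j))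
        (<°-sub {C₀ *ₚ C (h (suc (suc j))) +ₚ C₁ *ₚ C (h (suc j)) P.- b′ *ₚ C (g (suc j))} {E₁-at j}
          (<°-sub {C₀ *ₚ C (h (suc (suc j))) +ₚ C₁ *ₚ C (h (suc j))} (<°-+ {C₀ *ₚ C (h (suc (suc j)))} (C*<° (h (suc (suc j))) C₀<d) (C*<° (h (suc j)) C₁<d)) (C*<° (g (suc j)) b′<d))
          (E₁<d′ j))
        where
        E₁<d′ : ∀ j → E₁-at j <° d
        E₁<d′ zero    = E₁<d
        E₁<d′ (suc j) = λ _ _ → ≡.refl

      D≋0 : ∀ j → PP.coeff D j ≋ []
      D≋0 = digits-zero D 1≤d D<d eval-D

      lead : g s₁ ≢ 0#
      lead = lead≉0 G (deg≥1⇒≋0̸ (ℕ.≤-trans (s≤s z≤n) s₁≥2))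

      h-above : ∀ j → s₁ ℕ.< j → h j ≡ 0#
      h-above j lt = ≡.trans (≡.cong (ι j *_) (<°deg G j lt)) (zeroʳ _)

    -- The digit of index s₁ = deg G: the coefficient of G at s₁ + 1 vanishes, which removes C₀, and
    -- s₁ ≥ 2 keeps E₀ and E₁ out.
    b′≋ : deriv b ≋ C (ι s₁) *ₚ C₁
    b′≋ = C*-cancelˡ lead (P.begin
      C (g s₁) *ₚ b′
        P.≈⟨ P.solve 4 (λ g b′ u v → g P.:* b′ P.:= (u P.:+ v) P.:- (u P.:+ v P.:- b′ P.:* g)) P.refl (C (g s₁)) b′ (C₀ *ₚ C (h (suc s₁))) (C₁ *ₚ C (h s₁)) ⟩
      (C₀ *ₚ C (h (suc s₁)) +ₚ C₁ *ₚ C (h s₁)) P.- (C₀ *ₚ C (h (suc s₁)) +ₚ C₁ *ₚ C (h s₁) P.- b′ *ₚ C (g s₁))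
        P.≈⟨ P.+-cong (P.+-congʳ (P.trans (P.*-comm C₀ _) (C-zero* C₀ (h-above (suc s₁) ℕ.≤-refl)))) (P.-‿cong (top s₁ s₁≥2)) ⟩
      ([] +ₚ C₁ *ₚ C (h s₁)) P.- []
        P.≈⟨ P.+-congˡ (P.-‿cong P.refl) ⟩
      ([] +ₚ C₁ *ₚ C (h s₁)) P.- []
        P.≈⟨ P.solve 1 (λ u → (P.con (pos 0) P.:+ u) P.:- P.con (pos 0) P.:= u) P.refl (C₁ *ₚ C (h s₁)) ⟩
      C₁ *ₚ C (ι s₁ * g s₁)
        P.≈⟨ P.trans (P.*-comm C₁ _) (P.sym (P.trans (C*C* (g s₁) (ι s₁) C₁) (P.*-congʳ (C-cong (*-comm _ _))))) ⟩
      C (g s₁) *ₚ (C (ι s₁) *ₚ C₁) P.∎)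
      where
      top : ∀ j → 2 ℕ.≤ j → C₀ *ₚ C (h (suc j)) +ₚ C₁ *ₚ C (h j) P.- b′ *ₚ C (g j) ≋ []
      top (suc (suc j)) _ = P.trans (P.trans (P.sym (P.trans (P.+-congˡ P.-0≈0) (P.+-identityʳ _))) (P.sym (coeff-D-suc (suc j)))) (D≋0 (suc (suc j)))
      top (suc zero) (s≤s ())

    private
      -- Substituting b′ = s₁ C₁ leaves a two-term relation between consecutive coefficients of `G`.
      combine : ∀ j → C₀ *ₚ C (h (suc j)) +ₚ C₁ *ₚ C (h j) P.- b′ *ₚ C (g j)
                      ≋ C (h (suc j)) *ₚ C₀ +ₚ C ((ι j - ι s₁) * g j) *ₚ C₁
      combine j = P.begin
        C₀ *ₚ C (h (suc j)) +ₚ C₁ *ₚ C (h j) P.- b′ *ₚ C (g j)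
          P.≈⟨ P.+-congˡ (P.-‿cong (P.*-congʳ b′≋)) ⟩
        C₀ *ₚ C (h (suc j)) +ₚ C₁ *ₚ C (h j) P.- (C (ι s₁) *ₚ C₁) *ₚ C (g j)
          P.≈⟨ P.+-congʳ (P.+-congˡ (P.*-congˡ (C-* (ι j) (g j)))) ⟩
        C₀ *ₚ C (h (suc j)) +ₚ C₁ *ₚ (C (ι j) *ₚ C (g j)) P.- (C (ι s₁) *ₚ C₁) *ₚ C (g j)
          P.≈⟨ P.solve 6 (λ C₀ h C₁ i g s → C₀ P.:* h P.:+ C₁ P.:* (i P.:* g) P.:- (s P.:* C₁) P.:* g P.:= h P.:* C₀ P.:+ ((i P.:- s) P.:* g) P.:* C₁)
                 P.refl C₀ (C (h (suc j))) C₁ (C (ι j)) (C (g j)) (C (ι s₁)) ⟩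
        C (h (suc j)) *ₚ C₀ +ₚ ((C (ι j) P.- C (ι s₁)) *ₚ C (g j)) *ₚ C₁
          P.≈⟨ P.+-congˡ (P.*-congʳ (P.trans (C-* _ _) (P.*-congʳ (C-sub _ _)))) ⟨
        C (h (suc j)) *ₚ C₀ +ₚ C ((ι j - ι s₁) * g j) *ₚ C₁ P.∎

    digit-0 : E₀ ≋ C₀ *ₚ C (h 1) P.- deriv b *ₚ C (g 0)
    digit-0 = P.sym (P.x-y≈0⇒x≈y (P.trans (P.sym coeff-D₀) (D≋0 0)))

    digit-1 : E₁ ≋ C (h 2) *ₚ C₀ +ₚ C ((ι 1 - ι s₁) * g 1) *ₚ C₁
    digit-1 = P.trans (P.sym (P.x-y≈0⇒x≈y (P.trans (P.sym (coeff-D-suc 0)) (D≋0 1)))) (combine 1)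

    digit-≥2 : ∀ j → 2 ℕ.≤ j → C (h (suc j)) *ₚ C₀ +ₚ C ((ι j - ι s₁) * g j) *ₚ C₁ ≋ []
    digit-≥2 (suc zero) (s≤s ())
    digit-≥2 (suc (suc j)) _ = P.trans (P.sym (P.trans (P.trans (P.+-congˡ P.-0≈0) (P.+-identityʳ _)) (combine (suc (suc j)))))
      (P.trans (P.sym (coeff-D-suc (suc j))) (D≋0 (suc (suc j))))

  eval-at-0 : ∀ f → eval f 0# ≡ coeff f 0
  eval-at-0 []      = ≡.refl
  eval-at-0 (a ∷ f) = ≡.trans (≡.cong (a +_) (zeroˡ _)) (+-identityʳ a)

  comp-𝕏^ : ∀ m F → comp (𝕏 P.^ m) F ≋ F P.^ m
  comp-𝕏^ m F = P.trans (comp-^ 𝕏 m F) (P.^-congˡ m (comp-𝕏 F))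

  comp-C*𝕏^ : ∀ c m F → comp (C c *ₚ 𝕏 P.^ m) F ≋ C c *ₚ F P.^ m
  comp-C*𝕏^ c m F = P.trans (comp-* (C c) (𝕏 P.^ m) F) (P.*-cong (comp-C c F) (comp-𝕏^ m F))

  comp-C* : ∀ c f F → comp (C c *ₚ f) F ≋ C c *ₚ comp f F
  comp-C* c f F = P.trans (comp-* (C c) f F) (P.*-congʳ (comp-C c F))

  deg-max : ∀ {f g} → g ≋0̸ → deg f ≢ deg g → deg f ℕ.≤ deg (f +ₚ g) × deg g ℕ.≤ deg (f +ₚ g)
  deg-max {f} {g} ng ne = case (deg f ℕ.<? deg g)
    where
    case : Dec (deg f ℕ.< deg g) → deg f ℕ.≤ deg (f +ₚ g) × deg g ℕ.≤ deg (f +ₚ g)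
    case (yes lt) = ≡.subst (deg f ℕ.≤_) (≡.sym e) (ℕ.<⇒≤ lt) , ℕ.≤-reflexive (≡.sym e)
      where
      e : deg (f +ₚ g) ≡ deg g
      e = proj₂ (+-dominant {f} {g} (deg<⇒<° {f} lt) ng)
    case (no nlt) = ℕ.≤-reflexive (≡.sym e) , ≡.subst (deg g ℕ.≤_) (≡.sym e) (ℕ.<⇒≤ gt)
      where
      gt : deg g ℕ.< deg f
      gt = ℕ.≤∧≢⇒< (ℕ.≮⇒≥ nlt) (λ e → ne (≡.sym e))
      e : deg (f +ₚ g) ≡ deg f
      e = ≡.trans (deg-cong (P.+-comm f g)) (proj₂ (+-dominant {g} {f} (deg<⇒<° {g} gt) (deg≥1⇒≋0̸ (ℕ.≤-trans (s≤s z≤n) gt))))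

  deg-sum-≤ : ∀ f g {m} → deg f ℕ.≤ m → deg g ℕ.≤ m → f +ₚ g <° suc m
  deg-sum-≤ f g lf lg = <°-+ {f} {g} (<°-mono f (s≤s lf) (<°deg f)) (<°-mono g (s≤s lg) (<°deg g))

  -- The hypothesis T(F) = κ (X^q - X) F′ and the states of the descent.

  record Hyp (F T : Poly) : Set where
    field
      1≤d   : 1 ℕ.≤ deg F
      3≤s   : 3 ℕ.≤ deg T
      bound : ℕ.pred (deg T) ℕ.* deg F ℕ.< q
      κ     : Fin q
      κ≢0   : κ ≢ 0#
      T0    : coeff T 0 ≡ 0#
      TF    : comp T F ≋ C κ *ₚ (𝕏q-𝕏 *ₚ deriv F)

  module HypFacts {F T : Poly} (H : Hyp F T) where
    open Hyp H public

    d : ℕ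
    d = deg F

    nF : F ≋0̸
    nF = deg≥1⇒≋0̸ 1≤d

    nT : T ≋0̸
    nT = deg≥1⇒≋0̸ (ℕ.≤-trans (s≤s z≤n) 3≤s)

    nF′ : deriv F ≋0̸
    nF′ z = comp-≋0̸ T 1≤d nT (P.trans TF (P.trans (P.*-congˡ (P.trans (P.*-congˡ z) (P.zeroʳ 𝕏q-𝕏))) (P.zeroʳ (C κ))))

    d′<d : deg (deriv F) ℕ.< d
    d′<d = deg-deriv nF′

    -- T has no constant term, so F divides T(F) = κ (X^q - X) F′.
    F∣F′R : F D.∣ᵣ deriv F *ₚ 𝕏q-𝕏
    F∣F′R = C κ⁻¹ *ₚ proj₁ (factor T T0) , (P.begin
      F *ₚ (C κ⁻¹ *ₚ proj₁ (factor T T0))         P.≈⟨ P.solve 3 (λ F c t → F P.:* (c P.:* t) P.:= c P.:* (F P.:* t)) P.refl F (C κ⁻¹) _ ⟩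
      C κ⁻¹ *ₚ (F *ₚ proj₁ (factor T T0))         P.≈⟨ P.*-congˡ (P.trans (P.sym (proj₂ (factor T T0))) TF) ⟩
      C κ⁻¹ *ₚ (C κ *ₚ (𝕏q-𝕏 *ₚ deriv F))         P.≈⟨ C-inv κ≢0 _ ⟩
      𝕏q-𝕏 *ₚ deriv F                             P.≈⟨ P.*-comm 𝕏q-𝕏 (deriv F) ⟩
      deriv F *ₚ 𝕏q-𝕏                             P.∎)
      where
      κ⁻¹ = proj₁ (invert κ κ≢0)
      factor : ∀ T → coeff T 0 ≡ 0# → ∃[ t ] comp T F ≋ F *ₚ t
      factor []      e = [] , P.sym (P.zeroʳ F)
      factor (a ∷ T) e = comp T F , P.trans (P.+-congʳ (P.trans (C-cong e) C-0)) (P.+-identityˡ _)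

  -- The invariant of the descent. With P = p^K it says f(F) = a^P + x b^P, and
  -- κ f + T f′ = κ G^P then gives a + x^(q/P) b = G(F).
  record State {F T : Poly} (H : Hyp F T) (K w : ℕ) : Set where
    open Hyp H using (κ)
    field
      f G a b : Poly
      ω       : Fin q
      ω≢0     : ω ≢ 0#
      1≤K     : 1 ℕ.≤ K
      K≤n     : K ℕ.≤ n
      W<P     : suc w ℕ.< p ℕ.^ K
      f<P     : deg f ℕ.< p ℕ.^ K
      f<s+w   : deg f ℕ.< deg T ℕ.+ w
      f0      : coeff f 0 ≡ 0#
      f′      : deriv f ≋ C ω *ₚ 𝕏 P.^ w
      κf+Tf′  : C κ *ₚ f +ₚ T *ₚ deriv f ≋ C κ *ₚ G P.^ (p ℕ.^ K)
      f∘F     : a P.^ (p ℕ.^ K) +ₚ 𝕏 *ₚ b P.^ (p ℕ.^ K) ≋ comp f F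

  module StateFacts {F T : Poly} {H : Hyp F T} {K w : ℕ} (St : State H K w) where
    open HypFacts H public
    open State St public

    P′ : ℕ
    P′ = p ℕ.^ K

    P≥2 : 2 ℕ.≤ P′
    P≥2 = ℕ.≤-trans (s≤s (s≤s z≤n)) W<P

    instance
      P-nonZero : ℕ.NonZero P′
      P-nonZero = ℕ.m^n≢0 p K

    nf : f ≋0̸
    nf z = C≋0̸ ω≢0 (*ₚ-cancel-0 (^ₚ-≋0̸ w 𝕏≋0̸) (P.trans (P.*-comm (𝕏 P.^ w) (C ω))
      (P.trans (P.sym f′) (P.trans (deriv-cong z) deriv-[]))))

    f′∘F : comp (deriv f) F ≋ C ω *ₚ F P.^ w
    f′∘F = P.trans (comp-cong F f′) (comp-C*𝕏^ ω w F)

    -- Differentiate f(F) = a^P + x b^P: the P-th powers have derivative zero, and b^P = f′(F) F′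
    -- remains.
    b^P : b P.^ P′ ≋ C ω *ₚ (F P.^ w *ₚ deriv F)
    b^P = P.begin
      b P.^ P′
        P.≈⟨ P.solve 2 (λ b X → b P.:= P.con (pos 0) P.:+ (b P.:+ X P.:* P.con (pos 0))) P.refl (b P.^ P′) 𝕏 ⟩
      [] +ₚ (b P.^ P′ +ₚ 𝕏 *ₚ [])
        P.≈⟨ P.+-cong (deriv-p^ a K 1≤K) (P.trans (deriv-𝕏* (b P.^ P′)) (P.+-congˡ (P.*-congˡ (deriv-p^ b K 1≤K)))) ⟨
      deriv (a P.^ P′) +ₚ deriv (𝕏 *ₚ b P.^ P′)
        P.≈⟨ deriv-+ (a P.^ P′) (𝕏 *ₚ b P.^ P′) ⟨
      deriv (a P.^ P′ +ₚ 𝕏 *ₚ b P.^ P′)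
        P.≈⟨ P.trans (deriv-cong f∘F) (deriv-comp f F) ⟩
      comp (deriv f) F *ₚ deriv F
        P.≈⟨ P.trans (P.*-congʳ f′∘F) (P.*-assoc (C ω) (F P.^ w) (deriv F)) ⟩
      C ω *ₚ (F P.^ w *ₚ deriv F) P.∎

    n-b^P : b P.^ P′ ≋0̸
    n-b^P = ≋0̸-cong (P.sym b^P) (*ₚ-≋0̸ (C≋0̸ ω≢0) (*ₚ-≋0̸ (^ₚ-≋0̸ w nF) nF′))

    nb : b ≋0̸
    nb z = n-b^P (P.trans (P.^-congˡ P′ z) (P.0^ P′ (ℕ.≤-trans (s≤s z≤n) P≥2)))

    nF′b : deriv F *ₚ b ≋0̸
    nF′b = *ₚ-≋0̸ nF′ nb

    deg-b : P′ ℕ.* deg b ≡ w ℕ.* d ℕ.+ deg (deriv F)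
    deg-b = ≡.trans (≡.sym (deg-^ P′ nb)) (≡.trans (deg-cong b^P)
      (≡.trans (deg-C* ω≢0 (*ₚ-≋0̸ (^ₚ-≋0̸ w nF) nF′)) (≡.trans (deg-* (^ₚ-≋0̸ w nF) nF′) (≡.cong (ℕ._+ deg (deriv F)) (deg-^ w nF)))))

    G0 : coeff G 0 ≡ 0#
    G0 = case (coeff G 0 Fin.≟ 0#)
      where
      eq : κ * coeff G 0 ^ P′ ≡ 0#
      eq = begin
        κ * coeff G 0 ^ P′                       ≡⟨ ≡.cong (λ x → κ * x ^ P′) (eval-at-0 G) ⟨
        κ * eval G 0# ^ P′                       ≡⟨ ≡.cong₂ _*_ (eval-C κ 0#) (eval-^ G P′ 0#) ⟨
        eval (C κ) 0# * eval (G P.^ P′) 0#       ≡⟨ eval-* (C κ) (G P.^ P′) 0# ⟨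
        eval (C κ *ₚ G P.^ P′) 0#                ≡⟨ eval-cong 0# κf+Tf′ ⟨
        eval (C κ *ₚ f +ₚ T *ₚ deriv f) 0#       ≡⟨ eval-+ (C κ *ₚ f) (T *ₚ deriv f) 0# ⟩
        eval (C κ *ₚ f) 0# + eval (T *ₚ deriv f) 0# ≡⟨ ≡.cong₂ _+_ (eval-* (C κ) f 0#) (eval-* T (deriv f) 0#) ⟩
        eval (C κ) 0# * eval f 0# + eval T 0# * eval (deriv f) 0#
          ≡⟨ ≡.cong₂ _+_ (≡.trans (≡.cong (eval (C κ) 0# *_) (≡.trans (eval-at-0 f) f0)) (zeroʳ _)) (≡.trans (≡.cong (_* eval (deriv f) 0#) (≡.trans (eval-at-0 T) T0)) (zeroˡ _)) ⟩
        0# + 0#                                  ≡⟨ +-identityˡ 0# ⟩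
        0#                                       ∎
      case : Dec (coeff G 0 ≡ 0#) → coeff G 0 ≡ 0#
      case (yes e) = e
      case (no ne) = contradiction eq (*-≉0 κ≢0 (^-≉0 P′ ne))

    X_K : Poly
    X_K = 𝕏 P.^ (p ℕ.^ (n ℕ.∸ K))

    -- Compare P-th powers. Adding (X^q - X) b^P = (X^q - X) f′(F) F′ to f(F) turns x b^P into x^q
    -- b^P, and κ (X^q - X) F′ = T(F) identifies the sum with G(F)^P.
    relation-ab : a +ₚ X_K *ₚ b ≋ comp G F
    relation-ab = ^p-injective K (C*-cancelˡ κ≢0 (P.begin
      C κ *ₚ (a +ₚ X_K *ₚ b) P.^ P′
        P.≈⟨ P.*-congˡ (P.trans (FrobP.frobenius^ K a (X_K *ₚ b)) (P.+-congˡ (P.^-distrib-* X_K b P′))) ⟩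
      C κ *ₚ (a P.^ P′ +ₚ X_K P.^ P′ *ₚ b P.^ P′)
        P.≈⟨ P.*-congˡ (P.+-congˡ (P.*-congʳ (P.trans (P.^-assocʳ 𝕏 (p ℕ.^ (n ℕ.∸ K)) P′) (P.reflexive (≡.cong (𝕏 P.^_) expo))))) ⟩
      C κ *ₚ (a P.^ P′ +ₚ 𝕏 P.^ q *ₚ b P.^ P′)
        P.≈⟨ P.solve 5 (λ k a X Xq b → k P.:* (a P.:+ Xq P.:* b) P.:= k P.:* (a P.:+ X P.:* b) P.:+ (k P.:* ((Xq P.:- X) P.:* b))) P.refl (C κ) (a P.^ P′) 𝕏 (𝕏 P.^ q) (b P.^ P′) ⟩
      C κ *ₚ (a P.^ P′ +ₚ 𝕏 *ₚ b P.^ P′) +ₚ C κ *ₚ ((𝕏 P.^ q P.- 𝕏) *ₚ b P.^ P′)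
        P.≈⟨ P.+-cong (P.*-congˡ f∘F) (P.*-congˡ (P.*-cong (P.sym 𝕏q-𝕏≡) (P.trans b^P (P.trans (P.sym (P.*-assoc (C ω) (F P.^ w) (deriv F))) (P.*-congʳ (P.sym f′∘F)))))) ⟩
      C κ *ₚ comp f F +ₚ C κ *ₚ (𝕏q-𝕏 *ₚ (comp (deriv f) F *ₚ deriv F))
        P.≈⟨ P.+-congˡ (P.solve 4 (λ k R c f → k P.:* (R P.:* (c P.:* f)) P.:= (k P.:* (R P.:* f)) P.:* c) P.refl (C κ) 𝕏q-𝕏 (comp (deriv f) F) (deriv F)) ⟩
      C κ *ₚ comp f F +ₚ (C κ *ₚ (𝕏q-𝕏 *ₚ deriv F)) *ₚ comp (deriv f) F
        P.≈⟨ P.+-cong (P.sym (comp-C* κ f F)) (P.trans (P.*-congʳ (P.sym TF)) (P.sym (comp-* T (deriv f) F))) ⟩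
      comp (C κ *ₚ f) F +ₚ comp (T *ₚ deriv f) F
        P.≈⟨ P.trans (P.sym (comp-+ (C κ *ₚ f) (T *ₚ deriv f) F)) (comp-cong F κf+Tf′) ⟩
      comp (C κ *ₚ G P.^ P′) F
        P.≈⟨ P.trans (comp-C* κ (G P.^ P′) F) (P.*-congˡ (comp-^ G P′ F)) ⟩
      C κ *ₚ comp G F P.^ P′ P.∎))
      where
      expo : p ℕ.^ (n ℕ.∸ K) ℕ.* P′ ≡ q
      expo = ≡.trans (≡.sym (ℕ.^-distribˡ-+-* p (n ℕ.∸ K) K)) (≡.cong (p ℕ.^_) (ℕ.m∸n+n≡m K≤n))

    deg-𝕏b^P : deg (𝕏 *ₚ b P.^ P′) ≡ suc (P′ ℕ.* deg b)
    deg-𝕏b^P = ≡.trans (deg-* 𝕏≋0̸ n-b^P) (≡.cong₂ ℕ._+_ deg-𝕏 (deg-^ P′ nb))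

    private
      deg-a^P : deg (a P.^ P′) ≡ P′ ℕ.* deg a
      deg-a^P = case (zero? a)
        where
        case : Dec (a ≋ []) → deg (a P.^ P′) ≡ P′ ℕ.* deg a
        case (no na) = deg-^ P′ na
        case (yes z) = ≡.trans (deg-zero (a P.^ P′) (P.trans (P.^-congˡ P′ z) (P.0^ P′ (ℕ.≤-trans (s≤s z≤n) P≥2))))
          (≡.sym (≡.trans (≡.cong (P′ ℕ.*_) (deg-zero a z)) (ℕ.*-zeroʳ P′)))

      -- One degree is divisible by P, the other is 1 modulo P. Hence a^P and x b^P cannot cancel,
      -- and the degree of f(F) bounds both.
      distinct : deg (a P.^ P′) ≢ deg (𝕏 *ₚ b P.^ P′)
      distinct e = ℕ.<⇒≱ P≥2 (∣⇒≤ (∣m+n∣m⇒∣n {P′} {P′ ℕ.* deg b} {1}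
        (≡.subst (P′ ∣_) (≡.trans (≡.trans (≡.sym deg-a^P) (≡.trans e deg-𝕏b^P)) (ℕ.+-comm 1 (P′ ℕ.* deg b))) (m∣m*n (deg a)))
        (m∣m*n (deg b))))
        where open import Data.Nat.Divisibility using (_∣_; ∣⇒≤; ∣m+n∣m⇒∣n; m∣m*n)

      bounds : deg (a P.^ P′) ℕ.≤ deg (a P.^ P′ +ₚ 𝕏 *ₚ b P.^ P′) × deg (𝕏 *ₚ b P.^ P′) ℕ.≤ deg (a P.^ P′ +ₚ 𝕏 *ₚ b P.^ P′)
      bounds = deg-max {a P.^ P′} {𝕏 *ₚ b P.^ P′} (*ₚ-≋0̸ 𝕏≋0̸ n-b^P) distinct

      deg-f∘F : deg (a P.^ P′ +ₚ 𝕏 *ₚ b P.^ P′) ≡ deg f ℕ.* d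
      deg-f∘F = ≡.trans (deg-cong f∘F) (deg-comp f 1≤d nf)

    P*deg-a≤ : P′ ℕ.* deg a ℕ.≤ deg f ℕ.* d
    P*deg-a≤ = ≡.subst₂ ℕ._≤_ deg-a^P deg-f∘F (proj₁ bounds)

    P*deg-b< : P′ ℕ.* deg b ℕ.< deg f ℕ.* d
    P*deg-b< = ≡.subst₂ ℕ._≤_ deg-𝕏b^P deg-f∘F (proj₂ bounds)

    deg-a<d : deg a ℕ.< d
    deg-a<d = ℕ.*-cancelˡ-< P′ (deg a) d (ℕ.≤-<-trans P*deg-a≤ (ℕ.*-monoˡ-< d {{ℕ.>-nonZero 1≤d}} f<P))

    deg-b<d : deg b ℕ.< d
    deg-b<d = ℕ.*-cancelˡ-< P′ (deg b) d (ℕ.<-trans P*deg-b< (ℕ.*-monoˡ-< d {{ℕ.>-nonZero 1≤d}} f<P))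

    -- By `f<s+w` the term T f′, of degree s + w, dominates κ f.
    deg-G : P′ ℕ.* deg G ≡ deg T ℕ.+ w
    deg-G = ≡.trans (≡.sym (deg-^ P′ nG)) (≡.trans (≡.sym (deg-C* κ≢0 (^ₚ-≋0̸ P′ nG))) (≡.trans (deg-cong (P.sym κf+Tf′)) (≡.trans (proj₂ dom) deg-Tf′)))
      where
      nf′ : deriv f ≋0̸
      nf′ = ≋0̸-cong (P.sym f′) (*ₚ-≋0̸ (C≋0̸ ω≢0) (^ₚ-≋0̸ w 𝕏≋0̸))
      deg-Tf′ : deg (T *ₚ deriv f) ≡ deg T ℕ.+ w
      deg-Tf′ = ≡.trans (deg-* nT nf′) (≡.cong (deg T ℕ.+_) (≡.trans (deg-cong f′) (≡.trans (deg-C* ω≢0 (^ₚ-≋0̸ w 𝕏≋0̸)) (deg-𝕏^ w))))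
      dom : (C κ *ₚ f +ₚ T *ₚ deriv f ≋0̸) × deg (C κ *ₚ f +ₚ T *ₚ deriv f) ≡ deg (T *ₚ deriv f)
      dom = +-dominant {C κ *ₚ f} {T *ₚ deriv f} (≡.subst (C κ *ₚ f <°_) (≡.sym deg-Tf′)
              (<°-C* {f} κ (deg<⇒<° {f} f<s+w))) (*ₚ-≋0̸ nT nf′)
      nG : G ≋0̸
      nG z = proj₁ dom (P.trans κf+Tf′ (P.trans (P.*-congˡ (P.trans (P.^-congˡ P′ z) (P.0^ P′ (ℕ.≤-trans (s≤s z≤n) P≥2)))) (P.zeroʳ (C κ))))

    deg-G≥1 : 1 ℕ.≤ deg G
    deg-G≥1 = ℕ.*-cancelˡ-< P′ 0 (deg G) (≡.subst₂ ℕ._<_ (≡.sym (ℕ.*-zeroʳ P′)) (≡.sym deg-G) (ℕ.≤-trans (ℕ.≤-trans (s≤s z≤n) 3≤s) (ℕ.m≤m+n _ w)))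

    nG : G ≋0̸
    nG = deg≥1⇒≋0̸ deg-G≥1

    -- For K = n the relation reads a + x b = G(F); the left side has degree at most d, the right
    -- side at least 2 d.
    K<n : 2 ℕ.≤ deg G → K ℕ.< n
    K<n 2≤ = ℕ.≤∧≢⇒< K≤n K≢n
      where
      K≢n : K ≢ n
      K≢n e = contradiction (ℕ.≤-trans (ℕ.*-monoˡ-≤ d 2≤) (ℕ.≤-trans (ℕ.≤-reflexive (≡.sym (deg-comp G 1≤d nG)))
          (ℕ.≤-trans (ℕ.≤-reflexive (deg-cong (P.sym relation-ab))) small)))
          (ℕ.<⇒≱ (ℕ.m<m+n d (≡.subst (0 ℕ.<_) (≡.sym (ℕ.+-identityʳ d)) 1≤d)))
        where
        X≡ : X_K ≋ 𝕏
        X≡ = P.trans (P.reflexive (≡.cong (λ k → 𝕏 P.^ (p ℕ.^ k)) (≡.trans (≡.cong (n ℕ.∸_) e) (ℕ.n∸n≡0 n)))) (P.*-identityʳ 𝕏)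
        deg-Xb : deg (X_K *ₚ b) ≡ suc (deg b)
        deg-Xb = ≡.trans (deg-cong (P.*-congʳ X≡)) (≡.trans (deg-* 𝕏≋0̸ nb) (≡.cong (ℕ._+ deg b) deg-𝕏))
        small : deg (a +ₚ X_K *ₚ b) ℕ.≤ d
        small = ℕ.≤-pred (<°⇒deg< (≋0̸-cong (P.sym relation-ab) (comp-≋0̸ G 1≤d nG))
          (deg-sum-≤ a (X_K *ₚ b) (ℕ.<⇒≤ deg-a<d) (≡.subst (ℕ._≤ d) (≡.sym deg-Xb) deg-b<d)))

    deriv-X_K : K ℕ.< n → deriv X_K ≋ []
    deriv-X_K lt = deriv-p^ 𝕏 (n ℕ.∸ K) (ℕ.m<n⇒0<n∸m lt)

    -- F divides F′b, because F divides F′(X^q − X) and F^w divides b^P.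
    F∣F′b : 1 ℕ.≤ w → F D.∣ᵣ deriv F *ₚ b
    F∣F′b 1≤w = root-∣ {F} {deriv F *ₚ b} {𝕏q-𝕏} P′ j j<P deriv-𝕏q-𝕏 nF 𝕏q-𝕏≋0̸ (Y , (P.begin
      F P.^ P′ *ₚ Y
        P.≡⟨ ≡.cong (λ m → F P.^ m *ₚ Y) P≡ ⟩
      F P.^ (w ℕ.+ j) *ₚ Y
        P.≈⟨ P.*-congʳ (P.^-homo-* F w j) ⟩
      (F P.^ w *ₚ F P.^ j) *ₚ (C ω *ₚ (deriv F P.^ suc w *ₚ k P.^ j))
        P.≈⟨ P.solve 5 (λ A B c D k → (A P.:* B) P.:* (c P.:* (D P.:* k)) P.:= (c P.:* A P.:* D) P.:* (B P.:* k)) P.refl (F P.^ w) (F P.^ j) (C ω) (deriv F P.^ suc w) (k P.^ j) ⟩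
      (C ω *ₚ F P.^ w *ₚ deriv F P.^ suc w) *ₚ (F P.^ j *ₚ k P.^ j)
        P.≈⟨ P.*-congˡ (P.trans (P.sym (P.^-distrib-* F k j)) (P.trans (P.^-congˡ j (proj₂ F∣F′R)) (P.^-distrib-* (deriv F) 𝕏q-𝕏 j))) ⟩
      (C ω *ₚ F P.^ w *ₚ (deriv F *ₚ deriv F P.^ w)) *ₚ (deriv F P.^ j *ₚ 𝕏q-𝕏 P.^ j)
        P.≈⟨ P.solve 6 (λ c A D E B R → (c P.:* A P.:* (D P.:* E)) P.:* (B P.:* R) P.:= ((E P.:* B) P.:* (c P.:* (A P.:* D))) P.:* R) P.refl (C ω) (F P.^ w) (deriv F) (deriv F P.^ w) (deriv F P.^ j) (𝕏q-𝕏 P.^ j) ⟩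
      ((deriv F P.^ w *ₚ deriv F P.^ j) *ₚ (C ω *ₚ (F P.^ w *ₚ deriv F))) *ₚ 𝕏q-𝕏 P.^ j
        P.≈⟨ P.*-congʳ (P.*-cong (P.trans (P.sym (P.^-homo-* (deriv F) w j)) (P.reflexive (≡.cong (deriv F P.^_) (≡.sym P≡)))) (P.sym b^P)) ⟩
      (deriv F P.^ P′ *ₚ b P.^ P′) *ₚ 𝕏q-𝕏 P.^ j
        P.≈⟨ P.*-congʳ (P.sym (P.^-distrib-* (deriv F) b P′)) ⟩
      (deriv F *ₚ b) P.^ P′ *ₚ 𝕏q-𝕏 P.^ j P.∎))
      where
      -- F^P is assembled from F^w in b^P and F^j in (F′ (X^q - X))^j. `root-∣` allows only j < P,
      -- which is where w ≥ 1 enters.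
      j = P′ ℕ.∸ w
      w≤P : w ℕ.≤ P′
      w≤P = ℕ.≤-trans (ℕ.n≤1+n w) (ℕ.<⇒≤ W<P)
      P≡ : P′ ≡ w ℕ.+ j
      P≡ = ≡.sym (ℕ.m+[n∸m]≡n w≤P)
      j<P : j ℕ.< P′
      j<P = ℕ.∸-monoʳ-< 1≤w w≤P
      k = proj₁ F∣F′R
      Y = C ω *ₚ (deriv F P.^ suc w *ₚ k P.^ j)

  -- What one comparison of digits says about a, b and G.

  -- `b` differentiates like F^σ, and the exponents j ≥ 2 of `G` are congruent to σ modulo p. Index
  -- 1 is set apart because its digit contains E₁, a part of the Wronskian; `wr≋` measures how far
  -- `a` is from differentiating like `b`.
  record Concl {F T : Poly} {H : Hyp F T} {K w : ℕ} (St : State H K w) : Set where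
    open State St using (G; a; b)
    field
      σ   : ℕ
      Fb′ : F *ₚ deriv b ≋ C (ι σ) *ₚ (deriv F *ₚ b)
      wr≋ : wr a b ≋ C ((ι 1 - ι σ) * coeff G 1) *ₚ (deriv F *ₚ b)
      gj  : ∀ j → 2 ℕ.≤ j → (ι j - ι σ) * coeff G j ≡ 0#

  module Analysis {F T : Poly} {H : Hyp F T} {K w : ℕ} (St : State H K w) (s₁≥2 : 2 ℕ.≤ deg (State.G St)) where
    open StateFacts St

    private
      Z′ : deriv X_K ≋ []
      Z′ = deriv-X_K (K<n s₁≥2)

      b<° : b <° d
      b<° = deg<⇒<° {b} deg-b<d

      wr<2d : wr a b <° d ℕ.+ d
      wr<2d = <°-mono (wr a b) (ℕ.+-mono-≤ (ℕ.<⇒≤ deg-a<d) (ℕ.<⇒≤ deg-b<d)) (wr-<° a b)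

    -- Divisibility means C₀ = 0, and G(0) = 0 then gives E₀ = 0. Every remaining digit is a scalar
    -- times C₁ ≠ 0, so the scalars can be compared, with σ = deg G.
    divisible : F D.∣ᵣ deriv F *ₚ b → Concl St
    divisible (C₁ , e) = record
      { σ = deg G
      ; Fb′ = P.begin
          F *ₚ deriv b                        P.≈⟨ P.*-congˡ b′≋ ⟩
          F *ₚ (C (ι (deg G)) *ₚ C₁)          P.≈⟨ P.solve 3 (λ F c k → F P.:* (c P.:* k) P.:= c P.:* (F P.:* k)) P.refl F (C (ι (deg G))) C₁ ⟩
          C (ι (deg G)) *ₚ (F *ₚ C₁)          P.≈⟨ P.*-congˡ e ⟩
          C (ι (deg G)) *ₚ (deriv F *ₚ b)     P.∎
      ; wr≋ = P.begin
          wr a b                              P.≈⟨ wr≋ ⟩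
          E₁ *ₚ F +ₚ E₀                       P.≈⟨ P.+-cong (P.*-congʳ (P.trans digit-1 (P.trans (P.+-congʳ (P.zeroʳ _)) (P.+-identityˡ _)))) E₀≋0 ⟩
          (C c *ₚ C₁) *ₚ F +ₚ []              P.≈⟨ P.solve 3 (λ c k F → (c P.:* k) P.:* F P.:+ P.con (pos 0) P.:= c P.:* (F P.:* k)) P.refl (C c) C₁ F ⟩
          C c *ₚ (F *ₚ C₁)                    P.≈⟨ P.*-congˡ e ⟩
          C c *ₚ (deriv F *ₚ b)               P.∎
      ; gj = λ j 2≤j → C*-cancel nC₁ (P.trans (P.sym (P.trans (P.+-congʳ (P.zeroʳ _)) (P.+-identityˡ _))) (digit-≥2 j 2≤j)) }
      where
      ρ : Relation F
      ρ = relation 1≤d {a} {b} {X_K} {G} {[]} {C₁} relation-ab Z′ b<° (λ _ _ → ≡.refl)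
        (P.trans (P.sym e) (P.trans (P.*-comm F C₁) (P.sym (P.+-identityʳ _)))) wr<2d s₁≥2
      open Comparison ρ
      c = (ι 1 - ι (deg G)) * coeff G 1
      nC₁ : C₁ ≋0̸
      nC₁ z = nF′b (P.trans (P.sym e) (P.trans (P.*-congˡ z) (P.zeroʳ F)))
      E₀≋0 : E₀ ≋ []
      E₀≋0 = P.trans digit-0 (P.trans (P.+-cong (P.zeroˡ _) (P.-‿cong (P.trans (P.*-comm (deriv b) _) (C-zero* (deriv b) G0)))) (P.trans (P.+-identityˡ _) P.-0≈0))

  -- For w = 0 the digit C₀ need not vanish; the root −λ of F + λ may then replace 0.
  record Exceptional {F T : Poly} {H : Hyp F T} {K w : ℕ} (St : State H K w) : Set where
    open State St using (b)
    field
      lam : Fin q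
      C₁  : Poly
      F′b : deriv F *ₚ b ≋ C₁ *ₚ (F +ₚ C lam)

  module Analysis₀ {F T : Poly} {H : Hyp F T} {K : ℕ} (St : State H K 0) (s₁≥2 : 2 ℕ.≤ deg (State.G St))
    (p·deg-f≤P : p ℕ.* deg (State.f St) ℕ.≤ p ℕ.^ K) where
    open StateFacts St

    private
      Z′ : deriv X_K ≋ []
      Z′ = deriv-X_K (K<n s₁≥2)

      b<° : b <° d
      b<° = deg<⇒<° {b} deg-b<d

    -- P deg a and P deg b are at most deg f times d, and 2 deg f ≤ p deg f ≤ P. Hence deg a + deg b
    -- ≤ d, and E₁ vanishes.
    wr<d : wr a b <° d
    wr<d = <°-mono (wr a b) a+b≤d (wr-<° a b)
      where
      2f≤P : 2 ℕ.* deg f ℕ.≤ P′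
      2f≤P = ℕ.≤-trans (ℕ.*-monoˡ-≤ (deg f) p≥2) p·deg-f≤P
      half : ∀ {x} → P′ ℕ.* x ℕ.≤ deg f ℕ.* d → 2 ℕ.* x ℕ.≤ d
      half {x} le = ℕ.*-cancelˡ-≤ P′ (ℕ.≤-trans (ℕ.≤-reflexive (≡.trans (≡.sym (ℕ.*-assoc P′ 2 x)) (≡.trans (≡.cong (ℕ._* x) (ℕ.*-comm P′ 2)) (ℕ.*-assoc 2 P′ x))))
        (ℕ.≤-trans (ℕ.*-monoʳ-≤ 2 le) (ℕ.≤-trans (ℕ.≤-reflexive (≡.sym (ℕ.*-assoc 2 (deg f) d))) (ℕ.*-monoˡ-≤ d 2f≤P))))
      a+b≤d : deg a ℕ.+ deg b ℕ.≤ d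
      a+b≤d = ℕ.*-cancelˡ-≤ 2 (ℕ.≤-trans (ℕ.≤-reflexive (ℕ.*-distribˡ-+ 2 (deg a) (deg b)))
        (ℕ.≤-trans (ℕ.+-mono-≤ (half P*deg-a≤) (half (ℕ.<⇒≤ P*deg-b<))) (ℕ.≤-reflexive (≡.sym (≡.cong (d ℕ.+_) (ℕ.+-identityʳ d))))))

    -- With C₀ = 0 the digit E₁ is this scalar times C₁. It vanishes because the Wronskian has small
    -- degree; so there is no stop.
    wr-digit : F D.∣ᵣ deriv F *ₚ b → (ι 1 - ι (deg G)) * coeff G 1 ≡ 0#
    wr-digit (C₁ , e) = C*-cancel nC₁ (P.trans (P.sym (P.trans digit-1 (P.trans (P.+-congʳ (P.zeroʳ _)) (P.+-identityˡ _)))) (wr<d⇒E₁≋0 wr<d))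
      where
      ρ : Relation F
      ρ = relation 1≤d {a} {b} {X_K} {G} {[]} {C₁} relation-ab Z′ b<° (λ _ _ → ≡.refl)
        (P.trans (P.sym e) (P.trans (P.*-comm F C₁) (P.sym (P.+-identityʳ _)))) (<°-mono (wr a b) (ℕ.m≤m+n d d) wr<d) s₁≥2
      open Comparison ρ
      nC₁ : C₁ ≋0̸
      nC₁ z = nF′b (P.trans (P.sym e) (P.trans (P.*-congˡ z) (P.zeroʳ F)))

    private
      division = divMod F nF (deriv F *ₚ b)
      C₁ = proj₁ division
      C₀ = proj₁ (proj₂ division)
      F′b≋ : deriv F *ₚ b ≋ C₁ *ₚ F +ₚ C₀
      F′b≋ = proj₁ (proj₂ (proj₂ division))
      ρ : Relation F
      ρ = relation 1≤d {a} {b} {X_K} {G} {C₀} {C₁} relation-ab Z′ b<° (proj₂ (proj₂ (proj₂ division)))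
        F′b≋ (<°-mono (wr a b) (ℕ.m≤m+n d d) wr<d) s₁≥2
      open Comparison ρ

      g : ℕ → Fin q
      g = coeff G
      s₁ = deg G

      digit : ∀ j → 1 ℕ.≤ j → C (ι (suc j) * g (suc j)) *ₚ C₀ +ₚ C ((ι j - ι s₁) * g j) *ₚ C₁ ≋ []
      digit (suc zero)    _ = P.trans (P.sym digit-1) (wr<d⇒E₁≋0 wr<d)
      digit (suc (suc j)) _ = digit-≥2 (suc (suc j)) (s≤s (s≤s z≤n))

      -- Now b′ = s₁ C₁ = 0, and the digits relate (j + 1) g(j + 1) C₀ to j g(j) C₁. As C₀ and C₁
      -- are not both zero, the exponents of `G` above 1 are divisible by p; thus G′ is the constant
      -- g(1) and a′ = g(1) F′.
      separable : ι s₁ ≡ 0# → Concl St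
      separable ιs₁≡0 = record
        { σ = 0
        ; Fb′ = P.trans (P.*-congˡ b′≋0) (P.trans (P.zeroʳ F) (P.sym (C-zero* _ ≡.refl)))
        ; wr≋ = P.begin
            deriv a *ₚ b P.- a *ₚ deriv b         P.≈⟨ P.+-cong (P.*-congʳ a′≋) (P.-‿cong (P.trans (P.*-congˡ b′≋0) (P.zeroʳ a))) ⟩
            (C (g 1) *ₚ deriv F) *ₚ b P.- []      P.≈⟨ P.trans (P.+-congˡ P.-0≈0) (P.+-identityʳ _) ⟩
            (C (g 1) *ₚ deriv F) *ₚ b             P.≈⟨ P.*-assoc _ _ _ ⟩
            C (g 1) *ₚ (deriv F *ₚ b)             P.≈⟨ P.*-congʳ (C-cong (solve 1 (λ x → x := (con (pos 1) :+ con (pos 0) :- con (pos 0)) :* x) ≡.refl (g 1))) ⟩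
            C ((ι 1 - ι 0) * g 1) *ₚ (deriv F *ₚ b) P.∎
        ; gj = λ j 2≤j → ≡.trans (≡.cong (_* g j) (≡.trans (≡.cong (ι j +_) -0≈0) (+-identityʳ (ι j)))) (h≡0 j 2≤j) }
        where
        b′≋0 : deriv b ≋ []
        b′≋0 = P.trans b′≋ (C-zero* C₁ ιs₁≡0)
        digit′ : ∀ j → 1 ℕ.≤ j → C (ι (suc j) * g (suc j)) *ₚ C₀ +ₚ C (ι j * g j) *ₚ C₁ ≋ []
        digit′ j le = P.trans (P.+-congˡ (P.*-congʳ (C-cong (≡.cong (_* g j) (≡.sym (≡.trans (≡.cong (λ x → ι j - x) ιs₁≡0) (≡.trans (≡.cong (ι j +_) -0≈0) (+-identityʳ (ι j)))))))))
          (digit j le)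
        h≡0 : ∀ j → 2 ℕ.≤ j → ι j * g j ≡ 0#
        h≡0 = case (zero? C₁)
          where
          case : Dec (C₁ ≋ []) → ∀ j → 2 ℕ.≤ j → ι j * g j ≡ 0#
          case (yes z) (suc j) (s≤s 1≤j) = C*-cancel nC₀ (P.trans (P.sym (P.trans (P.+-congˡ (P.trans (P.*-congˡ z) (P.zeroʳ _))) (P.+-identityʳ _))) (digit′ j 1≤j))
            where
            nC₀ : C₀ ≋0̸
            nC₀ z₀ = nF′b (P.trans F′b≋ (P.trans (P.+-cong (P.trans (P.*-congʳ z) (P.zeroˡ F)) z₀) (P.+-identityˡ [])))
          -- Descending induction from the indices beyond deg G, where the coefficients vanish.
          case (no nC₁) j 2≤j = down (suc s₁) j (ℕ.≤-trans (s≤s z≤n) 2≤j) (ℕ.m≤n+m (suc s₁) j)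
            where
            down : ∀ k j → 1 ℕ.≤ j → s₁ ℕ.< j ℕ.+ k → ι j * g j ≡ 0#
            down zero    j 1≤j lt = ≡.trans (≡.cong (ι j *_) (<°deg G j (≡.subst (s₁ ℕ.<_) (ℕ.+-identityʳ j) lt))) (zeroʳ _)
            down (suc k) j 1≤j lt = C*-cancel nC₁ (P.trans (P.sym (P.trans (P.+-congʳ (C-zero* C₀ (down k (suc j) (s≤s z≤n) (≡.subst (s₁ ℕ.<_) (ℕ.+-suc j k) lt)))) (P.+-identityˡ _))) (digit′ j 1≤j))
        a′≋ : deriv a ≋ C (g 1) *ₚ deriv F
        a′≋ = P.begin
          deriv a                               P.≈⟨ P.trans (P.+-congˡ (P.trans (P.*-congˡ b′≋0) (P.zeroʳ X_K))) (P.+-identityʳ _) ⟨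
          deriv a +ₚ X_K *ₚ deriv b             P.≈⟨ derived ⟩
          comp (deriv G) F *ₚ deriv F           P.≈⟨ P.*-congʳ (P.trans (comp-cong F G′≋) (comp-C (g 1) F)) ⟩
          C (g 1) *ₚ deriv F                    P.∎
          where
          G′≋ : deriv G ≋ C (g 1)
          G′≋ = mk λ { zero → ≡.trans (coeff-deriv G 0) (≡.trans (≡.cong (_* g 1) ι1≈1) (*-identityˡ (g 1)))
                     ; (suc j) → ≡.trans (coeff-deriv G (suc j)) (h≡0 (suc (suc j)) (s≤s (s≤s z≤n))) }

      -- C₀ is a scalar multiple of C₁, so a translate of F divides F′b and may take the place of F.
      exceptional : ι s₁ ≢ 0# → Exceptional St
      exceptional ne = record { lam = lam ; C₁ = C₁ ; F′b = F′b≋′ }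
        where
        r = ℕ.pred s₁
        s₁≡ : suc r ≡ s₁
        s₁≡ = ℕ.suc-pred s₁ {{ℕ.>-nonZero (ℕ.≤-trans (s≤s z≤n) s₁≥2)}}
        lead = ι s₁ * g s₁
        lead≢0 : lead ≢ 0#
        lead≢0 = *-≉0 ne (lead≉0 G nG)
        l⁻¹ = proj₁ (invert lead lead≢0)
        lam = l⁻¹ * g r
        -- the digit of index s₁ − 1 reads  s₁ g(s₁) C₀ = g(s₁ − 1) C₁
        top : C lead *ₚ C₀ ≋ C (g r) *ₚ C₁
        top = P.x-y≈0⇒x≈y (P.begin
          C lead *ₚ C₀ P.- C (g r) *ₚ C₁
            P.≈⟨ P.solve 3 (λ u g c → u P.:- g P.:* c P.:= u P.:+ (P.:- g) P.:* c) P.refl (C lead *ₚ C₀) (C (g r)) C₁ ⟩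
          C lead *ₚ C₀ +ₚ (P.- C (g r)) *ₚ C₁
            P.≈⟨ P.+-cong (P.*-congʳ (C-cong (≡.cong (λ m → ι m * g m) (≡.sym s₁≡)))) (P.*-congʳ (P.trans (P.sym (C-neg (g r))) (C-cong minus))) ⟩
          C (ι (suc r) * g (suc r)) *ₚ C₀ +ₚ C ((ι r - ι s₁) * g r) *ₚ C₁
            P.≈⟨ digit r (ℕ.≤-pred (≡.subst (2 ℕ.≤_) (≡.sym s₁≡) s₁≥2)) ⟩
          [] P.∎)
          where
          minus : - g r ≡ (ι r - ι s₁) * g r
          minus = ≡.trans (solve 2 (λ i x → :- x := (i :- (con (pos 1) :+ i)) :* x) ≡.refl (ι r) (g r))
            (≡.cong (λ m → (ι r - ι m) * g r) s₁≡)
        C₀≋ : C₀ ≋ C lam *ₚ C₁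
        C₀≋ = P.trans (P.sym (C-inv lead≢0 C₀)) (P.trans (P.*-congˡ top) (C*C* l⁻¹ (g r) C₁))
        F′b≋′ : deriv F *ₚ b ≋ C₁ *ₚ (F +ₚ C lam)
        F′b≋′ = P.trans F′b≋ (P.trans (P.+-congˡ (P.trans C₀≋ (P.*-comm (C lam) C₁))) (P.sym (P.distribˡ C₁ F (C lam))))

    analysis : Concl St ⊎ Exceptional St
    analysis = case (ι s₁ Fin.≟ 0#)
      where
      case : Dec (ι s₁ ≡ 0#) → Concl St ⊎ Exceptional St
      case (yes e) = inj₁ (separable e)
      case (no ne) = inj₂ (exceptional ne)

  -- The step from level K to level K + 1.

  open import Data.Nat.Divisibility using (_∣_; divides)
  open import Data.Nat.DivMod using (m≡m%n+[m/n]*n; m%n<n) renaming (_%_ to infixl 7 _%_; _/_ to infixl 7 _/_)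

  -- -σ is needed as a natural number below p, because it is to be the exponent of F and the next
  -- digit.
  ι-negation : ∀ σ → ∃[ r ] r ℕ.< p × ι r + ι σ ≡ 0#
  ι-negation σ = case (σ % p) ≡.refl
    where
    ισ≡ : ι σ ≡ ι (σ % p)
    ισ≡ = ≡.trans (≡.cong ι (m≡m%n+[m/n]*n σ p)) (≡.trans (ι-homo-+ (σ % p) _)
      (≡.trans (≡.cong (ι (σ % p) +_) (Frob.ι-∣ (divides (σ / p) ≡.refl))) (+-identityʳ _)))
    case : ∀ m → σ % p ≡ m → ∃[ r ] r ℕ.< p × ι r + ι σ ≡ 0#
    case zero    e = 0 , ℕ.≤-trans (s≤s z≤n) p≥2 , ≡.trans (+-identityˡ _) (≡.trans ισ≡ (≡.cong ι e))
    case (suc m) e = p ℕ.∸ suc m , ℕ.∸-monoʳ-< (s≤s z≤n) (ℕ.<⇒≤ m<p) , (begin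
      ι (p ℕ.∸ suc m) + ι σ          ≡⟨ ≡.cong (ι (p ℕ.∸ suc m) +_) (≡.trans ισ≡ (≡.cong ι e)) ⟩
      ι (p ℕ.∸ suc m) + ι (suc m)    ≡⟨ ι-homo-+ (p ℕ.∸ suc m) (suc m) ⟨
      ι (p ℕ.∸ suc m ℕ.+ suc m)      ≡⟨ ≡.cong ι (ℕ.m∸n+n≡m (ℕ.<⇒≤ m<p)) ⟩
      ι p                            ≡⟨ ι-p ⟩
      0#                             ∎)
      where
      m<p : suc m ℕ.< p
      m<p = ≡.subst (ℕ._< p) e (m%n<n σ p)

  -- The coefficient g* of y in G that is split off: either 0 or the whole of it.
  Choice : {F T : Poly} {H : Hyp F T} {K w : ℕ} (St : State H K w) → Concl St → Fin q → Set
  Choice {T = T} {K = K} {w} St concl g* =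
      (g* ≡ 0# × (ι 1 - ι (Concl.σ concl)) * coeff (State.G St) 1 ≡ 0#)
    ⊎ (g* ≡ coeff (State.G St) 1 × ι (Concl.σ concl) ≢ ι 1 × p ℕ.^ K ℕ.< deg T ℕ.+ w)

  module Advancing {F T : Poly} {H : Hyp F T} {K w : ℕ} (St : State H K w) (K<n : K ℕ.< n) (concl : Concl St)
    (g* : Fin q)
    (choice : Choice St concl g*) where

    open StateFacts St hiding (K<n)
    open Concl concl

    r : ℕ
    r = proj₁ (ι-negation σ)

    r<p : r ℕ.< p
    r<p = proj₁ (proj₂ (ι-negation σ))

    r+σ : ι r + ι σ ≡ 0#
    r+σ = proj₂ (proj₂ (ι-negation σ))

    private
      c = ι σ

      -- This scalar is the coefficient in the Wronskian of a - g* F and `b`, and it is also the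
      -- homogeneity condition on G - g* y at index 1. Either choice of `g*` makes it vanish.
      balanced : (ι 1 - c) * (coeff G 1 - g*) ≡ 0#
      balanced = case choice
        where
        case : _ ⊎ _ → (ι 1 - c) * (coeff G 1 - g*) ≡ 0#
        case (inj₁ (e , e′)) = ≡.trans (≡.cong (λ x → (ι 1 - c) * (coeff G 1 - x)) e)
          (≡.trans (≡.cong ((ι 1 - c) *_) (≡.trans (≡.cong (coeff G 1 +_) -0≈0) (+-identityʳ _))) e′)
        case (inj₂ (e , _)) = ≡.trans (≡.cong (λ x → (ι 1 - c) * (coeff G 1 - x)) e)
          (≡.trans (≡.cong ((ι 1 - c) *_) (-‿inverseʳ _)) (zeroʳ _))

      â Ĝ f̂ : Poly
      â = a P.- C g* *ₚ F
      Ĝ = G P.- C g* *ₚ 𝕏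
      f̂ = f P.- C (g* ^ P′) *ₚ 𝕏 P.^ P′

      euler-b : F *ₚ deriv b ≋ C c *ₚ (deriv F *ₚ b)
      euler-b = Fb′

      wr-â : wr â b ≋ []
      wr-â = P.begin
        deriv â *ₚ b P.- â *ₚ deriv b
          P.≈⟨ P.+-congʳ (P.*-congʳ (P.trans (deriv-sub a (C g* *ₚ F)) (P.+-congˡ (P.-‿cong (deriv-C* g* F))))) ⟩
        (deriv a P.- C g* *ₚ deriv F) *ₚ b P.- (a P.- C g* *ₚ F) *ₚ deriv b
          P.≈⟨ P.solve 7 (λ a a′ g F F′ b b′ → (a′ P.:- g P.:* F′) P.:* b P.:- (a P.:- g P.:* F) P.:* b′
                P.:= (a′ P.:* b P.:- a P.:* b′) P.:- g P.:* (F′ P.:* b P.:- F P.:* b′)) P.refl a (deriv a) (C g*) F (deriv F) b (deriv b) ⟩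
        wr a b P.- C g* *ₚ (deriv F *ₚ b P.- F *ₚ deriv b)
          P.≈⟨ P.+-cong wr≋ (P.-‿cong (P.*-congˡ (P.+-congˡ (P.-‿cong Fb′)))) ⟩
        C ((ι 1 - c) * coeff G 1) *ₚ (deriv F *ₚ b) P.- C g* *ₚ (deriv F *ₚ b P.- C c *ₚ (deriv F *ₚ b))
          P.≈⟨ P.+-congˡ (P.-‿cong (P.*-congˡ (P.+-congʳ (P.sym (P.trans (P.*-congʳ (C-cong ι1≈1)) (P.*-identityˡ _)))))) ⟩
        C ((ι 1 - c) * coeff G 1) *ₚ (deriv F *ₚ b) P.- C g* *ₚ (C (ι 1) *ₚ (deriv F *ₚ b) P.- C c *ₚ (deriv F *ₚ b))
          P.≈⟨ P.solve 5 (λ x g i c u → x P.:* u P.:- g P.:* (i P.:* u P.:- c P.:* u) P.:= (x P.:- (i P.:- c) P.:* g) P.:* u) P.refl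
                (C ((ι 1 - c) * coeff G 1)) (C g*) (C (ι 1)) (C c) (deriv F *ₚ b) ⟩
        (C ((ι 1 - c) * coeff G 1) P.- (C (ι 1) P.- C c) *ₚ C g*) *ₚ (deriv F *ₚ b)
          P.≈⟨ P.*-congʳ (P.+-congˡ (P.-‿cong (P.trans (C-* (ι 1 - c) g*) (P.*-congʳ (C-sub (ι 1) c))))) ⟨
        (C ((ι 1 - c) * coeff G 1) P.- C ((ι 1 - c) * g*)) *ₚ (deriv F *ₚ b)
          P.≈⟨ P.*-congʳ (P.trans (P.sym (C-sub _ _)) (C-cong (solve 3 (λ i x y → i :* x :- i :* y := i :* (x :- y)) ≡.refl (ι 1 - c) (coeff G 1) g*))) ⟩
        C ((ι 1 - c) * (coeff G 1 - g*)) *ₚ (deriv F *ₚ b)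
          P.≈⟨ C-zero* _ balanced ⟩
        [] P.∎

      -- a - g* F and `b` have Wronskian zero, so their quotient has derivative zero, and the first
      -- inherits the Euler equation of the second.
      euler-â : F *ₚ deriv â ≋ C c *ₚ (deriv F *ₚ â)
      euler-â = *ₚ-cancelˡ nb (P.begin
        b *ₚ (F *ₚ deriv â)            P.≈⟨ P.solve 3 (λ b F a → b P.:* (F P.:* a) P.:= F P.:* (a P.:* b)) P.refl b F (deriv â) ⟩
        F *ₚ (deriv â *ₚ b)            P.≈⟨ P.*-congˡ (P.x-y≈0⇒x≈y wr-â) ⟩
        F *ₚ (â *ₚ deriv b)            P.≈⟨ P.solve 3 (λ F a b → F P.:* (a P.:* b) P.:= a P.:* (F P.:* b)) P.refl F â (deriv b) ⟩
        â *ₚ (F *ₚ deriv b)            P.≈⟨ P.*-congˡ Fb′ ⟩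
        â *ₚ (C c *ₚ (deriv F *ₚ b))   P.≈⟨ P.solve 4 (λ a c F b → a P.:* (c P.:* (F P.:* b)) P.:= b P.:* (c P.:* (F P.:* a))) P.refl â (C c) (deriv F) b ⟩
        b *ₚ (C c *ₚ (deriv F *ₚ â))   P.∎)

      coeff-Ĝ : ∀ j → coeff Ĝ j ≡ coeff G j - g* * coeff 𝕏 j
      coeff-Ĝ j = ≡.trans (coeff-sub G (C g* *ₚ 𝕏) j) (≡.cong (λ x → coeff G j - x) (coeff-C* g* 𝕏 j))

      Ĝ-homogeneous : ∀ j → (ι j - c) * coeff Ĝ j ≡ 0#
      Ĝ-homogeneous zero = ≡.trans (≡.cong ((ι 0 - c) *_) (≡.trans (coeff-Ĝ 0) (≡.trans (≡.cong₂ _-_ G0 (zeroʳ g*)) (-‿inverseʳ 0#)))) (zeroʳ _)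
      Ĝ-homogeneous (suc zero) = ≡.trans (≡.cong ((ι 1 - c) *_) (≡.trans (coeff-Ĝ 1) (≡.cong (λ x → coeff G 1 - x) (*-identityʳ g*)))) balanced
      Ĝ-homogeneous (suc (suc j)) = ≡.trans (≡.cong ((ι (suc (suc j)) - c) *_) (≡.trans (coeff-Ĝ (suc (suc j)))
        (≡.trans (≡.cong (λ x → coeff G (suc (suc j)) - x) (zeroʳ g*)) (≡.trans (≡.cong (coeff G (suc (suc j)) +_) -0≈0) (+-identityʳ _)))))
        (gj (suc (suc j)) (s≤s (s≤s z≤n)))

      root-b : ∃[ h ] h P.^ p ≋ b *ₚ F P.^ r
      root-b = poly-p-th-root (b *ₚ F P.^ r) (euler F b c r nF euler-b r+σ)

      root-a : ∃[ h ] h P.^ p ≋ â *ₚ F P.^ r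
      root-a = poly-p-th-root (â *ₚ F P.^ r) (euler F â c r nF euler-â r+σ)

      root-G : ∃[ h ] h P.^ p ≋ Ĝ *ₚ 𝕏 P.^ r
      root-G = poly-p-th-root (Ĝ *ₚ 𝕏 P.^ r) (euler 𝕏 Ĝ c r 𝕏≋0̸ (euler-𝕏 Ĝ c Ĝ-homogeneous) r+σ)

      b₊ a₊ G₊ : Poly
      b₊ = proj₁ root-b
      a₊ = proj₁ root-a
      G₊ = proj₁ root-G

    -- Subtracting (g* F)^P from f(F) replaces `a` by a - g* F; the factor F^(rP) then makes (a - g*
    -- F)^P and b^P powers with exponent p P.
    f₊ : Poly
    f₊ = 𝕏 P.^ (r ℕ.* P′) *ₚ (f P.- C (g* ^ P′) *ₚ 𝕏 P.^ P′)

    private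
      P₊ = p ℕ.^ suc K
      w₊ = w ℕ.+ r ℕ.* P′

      deriv-f̂ : deriv f̂ ≋ deriv f
      deriv-f̂ = P.trans (deriv-sub f (C (g* ^ P′) *ₚ 𝕏 P.^ P′)) (P.trans (P.+-congˡ (P.trans (P.-‿cong
        (P.trans (deriv-C* (g* ^ P′) (𝕏 P.^ P′)) (P.trans (P.*-congˡ (deriv-p^ 𝕏 K 1≤K)) (P.zeroʳ (C (g* ^ P′)))))) P.-0≈0)) (P.+-identityʳ _))

      deriv-𝕏^rP : deriv (𝕏 P.^ (r ℕ.* P′)) ≋ []
      deriv-𝕏^rP = P.trans (deriv-cong (P.sym (P.^-assocʳ 𝕏 r P′))) (deriv-p^ (𝕏 P.^ r) K 1≤K)

      deriv-f₊ : deriv f₊ ≋ 𝕏 P.^ (r ℕ.* P′) *ₚ deriv f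
      deriv-f₊ = P.trans (deriv-* (𝕏 P.^ (r ℕ.* P′)) f̂) (P.trans (P.+-cong (P.trans (P.*-congʳ deriv-𝕏^rP) (P.zeroˡ f̂)) (P.*-congˡ deriv-f̂)) (P.+-identityˡ _))

      f₊′ : deriv f₊ ≋ C ω *ₚ 𝕏 P.^ w₊
      f₊′ = P.trans deriv-f₊ (P.trans (P.*-congˡ f′) (P.trans
        (P.solve 3 (λ u c v → u P.:* (c P.:* v) P.:= c P.:* (v P.:* u)) P.refl (𝕏 P.^ (r ℕ.* P′)) (C ω) (𝕏 P.^ w))
        (P.*-congˡ (P.sym (P.^-homo-* 𝕏 w (r ℕ.* P′))))))

      g*𝕏^P : ∀ Y → (C g* *ₚ Y) P.^ P′ ≋ C (g* ^ P′) *ₚ Y P.^ P′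
      g*𝕏^P Y = P.trans (P.^-distrib-* (C g*) Y P′) (P.*-congʳ (P.sym (C-^ g* P′)))

      nf̂ : f̂ ≋0̸
      nf̂ z = *ₚ-≋0̸ (C≋0̸ ω≢0) (^ₚ-≋0̸ w 𝕏≋0̸) (P.trans (P.sym f′) (P.trans (P.sym deriv-f̂) (P.trans (deriv-cong z) deriv-[])))

      deg-f₊ : deg f₊ ≡ r ℕ.* P′ ℕ.+ deg f̂
      deg-f₊ = ≡.trans (deg-* (^ₚ-≋0̸ (r ℕ.* P′) 𝕏≋0̸) nf̂) (≡.cong (ℕ._+ deg f̂) (deg-𝕏^ (r ℕ.* P′)))

      -- Splitting off g(1) brings in the monomial y^P. In that case σ is not 1 modulo p, so r + 1 <
      -- p keeps the exponent (r + 1) P below p P, and P < s + w preserves `f<s+w`.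
      deg-f̂ : (deg f̂ ≡ deg f) ⊎ (suc r ℕ.< p × deg f̂ ℕ.≤ P′ × P′ ℕ.< deg T ℕ.+ w)
      deg-f̂ = case choice
        where
        case : _ ⊎ _ → (deg f̂ ≡ deg f) ⊎ (suc r ℕ.< p × deg f̂ ℕ.≤ P′ × P′ ℕ.< deg T ℕ.+ w)
        case (inj₁ (e , _)) = inj₁ (deg-cong (P.trans (P.+-congˡ (P.trans (P.-‿cong (C-zero* _
          (≡.trans (^-congˡ P′ e) (0^ P′ (ℕ.≤-trans (s≤s z≤n) P≥2))))) P.-0≈0)) (P.+-identityʳ f)))
        case (inj₂ (_ , ne , P<s+w)) = inj₂ (ℕ.≤∧≢⇒< r<p r≢ , ℕ.≤-pred (<°⇒deg< nf̂
          (<°-sub {f} {C (g* ^ P′) *ₚ 𝕏 P.^ P′} (<°-mono f (ℕ.≤-trans f<P (ℕ.n≤1+n P′)) (<°deg f))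
            (<°-C* {𝕏 P.^ P′} (g* ^ P′) (≡.subst (λ m → 𝕏 P.^ P′ <° suc m) (deg-𝕏^ P′) (<°deg (𝕏 P.^ P′)))))) , P<s+w)
          where
          r≢ : suc r ≢ p
          r≢ e = ne (begin
            ι σ                         ≡⟨ solve 2 (λ s r → s := (r :+ s) :- (con (pos 1) :+ r) :+ con (pos 1)) ≡.refl (ι σ) (ι r) ⟩
            (ι r + ι σ) - ι (suc r) + 1# ≡⟨ ≡.cong₂ (λ x y → x - y + 1#) r+σ (≡.trans (≡.cong ι e) ι-p) ⟩
            0# - 0# + 1#                ≡⟨ solve 0 (con (pos 0) :- con (pos 0) :+ con (pos 1) := con (pos 1) :+ con (pos 0)) ≡.refl ⟩
            ι 1                         ∎)

      W₊<P₊ : suc w₊ ℕ.< P₊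
      W₊<P₊ = ℕ.<-≤-trans (ℕ.+-monoˡ-< (r ℕ.* P′) W<P) (ℕ.*-monoˡ-≤ P′ r<p)

      f₊<P₊ : deg f₊ ℕ.< P₊
      f₊<P₊ = ≡.subst (ℕ._< P₊) (≡.sym (≡.trans deg-f₊ (ℕ.+-comm (r ℕ.* P′) (deg f̂)))) (case deg-f̂)
        where
        case : _ ⊎ _ → deg f̂ ℕ.+ r ℕ.* P′ ℕ.< P₊
        case (inj₁ e) = ℕ.<-≤-trans (ℕ.+-monoˡ-< (r ℕ.* P′) (≡.subst (ℕ._< P′) (≡.sym e) f<P)) (ℕ.*-monoˡ-≤ P′ r<p)
        case (inj₂ (sr<p , le , _)) = ℕ.≤-<-trans (ℕ.+-monoˡ-≤ (r ℕ.* P′) le) (ℕ.*-monoˡ-< P′ sr<p)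

      f₊<s+w₊ : deg f₊ ℕ.< deg T ℕ.+ w₊
      f₊<s+w₊ = ≡.subst₂ ℕ._<_ (≡.sym (≡.trans deg-f₊ (ℕ.+-comm (r ℕ.* P′) (deg f̂)))) (ℕ.+-assoc (deg T) w (r ℕ.* P′))
          (ℕ.+-monoˡ-< (r ℕ.* P′) (case deg-f̂))
        where
        case : _ ⊎ _ → deg f̂ ℕ.< deg T ℕ.+ w
        case (inj₁ e) = ≡.subst (ℕ._< deg T ℕ.+ w) (≡.sym e) f<s+w
        case (inj₂ (_ , le , lt)) = ℕ.≤-<-trans le lt

      f₊0 : coeff f₊ 0 ≡ 0#
      f₊0 = begin
        coeff f₊ 0                                       ≡⟨ eval-at-0 f₊ ⟨
        eval f₊ 0#                                       ≡⟨ eval-* (𝕏 P.^ (r ℕ.* P′)) f̂ 0# ⟩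
        eval (𝕏 P.^ (r ℕ.* P′)) 0# * eval f̂ 0#           ≡⟨ ≡.cong (eval (𝕏 P.^ (r ℕ.* P′)) 0# *_) f̂0 ⟩
        eval (𝕏 P.^ (r ℕ.* P′)) 0# * 0#                  ≡⟨ zeroʳ _ ⟩
        0#                                               ∎
        where
        f̂0 : eval f̂ 0# ≡ 0#
        f̂0 = begin
          eval f̂ 0#                                               ≡⟨ eval-sub f (C (g* ^ P′) *ₚ 𝕏 P.^ P′) 0# ⟩
          eval f 0# - eval (C (g* ^ P′) *ₚ 𝕏 P.^ P′) 0#
            ≡⟨ ≡.cong₂ _-_ (≡.trans (eval-at-0 f) f0) (≡.trans (eval-* (C (g* ^ P′)) (𝕏 P.^ P′) 0#)
                (≡.trans (≡.cong (eval (C (g* ^ P′)) 0# *_) (≡.trans (eval-^ 𝕏 P′ 0#) (≡.trans (^-congˡ P′ (eval-𝕏 0#)) (0^ P′ (ℕ.≤-trans (s≤s z≤n) P≥2))))) (zeroʳ _))) ⟩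
          0# - 0#                                                 ≡⟨ -‿inverseʳ 0# ⟩
          0#                                                      ∎

      pow₊ : ∀ {h Y U} → h P.^ p ≋ Y *ₚ U P.^ r → h P.^ P₊ ≋ Y P.^ P′ *ₚ U P.^ (r ℕ.* P′)
      pow₊ {h} {Y} {U} e = P.begin
        h P.^ P₊                           P.≈⟨ P.^-assocʳ h p P′ ⟨
        (h P.^ p) P.^ P′                   P.≈⟨ P.^-congˡ P′ e ⟩
        (Y *ₚ U P.^ r) P.^ P′              P.≈⟨ P.^-distrib-* Y (U P.^ r) P′ ⟩
        Y P.^ P′ *ₚ (U P.^ r) P.^ P′       P.≈⟨ P.*-congˡ (P.^-assocʳ U r P′) ⟩
        Y P.^ P′ *ₚ U P.^ (r ℕ.* P′)       P.∎

      κf₊ : C κ *ₚ f₊ +ₚ T *ₚ deriv f₊ ≋ C κ *ₚ G₊ P.^ P₊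
      κf₊ = P.begin
        C κ *ₚ (𝕏 P.^ (r ℕ.* P′) *ₚ f̂) +ₚ T *ₚ deriv f₊
          P.≈⟨ P.+-congˡ (P.*-congˡ deriv-f₊) ⟩
        C κ *ₚ (𝕏 P.^ (r ℕ.* P′) *ₚ f̂) +ₚ T *ₚ (𝕏 P.^ (r ℕ.* P′) *ₚ deriv f)
          P.≈⟨ P.solve 6 (λ k X f g T f′ → k P.:* (X P.:* (f P.:- g)) P.:+ T P.:* (X P.:* f′) P.:= X P.:* ((k P.:* f P.:+ T P.:* f′) P.:- k P.:* g)) P.refl
               (C κ) (𝕏 P.^ (r ℕ.* P′)) f (C (g* ^ P′) *ₚ 𝕏 P.^ P′) T (deriv f) ⟩
        𝕏 P.^ (r ℕ.* P′) *ₚ ((C κ *ₚ f +ₚ T *ₚ deriv f) P.- C κ *ₚ (C (g* ^ P′) *ₚ 𝕏 P.^ P′))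
          P.≈⟨ P.*-congˡ (P.+-cong κf+Tf′ (P.-‿cong (P.*-congˡ (P.sym (g*𝕏^P 𝕏))))) ⟩
        𝕏 P.^ (r ℕ.* P′) *ₚ (C κ *ₚ G P.^ P′ P.- C κ *ₚ (C g* *ₚ 𝕏) P.^ P′)
          P.≈⟨ P.solve 4 (λ X k u v → X P.:* (k P.:* u P.:- k P.:* v) P.:= k P.:* ((u P.:- v) P.:* X)) P.refl (𝕏 P.^ (r ℕ.* P′)) (C κ) (G P.^ P′) ((C g* *ₚ 𝕏) P.^ P′) ⟩
        C κ *ₚ ((G P.^ P′ P.- (C g* *ₚ 𝕏) P.^ P′) *ₚ 𝕏 P.^ (r ℕ.* P′))
          P.≈⟨ P.*-congˡ (P.trans (P.*-congʳ (P.sym (FrobP.frobenius-sub K G (C g* *ₚ 𝕏)))) (P.sym (pow₊ (proj₂ root-G)))) ⟩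
        C κ *ₚ G₊ P.^ P₊ P.∎

      f₊∘F : a₊ P.^ P₊ +ₚ 𝕏 *ₚ b₊ P.^ P₊ ≋ comp f₊ F
      f₊∘F = P.begin
        a₊ P.^ P₊ +ₚ 𝕏 *ₚ b₊ P.^ P₊
          P.≈⟨ P.+-cong (pow₊ (proj₂ root-a)) (P.*-congˡ (pow₊ (proj₂ root-b))) ⟩
        â P.^ P′ *ₚ FrP +ₚ 𝕏 *ₚ (b P.^ P′ *ₚ FrP)
          P.≈⟨ P.+-congʳ (P.*-congʳ (P.trans (FrobP.frobenius-sub K a (C g* *ₚ F)) (P.+-congˡ (P.-‿cong (g*𝕏^P F))))) ⟩
        (a P.^ P′ P.- C (g* ^ P′) *ₚ F P.^ P′) *ₚ FrP +ₚ 𝕏 *ₚ (b P.^ P′ *ₚ FrP)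
          P.≈⟨ P.solve 5 (λ a g E X b → (a P.:- g) P.:* E P.:+ X P.:* (b P.:* E) P.:= E P.:* ((a P.:+ X P.:* b) P.:- g)) P.refl
               (a P.^ P′) (C (g* ^ P′) *ₚ F P.^ P′) FrP 𝕏 (b P.^ P′) ⟩
        FrP *ₚ ((a P.^ P′ +ₚ 𝕏 *ₚ b P.^ P′) P.- C (g* ^ P′) *ₚ F P.^ P′)
          P.≈⟨ P.*-cong (P.sym (comp-𝕏^ (r ℕ.* P′) F)) (P.+-cong f∘F (P.-‿cong (P.sym (comp-C*𝕏^ (g* ^ P′) P′ F)))) ⟩
        comp (𝕏 P.^ (r ℕ.* P′)) F *ₚ (comp f F P.- comp (C (g* ^ P′) *ₚ 𝕏 P.^ P′) F)
          P.≈⟨ P.*-congˡ (P.sym (comp-sub f (C (g* ^ P′) *ₚ 𝕏 P.^ P′) F)) ⟩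
        comp (𝕏 P.^ (r ℕ.* P′)) F *ₚ comp f̂ F
          P.≈⟨ comp-* (𝕏 P.^ (r ℕ.* P′)) f̂ F ⟨
        comp f₊ F P.∎
        where FrP = F P.^ (r ℕ.* P′)

    state₊ : State H (suc K) (w ℕ.+ r ℕ.* p ℕ.^ K)
    state₊ = record
      { f = f₊ ; G = G₊ ; a = a₊ ; b = b₊ ; ω = ω ; ω≢0 = ω≢0 ; 1≤K = s≤s z≤n ; K≤n = K<n
      ; W<P = W₊<P₊ ; f<P = f₊<P₊ ; f<s+w = f₊<s+w₊ ; f0 = f₊0 ; f′ = f₊′ ; κf+Tf′ = κf₊ ; f∘F = f₊∘F }

    coeff-f₊ : ∀ m → coeff f₊ m ≢ 0# → ∃[ m′ ] m ≡ r ℕ.* P′ ℕ.+ m′ × (coeff f m′ ≢ 0# ⊎ (g* ≢ 0# × m′ ≡ P′))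
    coeff-f₊ m ne = case (m ℕ.<? r ℕ.* P′)
      where
      case : Dec (m ℕ.< r ℕ.* P′) → ∃[ m′ ] m ≡ r ℕ.* P′ ℕ.+ m′ × (coeff f m′ ≢ 0# ⊎ (g* ≢ 0# × m′ ≡ P′))
      case (yes lt) = contradiction (coeff-𝕏^*-< (r ℕ.* P′) f̂ m lt) ne
      case (no nlt) = m′ , m≡ , split (coeff f m′ Fin.≟ 0#)
        where
        m′ = m ℕ.∸ r ℕ.* P′
        m≡ : m ≡ r ℕ.* P′ ℕ.+ m′
        m≡ = ≡.sym (ℕ.m+[n∸m]≡n (ℕ.≮⇒≥ nlt))
        val : coeff f₊ m ≡ coeff f m′ - g* ^ P′ * coeff (𝕏 P.^ P′) m′
        val = ≡.trans (≡.cong (coeff f₊) m≡) (≡.trans (coeff-𝕏^* (r ℕ.* P′) f̂ m′) (≡.trans (coeff-sub f _ m′) (≡.cong (λ x → coeff f m′ - x) (coeff-C* (g* ^ P′) (𝕏 P.^ P′) m′))))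
        split : Dec (coeff f m′ ≡ 0#) → coeff f m′ ≢ 0# ⊎ (g* ≢ 0# × m′ ≡ P′)
        split (no nz) = inj₁ nz
        split (yes z) = inj₂ (g*≢0 , m′≡P (m′ ℕ.≟ P′))
          where
          ne′ : 0# - g* ^ P′ * coeff (𝕏 P.^ P′) m′ ≢ 0#
          ne′ e = ne (≡.trans val (≡.trans (≡.cong (λ x → x - g* ^ P′ * coeff (𝕏 P.^ P′) m′) z) e))
          vanishes : g* ^ P′ * coeff (𝕏 P.^ P′) m′ ≢ 0#
          vanishes e = ne′ (≡.trans (≡.cong (λ x → 0# - x) e) (-‿inverseʳ 0#))
          g*≢0 : g* ≢ 0#
          g*≢0 e = vanishes (≡.trans (≡.cong (_* coeff (𝕏 P.^ P′) m′) (≡.trans (^-congˡ P′ e) (0^ P′ (ℕ.≤-trans (s≤s z≤n) P≥2)))) (zeroˡ _))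
          m′≡P : Dec (m′ ≡ P′) → m′ ≡ P′
          m′≡P (yes e) = e
          m′≡P (no m′≢P) = contradiction (≡.trans (≡.cong (g* ^ P′ *_) (coeff-𝕏^-≢ P′ m′ m′≢P)) (zeroʳ _)) vanishes

  -- The late phase: the equation b^v = F^t Q and the end of the descent.

  open DegreeBounds

  -- In the second case z T(z^v) = z^v A(z) with A additive.
  data Shape (T : Poly) : Set where
    binomial : ∀ t₁ c → T ≋ C t₁ *ₚ 𝕏 +ₚ C c *ₚ 𝕏 P.^ deg T → Shape T
    additive : ∀ v K i₀ e₀ → 1 ℕ.≤ v →
               (∀ j → coeff T j ≢ 0# → 1 ℕ.≤ j × ∃[ i ] suc (v ℕ.* ℕ.pred j) ≡ p ℕ.^ i) →
               suc (v ℕ.* ℕ.pred (deg T)) ≡ p ℕ.^ K →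
               1 ℕ.≤ i₀ → i₀ ℕ.< K → suc (v ℕ.* e₀) ≡ p ℕ.^ i₀ → Shape T

  deg-neg : ∀ f → deg (P.- f) ≡ deg f
  deg-neg f = case (zero? f)
    where
    case : Dec (f ≋ []) → deg (P.- f) ≡ deg f
    case (yes z) = deg-cong (P.trans (P.-‿cong z) (P.trans P.-0≈0 (P.sym z)))
    case (no nf) = deg-unique {P.- f} (λ e → lead≉0 f nf (≡.trans (≡.sym (-‿involutive _))
      (≡.trans (≡.cong -_ (≡.trans (≡.sym (coeff-neg f (deg f))) e)) -0≈0))) (<°-neg {f} (<°deg f))

  module Power {F T : Poly} {H : Hyp F T} {K w : ℕ} (St : State H K w) (v t : ℕ)
    (vW : v ℕ.* suc w ≡ suc (t ℕ.* p ℕ.^ K)) (v<P : v ℕ.< p ℕ.^ K) where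
    open StateFacts St

    1≤v : 1 ℕ.≤ v
    1≤v = go v vW
      where
      go : ∀ v → v ℕ.* suc w ≡ suc (t ℕ.* p ℕ.^ K) → 1 ℕ.≤ v
      go (suc v) _ = s≤s z≤n

    private
      k : Poly
      k = proj₁ F∣F′R

      Y : Poly
      Y = C ω P.^ v *ₚ (k P.^ v)

      -- b^P R = ω F^w (F′ R) = ω F^(w+1) k
      b^P*R : b P.^ P′ *ₚ 𝕏q-𝕏 ≋ C ω *ₚ (F P.^ suc w *ₚ k)
      b^P*R = P.begin
        b P.^ P′ *ₚ 𝕏q-𝕏                            P.≈⟨ P.*-congʳ b^P ⟩
        (C ω *ₚ (F P.^ w *ₚ deriv F)) *ₚ 𝕏q-𝕏       P.≈⟨ P.solve 4 (λ c A D R → (c P.:* (A P.:* D)) P.:* R P.:= c P.:* (A P.:* (D P.:* R))) P.refl (C ω) (F P.^ w) (deriv F) 𝕏q-𝕏 ⟩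
        C ω *ₚ (F P.^ w *ₚ (deriv F *ₚ 𝕏q-𝕏))       P.≈⟨ P.*-congˡ (P.*-congˡ (P.sym (proj₂ F∣F′R))) ⟩
        C ω *ₚ (F P.^ w *ₚ (F *ₚ k))                P.≈⟨ P.solve 4 (λ c A F k → c P.:* (A P.:* (F P.:* k)) P.:= c P.:* ((F P.:* A) P.:* k)) P.refl (C ω) (F P.^ w) F k ⟩
        C ω *ₚ (F P.^ suc w *ₚ k)                   P.∎

      -- Raise b^P (X^q - X) = ω F^(w+1) k to the power v. As v (w + 1) = t P + 1, the right side is
      -- divisible by (F^t)^P, and v < P lets `root-∣` pass to P-th roots.
      F^t∣b^v : F P.^ t D.∣ᵣ b P.^ v
      F^t∣b^v = root-∣ {F P.^ t} {b P.^ v} {𝕏q-𝕏} P′ v v<P deriv-𝕏q-𝕏 (^ₚ-≋0̸ t nF) 𝕏q-𝕏≋0̸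
        (F *ₚ Y , (P.begin
        (F P.^ t) P.^ P′ *ₚ (F *ₚ Y)
          P.≈⟨ P.*-congʳ (P.^-assocʳ F t P′) ⟩
        F P.^ (t ℕ.* P′) *ₚ (F *ₚ Y)
          P.≈⟨ P.solve 4 (λ A F c k → A P.:* (F P.:* (c P.:* k)) P.:= c P.:* ((F P.:* A) P.:* k)) P.refl (F P.^ (t ℕ.* P′)) F (C ω P.^ v) (k P.^ v) ⟩
        C ω P.^ v *ₚ (F P.^ suc (t ℕ.* P′) *ₚ k P.^ v)
          P.≡⟨ ≡.cong (λ m → C ω P.^ v *ₚ (F P.^ m *ₚ k P.^ v)) (≡.trans (≡.sym vW) (ℕ.*-comm v (suc w))) ⟩
        C ω P.^ v *ₚ (F P.^ (suc w ℕ.* v) *ₚ k P.^ v)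
          P.≈⟨ P.*-congˡ (P.*-congʳ (P.sym (P.^-assocʳ F (suc w) v))) ⟩
        C ω P.^ v *ₚ ((F P.^ suc w) P.^ v *ₚ k P.^ v)
          P.≈⟨ P.trans (P.^-distrib-* (C ω) (F P.^ suc w *ₚ k) v) (P.*-congˡ (P.^-distrib-* (F P.^ suc w) k v)) ⟨
        (C ω *ₚ (F P.^ suc w *ₚ k)) P.^ v
          P.≈⟨ P.^-congˡ v b^P*R ⟨
        (b P.^ P′ *ₚ 𝕏q-𝕏) P.^ v
          P.≈⟨ P.trans (P.^-distrib-* (b P.^ P′) 𝕏q-𝕏 v) (P.*-congʳ (P.^-swap b P′ v)) ⟩
        (b P.^ v) P.^ P′ *ₚ 𝕏q-𝕏 P.^ v P.∎))

    opaque
      Q : Poly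
      Q = proj₁ F^t∣b^v

      b^v : F P.^ t *ₚ Q ≋ b P.^ v
      b^v = proj₂ F^t∣b^v

    nQ : Q ≋0̸
    nQ z = ^ₚ-≋0̸ v nb (P.trans (P.sym b^v) (P.trans (P.*-congˡ z) (P.zeroʳ (F P.^ t))))

    degree-Q : P′ ℕ.* deg Q ℕ.+ v ℕ.* d ≡ d ℕ.+ v ℕ.* deg (deriv F)
    degree-Q = Q-degree {P′} {v} {w} {t} {d} {deg (deriv F)} {deg b} {deg Q} deg-b
      (≡.trans (≡.sym (deg-^ v nb)) (≡.trans (deg-cong (P.sym b^v)) (≡.trans (deg-* (^ₚ-≋0̸ t nF) nQ) (≡.cong (ℕ._+ deg Q) (deg-^ t nF))))) vW

    vd≤ : v ℕ.* d ℕ.≤ d ℕ.+ v ℕ.* deg (deriv F)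
    vd≤ = ≡.subst (v ℕ.* d ℕ.≤_) degree-Q (ℕ.m≤n+m (v ℕ.* d) (P′ ℕ.* deg Q))

    -- The identity v b′/b = t F′/F + Q′/Q with denominators cleared.
    log-derivative : b *ₚ (C (ι t) *ₚ (deriv F *ₚ Q) +ₚ F *ₚ deriv Q) ≋ C (ι v) *ₚ (Q *ₚ (F *ₚ deriv b))
    log-derivative = *ₚ-cancelˡ (^ₚ-≋0̸ t nF) (P.begin
      F P.^ t *ₚ (b *ₚ (C (ι t) *ₚ (deriv F *ₚ Q) +ₚ F *ₚ deriv Q))
        P.≈⟨ P.solve 7 (λ E b i F′ Q F Q′ → E P.:* (b P.:* (i P.:* (F′ P.:* Q) P.:+ F P.:* Q′)) P.:= b P.:* ((i P.:* (E P.:* F′)) P.:* Q P.:+ F P.:* (E P.:* Q′))) P.refl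
             (F P.^ t) b (C (ι t)) (deriv F) Q F (deriv Q) ⟩
      b *ₚ ((C (ι t) *ₚ (F P.^ t *ₚ deriv F)) *ₚ Q +ₚ F *ₚ (F P.^ t *ₚ deriv Q))
        P.≈⟨ P.*-congˡ (P.+-congʳ (P.*-congʳ (P.sym (f*deriv-^ F t)))) ⟩
      b *ₚ ((F *ₚ deriv (F P.^ t)) *ₚ Q +ₚ F *ₚ (F P.^ t *ₚ deriv Q))
        P.≈⟨ P.solve 6 (λ b F E′ Q E Q′ → b P.:* ((F P.:* E′) P.:* Q P.:+ F P.:* (E P.:* Q′)) P.:= F P.:* (b P.:* (E′ P.:* Q P.:+ E P.:* Q′))) P.refl
             b F (deriv (F P.^ t)) Q (F P.^ t) (deriv Q) ⟩
      F *ₚ (b *ₚ (deriv (F P.^ t) *ₚ Q +ₚ F P.^ t *ₚ deriv Q))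
        P.≈⟨ P.*-congˡ (P.*-congˡ (P.trans (P.sym (deriv-* (F P.^ t) Q)) (deriv-cong b^v))) ⟩
      F *ₚ (b *ₚ deriv (b P.^ v))
        P.≈⟨ P.*-congˡ (P.trans (f*deriv-^ b v) (P.*-congˡ (P.*-congʳ (P.sym b^v)))) ⟩
      F *ₚ (C (ι v) *ₚ ((F P.^ t *ₚ Q) *ₚ deriv b))
        P.≈⟨ P.solve 5 (λ F i E Q b′ → F P.:* (i P.:* ((E P.:* Q) P.:* b′)) P.:= E P.:* (i P.:* (Q P.:* (F P.:* b′)))) P.refl F (C (ι v)) (F P.^ t) Q (deriv b) ⟩
      F P.^ t *ₚ (C (ι v) *ₚ (Q *ₚ (F *ₚ deriv b))) P.∎)

    F*Q′ : ∀ σ → F *ₚ deriv b ≋ C (ι σ) *ₚ (deriv F *ₚ b) → F *ₚ deriv Q ≋ C (ι v * ι σ - ι t) *ₚ (deriv F *ₚ Q)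
    F*Q′ σ e = P.begin
      F *ₚ deriv Q
        P.≈⟨ P.solve 3 (λ u i U → u P.:= (i P.:* U P.:+ u) P.:- i P.:* U) P.refl (F *ₚ deriv Q) (C (ι t)) (deriv F *ₚ Q) ⟩
      (C (ι t) *ₚ (deriv F *ₚ Q) +ₚ F *ₚ deriv Q) P.- C (ι t) *ₚ (deriv F *ₚ Q)
        P.≈⟨ P.+-congʳ cancelled ⟩
      (C (ι v) *ₚ C (ι σ)) *ₚ (deriv F *ₚ Q) P.- C (ι t) *ₚ (deriv F *ₚ Q)
        P.≈⟨ P.solve 3 (λ u i U → u P.:* U P.:- i P.:* U P.:= (u P.:- i) P.:* U) P.refl (C (ι v) *ₚ C (ι σ)) (C (ι t)) (deriv F *ₚ Q) ⟩
      (C (ι v) *ₚ C (ι σ) P.- C (ι t)) *ₚ (deriv F *ₚ Q)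
        P.≈⟨ P.*-congʳ (P.trans (C-sub (ι v * ι σ) (ι t)) (P.+-congʳ (C-* (ι v) (ι σ)))) ⟨
      C (ι v * ι σ - ι t) *ₚ (deriv F *ₚ Q) P.∎
      where
      cancelled : C (ι t) *ₚ (deriv F *ₚ Q) +ₚ F *ₚ deriv Q ≋ (C (ι v) *ₚ C (ι σ)) *ₚ (deriv F *ₚ Q)
      cancelled = *ₚ-cancelˡ nb (P.trans log-derivative (P.trans (P.*-congˡ (P.*-congˡ e))
        (P.solve 5 (λ i Q s F′ b → i P.:* (Q P.:* (s P.:* (F′ P.:* b))) P.:= b P.:* ((i P.:* s) P.:* (F′ P.:* Q))) P.refl (C (ι v)) Q (C (ι σ)) (deriv F) b)))

    deg-F*Q′ : deriv Q ≋0̸ → d ℕ.≤ deg (F *ₚ deriv Q)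
    deg-F*Q′ nQ′ = ≡.subst (d ℕ.≤_) (≡.sym (deg-* nF nQ′)) (ℕ.m≤m+n d _)

    -- For c ≠ 0 also Q′ ≠ 0, and the left side has degree at least d, which F′Q does not reach.
    F*Q′-zero : ¬ (d ℕ.≤ deg (deriv F) ℕ.+ deg Q) → ∀ c → F *ₚ deriv Q ≋ C c *ₚ (deriv F *ₚ Q) → c ≡ 0#
    F*Q′-zero small c e = case (c Fin.≟ 0#)
      where
      case : Dec (c ≡ 0#) → c ≡ 0#
      case (yes z) = z
      case (no nz) = contradiction (≡.subst (d ℕ.≤_) (≡.trans (deg-cong e) (≡.trans (deg-C* nz nF′Q) (deg-* nF′ nQ))) (deg-F*Q′ nQ′)) small
        where
        nF′Q : deriv F *ₚ Q ≋0̸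
        nF′Q = *ₚ-≋0̸ nF′ nQ
        nQ′ : deriv Q ≋0̸
        nQ′ z = *ₚ-≋0̸ (C≋0̸ nz) nF′Q (P.trans (P.sym e) (P.trans (P.*-congˡ z) (P.zeroʳ F)))

  -- This is the consequence of a stop: the Wronskian has degree below deg a + deg b, but is a
  -- nonzero multiple of F′b.
  deg-F′<deg-a : {F T : Poly} {H : Hyp F T} {K w : ℕ} (St : State H K w) → ∀ c → c ≢ 0# →
                 wr (State.a St) (State.b St) ≋ C c *ₚ (deriv F *ₚ State.b St) → deg (deriv F) ℕ.< deg (State.a St)
  deg-F′<deg-a {F} St c c≢0 e = ℕ.+-cancelʳ-< (deg b) (deg (deriv F)) (deg a)
    (≡.subst (ℕ._< deg a ℕ.+ deg b) (≡.trans (deg-cong e) (≡.trans (deg-C* c≢0 nF′b) (deg-* nF′ nb)))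
      (<°⇒deg< (≋0̸-cong (P.sym e) (*ₚ-≋0̸ (C≋0̸ c≢0) nF′b)) (wr-<° a b)))
    where open StateFacts St

  -- The state of the descent once the second exponent i₀ of T has been found.
  record Late {F T : Poly} {H : Hyp F T} {K w : ℕ} (St : State H K w) : Set where
    open State St using (f; G)
    field
      v t i₀ e₀ : ℕ
      vW     : v ℕ.* suc w ≡ suc (t ℕ.* p ℕ.^ K)
      exps   : ∀ m → coeff f m ≢ 0# → ∃[ i ] i ℕ.< K × v ℕ.* m ≡ t ℕ.* p ℕ.^ K ℕ.+ p ℕ.^ i
      1≤i₀   : 1 ℕ.≤ i₀
      i₀≤K   : i₀ ℕ.≤ K
      ve₀    : suc (v ℕ.* e₀) ≡ p ℕ.^ i₀
      v<P₁   : v ℕ.< p ℕ.^ i₀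
      slope  : p ℕ.^ i₀ ℕ.* (deg F ℕ.+ v ℕ.* deg (deriv F)) ℕ.< deg F ℕ.+ p ℕ.^ i₀ ℕ.* (v ℕ.* deg F)
      late   : i₀ ℕ.< K ⊎ 2 ℕ.≤ deg G

  module LateFacts {F T : Poly} {H : Hyp F T} {K w : ℕ} {St : State H K w} (L : Late St) where
    open Late L public
    open StateFacts St public

    P₁ : ℕ
    P₁ = p ℕ.^ i₀

    P₁≤P : P₁ ℕ.≤ P′
    P₁≤P = ℕ.^-monoʳ-≤ p i₀≤K

    p≤P : p ℕ.≤ P′
    p≤P = ≡.subst (ℕ._≤ P′) (ℕ.*-identityʳ p) (ℕ.^-monoʳ-≤ p 1≤K)

    1≤p : 1 ℕ.≤ p
    1≤p = ℕ.<⇒≤ p≥2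

    1≤P : 1 ℕ.≤ P′
    1≤P = ℕ.<⇒≤ P≥2

    v<P : v ℕ.< P′
    v<P = ℕ.<-≤-trans v<P₁ P₁≤P

    open Power St v t vW v<P public

    2≤P₁ : 2 ℕ.≤ P₁
    2≤P₁ = ℕ.≤-trans p≥2 (≡.subst (ℕ._≤ P₁) (ℕ.*-identityʳ p) (ℕ.^-monoʳ-≤ p 1≤i₀))

    Q-tiny : P₁ ℕ.* (P′ ℕ.* deg Q) ℕ.< d
    Q-tiny = Q-small {P₁} {P′} {v} {d} {deg (deriv F)} {deg Q} slope degree-Q

    small : ¬ (d ℕ.≤ deg (deriv F) ℕ.+ deg Q)
    small = small-contradiction P₁ P′ v d (deg (deriv F)) (deg Q) 2≤P₁ (ℕ.<⇒≤ v<P) slope Q-tiny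

    deg-f-bound : p ℕ.* (v ℕ.* deg f) ℕ.≤ p ℕ.* (t ℕ.* P′) ℕ.+ P′
    deg-f-bound = top (exps (deg f) (lead≉0 f nf))
      where
      top : ∃[ i ] i ℕ.< K × v ℕ.* deg f ≡ t ℕ.* P′ ℕ.+ p ℕ.^ i → p ℕ.* (v ℕ.* deg f) ℕ.≤ p ℕ.* (t ℕ.* P′) ℕ.+ P′
      top (i , i<K , e) = ℕ.≤-trans (ℕ.≤-reflexive (≡.trans (≡.cong (p ℕ.*_) e) (ℕ.*-distribˡ-+ p _ _)))
        (ℕ.+-monoʳ-≤ (p ℕ.* (t ℕ.* P′)) (ℕ.^-monoʳ-≤ p i<K))

    stop⇒v≤ : deg (deriv F) ℕ.< deg a → v ℕ.≤ suc t
    stop⇒v≤ lt = stop-v≤ p P′ v d (deg (deriv F)) (deg a) (deg f) t 1≤p 1≤P 1≤v lt P*deg-a≤ deg-f-bound vd≤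

    t<v′ : t ℕ.< v
    t<v′ = t<v vW W<P

    v≡suc-t : v ℕ.≤ suc t → v ≡ suc t
    v≡suc-t le = ℕ.≤-antisym le t<v′

  module LateStep {F T : Poly} {H : Hyp F T} {K w : ℕ} {St : State H K w} (L : Late St) (K<n : K ℕ.< n)
    (concl : Concl St) (g* : Fin q)
    (choice : Choice St concl g*)
    (stop : g* ≢ 0# → Late.v L ≡ suc (Late.t L)) where

    open LateFacts L hiding (K<n)
    open Concl concl
    open Advancing St K<n concl g* choice

    private
      vσ≡t : ι v * ι σ - ι t ≡ 0#
      vσ≡t = F*Q′-zero small _ (F*Q′ σ Fb′)

      -- v σ ≡ t because F Q′ = (v σ - t) F′Q, and r ≡ -σ. The quotient is the next t, which keeps v
      -- inverse to the next w + 1.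
      p∣t+vr : p ∣ t ℕ.+ v ℕ.* r
      p∣t+vr = ι≡0⇒p∣ (t ℕ.+ v ℕ.* r) (begin
        ι (t ℕ.+ v ℕ.* r)               ≡⟨ ≡.trans (ι-homo-+ t (v ℕ.* r)) (≡.cong (ι t +_) (ι-homo-* v r)) ⟩
        ι t + ι v * ι r                 ≡⟨ solve 4 (λ t v r s → t :+ v :* r := v :* (r :+ s) :- (v :* s :- t)) ≡.refl (ι t) (ι v) (ι r) (ι σ) ⟩
        ι v * (ι r + ι σ) - (ι v * ι σ - ι t) ≡⟨ ≡.cong₂ (λ x y → ι v * x - y) r+σ vσ≡t ⟩
        ι v * 0# - 0#                   ≡⟨ ≡.trans (≡.cong (_- 0#) (zeroʳ _)) (-‿inverseʳ 0#) ⟩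
        0#                              ∎)

      t₊ : ℕ
      t₊ = _∣_.quotient p∣t+vr

      t₊≡ : t ℕ.+ v ℕ.* r ≡ t₊ ℕ.* p
      t₊≡ = _∣_.equality p∣t+vr

    late₊ : Late state₊
    late₊ = record
      { v = v ; t = t₊ ; i₀ = i₀ ; e₀ = e₀
      ; vW = next-vW {v} {w} {t} {t₊} {r} {p} {P′} vW t₊≡
      ; exps = λ m ne → exps₊ m (coeff-f₊ m ne)
      ; 1≤i₀ = 1≤i₀ ; i₀≤K = ℕ.m≤n⇒m≤1+n i₀≤K ; ve₀ = ve₀ ; v<P₁ = v<P₁ ; slope = slope ; late = inj₁ (s≤s i₀≤K) }
      where
      exps₊ : ∀ m → (∃[ m′ ] m ≡ r ℕ.* P′ ℕ.+ m′ × (coeff f m′ ≢ 0# ⊎ (g* ≢ 0# × m′ ≡ P′))) →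
              ∃[ i ] i ℕ.< suc K × v ℕ.* m ≡ t₊ ℕ.* p ℕ.^ suc K ℕ.+ p ℕ.^ i
      exps₊ m (m′ , ≡.refl , inj₁ ne) = proj₁ E , ℕ.m≤n⇒m≤1+n (proj₁ (proj₂ E)) ,
          next-exponent {v} {t} {t₊} {r} {p} {P′} {m′} t₊≡ (proj₂ (proj₂ E))
        where
        E : ∃[ i ] i ℕ.< K × v ℕ.* m′ ≡ t ℕ.* P′ ℕ.+ p ℕ.^ i
        E = exps m′ ne
      -- The new exponent P needs v P = t P + P; by `stop`, a nonzero `g*` occurs only with v = t +
      -- 1.
      exps₊ m (m′ , ≡.refl , inj₂ (ne , ≡.refl)) = K , ℕ.≤-refl ,
          next-exponent {v} {t} {t₊} {r} {p} {P′} {P′} t₊≡ (≡.trans (≡.cong (ℕ._* P′) (stop ne)) (ℕ.+-comm P′ (t ℕ.* P′)))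

  -- The coefficients of T, read off from κ f + T f′ = κ (c y)^P.
  module LinearG {F T : Poly} {H : Hyp F T} {K w : ℕ} (St : State H K w) (deg-G≡1 : deg (State.G St) ≡ 1) where
    open StateFacts St

    c : Fin q
    c = coeff G 1

    c≢0 : c ≢ 0#
    c≢0 e = lead≉0 G nG (≡.trans (≡.cong (coeff G) deg-G≡1) e)

    G≋ : G ≋ C c *ₚ 𝕏
    G≋ = mk λ { zero → ≡.trans G0 (≡.sym (≡.trans (coeff-C* c 𝕏 0) (zeroʳ c)))
              ; (suc zero) → ≡.sym (≡.trans (coeff-C* c 𝕏 1) (*-identityʳ c))
              ; (suc (suc j)) → ≡.trans (<°deg G (suc (suc j)) (≡.subst (ℕ._< suc (suc j)) (≡.sym deg-G≡1) (s≤s (s≤s z≤n))))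
                                  (≡.sym (≡.trans (coeff-C* c 𝕏 (suc (suc j))) (zeroʳ c))) }

    s+w≡P : deg T ℕ.+ w ≡ P′
    s+w≡P = ≡.trans (≡.sym deg-G) (≡.trans (≡.cong (P′ ℕ.*_) deg-G≡1) (ℕ.*-identityʳ P′))

    ωT𝕏^w : C ω *ₚ (𝕏 P.^ w *ₚ T) ≋ C κ *ₚ (C (c ^ P′) *ₚ 𝕏 P.^ P′ P.- f)
    ωT𝕏^w = P.begin
      C ω *ₚ (𝕏 P.^ w *ₚ T)
        P.≈⟨ P.solve 4 (λ o X T kf → o P.:* (X P.:* T) P.:= (kf P.:+ T P.:* (o P.:* X)) P.:- kf) P.refl (C ω) (𝕏 P.^ w) T (C κ *ₚ f) ⟩
      (C κ *ₚ f +ₚ T *ₚ (C ω *ₚ 𝕏 P.^ w)) P.- C κ *ₚ f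
        P.≈⟨ P.+-congʳ (P.trans (P.+-congˡ (P.*-congˡ (P.sym f′))) κf+Tf′) ⟩
      C κ *ₚ G P.^ P′ P.- C κ *ₚ f
        P.≈⟨ P.+-congʳ (P.*-congˡ (P.trans (P.^-congˡ P′ G≋) (P.trans (P.^-distrib-* (C c) 𝕏 P′) (P.*-congʳ (P.sym (C-^ c P′)))))) ⟩
      C κ *ₚ (C (c ^ P′) *ₚ 𝕏 P.^ P′) P.- C κ *ₚ f
        P.≈⟨ P.solve 3 (λ k u f → k P.:* u P.:- k P.:* f P.:= k P.:* (u P.:- f)) P.refl (C κ) (C (c ^ P′) *ₚ 𝕏 P.^ P′) f ⟩
      C κ *ₚ (C (c ^ P′) *ₚ 𝕏 P.^ P′ P.- f) P.∎

    coeff-T : ∀ j → ω * coeff T j ≡ κ * (c ^ P′ * coeff (𝕏 P.^ P′) (w ℕ.+ j) - coeff f (w ℕ.+ j))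
    coeff-T j = begin
      ω * coeff T j                                      ≡⟨ ≡.cong (ω *_) (coeff-𝕏^* w T j) ⟨
      ω * coeff (𝕏 P.^ w *ₚ T) (w ℕ.+ j)                 ≡⟨ coeff-C* ω (𝕏 P.^ w *ₚ T) (w ℕ.+ j) ⟨
      coeff (C ω *ₚ (𝕏 P.^ w *ₚ T)) (w ℕ.+ j)            ≡⟨ at ωT𝕏^w (w ℕ.+ j) ⟩
      _                                                  ≡⟨ coeff-C* κ (C (c ^ P′) *ₚ 𝕏 P.^ P′ P.- f) (w ℕ.+ j) ⟩
      κ * coeff (C (c ^ P′) *ₚ 𝕏 P.^ P′ P.- f) (w ℕ.+ j) ≡⟨ ≡.cong (κ *_) (≡.trans (coeff-sub (C (c ^ P′) *ₚ 𝕏 P.^ P′) f (w ℕ.+ j)) (≡.cong (λ x → x - coeff f (w ℕ.+ j)) (coeff-C* (c ^ P′) (𝕏 P.^ P′) (w ℕ.+ j)))) ⟩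
      κ * (c ^ P′ * coeff (𝕏 P.^ P′) (w ℕ.+ j) - coeff f (w ℕ.+ j)) ∎

    support : ∀ j → coeff T j ≢ 0# → w ℕ.+ j ≡ P′ ⊎ coeff f (w ℕ.+ j) ≢ 0#
    support j ne = case (coeff f (w ℕ.+ j) Fin.≟ 0#) (w ℕ.+ j ℕ.≟ P′)
      where
      case : Dec (coeff f (w ℕ.+ j) ≡ 0#) → Dec (w ℕ.+ j ≡ P′) → w ℕ.+ j ≡ P′ ⊎ coeff f (w ℕ.+ j) ≢ 0#
      case _        (yes e) = inj₁ e
      case (no nz)  _       = inj₂ nz
      case (yes z)  (no ne′) = contradiction (*-cancel-0 ω≢0 (≡.trans (coeff-T j) (≡.trans (≡.cong (κ *_)
        (≡.trans (≡.cong₂ (λ x y → c ^ P′ * x - y) (coeff-𝕏^-≢ P′ (w ℕ.+ j) ne′) z) (≡.trans (≡.cong (_- 0#) (zeroʳ _)) (-‿inverseʳ 0#)))) (zeroʳ κ)))) ne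

  module LateEnd {F T : Poly} {H : Hyp F T} {K w : ℕ} {St : State H K w} (L : Late St)
    (deg-G≡1 : deg (State.G St) ≡ 1) where
    open LateFacts L
    open LinearG St deg-G≡1

    -- For v = t + 1 the exponent P of G^P obeys the same rule v m = t P + p^i as the exponents of
    -- f, with i = K. So `exponent` applies to everything that occurs in y^w T.
    finish : v ≡ suc t → Shape T
    finish v≡ = additive v K i₀ e₀ 1≤v (λ j ne → exponents j ne (support j ne)) top 1≤i₀ i₀<K ve₀
      where
      -- By `late`, i₀ = K is possible only while deg G ≥ 2, as at the first stop; here G is linear.
      i₀<K : i₀ ℕ.< K
      i₀<K = case late
        where
        case : i₀ ℕ.< K ⊎ 2 ℕ.≤ deg G → i₀ ℕ.< K
        case (inj₁ lt) = lt
        case (inj₂ le) = contradiction (≡.subst (2 ℕ.≤_) deg-G≡1 le) λ { (s≤s ()) }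
      vP≡ : v ℕ.* P′ ≡ t ℕ.* P′ ℕ.+ P′
      vP≡ = ≡.trans (≡.cong (ℕ._* P′) v≡) (ℕ.+-comm P′ (t ℕ.* P′))
      exponents : ∀ j → coeff T j ≢ 0# → w ℕ.+ j ≡ P′ ⊎ coeff f (w ℕ.+ j) ≢ 0# → 1 ℕ.≤ j × ∃[ i ] suc (v ℕ.* ℕ.pred j) ≡ p ℕ.^ i
      exponents zero    ne _        = contradiction T0 ne
      exponents (suc j) ne (inj₁ e) = s≤s z≤n , K , exponent {v} {w} {t} {P′} {j} vW (≡.trans (≡.cong (v ℕ.*_) e) vP≡)
      exponents (suc j) ne (inj₂ nf) = s≤s z≤n , proj₁ E , exponent {v} {w} {t} {P′} {j} vW (proj₂ (proj₂ E))
        where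
        E : ∃[ i ] i ℕ.< K × v ℕ.* (w ℕ.+ suc j) ≡ t ℕ.* P′ ℕ.+ p ℕ.^ i
        E = exps (w ℕ.+ suc j) nf
      top : suc (v ℕ.* ℕ.pred (deg T)) ≡ P′
      top = exponent {v} {w} {t} {P′} {ℕ.pred (deg T)} vW (≡.trans (≡.cong (v ℕ.*_)
        (≡.trans (≡.cong (w ℕ.+_) (ℕ.suc-pred (deg T) {{ℕ.>-nonZero (ℕ.≤-trans (s≤s z≤n) 3≤s)}})) (≡.trans (ℕ.+-comm w (deg T)) s+w≡P))) vP≡)

    -- At K = n the bound (s - 1) d < q forces v ≤ t + 1, so while v ≥ t + 2 there is a further
    -- level.
    K<n-or-done : v ≡ suc t ⊎ (suc (suc t) ℕ.≤ v × K ℕ.< n)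
    K<n-or-done = case (v ℕ.≤? suc t)
      where
      case : Dec (v ℕ.≤ suc t) → v ≡ suc t ⊎ (suc (suc t) ℕ.≤ v × K ℕ.< n)
      case (yes le) = inj₁ (v≡suc-t le)
      case (no nle) = inj₂ (ℕ.≰⇒> nle , ℕ.≤∧≢⇒< K≤n K≢n)
        where
        K≢n : K ≢ n
        K≢n e = nle (last-level {v} {w} {t} {deg T} {d} {q} (ℕ.<⇒≤ q≥2) (≡.trans vW (≡.cong (λ k → suc (t ℕ.* p ℕ.^ k)) e))
          (≡.trans s+w≡P (≡.cong (p ℕ.^_) e)) (ℕ.≤-trans (s≤s z≤n) 3≤s) bound (v≤d {v} {d} {deg (deriv F)} vd≤ d′<d))

    -- One more digit of 1/v has to be computed.
    continue : suc (suc t) ℕ.≤ v → K ℕ.< n → Concl St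
    continue t+2≤v K<n = record
      { σ = 1 ; Fb′ = Fb′ ; wr≋ = P.trans wr≋0 (P.sym (C-zero* _ (≡.trans (≡.cong (_* coeff G 1) (-‿inverseʳ (ι 1))) (zeroˡ _))))
      ; gj = λ j 2≤j → ≡.trans (≡.cong ((ι j - ι 1) *_) (<°deg G j (≡.subst (ℕ._< j) (≡.sym deg-G≡1) 2≤j))) (zeroʳ _) }
      where
      X′ : deriv X_K ≋ []
      X′ = deriv-X_K K<n
      a′+Xb′ : deriv a +ₚ X_K *ₚ deriv b ≋ C c *ₚ deriv F
      a′+Xb′ = P.begin
        deriv a +ₚ X_K *ₚ deriv b                         P.≈⟨ P.+-congˡ (P.trans (P.+-congʳ (P.trans (P.*-congʳ X′) (P.zeroˡ b))) (P.+-identityˡ _)) ⟨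
        deriv a +ₚ (deriv X_K *ₚ b +ₚ X_K *ₚ deriv b)     P.≈⟨ P.trans (deriv-+ a (X_K *ₚ b)) (P.+-congˡ (deriv-* X_K b)) ⟨
        deriv (a +ₚ X_K *ₚ b)                             P.≈⟨ deriv-cong a+Xb ⟩
        deriv (C c *ₚ F)                                  P.≈⟨ deriv-C* c F ⟩
        C c *ₚ deriv F                                    P.∎
        where
        a+Xb : a +ₚ X_K *ₚ b ≋ C c *ₚ F
        a+Xb = P.trans relation-ab (P.trans (comp-cong F G≋) (P.trans (comp-C* c 𝕏 F) (P.*-congˡ (comp-𝕏 F))))
      a+Xb : a +ₚ X_K *ₚ b ≋ C c *ₚ F
      a+Xb = P.trans relation-ab (P.trans (comp-cong F G≋) (P.trans (comp-C* c 𝕏 F) (P.*-congˡ (comp-𝕏 F))))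
      wr-c : wr a b ≋ C c *ₚ (deriv F *ₚ b P.- F *ₚ deriv b)
      wr-c = P.begin
        deriv a *ₚ b P.- a *ₚ deriv b
          P.≈⟨ P.solve 5 (λ a a′ X b b′ → a′ P.:* b P.:- a P.:* b′ P.:= (a′ P.:+ X P.:* b′) P.:* b P.:- (a P.:+ X P.:* b) P.:* b′) P.refl a (deriv a) X_K b (deriv b) ⟩
        (deriv a +ₚ X_K *ₚ deriv b) *ₚ b P.- (a +ₚ X_K *ₚ b) *ₚ deriv b
          P.≈⟨ P.+-cong (P.*-congʳ a′+Xb′) (P.-‿cong (P.*-congʳ a+Xb)) ⟩
        (C c *ₚ deriv F) *ₚ b P.- (C c *ₚ F) *ₚ deriv b
          P.≈⟨ P.solve 5 (λ c F′ b F b′ → (c P.:* F′) P.:* b P.:- (c P.:* F) P.:* b′ P.:= c P.:* (F′ P.:* b P.:- F P.:* b′)) P.refl (C c) (deriv F) b F (deriv b) ⟩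
        C c *ₚ (deriv F *ₚ b P.- F *ₚ deriv b) P.∎
      U : Poly
      U = deriv F *ₚ Q
      nU : U ≋0̸
      nU = *ₚ-≋0̸ nF′ nQ
      -- v Q (a′b − ab′) = c b ((v − t) F′Q − F Q′)
      vQwr : C (ι v) *ₚ (Q *ₚ wr a b) ≋ C c *ₚ (b *ₚ (C (ι v - ι t) *ₚ U P.- F *ₚ deriv Q))
      vQwr = P.begin
        C (ι v) *ₚ (Q *ₚ wr a b)
          P.≈⟨ P.*-congˡ (P.*-congˡ wr-c) ⟩
        C (ι v) *ₚ (Q *ₚ (C c *ₚ (deriv F *ₚ b P.- F *ₚ deriv b)))
          P.≈⟨ P.solve 6 (λ i Q c F′ b u → i P.:* (Q P.:* (c P.:* (F′ P.:* b P.:- u))) P.:= c P.:* (b P.:* (i P.:* (F′ P.:* Q)) P.:- i P.:* (Q P.:* u))) P.refl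
               (C (ι v)) Q (C c) (deriv F) b (F *ₚ deriv b) ⟩
        C c *ₚ (b *ₚ (C (ι v) *ₚ U) P.- C (ι v) *ₚ (Q *ₚ (F *ₚ deriv b)))
          P.≈⟨ P.*-congˡ (P.+-congˡ (P.-‿cong (P.sym log-derivative))) ⟩
        C c *ₚ (b *ₚ (C (ι v) *ₚ U) P.- b *ₚ (C (ι t) *ₚ U +ₚ F *ₚ deriv Q))
          P.≈⟨ P.*-congˡ (P.solve 5 (λ b i j U u → b P.:* (i P.:* U) P.:- b P.:* (j P.:* U P.:+ u) P.:= b P.:* ((i P.:- j) P.:* U P.:- u)) P.refl b (C (ι v)) (C (ι t)) U (F *ₚ deriv Q)) ⟩
        C c *ₚ (b *ₚ ((C (ι v) P.- C (ι t)) *ₚ U P.- F *ₚ deriv Q))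
          P.≈⟨ P.*-congˡ (P.*-congˡ (P.+-congʳ (P.*-congʳ (P.sym (C-sub (ι v) (ι t)))))) ⟩
        C c *ₚ (b *ₚ (C (ι v - ι t) *ₚ U P.- F *ₚ deriv Q)) P.∎
      Y : Poly
      Y = C (ι v - ι t) *ₚ U P.- F *ₚ deriv Q
      -- v Q times the Wronskian equals c b Y, and the Wronskian has degree below deg a + deg b.
      deg-Y< : Y ≋0̸ → deg Y ℕ.< deg Q ℕ.+ deg a
      deg-Y< nY = ℕ.+-cancelˡ-< (deg b) (deg Y) (deg Q ℕ.+ deg a) (≡.subst₂ ℕ._<_ deg-left eqn (ℕ.+-monoʳ-< (deg Q) (<°⇒deg< nwr (wr-<° a b))))
        where
        nright : C c *ₚ (b *ₚ Y) ≋0̸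
        nright = *ₚ-≋0̸ (C≋0̸ c≢0) (*ₚ-≋0̸ nb nY)
        ιv≢0 : ι v ≢ 0#
        ιv≢0 e = nright (P.trans (P.sym vQwr) (C-zero* _ e))
        nwr : wr a b ≋0̸
        nwr z = nright (P.trans (P.sym vQwr) (P.trans (P.*-congˡ (P.trans (P.*-congˡ z) (P.zeroʳ Q))) (P.zeroʳ (C (ι v)))))
        deg-left : deg Q ℕ.+ deg (wr a b) ≡ deg b ℕ.+ deg Y
        deg-left = ≡.trans (≡.sym (≡.trans (deg-C* ιv≢0 (*ₚ-≋0̸ nQ nwr)) (deg-* nQ nwr)))
          (≡.trans (deg-cong vQwr) (≡.trans (deg-C* c≢0 (*ₚ-≋0̸ nb nY)) (deg-* nb nY)))
        eqn : deg Q ℕ.+ (deg a ℕ.+ deg b) ≡ deg b ℕ.+ (deg Q ℕ.+ deg a)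
        eqn = ≡.trans (≡.sym (ℕ.+-assoc (deg Q) (deg a) (deg b))) (ℕ.+-comm (deg Q ℕ.+ deg a) (deg b))
      -- Otherwise F Q′, of degree at least d, dominates `Y`, because deg F′Q < d. This gives d <
      -- deg Q + deg a, which `large-contradiction` excludes.
      Q′≋0 : deriv Q ≋ []
      Q′≋0 = case (zero? (deriv Q))
        where
        case : Dec (deriv Q ≋ []) → deriv Q ≋ []
        case (yes z) = z
        case (no nQ′) = contradiction (ℕ.≤-<-trans (≡.subst (d ℕ.≤_) (≡.sym (≡.trans (proj₂ dom) (deg-neg (F *ₚ deriv Q)))) (deg-F*Q′ nQ′)) (deg-Y< (proj₁ dom)))
            (large-contradiction p P′ P₁ v d (deg a) (deg Q) (deg f) t 1≤p 1≤P p≤P (ℕ.<⇒≤ v<P₁) P*deg-a≤ deg-f-bound t+2≤v Q-tiny)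
          where
          nFQ′ : F *ₚ deriv Q ≋0̸
          nFQ′ = *ₚ-≋0̸ nF nQ′
          n-FQ′ : P.- (F *ₚ deriv Q) ≋0̸
          n-FQ′ z = nFQ′ (P.trans (P.sym (P.-‿involutive _)) (P.trans (P.-‿cong z) P.-0≈0))
          U<d : U <° d
          U<d = deg<⇒<° {U} (≡.subst (ℕ._< d) (≡.sym (deg-* nF′ nQ)) (ℕ.≰⇒> small))
          dom : (Y ≋0̸) × deg Y ≡ deg (P.- (F *ₚ deriv Q))
          dom = +-dominant {C (ι v - ι t) *ₚ U} {P.- (F *ₚ deriv Q)}
            (<°-mono (C (ι v - ι t) *ₚ U) (≡.subst (d ℕ.≤_) (≡.sym (deg-neg (F *ₚ deriv Q))) (deg-F*Q′ nQ′)) (<°-C* {U} (ι v - ι t) U<d)) n-FQ′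
      Y≋ : Y ≋ C (ι v - ι t) *ₚ U
      Y≋ = P.trans (P.+-congˡ (P.trans (P.-‿cong (P.trans (P.*-congˡ Q′≋0) (P.zeroʳ F))) P.-0≈0)) (P.+-identityʳ _)
      -- Otherwise `Y` is a nonzero multiple of F′Q, and the bound on its degree says deg F′ < deg
      -- a; but this would give v ≤ t + 1, as at a stop.
      v≡t : ι v - ι t ≡ 0#
      v≡t = case (ι v - ι t Fin.≟ 0#)
        where
        case : Dec (ι v - ι t ≡ 0#) → ι v - ι t ≡ 0#
        case (yes z) = z
        case (no nz) = contradiction (stop⇒v≤ (ℕ.+-cancelˡ-< (deg Q) (deg (deriv F)) (deg a)
            (≡.subst (ℕ._< deg Q ℕ.+ deg a) (≡.trans (deg-cong Y≋) (≡.trans (deg-C* nz nU) (≡.trans (deg-* nF′ nQ) (ℕ.+-comm (deg (deriv F)) (deg Q))))) (deg-Y< nY))))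
            (ℕ.<⇒≱ t+2≤v)
          where
          nY : Y ≋0̸
          nY = ≋0̸-cong (P.sym Y≋) (*ₚ-≋0̸ (C≋0̸ nz) nU)
      ιv≢0 : ι v ≢ 0#
      ιv≢0 e = 1≢0 (begin
        1#                                   ≡⟨ +-identityʳ 1# ⟨
        1# + 0#                              ≡⟨ ≡.cong (1# +_) (Frob.ι-∣ p∣tP) ⟨
        ι (suc (t ℕ.* P′))                   ≡⟨ ≡.cong ι vW ⟨
        ι (v ℕ.* suc w)                      ≡⟨ ≡.trans (ι-homo-* v (suc w)) (≡.trans (≡.cong (_* ι (suc w)) e) (zeroˡ _)) ⟩
        0#                                   ∎)
        where
        open import Data.Nat.Divisibility using (∣n⇒∣m*n; m∣m*n)
        p∣tP : p ∣ t ℕ.* P′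
        p∣tP = ∣n⇒∣m*n t (≡.subst (λ k → p ∣ p ℕ.^ k) (ℕ.suc-pred K {{ℕ.>-nonZero 1≤K}}) (m∣m*n (p ℕ.^ ℕ.pred K)))
      Fb′₀ : F *ₚ deriv b ≋ deriv F *ₚ b
      Fb′₀ = *ₚ-cancelˡ (*ₚ-≋0̸ (C≋0̸ ιv≢0) nQ) (P.begin
        (C (ι v) *ₚ Q) *ₚ (F *ₚ deriv b)           P.≈⟨ P.trans (P.*-assoc _ _ _) (P.sym log-derivative) ⟩
        b *ₚ (C (ι t) *ₚ U +ₚ F *ₚ deriv Q)        P.≈⟨ P.*-congˡ (P.trans (P.+-congˡ (P.trans (P.*-congˡ Q′≋0) (P.zeroʳ F))) (P.+-identityʳ _)) ⟩
        b *ₚ (C (ι t) *ₚ U)                        P.≈⟨ P.*-congˡ (P.*-congʳ (C-cong (≡.sym (x-y≈0⇒x≈y v≡t)))) ⟩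
        b *ₚ (C (ι v) *ₚ (deriv F *ₚ Q))           P.≈⟨ P.solve 4 (λ b i F′ Q → b P.:* (i P.:* (F′ P.:* Q)) P.:= (i P.:* Q) P.:* (F′ P.:* b)) P.refl b (C (ι v)) (deriv F) Q ⟩
        (C (ι v) *ₚ Q) *ₚ (deriv F *ₚ b)           P.∎)
      Fb′ : F *ₚ deriv b ≋ C (ι 1) *ₚ (deriv F *ₚ b)
      Fb′ = P.trans Fb′₀ (P.sym (P.trans (P.*-congʳ (C-cong ι1≈1)) (P.*-identityˡ _)))
      wr≋0 : wr a b ≋ []
      wr≋0 = P.trans wr-c (P.trans (P.*-congˡ (P.x≈y⇒x-y≈0 (P.sym Fb′₀))) (P.zeroʳ (C c)))

  -- The loops of the descent.

  open import Data.Nat.Divisibility using (_∣_; divides; m∣m*n)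
  open import Data.Nat.DivMod using (m≡m%n+[m/n]*n; m%n<n; %-distribˡ-*; m%n%n≡m%n; [m+kn]%n≡m%n; m<n⇒m%n≡m) renaming (_%_ to infixl 7 _%_; _/_ to infixl 7 _/_)
  open import Data.Nat.Primality using (prime⇒irreducible)

  P<s+w : {F T : Poly} {H : Hyp F T} {K w : ℕ} (St : State H K w) → 2 ℕ.≤ deg (State.G St) → p ℕ.^ K ℕ.< deg T ℕ.+ w
  P<s+w St 2≤ = ≡.subst (P′ ℕ.<_) deg-G (ℕ.<-≤-trans (ℕ.m<m+n P′ (ℕ.<⇒≤ P≥2))
    (ℕ.≤-trans (ℕ.≤-reflexive (≡.sym (≡.trans (ℕ.*-suc P′ 1) (≡.cong (P′ ℕ.+_) (ℕ.*-identityʳ P′))))) (ℕ.*-monoʳ-≤ P′ 2≤)))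
    where open StateFacts St

  σ≢1 : ∀ σ {g} → (ι 1 - ι σ) * g ≢ 0# → ι σ ≢ ι 1
  σ≢1 σ {g} ne e = ne (≡.trans (≡.cong (_* g) (≡.trans (≡.cong (λ x → ι 1 - x) e) (-‿inverseʳ (ι 1)))) (zeroˡ g))

  deg-F+C : ∀ F lam → 1 ℕ.≤ deg F → deg (F +ₚ C lam) ≡ deg F
  deg-F+C F lam 1≤d = ≡.trans (deg-cong (P.+-comm F (C lam)))
    (proj₂ (+-dominant {C lam} {F} (<°-mono (C lam) 1≤d (<°-C lam)) (deg≥1⇒≋0̸ 1≤d)))

  -- For w = 0 one has v = t P + 1 < P, hence t = 0, v = 1 and Q = b. An exceptional translate of F
  -- would divide F′b = F′Q, whose degree is below d.
  late-concl : {F T : Poly} {H : Hyp F T} {K w : ℕ} {St : State H K w} → Late St → 2 ℕ.≤ deg (State.G St) → Concl St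
  late-concl {w = suc w} {St} L 2≤ = Analysis.divisible St 2≤ (StateFacts.F∣F′b St (s≤s z≤n))
  late-concl {F} {w = zero} {St} L 2≤ = case (Analysis₀.analysis St 2≤ bound₀)
    where
    open LateFacts L
    v≡ : v ≡ suc (t ℕ.* P′)
    v≡ = ≡.trans (≡.sym (ℕ.*-identityʳ v)) vW
    t≡0 : t ≡ 0
    t≡0 = ℕ.n<1⇒n≡0 (ℕ.*-cancelʳ-< P′ t 1 (ℕ.<-trans (≡.subst (t ℕ.* P′ ℕ.<_) (≡.sym v≡) (ℕ.n<1+n _)) (≡.subst (v ℕ.<_) (≡.sym (ℕ.*-identityˡ P′)) v<P)))
    v≡1 : v ≡ 1
    v≡1 = ≡.trans v≡ (≡.cong (λ t → suc (t ℕ.* P′)) t≡0)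
    bound₀ : p ℕ.* deg f ℕ.≤ P′
    bound₀ = ≡.subst₂ ℕ._≤_ (≡.cong (p ℕ.*_) (≡.trans (≡.cong (ℕ._* deg f) v≡1) (ℕ.*-identityˡ (deg f))))
      (≡.trans (≡.cong (λ t → p ℕ.* (t ℕ.* P′) ℕ.+ P′) t≡0) (≡.cong (ℕ._+ P′) (ℕ.*-zeroʳ p))) deg-f-bound
    deg-Q≡ : deg Q ≡ deg b
    deg-Q≡ = deg-cong (P.trans (P.sym (P.*-identityˡ Q)) (P.trans (P.trans (P.*-congʳ (P.reflexive (≡.cong (F P.^_) (≡.sym t≡0)))) b^v)
      (P.trans (P.reflexive (≡.cong (b P.^_) v≡1)) (P.*-identityʳ b))))
    case : Concl St ⊎ Exceptional St → Concl St
    case (inj₁ c) = c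
    case (inj₂ e) = contradiction (≡.subst (d ℕ.≤_) (≡.trans (≡.sym (deg-* nC₁ nF+)) (≡.trans (deg-cong (P.sym F′b)) (≡.trans (deg-* nF′ nb) (≡.cong (deg (deriv F) ℕ.+_) (≡.sym deg-Q≡)))))
        (≡.subst (ℕ._≤ deg C₁ ℕ.+ deg (F +ₚ C lam)) (deg-F+C F lam 1≤d) (ℕ.m≤n+m _ (deg C₁)))) small
      where
      open Exceptional e
      nC₁ : C₁ ≋0̸
      nC₁ z = nF′b (P.trans F′b (P.trans (P.*-congʳ z) (P.zeroˡ _)))
      nF+ : F +ₚ C lam ≋0̸
      nF+ = deg≥1⇒≋0̸ (≡.subst (1 ℕ.≤_) (≡.sym (deg-F+C F lam 1≤d)) 1≤d)

  -- The fuel bounds the number n - K of remaining levels; every continuation comes with K < n, so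
  -- it cannot run out.
  late-loop : ∀ fuel {F T : Poly} {H : Hyp F T} {K w : ℕ} {St : State H K w} → Late St → n ℕ.≤ K ℕ.+ fuel → Shape T
  late-loop fuel {F} {T} {H} {K} {w} {St} L enough = by-degree (2 ℕ.≤? deg G)
    where
    open LateFacts L using (G; a; b; deg-G≥1; stop⇒v≤; v≡suc-t; K<n)
    next : ∀ fuel → n ℕ.≤ K ℕ.+ fuel → K ℕ.< n → (c : Concl St) (g* : Fin q) (choice : Choice St c g*) (stop : g* ≢ 0# → Late.v L ≡ suc (Late.t L)) → Shape T
    next zero    enough lt c g* choice stop = contradiction (≡.subst (n ℕ.≤_) (ℕ.+-identityʳ K) enough) (ℕ.<⇒≱ lt)
    next (suc fuel) enough lt c g* choice stop = late-loop fuel (LateStep.late₊ L lt c g* choice stop) (≡.subst (n ℕ.≤_) (ℕ.+-suc K fuel) enough)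
    large : 2 ℕ.≤ deg G → Shape T
    large 2≤ = decide ((ι 1 - ι σ) * coeff G 1 Fin.≟ 0#)
      where
      c : Concl St
      c = late-concl L 2≤
      open Concl c
      decide : Dec ((ι 1 - ι σ) * coeff G 1 ≡ 0#) → Shape T
      decide (yes e) = next fuel enough (K<n 2≤) c 0# (inj₁ (≡.refl , e)) (λ ne → contradiction ≡.refl ne)
      decide (no ne) = next fuel enough (K<n 2≤) c (coeff G 1) (inj₂ (≡.refl , σ≢1 σ ne , P<s+w St 2≤))
        (λ _ → v≡suc-t (stop⇒v≤ (deg-F′<deg-a St _ ne wr≋)))
    small′ : deg G ≡ 1 → Shape T
    small′ e = decide (LateEnd.K<n-or-done L e)
      where
      decide : Late.v L ≡ suc (Late.t L) ⊎ (suc (suc (Late.t L)) ℕ.≤ Late.v L × K ℕ.< n) → Shape T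
      decide (inj₁ v≡) = LateEnd.finish L e v≡
      decide (inj₂ (lt , K<n)) = next fuel enough K<n (LateEnd.continue L e lt K<n) 0#
        (inj₁ (≡.refl , ≡.trans (≡.cong (_* coeff G 1) (-‿inverseʳ (ι 1))) (zeroˡ _))) (λ ne → contradiction ≡.refl ne)
    by-degree : Dec (2 ℕ.≤ deg G) → Shape T
    by-degree (yes 2≤) = large 2≤
    by-degree (no n2≤) = small′ (ℕ.≤-antisym (ℕ.≤-pred (ℕ.≰⇒> n2≤)) deg-G≥1)

  -- Before the second exponent is found, f is a power of y.
  Early : {F T : Poly} {H : Hyp F T} {K w : ℕ} → State H K w → Set
  Early {w = w} St = State.f St ≋ 𝕏 P.^ suc w

  inverse-mod : ∀ m P .{{_ : ℕ.NonZero P}} → 2 ℕ.≤ P → Coprimality.Coprime m P → ∃[ v ] ∃[ t ] v ℕ.* m ≡ suc (t ℕ.* P) × v ℕ.< P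
  inverse-mod m P 2≤P c = reduce (some (Coprimality.coprime-Bézout c))
    where
    some : Bézout.Identity 1 m P → ∃[ v ] ∃[ t ] v ℕ.* m ≡ suc (t ℕ.* P)
    some (Bézout.+- x y e) = x , y , ≡.sym e
    some (Bézout.-+ x zero ())
    -- Here x m ≡ -1 modulo P; multiplication by P - 1 changes the sign.
    some (Bézout.-+ x (suc y) e) = ℕ.pred P ℕ.* x , ℕ.pred P ℕ.* suc y ℕ.∸ 1 , ℕ.+-cancelʳ-≡ (ℕ.pred P) _ _ eq
      where
      r = ℕ.pred P
      P≡ : P ≡ suc r
      P≡ = ≡.sym (ℕ.suc-pred P)
      1≤ : 1 ℕ.≤ r ℕ.* suc y
      1≤ = ℕ.*-mono-≤ (ℕ.≤-pred (≡.subst (2 ℕ.≤_) P≡ 2≤P)) (s≤s z≤n)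
      eq : r ℕ.* x ℕ.* m ℕ.+ r ≡ suc ((r ℕ.* suc y ℕ.∸ 1) ℕ.* P) ℕ.+ r
      eq = ≡.trans (lem r x m) (≡.trans (≡.cong (r ℕ.*_) e) (≡.trans (≡.sym (ℕ.*-assoc r (suc y) P))
        (≡.trans (≡.cong (ℕ._* P) (≡.sym (ℕ.m∸n+n≡m 1≤))) (≡.trans (lem′ (r ℕ.* suc y ℕ.∸ 1) P)
          (≡.trans (≡.cong ((r ℕ.* suc y ℕ.∸ 1) ℕ.* P ℕ.+_) P≡) (ℕ.+-suc _ r))))))
        where
        open import Data.Nat.Tactic.RingSolver using (solve-∀)
        lem : ∀ r x m → r ℕ.* x ℕ.* m ℕ.+ r ≡ r ℕ.* (1 ℕ.+ x ℕ.* m)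
        lem = solve-∀
        lem′ : ∀ u P → (u ℕ.+ 1) ℕ.* P ≡ u ℕ.* P ℕ.+ P
        lem′ = solve-∀
    reduce : ∃[ v ] ∃[ t ] v ℕ.* m ≡ suc (t ℕ.* P) → ∃[ v ] ∃[ t ] v ℕ.* m ≡ suc (t ℕ.* P) × v ℕ.< P
    reduce (v , t , e) = v % P , (v % P ℕ.* m) / P , ≡.trans (m≡m%n+[m/n]*n (v % P ℕ.* m) P) (≡.cong (ℕ._+ (v % P ℕ.* m) / P ℕ.* P) rem≡1) , m%n<n v P
      where
      rem≡1 : (v % P ℕ.* m) % P ≡ 1
      rem≡1 = ≡.trans (%-distribˡ-* (v % P) m P) (≡.trans (≡.cong (λ x → (x ℕ.* (m % P)) % P) (m%n%n≡m%n v P))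
        (≡.trans (≡.sym (%-distribˡ-* v m P)) (≡.trans (≡.cong (_% P) e) (≡.trans ([m+kn]%n≡m%n 1 t P) (m<n⇒m%n≡m 2≤P)))))

  coprime-p^ : ∀ {m} K → ¬ (p ∣ m) → Coprimality.Coprime m (p ℕ.^ K)
  coprime-p^ {m} K p∤m (d∣m , d∣P) = go K d∣m d∣P
    where
    open import Data.Nat.Divisibility using (∣-trans; ∣1⇒≡1)
    go : ∀ K {d} → d ∣ m → d ∣ p ℕ.^ K → d ≡ 1
    go zero    d∣m d∣1 = ∣1⇒≡1 d∣1
    go (suc K) {d} d∣m d∣P = go K d∣m (Coprimality.coprime-divisor {d} {p} coprime d∣P)
      where
      coprime : Coprimality.Coprime d p
      coprime (e∣d , e∣p) = split (prime⇒irreducible pr e∣p)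
        where
        split : _ ⊎ _ → _ ≡ 1
        split (inj₁ e≡1)    = e≡1
        split (inj₂ ≡.refl) = contradiction (∣-trans e∣d d∣m) p∤m

  -- At the first stop deg F′ < deg a, while f is still y^(w+1). Together these force v = t + 1 and
  -- yield `slope` with i₀ = K. The only exponent of f so far satisfies v (w + 1) = t P + p^0.
  first-stop : {F T : Poly} {H : Hyp F T} {K w : ℕ} (St : State H K w) → Early St → (c : Concl St) →
               (ι 1 - ι (Concl.σ c)) * coeff (State.G St) 1 ≢ 0# → 2 ℕ.≤ deg (State.G St) → Late St
  first-stop {F} {T} {H} {K} {w} St E c ne 2≤ = record
    { v = v ; t = t ; i₀ = K ; e₀ = P′ ℕ.∸ suc w ; vW = vW ; exps = exps ; 1≤i₀ = 1≤K ; i₀≤K = ℕ.≤-refl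
    ; ve₀ = ve₀ ; v<P₁ = v<P ; slope = first-bound P′ v d (deg (deriv F)) (deg a) (suc w) t (ℕ.<⇒≤ P≥2) lt
        (≡.subst (λ m → P′ ℕ.* deg a ℕ.≤ m ℕ.* d) deg-f≡ P*deg-a≤) vW v≡ ; late = inj₂ 2≤ }
    where
    open StateFacts St
    deg-f≡ : deg f ≡ suc w
    deg-f≡ = ≡.trans (deg-cong E) (deg-𝕏^ (suc w))
    p∤W : ¬ (p ∣ suc w)
    p∤W d = ω≢0 (begin
      ω                                        ≡⟨ *-identityʳ ω ⟨
      ω * 1#                                   ≡⟨ ≡.cong (ω *_) (coeff-𝕏^ w) ⟨
      ω * coeff (𝕏 P.^ w) w                    ≡⟨ coeff-C* ω (𝕏 P.^ w) w ⟨
      coeff (C ω *ₚ 𝕏 P.^ w) w                 ≡⟨ at f′ w ⟨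
      coeff (deriv f) w                        ≡⟨ coeff-deriv f w ⟩
      ι (suc w) * coeff f (suc w)              ≡⟨ ≡.trans (≡.cong (_* coeff f (suc w)) (Frob.ι-∣ d)) (zeroˡ _) ⟩
      0#                                       ∎)
    inv : ∃[ v ] ∃[ t ] v ℕ.* suc w ≡ suc (t ℕ.* P′) × v ℕ.< P′
    inv = inverse-mod (suc w) P′ P≥2 (coprime-p^ K p∤W)
    v = proj₁ inv
    t = proj₁ (proj₂ inv)
    vW = proj₁ (proj₂ (proj₂ inv))
    v<P = proj₂ (proj₂ (proj₂ inv))
    open Power St v t vW v<P
    lt : deg (deriv F) ℕ.< deg a
    lt = deg-F′<deg-a St _ ne (Concl.wr≋ c)
    p≤P : p ℕ.≤ P′
    p≤P = ≡.subst (ℕ._≤ P′) (ℕ.*-identityʳ p) (ℕ.^-monoʳ-≤ p 1≤K)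
    v≡ : v ≡ suc t
    v≡ = ℕ.≤-antisym (stop-v≤ p P′ v d (deg (deriv F)) (deg a) (deg f) t (ℕ.<⇒≤ p≥2) (ℕ.<⇒≤ P≥2) 1≤v lt P*deg-a≤ pvf≤ vd≤) (t<v vW W<P)
      where
      pvf≤ : p ℕ.* (v ℕ.* deg f) ℕ.≤ p ℕ.* (t ℕ.* P′) ℕ.+ P′
      pvf≤ = ℕ.≤-trans (ℕ.≤-reflexive (≡.trans (≡.cong (p ℕ.*_) (≡.trans (≡.cong (v ℕ.*_) deg-f≡) vW)) (ℕ.*-suc p (t ℕ.* P′))))
        (ℕ.≤-trans (ℕ.≤-reflexive (ℕ.+-comm p _)) (ℕ.+-monoʳ-≤ (p ℕ.* (t ℕ.* P′)) p≤P))
    -- With W = w + 1: v (P - W) + 1 = (t + 1) P - (t P + 1) + 1 = P. In particular v divides p^i₀ -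
    -- 1.
    ve₀ : suc (v ℕ.* (P′ ℕ.∸ suc w)) ≡ P′
    ve₀ = ℕ.+-cancelˡ-≡ (t ℕ.* P′) _ _ (≡.trans (≡.trans (ℕ.+-suc (t ℕ.* P′) _) (≡.cong (ℕ._+ v ℕ.* (P′ ℕ.∸ suc w)) (≡.sym vW)))
      (≡.trans (≡.sym (ℕ.*-distribˡ-+ v (suc w) (P′ ℕ.∸ suc w))) (≡.trans (≡.cong (v ℕ.*_) (ℕ.m+[n∸m]≡n (ℕ.<⇒≤ W<P)))
        (≡.trans (≡.cong (ℕ._* P′) v≡) (ℕ.+-comm P′ (t ℕ.* P′))))))
    exps : ∀ m → coeff f m ≢ 0# → ∃[ i ] i ℕ.< K × v ℕ.* m ≡ t ℕ.* P′ ℕ.+ p ℕ.^ i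
    exps m nz = 0 , 1≤K , ≡.trans (≡.cong (v ℕ.*_) (m≡ (m ℕ.≟ suc w))) (≡.trans vW (ℕ.+-comm 1 (t ℕ.* P′)))
      where
      m≡ : Dec (m ≡ suc w) → m ≡ suc w
      m≡ (yes e) = e
      m≡ (no m≢) = contradiction (≡.trans (at E m) (coeff-𝕏^-≢ (suc w) m m≢)) nz

  -- Translations of F and T, and the early phase.

  -- F may have to be replaced by F + λ on the way, so the shape is established for a polynomial
  -- whose roots are those of T moved by a constant.
  Result : Poly → Set
  Result T = ∃[ T′ ] ∃[ lam ] Shape T′ × (∀ y → eval T′ y ≡ eval T (y - lam)) × deg T′ ≡ deg T

  unshifted : ∀ {T} → Shape T → Result T
  unshifted {T} S = T , 0# , S , (λ y → eval-congˡ T (≡.sym (≡.trans (≡.cong (y +_) -0≈0) (+-identityʳ y)))) , ≡.refl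

  shift : Poly → Fin q → Poly
  shift g lam = comp g (𝕏 P.- C lam)

  eval-shift : ∀ g lam y → eval (shift g lam) y ≡ eval g (y - lam)
  eval-shift g lam y = ≡.trans (eval-comp g (𝕏 P.- C lam) y) (eval-congˡ g (eval-𝕏-C lam y))

  deg-shift : ∀ g lam → g ≋0̸ → deg (shift g lam) ≡ deg g
  deg-shift g lam ng = ≡.trans (deg-comp g (ℕ.≤-reflexive (≡.sym (deg-𝕏-C lam))) ng)
    (≡.trans (≡.cong (deg g ℕ.*_) (deg-𝕏-C lam)) (ℕ.*-identityʳ (deg g)))

  comp-comp : ∀ g f h → comp (comp g f) h ≋ comp g (comp f h)
  comp-comp []      f h = P.refl
  comp-comp (x ∷ g) f h = P.trans (comp-+ (C x) (f *ₚ comp g f) h) (P.+-cong (comp-C x h)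
    (P.trans (comp-* f (comp g f) h) (P.*-congˡ (comp-comp g f h))))

  comp-shift : ∀ g lam F → comp (shift g lam) (F +ₚ C lam) ≋ comp g F
  comp-shift g lam F = P.trans (comp-comp g (𝕏 P.- C lam) (F +ₚ C lam)) (comp-congˡ g (P.begin
    comp (𝕏 P.- C lam) (F +ₚ C lam)                      P.≈⟨ comp-sub 𝕏 (C lam) (F +ₚ C lam) ⟩
    comp 𝕏 (F +ₚ C lam) P.- comp (C lam) (F +ₚ C lam)    P.≈⟨ P.+-cong (comp-𝕏 (F +ₚ C lam)) (P.-‿cong (comp-C lam (F +ₚ C lam))) ⟩
    (F +ₚ C lam) P.- C lam                               P.≈⟨ P.solve 2 (λ F c → (F P.:+ c) P.:- c P.:= F) P.refl F (C lam) ⟩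
    F                                                    P.∎))

  deriv-F+C : ∀ F lam → deriv (F +ₚ C lam) ≋ deriv F
  deriv-F+C F lam = P.trans (deriv-+ F (C lam)) (P.trans (P.+-congˡ (deriv-C lam)) (P.+-identityʳ _))

  shifted-result : ∀ {T} lam → T ≋0̸ → Result (shift T lam) → Result T
  shifted-result {T} lam nT (T′ , μ , S , e , de) = T′ , μ + lam , S ,
    (λ y → ≡.trans (e y) (≡.trans (eval-shift T lam (y - μ)) (eval-congˡ T (solve 3 (λ y m l → (y :- m) :- l := y :- (m :+ l)) ≡.refl y μ lam)))) ,
    ≡.trans de (deg-shift T lam nT)

  shift-hyp : ∀ {F T} (H : Hyp F T) lam → coeff (shift T lam) 0 ≡ 0# → Hyp (F +ₚ C lam) (shift T lam)
  shift-hyp {F} {T} H lam T0′ = record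
    { 1≤d = ≡.subst (1 ℕ.≤_) (≡.sym dF) 1≤d ; 3≤s = ≡.subst (3 ℕ.≤_) (≡.sym dT) 3≤s
    ; bound = ≡.subst₂ (λ s d → ℕ.pred s ℕ.* d ℕ.< q) (≡.sym dT) (≡.sym dF) bound
    ; κ = κ ; κ≢0 = κ≢0 ; T0 = T0′
    ; TF = P.trans (comp-shift T lam F) (P.trans TF (P.*-congˡ (P.*-congˡ (P.sym (deriv-F+C F lam))))) }
    where
    open HypFacts H
    dF = deg-F+C F lam 1≤d
    dT = deg-shift T lam nT

  module ExceptionalShift {F T : Poly} {H : Hyp F T} {K : ℕ} (St : State H K 0) (E : Early St)
    (2≤ : 2 ℕ.≤ deg (State.G St)) (exc : Exceptional St) where
    open StateFacts St
    open Exceptional exc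

    private
      F̃ T̃ : Poly
      F̃ = F +ₚ C lam
      T̃ = shift T lam

    -- Otherwise F + λ is coprime to F′ and divides F′b, hence b.
    T̃0 : coeff T̃ 0 ≡ 0#
    T̃0 = case (coeff T̃ 0 Fin.≟ 0#)
      where
      τ = coeff T̃ 0
      split-const : ∀ g h → ∃[ k ] comp g h ≋ C (coeff g 0) +ₚ h *ₚ k
      split-const []      h = [] , P.sym (P.trans (P.+-cong C-0 (P.zeroʳ h)) (P.+-identityˡ []))
      split-const (x ∷ g) h = comp g h , P.refl
      k = proj₁ (split-const T̃ F̃)
      eq : C τ *ₚ b ≋ F̃ *ₚ (C κ *ₚ (𝕏q-𝕏 *ₚ C₁) P.- k *ₚ b)
      eq = P.begin
        C τ *ₚ b
          P.≈⟨ P.solve 4 (λ t F k b → t P.:* b P.:= (t P.:+ F P.:* k) P.:* b P.:- F P.:* (k P.:* b)) P.refl (C τ) F̃ k b ⟩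
        (C τ +ₚ F̃ *ₚ k) *ₚ b P.- F̃ *ₚ (k *ₚ b)
          P.≈⟨ P.+-congʳ (P.*-congʳ (P.trans (P.sym (proj₂ (split-const T̃ F̃))) (P.trans (comp-shift T lam F) TF))) ⟩
        (C κ *ₚ (𝕏q-𝕏 *ₚ deriv F)) *ₚ b P.- F̃ *ₚ (k *ₚ b)
          P.≈⟨ P.+-congʳ (P.trans (P.solve 4 (λ c R F′ b → (c P.:* (R P.:* F′)) P.:* b P.:= c P.:* (R P.:* (F′ P.:* b))) P.refl (C κ) 𝕏q-𝕏 (deriv F) b) (P.*-congˡ (P.*-congˡ F′b))) ⟩
        C κ *ₚ (𝕏q-𝕏 *ₚ (C₁ *ₚ F̃)) P.- F̃ *ₚ (k *ₚ b)
          P.≈⟨ P.solve 6 (λ c R C₁ F k b → c P.:* (R P.:* (C₁ P.:* F)) P.:- F P.:* (k P.:* b) P.:= F P.:* (c P.:* (R P.:* C₁) P.:- k P.:* b)) P.refl (C κ) 𝕏q-𝕏 C₁ F̃ k b ⟩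
        F̃ *ₚ (C κ *ₚ (𝕏q-𝕏 *ₚ C₁) P.- k *ₚ b) P.∎
      case : Dec (τ ≡ 0#) → τ ≡ 0#
      case (yes e) = e
      case (no ne) = contradiction (ℕ.≤-trans (ℕ.≤-reflexive (≡.sym (deg-F+C F lam 1≤d))) (ℕ.≤-trans (ℕ.m≤m+n (deg F̃) _)
          (ℕ.≤-reflexive (≡.trans (≡.sym (deg-* nF̃ nk)) (≡.trans (deg-cong (P.sym eq)) (deg-C* ne nb)))))) (ℕ.<⇒≱ deg-b<d)
        where
        nF̃ : F̃ ≋0̸
        nF̃ = deg≥1⇒≋0̸ (≡.subst (1 ℕ.≤_) (≡.sym (deg-F+C F lam 1≤d)) 1≤d)
        nk : C κ *ₚ (𝕏q-𝕏 *ₚ C₁) P.- k *ₚ b ≋0̸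
        nk z = *ₚ-≋0̸ (C≋0̸ ne) nb (P.trans eq (P.trans (P.*-congˡ z) (P.zeroʳ F̃)))

    H̃ : Hyp F̃ T̃
    H̃ = shift-hyp H lam T̃0

    private
      μ = root K lam
      μ^P : C μ P.^ P′ ≋ C lam
      μ^P = P.trans (P.sym (C-^ μ P′)) (C-cong (root-^ K≤n lam))

      f≋𝕏 : f ≋ 𝕏
      f≋𝕏 = P.trans E (P.*-identityʳ 𝕏)

      κ𝕏+T : C κ *ₚ 𝕏 +ₚ T ≋ C κ *ₚ G P.^ P′
      κ𝕏+T = P.trans (P.+-cong (P.*-congˡ (P.sym f≋𝕏)) (P.sym (P.trans (P.*-congˡ (P.trans (deriv-cong f≋𝕏) deriv-𝕏)) (P.*-identityʳ T)))) κf+Tf′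

      κf̃ : C κ *ₚ 𝕏 +ₚ T̃ *ₚ deriv 𝕏 ≋ C κ *ₚ (shift G lam +ₚ C μ) P.^ P′
      κf̃ = P.begin
        C κ *ₚ 𝕏 +ₚ T̃ *ₚ deriv 𝕏
          P.≈⟨ P.+-congˡ (P.trans (P.*-congˡ deriv-𝕏) (P.*-identityʳ T̃)) ⟩
        C κ *ₚ 𝕏 +ₚ T̃
          P.≈⟨ P.solve 4 (λ k X l T → k P.:* X P.:+ T P.:= (k P.:* (X P.:- l) P.:+ T) P.:+ k P.:* l) P.refl (C κ) 𝕏 (C lam) T̃ ⟩
        (C κ *ₚ (𝕏 P.- C lam) +ₚ T̃) +ₚ C κ *ₚ C lam
          P.≈⟨ P.+-congʳ (P.trans (P.+-congʳ (P.trans (P.*-congˡ (P.sym (comp-𝕏 (𝕏 P.- C lam)))) (P.sym (comp-C* κ 𝕏 (𝕏 P.- C lam))))) (P.sym (comp-+ (C κ *ₚ 𝕏) T (𝕏 P.- C lam)))) ⟩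
        comp (C κ *ₚ 𝕏 +ₚ T) (𝕏 P.- C lam) +ₚ C κ *ₚ C lam
          P.≈⟨ P.+-cong (P.trans (comp-cong (𝕏 P.- C lam) κ𝕏+T) (P.trans (comp-C* κ (G P.^ P′) (𝕏 P.- C lam)) (P.*-congˡ (comp-^ G P′ (𝕏 P.- C lam))))) (P.*-congˡ (P.sym μ^P)) ⟩
        C κ *ₚ shift G lam P.^ P′ +ₚ C κ *ₚ C μ P.^ P′
          P.≈⟨ P.distribˡ (C κ) _ _ ⟨
        C κ *ₚ (shift G lam P.^ P′ +ₚ C μ P.^ P′)
          P.≈⟨ P.*-congˡ (P.sym (FrobP.frobenius^ K (shift G lam) (C μ))) ⟩
        C κ *ₚ (shift G lam +ₚ C μ) P.^ P′ P.∎

    -- For w = 0 an early state has f = y, so f(F) = F. The translation by λ = μ^P then only adds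
    -- the constant μ to `a` and to the shifted `G`.
    S̃t : State H̃ K 0
    S̃t = record
      { f = 𝕏 ; G = shift G lam +ₚ C μ ; a = a +ₚ C μ ; b = b ; ω = 1# ; ω≢0 = 1≢0 ; 1≤K = 1≤K ; K≤n = K≤n ; W<P = W<P
      ; f<P = ≡.subst (ℕ._< P′) (≡.sym deg-𝕏) W<P
      ; f<s+w = ≡.subst₂ ℕ._<_ (≡.sym deg-𝕏) (≡.sym (≡.trans (ℕ.+-identityʳ _) (deg-shift T lam nT))) (ℕ.≤-trans (s≤s (s≤s z≤n)) 3≤s)
      ; f0 = ≡.refl ; f′ = P.trans deriv-𝕏 (P.sym (P.*-identityˡ P.1#)) ; κf+Tf′ = κf̃
      ; f∘F = P.begin
          (a +ₚ C μ) P.^ P′ +ₚ 𝕏 *ₚ b P.^ P′           P.≈⟨ P.+-congʳ (P.trans (FrobP.frobenius^ K a (C μ)) (P.+-congˡ μ^P)) ⟩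
          (a P.^ P′ +ₚ C lam) +ₚ 𝕏 *ₚ b P.^ P′         P.≈⟨ P.solve 3 (λ u l v → (u P.:+ l) P.:+ v P.:= (u P.:+ v) P.:+ l) P.refl (a P.^ P′) (C lam) (𝕏 *ₚ b P.^ P′) ⟩
          (a P.^ P′ +ₚ 𝕏 *ₚ b P.^ P′) +ₚ C lam         P.≈⟨ P.+-congʳ (P.trans f∘F (P.trans (comp-cong F f≋𝕏) (comp-𝕏 F))) ⟩
          F̃                                            P.≈⟨ comp-𝕏 F̃ ⟨
          comp 𝕏 F̃                                     P.∎ }

    Ẽ : Early S̃t
    Ẽ = P.sym (P.*-identityʳ 𝕏)

    2≤̃ : 2 ℕ.≤ deg (State.G S̃t)
    2≤̃ = ≡.subst (2 ℕ.≤_) (ℕ.*-cancelˡ-≡ (deg G) (deg (State.G S̃t)) P′ (≡.trans deg-G (≡.trans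
      (≡.cong (ℕ._+ 0) (≡.sym (deg-shift T lam nT))) (≡.sym (StateFacts.deg-G S̃t))))) 2≤

    private
      F̃∣F̃′b : F̃ D.∣ᵣ deriv F̃ *ₚ b
      F̃∣F̃′b = C₁ , P.trans (P.*-comm F̃ C₁) (P.trans (P.sym F′b) (P.*-congʳ (P.sym (deriv-F+C F lam))))

    concl : Concl S̃t
    concl = Analysis.divisible S̃t 2≤̃ F̃∣F̃′b

    -- As f = y, the bound p deg f ≤ P holds, and the small degree of the Wronskian rules out a
    -- stop.
    no-stop : (ι 1 - ι (Concl.σ concl)) * coeff (State.G S̃t) 1 ≡ 0#
    no-stop = Analysis₀.wr-digit S̃t 2≤̃ (≡.subst (ℕ._≤ P′) (≡.sym (≡.trans (≡.cong (p ℕ.*_) deg-𝕏) (ℕ.*-identityʳ p)))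
      (≡.subst (ℕ._≤ P′) (ℕ.*-identityʳ p) (ℕ.^-monoʳ-≤ p 1≤K))) F̃∣F̃′b

  -- With f = y^(w+1) and G linear, y^w T is a combination of y^(w+1) and y^P, where P = s + w.
  early-end : {F T : Poly} {H : Hyp F T} {K w : ℕ} (St : State H K w) → Early St → deg (State.G St) ≡ 1 → Shape T
  early-end {F} {T} {H} {K} {w} St E e = binomial (coeff T 1) (coeff T s) (mk λ j → pointwise j (j ℕ.≟ 1) (j ℕ.≟ s))
    where
    open StateFacts St
    open LinearG St e
    s = deg T
    val : ∀ j → coeff (C (coeff T 1) *ₚ 𝕏 +ₚ C (coeff T s) *ₚ 𝕏 P.^ s) j ≡ coeff T 1 * coeff 𝕏 j + coeff T s * coeff (𝕏 P.^ s) j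
    val j = ≡.trans (coeff-+ (C (coeff T 1) *ₚ 𝕏) (C (coeff T s) *ₚ 𝕏 P.^ s) j) (≡.cong₂ _+_ (coeff-C* (coeff T 1) 𝕏 j) (coeff-C* (coeff T s) (𝕏 P.^ s) j))
    coeff-𝕏-≢ : ∀ j → j ≢ 1 → coeff 𝕏 j ≡ 0#
    coeff-𝕏-≢ zero          _ = ≡.refl
    coeff-𝕏-≢ (suc zero)    ne = contradiction ≡.refl ne
    coeff-𝕏-≢ (suc (suc j)) _ = ≡.refl
    zero-at : ∀ j → j ≢ 1 → j ≢ s → coeff T j ≡ 0#
    zero-at j j≢1 j≢s = decide (coeff T j Fin.≟ 0#)
      where
      impossible : w ℕ.+ j ≡ P′ ⊎ coeff f (w ℕ.+ j) ≢ 0# → coeff T j ≡ 0#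
      impossible (inj₁ e′) = contradiction (ℕ.+-cancelˡ-≡ w j s (≡.trans e′ (≡.trans (≡.sym s+w≡P) (ℕ.+-comm s w)))) j≢s
      impossible (inj₂ nz) = contradiction (≡.trans (at E (w ℕ.+ j)) (coeff-𝕏^-≢ (suc w) (w ℕ.+ j)
        (λ e′ → j≢1 (ℕ.+-cancelˡ-≡ w j 1 (≡.trans e′ (ℕ.+-comm 1 w)))))) nz
      decide : Dec (coeff T j ≡ 0#) → coeff T j ≡ 0#
      decide (yes z) = z
      decide (no nz) = impossible (support j nz)
    pointwise : ∀ j → Dec (j ≡ 1) → Dec (j ≡ s) → coeff T j ≡ coeff (C (coeff T 1) *ₚ 𝕏 +ₚ C (coeff T s) *ₚ 𝕏 P.^ s) j
    pointwise j (yes ≡.refl) _ = ≡.sym (≡.trans (val 1) (≡.trans (≡.cong₂ (λ x y → x + coeff T s * y) (*-identityʳ _)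
      (coeff-𝕏^-≢ s 1 λ e′ → ℕ.<⇒≢ (ℕ.≤-trans (s≤s (s≤s z≤n)) 3≤s) e′)) (≡.trans (≡.cong (coeff T 1 +_) (zeroʳ _)) (+-identityʳ _))))
    pointwise j (no j≢1) (yes ≡.refl) = ≡.sym (≡.trans (val s) (≡.trans (≡.cong₂ _+_ (≡.trans (≡.cong (coeff T 1 *_) (coeff-𝕏-≢ s j≢1)) (zeroʳ _))
      (≡.trans (≡.cong (coeff T s *_) (coeff-𝕏^ s)) (*-identityʳ _))) (+-identityˡ _)))
    pointwise j (no j≢1) (no j≢s) = ≡.trans (zero-at j j≢1 j≢s) (≡.sym (≡.trans (val j) (≡.trans (≡.cong₂ _+_
      (≡.trans (≡.cong (coeff T 1 *_) (coeff-𝕏-≢ j j≢1)) (zeroʳ _)) (≡.trans (≡.cong (coeff T s *_) (coeff-𝕏^-≢ s j j≢s)) (zeroʳ _))) (+-identityˡ _))))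

  early-loop : ∀ fuel {F T : Poly} {H : Hyp F T} {K w : ℕ} (St : State H K w) → Early St → n ℕ.≤ K ℕ.+ fuel → Result T

  early-advance : ∀ fuel {F T : Poly} {H : Hyp F T} {K w : ℕ} (St : State H K w) → Early St → n ℕ.≤ K ℕ.+ fuel → K ℕ.< n →
    (c : Concl St) → (ι 1 - ι (Concl.σ c)) * coeff (State.G St) 1 ≡ 0# → Result T
  early-advance zero {K = K} St E enough K<n c e = contradiction (≡.subst (n ℕ.≤_) (ℕ.+-identityʳ K) enough) (ℕ.<⇒≱ K<n)
  early-advance (suc fuel) {K = K} {w} St E enough K<n c e = early-loop fuel state₊ E₊ (≡.subst (n ℕ.≤_) (ℕ.+-suc K fuel) enough)
    where
    open StateFacts St hiding (K<n)
    open Advancing St K<n c 0# (inj₁ (≡.refl , e))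
    E₊ : Early state₊
    E₊ = P.begin
      𝕏 P.^ (r ℕ.* P′) *ₚ (f P.- C (0# ^ P′) *ₚ 𝕏 P.^ P′)
        P.≈⟨ P.*-congˡ (P.trans (P.+-cong E (P.trans (P.-‿cong (C-zero* _ (0^ P′ (ℕ.<⇒≤ P≥2)))) P.-0≈0)) (P.+-identityʳ _)) ⟩
      𝕏 P.^ (r ℕ.* P′) *ₚ 𝕏 P.^ suc w
        P.≈⟨ P.^-homo-* 𝕏 (r ℕ.* P′) (suc w) ⟨
      𝕏 P.^ (r ℕ.* P′ ℕ.+ suc w)
        P.≡⟨ ≡.cong (𝕏 P.^_) (ℕ.+-comm (r ℕ.* P′) (suc w)) ⟩
      𝕏 P.^ suc (w ℕ.+ r ℕ.* P′) P.∎

  early-continue : ∀ fuel {F T : Poly} {H : Hyp F T} {K w : ℕ} (St : State H K w) → Early St → n ℕ.≤ K ℕ.+ fuel →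
    2 ℕ.≤ deg (State.G St) → Concl St → Result T
  early-continue fuel {T = T} {K = K} St E enough 2≤ c = decide ((ι 1 - ι (Concl.σ c)) * coeff (State.G St) 1 Fin.≟ 0#)
    where
    decide : Dec ((ι 1 - ι (Concl.σ c)) * coeff (State.G St) 1 ≡ 0#) → Result T
    decide (yes e) = early-advance fuel St E enough (StateFacts.K<n St 2≤) c e
    decide (no ne) = unshifted (late-loop fuel (first-stop St E c ne 2≤) enough)

  early-loop fuel {F} {T} {H} {K} {w} St E enough = by-degree (2 ℕ.≤? deg G) w ≡.refl
    where
    open StateFacts St
    -- In the second case the digits have already been analysed for F + λ, and there is no stop. The
    -- translated state advances directly, so that every call of the loop is one level higher.
    exceptional : (St₀ : State H K 0) → Early St₀ → 2 ℕ.≤ deg (State.G St₀) → Concl St₀ ⊎ Exceptional St₀ → Result T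
    exceptional St₀ E₀ 2≤ (inj₁ c) = early-continue fuel St₀ E₀ enough 2≤ c
    exceptional St₀ E₀ 2≤ (inj₂ x) = shifted-result (Exceptional.lam x) nT
        (early-advance fuel X.S̃t X.Ẽ enough (StateFacts.K<n X.S̃t X.2≤̃) X.concl X.no-stop)
      where module X = ExceptionalShift St₀ E₀ 2≤ x
    by-degree : Dec (2 ℕ.≤ deg G) → ∀ w′ → w ≡ w′ → Result T
    by-degree (no n2≤) _ _ = unshifted (early-end St E (ℕ.≤-antisym (ℕ.≤-pred (ℕ.≰⇒> n2≤)) deg-G≥1))
    by-degree (yes 2≤) (suc w′) ≡.refl = early-continue fuel St E enough 2≤ (Analysis.divisible St 2≤ (F∣F′b (s≤s z≤n)))
    by-degree (yes 2≤) zero ≡.refl = exceptional St E 2≤ (Analysis₀.analysis St 2≤ (≡.subst (ℕ._≤ P′)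
      (≡.sym (≡.trans (≡.cong (p ℕ.*_) (≡.trans (deg-cong E) (deg-𝕏^ 1))) (ℕ.*-identityʳ p)))
      (≡.subst (ℕ._≤ P′) (ℕ.*-identityʳ p) (ℕ.^-monoʳ-≤ p 1≤K))))

  -- The first state of the descent, at level K = 1 with W = r + 1 ≡ 1 − s.
  module Initial {F T : Poly} (H : Hyp F T) (s : ℕ)
    (κ≡ : Hyp.κ H ≡ coeff T 1 * (ι s - 1#))
    (FF″ : F *ₚ deriv (deriv F) ≋ C (ι s) *ₚ (deriv F *ₚ deriv F))
    (tj : ∀ j → 2 ℕ.≤ j → (ι j - ι s) * coeff T j ≡ 0#) where
    open HypFacts H

    private
      r : ℕ
      r = proj₁ (ι-negation s)

      r<p : r ℕ.< p
      r<p = proj₁ (proj₂ (ι-negation s))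

      r+s : ι r + ι s ≡ 0#
      r+s = proj₂ (proj₂ (ι-negation s))

      ω : Fin q
      ω = ι (suc r)

      ω≡ : ω ≡ 1# - ι s
      ω≡ = begin
        1# + ι r                        ≡⟨ solve 2 (λ r s → con (pos 1) :+ r := (con (pos 1) :- s) :+ (r :+ s)) ≡.refl (ι r) (ι s) ⟩
        (1# - ι s) + (ι r + ι s)        ≡⟨ ≡.trans (≡.cong (1# - ι s +_) r+s) (+-identityʳ _) ⟩
        1# - ι s                        ∎

      ω≢0 : ω ≢ 0#
      ω≢0 e = κ≢0 (begin
        κ                             ≡⟨ κ≡ ⟩
        coeff T 1 * (ι s - 1#)        ≡⟨ solve 2 (λ t s → t :* (s :- con (pos 1)) := :- (t :* (con (pos 1) :- s))) ≡.refl (coeff T 1) (ι s) ⟩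
        - (coeff T 1 * (1# - ι s))    ≡⟨ ≡.cong (λ x → - (coeff T 1 * x)) (≡.trans (≡.sym ω≡) e) ⟩
        - (coeff T 1 * 0#)            ≡⟨ ≡.trans (≡.cong -_ (zeroʳ _)) -0≈0 ⟩
        0#                            ∎)

      W<p : suc r ℕ.< p
      W<p = ℕ.≤∧≢⇒< r<p (λ e → ω≢0 (≡.trans (≡.cong ι e) ι-p))

      p^1 : p ℕ.^ 1 ≡ p
      p^1 = ℕ.*-identityʳ p

      to-P : ∀ {h g} → h P.^ p ≋ g → h P.^ (p ℕ.^ 1) ≋ g
      to-P {h} e = P.trans (P.reflexive (≡.cong (h P.^_) p^1)) e

      B : Poly
      B = C ω *ₚ (deriv F *ₚ F P.^ r)

      b : ∃[ b ] b P.^ p ≋ B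
      b = poly-p-th-root B (P.trans (deriv-C* ω (deriv F *ₚ F P.^ r))
        (P.trans (P.*-congˡ (euler F (deriv F) (ι s) r nF FF″ r+s)) (P.zeroʳ (C ω))))

      A : Poly
      A = F P.^ suc r P.- 𝕏 *ₚ proj₁ b P.^ (p ℕ.^ 1)

      -- F^(r+1) and x b^p both have the derivative ω F^r F′ = b^p.
      A′ : deriv A ≋ []
      A′ = P.begin
        deriv A
          P.≈⟨ deriv-sub (F P.^ suc r) (𝕏 *ₚ proj₁ b P.^ (p ℕ.^ 1)) ⟩
        deriv (F P.^ suc r) P.- deriv (𝕏 *ₚ proj₁ b P.^ (p ℕ.^ 1))
          P.≈⟨ P.+-cong (P.trans (deriv-^ F r) (P.*-cong (P-ι≋C (suc r)) (P.*-comm (F P.^ r) (deriv F))))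
                (P.-‿cong (P.trans (deriv-𝕏* (proj₁ b P.^ (p ℕ.^ 1))) (P.trans (P.+-cong (to-P (proj₂ b)) (P.trans (P.*-congˡ (deriv-p^ (proj₁ b) 1 (s≤s z≤n))) (P.zeroʳ 𝕏))) (P.+-identityʳ B)))) ⟩
        B P.- B
          P.≈⟨ P.-‿inverseʳ B ⟩
        [] P.∎

      a : ∃[ a ] a P.^ p ≋ A
      a = poly-p-th-root A A′

      E : Poly
      E = C κ *ₚ 𝕏 +ₚ C ω *ₚ T

      coeff-E : ∀ j → coeff E j ≡ κ * coeff 𝕏 j + ω * coeff T j
      coeff-E j = ≡.trans (coeff-+ (C κ *ₚ 𝕏) (C ω *ₚ T) j) (≡.cong₂ _+_ (coeff-C* κ 𝕏 j) (coeff-C* ω T j))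

      -- By `tj` the exponents j ≥ 2 of T are congruent to s modulo p. The value κ = t₁ (s - 1) = -ω
      -- t₁ is the one that cancels the coefficient of y in `E`.
      homogeneous : ∀ j → (ι j - ι s) * coeff E j ≡ 0#
      homogeneous zero = ≡.trans (≡.cong ((ι 0 - ι s) *_) (≡.trans (coeff-E 0)
        (≡.trans (≡.cong₂ _+_ (zeroʳ κ) (≡.trans (≡.cong (ω *_) T0) (zeroʳ ω))) (+-identityˡ 0#)))) (zeroʳ _)
      homogeneous (suc zero) = ≡.trans (≡.cong ((ι 1 - ι s) *_) (begin
          coeff E 1                                            ≡⟨ coeff-E 1 ⟩
          κ * 1# + ω * coeff T 1                               ≡⟨ ≡.cong₂ (λ x y → x * 1# + y * coeff T 1) κ≡ ω≡ ⟩
          coeff T 1 * (ι s - 1#) * 1# + (1# - ι s) * coeff T 1 ≡⟨ solve 2 (λ t s → t :* (s :- con (pos 1)) :* con (pos 1) :+ (con (pos 1) :- s) :* t := con (pos 0)) ≡.refl (coeff T 1) (ι s) ⟩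
          0#                                                   ∎)) (zeroʳ _)
      homogeneous (suc (suc j)) = begin
          (ι (suc (suc j)) - ι s) * coeff E (suc (suc j))
            ≡⟨ ≡.cong ((ι (suc (suc j)) - ι s) *_) (≡.trans (coeff-E (suc (suc j))) (≡.trans (≡.cong (_+ ω * coeff T (suc (suc j))) (zeroʳ κ)) (+-identityˡ _))) ⟩
          (ι (suc (suc j)) - ι s) * (ω * coeff T (suc (suc j)))
            ≡⟨ solve 3 (λ i o t → i :* (o :* t) := o :* (i :* t)) ≡.refl (ι (suc (suc j)) - ι s) ω (coeff T (suc (suc j))) ⟩
          ω * ((ι (suc (suc j)) - ι s) * coeff T (suc (suc j)))
            ≡⟨ ≡.trans (≡.cong (ω *_) (tj (suc (suc j)) (s≤s (s≤s z≤n)))) (zeroʳ ω) ⟩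
          0# ∎

      κ⁻¹ : Fin q
      κ⁻¹ = proj₁ (invert κ κ≢0)

      G : ∃[ G ] G P.^ p ≋ C κ⁻¹ *ₚ (E *ₚ 𝕏 P.^ r)
      G = poly-p-th-root (C κ⁻¹ *ₚ (E *ₚ 𝕏 P.^ r)) (P.trans (deriv-C* κ⁻¹ (E *ₚ 𝕏 P.^ r))
        (P.trans (P.*-congˡ (euler 𝕏 E (ι s) r 𝕏≋0̸ (euler-𝕏 E (ι s) homogeneous) r+s)) (P.zeroʳ (C κ⁻¹))))

      f′ : deriv (𝕏 P.^ suc r) ≋ C ω *ₚ 𝕏 P.^ r
      f′ = P.trans (deriv-^ 𝕏 r) (P.*-cong (P-ι≋C (suc r)) (P.trans (P.*-congˡ deriv-𝕏) (P.*-identityʳ (𝕏 P.^ r))))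

    initial : State H 1 r
    initial = record
      { f = 𝕏 P.^ suc r ; G = proj₁ G ; a = proj₁ a ; b = proj₁ b ; ω = ω ; ω≢0 = ω≢0 ; 1≤K = s≤s z≤n ; K≤n = n≥1
      ; W<P = ≡.subst (suc r ℕ.<_) (≡.sym p^1) W<p
      ; f<P = ≡.subst₂ ℕ._<_ (≡.sym (deg-𝕏^ (suc r))) (≡.sym p^1) W<p
      ; f<s+w = ≡.subst (ℕ._< deg T ℕ.+ r) (≡.sym (deg-𝕏^ (suc r))) (ℕ.+-monoˡ-≤ r (ℕ.≤-trans (s≤s (s≤s z≤n)) 3≤s))
      ; f0 = ≡.trans (coeff-𝕏^-≢ (suc r) 0 λ ()) ≡.refl
      ; f′ = f′
      ; κf+Tf′ = P.begin
          C κ *ₚ (𝕏 *ₚ 𝕏 P.^ r) +ₚ T *ₚ deriv (𝕏 P.^ suc r)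
            P.≈⟨ P.+-congˡ (P.*-congˡ f′) ⟩
          C κ *ₚ (𝕏 *ₚ 𝕏 P.^ r) +ₚ T *ₚ (C ω *ₚ 𝕏 P.^ r)
            P.≈⟨ P.solve 5 (λ k X Y T o → k P.:* (X P.:* Y) P.:+ T P.:* (o P.:* Y) P.:= (k P.:* X P.:+ o P.:* T) P.:* Y) P.refl (C κ) 𝕏 (𝕏 P.^ r) T (C ω) ⟩
          E *ₚ 𝕏 P.^ r
            P.≈⟨ P.trans (P.sym (C-inv κ≢0 _)) (P.solve 3 (λ i k e → i P.:* (k P.:* e) P.:= k P.:* (i P.:* e)) P.refl (C κ⁻¹) (C κ) (E *ₚ 𝕏 P.^ r)) ⟩
          C κ *ₚ (C κ⁻¹ *ₚ (E *ₚ 𝕏 P.^ r))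
            P.≈⟨ P.*-congˡ (P.sym (to-P (proj₂ G))) ⟩
          C κ *ₚ proj₁ G P.^ (p ℕ.^ 1) P.∎
      ; f∘F = P.begin
          proj₁ a P.^ (p ℕ.^ 1) +ₚ 𝕏 *ₚ proj₁ b P.^ (p ℕ.^ 1)
            P.≈⟨ P.+-congʳ (to-P (proj₂ a)) ⟩
          A +ₚ 𝕏 *ₚ proj₁ b P.^ (p ℕ.^ 1)
            P.≈⟨ P.solve 2 (λ u v → (u P.:- v) P.:+ v P.:= u) P.refl (F P.^ suc r) (𝕏 *ₚ proj₁ b P.^ (p ℕ.^ 1)) ⟩
          F P.^ suc r
            P.≈⟨ comp-𝕏^ (suc r) F ⟨
          comp (𝕏 P.^ suc r) F P.∎ }

    result : Result T
    result = early-loop n initial P.refl (ℕ.n≤1+n n)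

  -- From T(F) = (X^q - X) H to the hypothesis of the descent.

  module Division (F T : Poly) (1≤d : 1 ℕ.≤ deg F) (3≤s : 3 ℕ.≤ deg T) (bound : ℕ.pred (deg T) ℕ.* deg F ℕ.< q)
    (H : Poly) (T∘F : comp T F ≋ 𝕏q-𝕏 *ₚ H) where

    private
      d = deg F
      s = deg T

    nF : F ≋0̸
    nF = deg≥1⇒≋0̸ 1≤d

    nT : T ≋0̸
    nT = deg≥1⇒≋0̸ (ℕ.≤-trans (s≤s z≤n) 3≤s)

    nH : H ≋0̸
    nH z = comp-≋0̸ T 1≤d nT (P.trans T∘F (P.trans (P.*-congˡ z) (P.zeroʳ 𝕏q-𝕏)))

    deg-H<d : deg H ℕ.< d
    deg-H<d = ℕ.+-cancelˡ-< q (deg H) d (≡.subst (ℕ._< q ℕ.+ d) sd≡ (≡.subst (λ s → s ℕ.* d ℕ.< q ℕ.+ d) s≡ (≡.subst (d ℕ.+ ℕ.pred s ℕ.* d ℕ.<_) (ℕ.+-comm d q) (ℕ.+-monoʳ-< d bound))))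
      where
      s≡ : suc (ℕ.pred s) ≡ s
      s≡ = ℕ.suc-pred s {{ℕ.>-nonZero (ℕ.≤-trans (s≤s z≤n) 3≤s)}}
      sd≡ : s ℕ.* d ≡ q ℕ.+ deg H
      sd≡ = ≡.trans (≡.sym (deg-comp T 1≤d nT)) (≡.trans (deg-cong T∘F) (≡.trans (deg-* 𝕏q-𝕏≋0̸ nH) (≡.cong (ℕ._+ deg H) deg-𝕏q-𝕏)))

    derived : comp (deriv T) F *ₚ deriv F ≋ 𝕏q-𝕏 *ₚ deriv H P.- H
    derived = P.begin
      comp (deriv T) F *ₚ deriv F                        P.≈⟨ P.trans (P.sym (deriv-comp T F)) (deriv-cong T∘F) ⟩
      deriv (𝕏q-𝕏 *ₚ H)                                  P.≈⟨ P.trans (deriv-* 𝕏q-𝕏 H) (P.+-congʳ (P.*-congʳ deriv-𝕏q-𝕏)) ⟩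
      (P.- P.1#) *ₚ H +ₚ 𝕏q-𝕏 *ₚ deriv H                 P.≈⟨ P.solve 3 (λ o H u → (P.:- P.con (pos 1)) P.:* H P.:+ u P.:= u P.:- H) P.refl P.1# H (𝕏q-𝕏 *ₚ deriv H) ⟩
      𝕏q-𝕏 *ₚ deriv H P.- H                              P.∎

    -- If F′ = 0, then H = (X^q - X) H′, which is impossible for a nonzero H of degree below d < q.
    nF′ : deriv F ≋0̸
    nF′ z = case (zero? (deriv H))
      where
      eq : 𝕏q-𝕏 *ₚ deriv H ≋ H
      eq = P.x-y≈0⇒x≈y (P.trans (P.sym derived) (P.trans (P.*-congˡ z) (P.zeroʳ _)))
      case : ¬ Dec (deriv H ≋ [])
      case (yes z′) = nH (P.trans (P.sym eq) (P.trans (P.*-congˡ z′) (P.zeroʳ 𝕏q-𝕏)))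
      case (no nH′) = ℕ.<⇒≱ (ℕ.<-trans deg-H<d d<q) (≡.subst₂ ℕ._≤_ deg-𝕏q-𝕏
        (≡.trans (≡.sym (deg-* 𝕏q-𝕏≋0̸ nH′)) (deg-cong eq)) (ℕ.m≤m+n (deg 𝕏q-𝕏) (deg (deriv H))))
        where
        d<q : d ℕ.< q
        d<q = ℕ.≤-<-trans (≡.subst (ℕ._≤ ℕ.pred s ℕ.* d) (ℕ.*-identityˡ d) (ℕ.*-monoˡ-≤ d (ℕ.pred-mono-≤ (ℕ.≤-trans (s≤s (s≤s z≤n)) 3≤s)))) bound

    private
      a : Poly
      a = P.- (𝕏 *ₚ H)

      -- T(F) = x^q H - x H is a relation of the kind studied above, with Z = x^q of derivative
      -- zero; its Wronskian is -H^2.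
      relation-aH : a +ₚ 𝕏 P.^ q *ₚ H ≋ comp T F
      relation-aH = P.trans (P.solve 3 (λ X Y H → P.:- (X P.:* H) P.:+ Y P.:* H P.:= (Y P.:- X) P.:* H) P.refl 𝕏 (𝕏 P.^ q) H)
        (P.trans (P.*-congʳ (P.sym 𝕏q-𝕏≡)) (P.sym T∘F))

    wr-aH : wr a H ≋ P.- (H *ₚ H)
    wr-aH = P.begin
      deriv (P.- (𝕏 *ₚ H)) *ₚ H P.- (P.- (𝕏 *ₚ H)) *ₚ deriv H
        P.≈⟨ P.+-congʳ (P.*-congʳ (P.trans (deriv-neg (𝕏 *ₚ H)) (P.-‿cong (deriv-𝕏* H)))) ⟩
      (P.- (H +ₚ 𝕏 *ₚ deriv H)) *ₚ H P.- (P.- (𝕏 *ₚ H)) *ₚ deriv H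
        P.≈⟨ P.solve 3 (λ X H H′ → (P.:- (H P.:+ X P.:* H′)) P.:* H P.:- (P.:- (X P.:* H)) P.:* H′ P.:= P.:- (H P.:* H)) P.refl 𝕏 H (deriv H) ⟩
      P.- (H *ₚ H) P.∎

    private
      H<° : H <° d
      H<° = deg<⇒<° {H} deg-H<d

      wr<2d : wr a H <° d ℕ.+ d
      wr<2d = <°-cong {P.- (H *ₚ H)} (P.sym wr-aH) (<°-neg {H *ₚ H} (<°-mono (H *ₚ H) (ℕ.+-mono-≤ deg-H<d (ℕ.<⇒≤ deg-H<d)) (<°-* H H (<°deg H) (<°deg H))))

      2≤s : 2 ℕ.≤ s
      2≤s = ℕ.≤-trans (s≤s (s≤s z≤n)) 3≤s

    -- The case in which the digit C₀ of F′H vanishes.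
    module Homogeneous (C₁ : Poly) (F′H : F *ₚ C₁ ≋ deriv F *ₚ H) (ιs≢0 : ι s ≢ 0#) where

      private
        ρ : Relation F
        ρ = relation 1≤d {a} {H} {𝕏 P.^ q} {T} {[]} {C₁} relation-aH (deriv-p^ 𝕏 n n≥1) H<° (λ _ _ → ≡.refl)
          (P.trans (P.sym F′H) (P.trans (P.*-comm F C₁) (P.sym (P.+-identityʳ _)))) wr<2d 2≤s
        open Comparison ρ using (b′≋; digit-0; digit-1; digit-≥2; wr≋; E₀; E₁)

        nC₁ : C₁ ≋0̸
        nC₁ z = *ₚ-≋0̸ nF′ nH (P.trans (P.sym F′H) (P.trans (P.*-congˡ z) (P.zeroʳ F)))

        t₀ t₁ c : Fin q
        t₀ = coeff T 0
        t₁ = coeff T 1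
        c  = (ι 1 - ι s) * t₁

      tj : ∀ j → 2 ℕ.≤ j → (ι j - ι s) * coeff T j ≡ 0#
      tj j 2≤j = C*-cancel nC₁ (P.trans (P.sym (P.trans (P.+-congʳ (P.zeroʳ _)) (P.+-identityˡ _))) (digit-≥2 j 2≤j))

      private
        HH : P.- (H *ₚ H) ≋ C c *ₚ (deriv F *ₚ H) P.- C t₀ *ₚ deriv H
        HH = P.begin
          P.- (H *ₚ H)                                  P.≈⟨ P.trans (P.sym wr-aH) wr≋ ⟩
          E₁ *ₚ F +ₚ E₀
            P.≈⟨ P.+-cong (P.*-congʳ (P.trans digit-1 (P.trans (P.+-congʳ (P.zeroʳ _)) (P.+-identityˡ _)))) (P.trans digit-0 (P.+-congʳ (P.zeroˡ _))) ⟩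
          (C c *ₚ C₁) *ₚ F +ₚ ([] P.- deriv H *ₚ C t₀)
            P.≈⟨ P.solve 5 (λ c k F h t → (c P.:* k) P.:* F P.:+ (P.con (pos 0) P.:- h P.:* t) P.:= c P.:* (F P.:* k) P.:- t P.:* h) P.refl (C c) C₁ F (deriv H) (C t₀) ⟩
          C c *ₚ (F *ₚ C₁) P.- C t₀ *ₚ deriv H          P.≈⟨ P.+-congʳ (P.*-congˡ F′H) ⟩
          C c *ₚ (deriv F *ₚ H) P.- C t₀ *ₚ deriv H     P.∎

        nH′ : deriv H ≋0̸
        nH′ z = *ₚ-≋0̸ (C≋0̸ ιs≢0) nC₁ (P.trans (P.sym b′≋) z)

      -- The digits give t₀ H′ = H (H + c F′). For t₀ ≠ 0 both sides are nonzero, and the right side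
      -- has degree at least deg H, more than that of H′.
      t₀≡0 : t₀ ≡ 0#
      t₀≡0 = case (t₀ Fin.≟ 0#)
        where
        Z : Poly
        Z = H +ₚ C c *ₚ deriv F
        eq : C t₀ *ₚ deriv H ≋ H *ₚ Z
        eq = P.begin
          C t₀ *ₚ deriv H
            P.≈⟨ P.solve 3 (λ u v w → w P.:= v P.:- (v P.:- w)) P.refl C₁ (C c *ₚ (deriv F *ₚ H)) (C t₀ *ₚ deriv H) ⟩
          C c *ₚ (deriv F *ₚ H) P.- (C c *ₚ (deriv F *ₚ H) P.- C t₀ *ₚ deriv H)
            P.≈⟨ P.+-congˡ (P.-‿cong (P.sym HH)) ⟩
          C c *ₚ (deriv F *ₚ H) P.- (P.- (H *ₚ H))
            P.≈⟨ P.solve 3 (λ c F H → c P.:* (F P.:* H) P.:- (P.:- (H P.:* H)) P.:= H P.:* (H P.:+ c P.:* F)) P.refl (C c) (deriv F) H ⟩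
          H *ₚ Z P.∎
        case : Dec (t₀ ≡ 0#) → t₀ ≡ 0#
        case (yes e) = e
        case (no ne) = contradiction (≡.subst (deg H ℕ.≤_) (≡.trans (≡.sym (deg-* nH nZ)) (≡.trans (deg-cong (P.sym eq)) (deg-C* ne nH′)))
            (ℕ.m≤m+n (deg H) (deg Z))) (ℕ.<⇒≱ (deg-deriv nH′))
          where
          nZ : Z ≋0̸
          nZ z = *ₚ-≋0̸ (C≋0̸ ne) nH′ (P.trans eq (P.trans (P.*-congˡ z) (P.zeroʳ H)))

      private
        κ : Fin q
        κ = t₁ * (ι s - 1#)

        H≋ : H ≋ C κ *ₚ deriv F
        H≋ = *ₚ-cancelˡ nH (P.begin
          H *ₚ H                                               P.≈⟨ P.-‿involutive (H *ₚ H) ⟨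
          P.- (P.- (H *ₚ H))                                   P.≈⟨ P.-‿cong HH ⟩
          P.- (C c *ₚ (deriv F *ₚ H) P.- C t₀ *ₚ deriv H)      P.≈⟨ P.-‿cong (P.trans (P.+-congˡ (P.trans (P.-‿cong (C-zero* _ t₀≡0)) P.-0≈0)) (P.+-identityʳ _)) ⟩
          P.- (C c *ₚ (deriv F *ₚ H))                          P.≈⟨ P.-‿distribˡ-* (C c) _ ⟩
          (P.- C c) *ₚ (deriv F *ₚ H)                          P.≈⟨ P.*-congʳ (P.trans (P.sym (C-neg c)) (C-cong -c≡κ)) ⟩
          C κ *ₚ (deriv F *ₚ H)                                P.≈⟨ P.solve 3 (λ k F H → k P.:* (F P.:* H) P.:= H P.:* (k P.:* F)) P.refl (C κ) (deriv F) H ⟩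
          H *ₚ (C κ *ₚ deriv F)                                P.∎)
          where
          -c≡κ : - c ≡ κ
          -c≡κ = solve 2 (λ s t → :- ((con (pos 1) :+ con (pos 0) :- s) :* t) := t :* (s :- con (pos 1))) ≡.refl (ι s) t₁

        κ≢0 : κ ≢ 0#
        κ≢0 e = nH (P.trans H≋ (C-zero* _ e))

        FF″ : F *ₚ deriv (deriv F) ≋ C (ι s) *ₚ (deriv F *ₚ deriv F)
        FF″ = C*-cancelˡ κ≢0 (P.begin
          C κ *ₚ (F *ₚ deriv (deriv F))                P.≈⟨ P.solve 3 (λ k F g → k P.:* (F P.:* g) P.:= F P.:* (k P.:* g)) P.refl (C κ) F (deriv (deriv F)) ⟩
          F *ₚ (C κ *ₚ deriv (deriv F))                P.≈⟨ P.*-congˡ (P.trans (P.sym (P.trans (deriv-cong H≋) (deriv-C* κ (deriv F)))) b′≋) ⟩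
          F *ₚ (C (ι s) *ₚ C₁)                         P.≈⟨ P.solve 3 (λ F i k → F P.:* (i P.:* k) P.:= i P.:* (F P.:* k)) P.refl F (C (ι s)) C₁ ⟩
          C (ι s) *ₚ (F *ₚ C₁)                         P.≈⟨ P.*-congˡ (P.trans F′H (P.*-congˡ H≋)) ⟩
          C (ι s) *ₚ (deriv F *ₚ (C κ *ₚ deriv F))     P.≈⟨ P.solve 3 (λ i F k → i P.:* (F P.:* (k P.:* F)) P.:= k P.:* (i P.:* (F P.:* F))) P.refl (C (ι s)) (deriv F) (C κ) ⟩
          C κ *ₚ (C (ι s) *ₚ (deriv F *ₚ deriv F))     P.∎)

        hyp : Hyp F T
        hyp = record { 1≤d = 1≤d ; 3≤s = 3≤s ; bound = bound ; κ = κ ; κ≢0 = κ≢0 ; T0 = t₀≡0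
          ; TF = P.trans T∘F (P.trans (P.*-congˡ H≋) (P.solve 3 (λ R k F → R P.:* (k P.:* F) P.:= k P.:* (R P.:* F)) P.refl 𝕏q-𝕏 (C κ) (deriv F))) }

      result : Result T
      result = Initial.result hyp s ≡.refl FF″ tj

    -- p divides s, or F′H = C₁ (F + λ) for some λ.
    private
      division = divMod F nF (deriv F *ₚ H)
      C₁ C₀ : Poly
      C₁ = proj₁ division
      C₀ = proj₁ (proj₂ division)
      F′H≋ : deriv F *ₚ H ≋ C₁ *ₚ F +ₚ C₀
      F′H≋ = proj₁ (proj₂ (proj₂ division))

      ρ : Relation F
      ρ = relation 1≤d {a} {H} {𝕏 P.^ q} {T} {C₀} {C₁} relation-aH (deriv-p^ 𝕏 n n≥1) H<°
        (proj₂ (proj₂ (proj₂ division))) F′H≋ wr<2d 2≤s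
      open Comparison ρ using (b′≋; digit-≥2)

      t : ℕ → Fin q
      t = coeff T

    -- H′ = s C₁ = 0, so that -H = T′(F) F′. The digits of index at least 2 show that T′ has degree
    -- at most 1, and deg H < d then makes it constant.
    separable : ι s ≡ 0# → t 0 ≡ 0# → Result T
    separable ιs≡0 t₀≡0 = Initial.result hyp s ≡.refl FF″ (λ j 2≤j → ≡.trans (≡.cong (_* t j) (ιj-ιs j)) (h≡0 j 2≤j))
      where
      H′≋0 : deriv H ≋ []
      H′≋0 = P.trans b′≋ (C-zero* C₁ ιs≡0)
      ιj-ιs : ∀ j → ι j - ι s ≡ ι j
      ιj-ιs j = ≡.trans (≡.cong (λ x → ι j - x) ιs≡0) (≡.trans (≡.cong (ι j +_) -0≈0) (+-identityʳ (ι j)))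
      digit : ∀ j → 2 ℕ.≤ j → C (ι (suc j) * t (suc j)) *ₚ C₀ +ₚ C (ι j * t j) *ₚ C₁ ≋ []
      digit j le = P.trans (P.+-congˡ (P.*-congʳ (C-cong (≡.cong (_* t j) (≡.sym (ιj-ιs j)))))) (digit-≥2 j le)
      h≡0′ : ∀ j → 3 ℕ.≤ j → ι j * t j ≡ 0#
      h≡0′ = case (zero? C₁)
        where
        case : Dec (C₁ ≋ []) → ∀ j → 3 ℕ.≤ j → ι j * t j ≡ 0#
        case (yes z) (suc j) (s≤s 2≤j) = C*-cancel nC₀ (P.trans (P.sym (P.trans (P.+-congˡ (P.trans (P.*-congˡ z) (P.zeroʳ _))) (P.+-identityʳ _))) (digit j 2≤j))
          where
          nC₀ : C₀ ≋0̸
          nC₀ z₀ = *ₚ-≋0̸ nF′ nH (P.trans F′H≋ (P.trans (P.+-cong (P.trans (P.*-congʳ z) (P.zeroˡ F)) z₀) (P.+-identityˡ [])))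
        case (no nC₁) j 3≤j = down (suc s) j (ℕ.≤-trans (s≤s (s≤s z≤n)) 3≤j) (ℕ.m≤n+m (suc s) j)
          where
          down : ∀ k j → 2 ℕ.≤ j → s ℕ.< j ℕ.+ k → ι j * t j ≡ 0#
          down zero    j 2≤j lt = ≡.trans (≡.cong (ι j *_) (<°deg T j (≡.subst (s ℕ.<_) (ℕ.+-identityʳ j) lt))) (zeroʳ _)
          down (suc k) j 2≤j lt = C*-cancel nC₁ (P.trans (P.sym (P.trans (P.+-congʳ (C-zero* C₀ (down k (suc j) (ℕ.m≤n⇒m≤1+n 2≤j) (≡.subst (s ℕ.<_) (ℕ.+-suc j k) lt)))) (P.+-identityˡ _))) (digit j 2≤j))
      -H≋ : P.- H ≋ comp (deriv T) F *ₚ deriv F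
      -H≋ = P.sym (P.trans derived (P.trans (P.+-congʳ (P.trans (P.*-congˡ H′≋0) (P.zeroʳ 𝕏q-𝕏))) (P.+-identityˡ (P.- H))))
      T′≋ : deriv T ≋ C (t 1) +ₚ C (ι 2 * t 2) *ₚ 𝕏
      T′≋ = mk λ { zero → ≡.trans (coeff-deriv T 0) (≡.trans (≡.cong (_* t 1) ι1≈1) (≡.trans (*-identityˡ (t 1))
                     (≡.sym (≡.trans (val 0) (≡.trans (≡.cong (t 1 +_) (zeroʳ _)) (+-identityʳ _))))))
                 ; (suc zero) → ≡.trans (coeff-deriv T 1) (≡.sym (≡.trans (val 1) (≡.trans (+-identityˡ _) (*-identityʳ _))))
                 ; (suc (suc j)) → ≡.trans (coeff-deriv T (suc (suc j))) (≡.trans (h≡0′ (suc (suc (suc j))) (s≤s (s≤s (s≤s z≤n))))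
                     (≡.sym (≡.trans (val (suc (suc j))) (≡.trans (+-identityˡ _) (zeroʳ _))))) }
        where
        val : ∀ j → coeff (C (t 1) +ₚ C (ι 2 * t 2) *ₚ 𝕏) j ≡ coeff (C (t 1)) j + (ι 2 * t 2) * coeff 𝕏 j
        val j = ≡.trans (coeff-+ (C (t 1)) (C (ι 2 * t 2) *ₚ 𝕏) j) (≡.cong (coeff (C (t 1)) j +_) (coeff-C* (ι 2 * t 2) 𝕏 j))
      T′F≋ : comp (deriv T) F ≋ C (t 1) +ₚ C (ι 2 * t 2) *ₚ F
      T′F≋ = P.trans (comp-cong F T′≋) (P.trans (comp-+ (C (t 1)) (C (ι 2 * t 2) *ₚ 𝕏) F)
        (P.+-cong (comp-C (t 1) F) (P.trans (comp-C* (ι 2 * t 2) 𝕏 F) (P.*-congˡ (comp-𝕏 F)))))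
      -- With T′ of degree 1 the product T′(F) F′ = -H would have degree at least d.
      h₂≡0 : ι 2 * t 2 ≡ 0#
      h₂≡0 = case (ι 2 * t 2 Fin.≟ 0#)
        where
        case : Dec (ι 2 * t 2 ≡ 0#) → ι 2 * t 2 ≡ 0#
        case (yes e) = e
        case (no ne) = contradiction (ℕ.≤-trans (ℕ.m≤m+n d (deg (deriv F))) (ℕ.≤-reflexive (≡.trans (≡.cong (ℕ._+ deg (deriv F)) (≡.sym (≡.trans (proj₂ dom) dF)))
            (≡.trans (≡.sym (deg-* (proj₁ dom) nF′)) (≡.trans (deg-cong (P.sym (P.trans -H≋ (P.*-congʳ T′F≋)))) (deg-neg H)))))) (ℕ.<⇒≱ deg-H<d)
          where
          dF : deg (C (ι 2 * t 2) *ₚ F) ≡ d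
          dF = deg-C* ne nF
          dom : (C (t 1) +ₚ C (ι 2 * t 2) *ₚ F ≋0̸) × deg (C (t 1) +ₚ C (ι 2 * t 2) *ₚ F) ≡ deg (C (ι 2 * t 2) *ₚ F)
          dom = +-dominant {C (t 1)} {C (ι 2 * t 2) *ₚ F} (<°-mono (C (t 1)) (≡.subst (1 ℕ.≤_) (≡.sym dF) 1≤d) (<°-C (t 1))) (*ₚ-≋0̸ (C≋0̸ ne) nF)
      h≡0 : ∀ j → 2 ℕ.≤ j → ι j * t j ≡ 0#
      h≡0 (suc zero) (s≤s ())
      h≡0 (suc (suc zero)) _ = h₂≡0
      h≡0 (suc (suc (suc j))) _ = h≡0′ (suc (suc (suc j))) (s≤s (s≤s (s≤s z≤n)))
      κ : Fin q
      κ = t 1 * (ι s - 1#)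
      κ≡ : κ ≡ - t 1
      κ≡ = ≡.trans (≡.cong (λ x → t 1 * (x - 1#)) ιs≡0) (solve 1 (λ t → t :* (con (pos 0) :- con (pos 1)) := :- t) ≡.refl (t 1))
      H≋ : H ≋ C κ *ₚ deriv F
      H≋ = P.begin
        H                                      P.≈⟨ P.-‿involutive H ⟨
        P.- (P.- H)                            P.≈⟨ P.-‿cong (P.trans -H≋ (P.*-congʳ (P.trans T′F≋ (P.trans (P.+-congˡ (C-zero* F h₂≡0)) (P.+-identityʳ _))))) ⟩
        P.- (C (t 1) *ₚ deriv F)               P.≈⟨ P.trans (P.-‿distribˡ-* (C (t 1)) (deriv F)) (P.*-congʳ (P.trans (P.sym (C-neg (t 1))) (C-cong (≡.sym κ≡)))) ⟩
        C κ *ₚ deriv F                         P.∎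
      κ≢0 : κ ≢ 0#
      κ≢0 e = nH (P.trans H≋ (C-zero* _ e))
      FF″ : F *ₚ deriv (deriv F) ≋ C (ι s) *ₚ (deriv F *ₚ deriv F)
      FF″ = P.trans (P.trans (P.*-congˡ (C*-cancelˡ κ≢0 (P.trans (P.sym (P.trans (deriv-cong H≋) (deriv-C* κ (deriv F)))) (P.trans H′≋0 (P.sym (P.zeroʳ (C κ))))))) (P.zeroʳ F))
        (P.sym (C-zero* _ ιs≡0))
      hyp : Hyp F T
      hyp = record { 1≤d = 1≤d ; 3≤s = 3≤s ; bound = bound ; κ = κ ; κ≢0 = κ≢0 ; T0 = t₀≡0
        ; TF = P.trans T∘F (P.trans (P.*-congˡ H≋) (P.solve 3 (λ R k F → R P.:* (k P.:* F) P.:= k P.:* (R P.:* F)) P.refl 𝕏q-𝕏 (C κ) (deriv F))) }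

    -- C₀ = λ C₁ by the digit of index s - 1. Since s ≥ 3, this index is at least 2 and the digit
    -- involves no part of the Wronskian.
    linear-factor : ι s ≢ 0# → ∃[ lam ] deriv F *ₚ H ≋ C₁ *ₚ (F +ₚ C lam)
    linear-factor ne = lam , P.trans F′H≋ (P.trans (P.+-congˡ (P.trans C₀≋ (P.*-comm (C lam) C₁))) (P.sym (P.distribˡ C₁ F (C lam))))
      where
      r = ℕ.pred s
      s≡ : suc r ≡ s
      s≡ = ℕ.suc-pred s {{ℕ.>-nonZero (ℕ.≤-trans (s≤s z≤n) 3≤s)}}
      lead = ι s * t s
      lead≢0 : lead ≢ 0#
      lead≢0 = *-≉0 ne (lead≉0 T nT)
      l⁻¹ = proj₁ (invert lead lead≢0)
      lam = l⁻¹ * t r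
      top : C lead *ₚ C₀ ≋ C (t r) *ₚ C₁
      top = P.x-y≈0⇒x≈y (P.begin
        C lead *ₚ C₀ P.- C (t r) *ₚ C₁
          P.≈⟨ P.solve 3 (λ u g c → u P.:- g P.:* c P.:= u P.:+ (P.:- g) P.:* c) P.refl (C lead *ₚ C₀) (C (t r)) C₁ ⟩
        C lead *ₚ C₀ +ₚ (P.- C (t r)) *ₚ C₁
          P.≈⟨ P.+-cong (P.*-congʳ (C-cong (≡.cong (λ m → ι m * t m) (≡.sym s≡)))) (P.*-congʳ (P.trans (P.sym (C-neg (t r))) (C-cong minus))) ⟩
        C (ι (suc r) * t (suc r)) *ₚ C₀ +ₚ C ((ι r - ι s) * t r) *ₚ C₁
          P.≈⟨ digit-≥2 r (ℕ.≤-pred (≡.subst (3 ℕ.≤_) (≡.sym s≡) 3≤s)) ⟩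
        [] P.∎)
        where
        minus : - t r ≡ (ι r - ι s) * t r
        minus = ≡.trans (solve 2 (λ i x → :- x := (i :- (con (pos 1) :+ i)) :* x) ≡.refl (ι r) (t r))
          (≡.cong (λ m → (ι r - ι m) * t r) s≡)
      C₀≋ : C₀ ≋ C lam *ₚ C₁
      C₀≋ = P.trans (P.sym (C-inv lead≢0 C₀)) (P.trans (P.*-congˡ top) (C*C* l⁻¹ (t r) C₁))

    quotient : Poly
    quotient = C₁

  -- If p does not divide s, the translation that makes C₀ vanish is determined, and that the
  -- translate of T vanishes at 0 is then derived. If p divides s, no translation is made and T(0) =
  -- 0 is taken from the hypothesis.
  shape : (F T : Poly) → 1 ℕ.≤ deg F → 3 ℕ.≤ deg T → ℕ.pred (deg T) ℕ.* deg F ℕ.< q →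
          (∀ x → eval T (eval F x) ≡ 0#) → coeff T 0 ≡ 0# → Result T
  shape F T 1≤d 3≤s bound vanish T0 = case (ι (deg T) Fin.≟ 0#)
    where
    factor : ∃[ H ] comp T F ≋ 𝕏q-𝕏 *ₚ H
    factor = vanishing⇒𝕏q-𝕏∣ (comp T F) (λ x → ≡.trans (eval-comp T F x) (vanish x))
    H = proj₁ factor
    module D₀ = Division F T 1≤d 3≤s bound H (proj₂ factor)
    case : Dec (ι (deg T) ≡ 0#) → Result T
    case (yes e) = D₀.separable e T0
    case (no ne) = shifted-result lam D₀.nT (D₁.Homogeneous.result D₀.quotient F̃′H (λ e → ne (≡.trans (≡.cong ι (≡.sym dT)) e)))
      where
      lam = proj₁ (D₀.linear-factor ne)
      dF = deg-F+C F lam 1≤d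
      dT = deg-shift T lam D₀.nT
      module D₁ = Division (F +ₚ C lam) (shift T lam) (≡.subst (1 ℕ.≤_) (≡.sym dF) 1≤d) (≡.subst (3 ℕ.≤_) (≡.sym dT) 3≤s)
        (≡.subst₂ (λ s d → ℕ.pred s ℕ.* d ℕ.< q) (≡.sym dT) (≡.sym dF) bound) H (P.trans (comp-shift T lam F) (proj₂ factor))
      F̃′H : (F +ₚ C lam) *ₚ D₀.quotient ≋ deriv (F +ₚ C lam) *ₚ H
      F̃′H = P.trans (P.*-comm (F +ₚ C lam) D₀.quotient) (P.trans (P.sym (proj₂ (D₀.linear-factor ne))) (P.*-congʳ (P.sym (deriv-F+C F lam))))

  -- Linearised operators, subfields and subspaces.

  open import Relation.Unary using (Decidable)
  open import Relation.Nullary.Decidable using (yes; no; _×-dec_; ¬?)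

  x^-shift : ∀ (x : Fin q) P i → x ^ (P ℕ.^ suc i) ≡ (x ^ P) ^ (P ℕ.^ i)
  x^-shift x P i = ≡.sym (^-assocʳ x P (P ℕ.^ i))

  sumTo : ℕ → (ℕ → Fin q) → Fin q
  sumTo zero    g = g 0
  sumTo (suc m) g = sumTo m g + g (suc m)

  sumTo-cong : ∀ m {g h : ℕ → Fin q} → (∀ i → g i ≡ h i) → sumTo m g ≡ sumTo m h
  sumTo-cong zero    e = e 0
  sumTo-cong (suc m) e = ≡.cong₂ _+_ (sumTo-cong m e) (e (suc m))

  sumTo-+ : ∀ m (g h : ℕ → Fin q) → sumTo m (λ i → g i + h i) ≡ sumTo m g + sumTo m h
  sumTo-+ zero    g h = ≡.refl
  sumTo-+ (suc m) g h = ≡.trans (≡.cong (_+ (g (suc m) + h (suc m))) (sumTo-+ m g h))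
    (solve 4 (λ a b c d → (a :+ b) :+ (c :+ d) := (a :+ c) :+ (b :+ d)) ≡.refl _ _ _ _)

  sumTo-* : ∀ m c (g : ℕ → Fin q) → sumTo m (λ i → c * g i) ≡ c * sumTo m g
  sumTo-* zero    c g = ≡.refl
  sumTo-* (suc m) c g = ≡.trans (≡.cong (_+ c * g (suc m)) (sumTo-* m c g)) (≡.sym (distribˡ c _ _))

  sumTo-suc : ∀ m (g : ℕ → Fin q) → sumTo (suc m) g ≡ g 0 + sumTo m (λ i → g (suc i))
  sumTo-suc zero    g = ≡.refl
  sumTo-suc (suc m) g = ≡.trans (≡.cong (_+ g (suc (suc m))) (sumTo-suc m g)) (+-assoc _ _ _)

  -- P-linearised polynomials, P = p^k, as functions.
  module Linearised (k : ℕ) where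

    Pₖ : ℕ
    Pₖ = p ℕ.^ k

    Pₖ^ : ∀ i → Pₖ ℕ.^ i ≡ p ℕ.^ (k ℕ.* i)
    Pₖ^ i = ℕ.^-*-assoc p k i

    frob^ : ∀ i x y → (x + y) ^ (Pₖ ℕ.^ i) ≡ x ^ (Pₖ ℕ.^ i) + y ^ (Pₖ ℕ.^ i)
    frob^ i x y = ≡.subst (λ m → (x + y) ^ m ≡ x ^ m + y ^ m) (≡.sym (Pₖ^ i)) (Frob.frobenius^ (k ℕ.* i) x y)

    op : ℕ → (ℕ → Fin q) → Fin q → Fin q
    op m a z = sumTo m (λ i → a i * z ^ (Pₖ ℕ.^ i))

    op-+ : ∀ m a x y → op m a (x + y) ≡ op m a x + op m a y
    op-+ m a x y = ≡.trans (sumTo-cong m (λ i → ≡.trans (≡.cong (a i *_) (frob^ i x y)) (distribˡ _ _ _))) (sumTo-+ m _ _)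

    Fixed : Fin q → Set
    Fixed c = c ^ Pₖ ≡ c

    Fixed? : Decidable Fixed
    Fixed? c = c ^ Pₖ Fin.≟ c

    fixed^ : ∀ {c} → Fixed c → ∀ i → c ^ (Pₖ ℕ.^ i) ≡ c
    fixed^ {c} e zero    = *-identityʳ c
    fixed^ {c} e (suc i) = ≡.trans (x^-shift c Pₖ i) (≡.trans (^-congˡ (Pₖ ℕ.^ i) e) (fixed^ e i))

    op-* : ∀ m a {c} → Fixed c → ∀ z → op m a (c * z) ≡ c * op m a z
    op-* m a {c} e z = ≡.trans (sumTo-cong m (λ i → ≡.trans (≡.cong (a i *_) (≡.trans (^-distrib-* c z (Pₖ ℕ.^ i)) (≡.cong (_* z ^ (Pₖ ℕ.^ i)) (fixed^ e i))))
      (solve 3 (λ a c z → a :* (c :* z) := c :* (a :* z)) ≡.refl (a i) c (z ^ (Pₖ ℕ.^ i))))) (sumTo-* m c _)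

    op-dilate : ∀ m a u z → op m a (u * z) ≡ op m (λ i → a i * u ^ (Pₖ ℕ.^ i)) z
    op-dilate m a u z = sumTo-cong m (λ i → ≡.trans (≡.cong (a i *_) (^-distrib-* u z (Pₖ ℕ.^ i))) (≡.sym (*-assoc _ _ _)))

    op-suc : ∀ m a z → op (suc m) a z ≡ a 0 * z + op m (λ i → a (suc i)) (z ^ Pₖ)
    op-suc m a z = ≡.trans (sumTo-suc m _) (≡.cong₂ _+_ (≡.cong (a 0 *_) (*-identityʳ z))
      (sumTo-cong m (λ i → ≡.cong (a (suc i) *_) (x^-shift z Pₖ i))))

    -- Division by Φ − 1, where Φ z = z^P.
    tails : ℕ → (ℕ → Fin q) → ℕ → Fin q
    tails m a zero    = sumTo m (λ i → a (suc i))
    tails (suc m) a (suc i) = tails m (λ i → a (suc i)) i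
    tails zero    a (suc i) = 0#

    tails-top : ∀ m a → tails m a m ≡ a (suc m)
    tails-top zero    a = ≡.refl
    tails-top (suc m) a = tails-top m (λ i → a (suc i))

    -- Division with remainder, where the remainder is the value of the operator at 1.
    op-divide : ∀ m a z → op (suc m) a z ≡ op m (tails m a) (z ^ Pₖ - z) + sumTo (suc m) a * z
    op-divide zero a z = begin
      a 0 * (z * 1#) + a 1 * z ^ (Pₖ ℕ.* 1)     ≡⟨ ≡.cong₂ (λ x y → a 0 * x + a 1 * y) (*-identityʳ z) (≡.cong (z ^_) (ℕ.*-identityʳ Pₖ)) ⟩
      a 0 * z + a 1 * z ^ Pₖ                    ≡⟨ solve 4 (λ a b z w → a :* z :+ b :* w := b :* ((w :- z) :* con (pos 1)) :+ (a :+ b) :* z) ≡.refl (a 0) (a 1) z (z ^ Pₖ) ⟩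
      a 1 * ((z ^ Pₖ - z) * 1#) + (a 0 + a 1) * z ∎
    op-divide (suc m) a z = begin
      op (suc (suc m)) a z
        ≡⟨ op-suc (suc m) a z ⟩
      a 0 * z + op (suc m) a′ w
        ≡⟨ ≡.cong (a 0 * z +_) (op-divide m a′ w) ⟩
      a 0 * z + (op m c′ (w ^ Pₖ - w) + σ * w)
        ≡⟨ ≡.cong (λ x → a 0 * z + (op m c′ x + σ * w)) (≡.sym (frob-sub w z)) ⟩
      a 0 * z + (op m c′ ((w - z) ^ Pₖ) + σ * w)
        ≡⟨ solve 5 (λ a z u s w → a :* z :+ (u :+ s :* w) := (s :* (w :- z) :+ u) :+ (a :+ s) :* z) ≡.refl (a 0) z (op m c′ ((w - z) ^ Pₖ)) σ w ⟩
      (σ * (w - z) + op m c′ ((w - z) ^ Pₖ)) + (a 0 + σ) * z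
        ≡⟨ ≡.cong₂ (λ x y → x + y * z) (≡.sym (op-suc m (tails (suc m) a) (w - z))) (≡.sym (sumTo-suc (suc m) a)) ⟩
      op (suc m) (tails (suc m) a) (w - z) + sumTo (suc (suc m)) a * z ∎
      where
      a′ : ℕ → Fin q
      a′ i = a (suc i)
      c′ = tails m a′
      w = z ^ Pₖ
      σ = sumTo (suc m) a′
      frob-sub : ∀ x z → (x - z) ^ Pₖ ≡ x ^ Pₖ - z ^ Pₖ
      frob-sub x z = Frob.frobenius-sub k x z

    #-ker : ∀ m a → a m ≢ 0# → # (λ z → op m a z Fin.≟ 0#) ℕ.≤ # Fixed? ℕ.^ m
    #-ker zero a ne = ℕ.≤-reflexive (#-unique (λ z → op 0 a z Fin.≟ 0#) 0# (≡.trans (≡.cong (a 0 *_) (zeroˡ 1#)) (zeroʳ _))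
      (λ z e → ≡.trans (≡.sym (*-identityʳ z)) (*-cancel-0 ne e)))
    #-ker (suc m) a ne = case (Fin.any? (λ z → (op (suc m) a z Fin.≟ 0#) ×-dec ¬? (z Fin.≟ 0#)))
      where
      N = # Fixed?
      1≤N : 1 ℕ.≤ N
      1≤N = ℕ.≤-trans (ℕ.≤-reflexive (≡.sym (#-unique (Fin._≟ 1#) 1# ≡.refl (λ _ e → e))))
        (#-mono (Fin._≟ 1#) Fixed? (λ { _ ≡.refl → 1^ Pₖ }))
      case : Dec _ → # (λ z → op (suc m) a z Fin.≟ 0#) ℕ.≤ N ℕ.^ suc m
      case (no none) = ℕ.≤-trans (#-mono (λ z → op (suc m) a z Fin.≟ 0#) (Fin._≟ 0#) only) (ℕ.≤-trans
        (ℕ.≤-reflexive (#-unique (Fin._≟ 0#) 0# ≡.refl (λ _ e → e))) (≡.subst (ℕ._≤ N ℕ.^ suc m) (ℕ.^-zeroˡ (suc m)) (ℕ.^-monoˡ-≤ (suc m) 1≤N)))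
        where
        only : ∀ z → op (suc m) a z ≡ 0# → z ≡ 0#
        only z e = split (z Fin.≟ 0#)
          where
          split : Dec (z ≡ 0#) → z ≡ 0#
          split (yes z≡0) = z≡0
          split (no nz)   = contradiction (z , e , nz) none
      -- As with roots of polynomials: scaling moves a nonzero kernel element u to 1, which makes
      -- the remainder zero. The operator then factors through z^P - z, whose fibres have at most N
      -- elements, and the quotient has order one less.
      case (yes (u , e , u≢0)) = ℕ.≤-trans (ℕ.≤-reflexive (#-permute (λ z → op (suc m) a z Fin.≟ 0#) (dilation u u≢0)))
        (ℕ.≤-trans (#-mono (λ z → op (suc m) a (u * z) Fin.≟ 0#) (λ z → op (suc m) a′ z Fin.≟ 0#) (λ z e → ≡.trans (≡.sym (op-dilate (suc m) a u z)) e))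
        (ℕ.≤-trans (Fibres.#-fibres-≤ (λ z → op (suc m) a′ z Fin.≟ 0#) (λ z → z ^ Pₖ - z) (λ w → op m c w Fin.≟ 0#) N in-ker small)
          (ℕ.*-monoʳ-≤ N (#-ker m c top))))
        where
        a′ : ℕ → Fin q
        a′ i = a i * u ^ (Pₖ ℕ.^ i)
        c = tails m a′
        top : c m ≢ 0#
        top = ≡.subst (_≢ 0#) (≡.sym (tails-top m a′)) (*-≉0 ne (^-≉0 (Pₖ ℕ.^ suc m) u≢0))
        Σa′ : sumTo (suc m) a′ ≡ 0#
        Σa′ = ≡.trans (sumTo-cong (suc m) (λ i → ≡.sym (≡.trans (≡.cong (a′ i *_) (1^ (Pₖ ℕ.^ i))) (*-identityʳ _))))
          (≡.trans (≡.sym (op-dilate (suc m) a u 1#)) (≡.trans (≡.cong (op (suc m) a) (*-identityʳ u)) e))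
        in-ker : ∀ z → op (suc m) a′ z ≡ 0# → op m c (z ^ Pₖ - z) ≡ 0#
        in-ker z e = ≡.trans (≡.trans (≡.sym (+-identityʳ _)) (≡.cong (op m c (z ^ Pₖ - z) +_) (≡.sym (≡.trans (≡.cong (_* z) Σa′) (zeroˡ z)))))
          (≡.trans (≡.sym (op-divide m a′ z)) e)
        open Fibres (λ z → op (suc m) a′ z Fin.≟ 0#) (λ z → z ^ Pₖ - z) using (fibre?)
        -- Two elements of one fibre of z ↦ z^P - z differ by a fixed element of Frobenius.
        small : ∀ y → op m c y ≡ 0# → # (fibre? y) ℕ.≤ N
        small y _ = split (Fin.any? (fibre? y))
          where
          split : Dec _ → # (fibre? y) ℕ.≤ N
          split (no none) = ℕ.≤-trans (ℕ.≤-reflexive (#-empty (fibre? y) (λ z h → none (z , h)))) z≤n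
          split (yes (z₀ , _ , e₀)) = ℕ.≤-trans (ℕ.≤-reflexive (#-permute (fibre? y) (translation z₀)))
              (#-mono (λ z → fibre? y (z₀ + z)) Fixed? fixed)
            where
            fixed : ∀ z → _ × (z₀ + z) ^ Pₖ - (z₀ + z) ≡ y → z ^ Pₖ ≡ z
            fixed z (_ , e) = x-y≈0⇒x≈y (begin
              z ^ Pₖ - z                                        ≡⟨ solve 4 (λ a b z w → w :- z := ((a :+ w) :- (b :+ z)) :- (a :- b)) ≡.refl (z₀ ^ Pₖ) z₀ z (z ^ Pₖ) ⟩
              (z₀ ^ Pₖ + z ^ Pₖ - (z₀ + z)) - (z₀ ^ Pₖ - z₀)    ≡⟨ ≡.cong₂ (λ x y → (x - (z₀ + z)) - y) (≡.sym (Frob.frobenius^ k z₀ z)) e₀ ⟩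
              ((z₀ + z) ^ Pₖ - (z₀ + z)) - y                    ≡⟨ ≡.cong (_- y) e ⟩
              y - y                                             ≡⟨ -‿inverseʳ y ⟩
              0#                                                ∎)

  record Subfield : Set₁ where
    field
      L     : Fin q → Set
      L?    : Decidable L
      1∈L   : L 1#
      +-L   : ∀ {x y} → L x → L y → L (x + y)
      neg-L : ∀ {x} → L x → L (- x)
      *-L   : ∀ {x y} → L x → L y → L (x * y)
      inv-L : ∀ {x y} → L x → x * y ≡ 1# → L y

    0∈L : L 0#
    0∈L = ≡.subst L (-‿inverseʳ 1#) (+-L 1∈L (neg-L 1∈L))

  module Subspaces (𝕃 : Subfield) where
    open Subfield 𝕃 public

    record Subspace : Set₁ where
      field
        W    : Fin q → Set
        W?   : Decidable W
        0∈W  : W 0#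
        +-W  : ∀ {x y} → W x → W y → W (x + y)
        *-W  : ∀ {c x} → L c → W x → W (c * x)

      neg-W : ∀ {x} → W x → W (- x)
      neg-W {x} w = ≡.subst W (≡.trans (≡.sym (-‿distribˡ-* 1# x)) (≡.cong -_ (*-identityˡ x))) (*-W (neg-L 1∈L) w)

      sub-W : ∀ {x y} → W x → W y → W (x - y)
      sub-W w w′ = +-W w (neg-W w′)

    open Subspace

    size : Subspace → ℕ
    size V = # (W? V)

    zeroSpace : Subspace
    zeroSpace = record
      { W = _≡ 0# ; W? = Fin._≟ 0# ; 0∈W = ≡.refl
      ; +-W = λ { ≡.refl ≡.refl → +-identityˡ 0# } ; *-W = λ { {c} _ ≡.refl → zeroʳ c } }

    extend : Subspace → Fin q → Subspace
    extend V u = record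
      { W = λ z → ∃[ c ] L c × W V (z - c * u)
      ; W? = λ z → Fin.any? (λ c → L? c ×-dec W? V (z - c * u))
      ; 0∈W = 0# , 0∈L , ≡.subst (W V) (solve 1 (λ u → con (pos 0) := con (pos 0) :- con (pos 0) :* u) ≡.refl u) (0∈W V)
      ; +-W = λ { {x} {y} (c , c∈ , w) (c′ , c′∈ , w′) → c + c′ , +-L c∈ c′∈ , ≡.subst (W V)
          (solve 5 (λ x y c c′ u → (x :- c :* u) :+ (y :- c′ :* u) := (x :+ y) :- (c :+ c′) :* u) ≡.refl x y c c′ u) (+-W V w w′) }
      ; *-W = λ { {e} {x} e∈ (c , c∈ , w) → e * c , *-L e∈ c∈ , ≡.subst (W V)
          (solve 4 (λ e x c u → e :* (x :- c :* u) := e :* x :- (e :* c) :* u) ≡.refl e x c u) (*-W V e∈ w) } }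

    extend-⊃ : ∀ V u z → W V z → W (extend V u) z
    extend-⊃ V u z w = 0# , 0∈L , ≡.subst (W V) (solve 2 (λ z u → z := z :- con (pos 0) :* u) ≡.refl z u) w

    -- As u ∉ V, every element is w + c u for unique w in V and c in L. The fibres of the coordinate
    -- c are translates of V.
    size-extend : ∀ V u → ¬ W V u → size (extend V u) ≡ size V ℕ.* # L?
    size-extend V u u∉ = ℕ.≤-antisym (#-fibres-≤ L? (size V) coordinate∈L (λ c c∈ → ℕ.≤-reflexive (fibre-size c c∈)))
        (#-fibres-≥ L? (size V) (λ c c∈ → ℕ.≤-reflexive (≡.sym (fibre-size c c∈))))
      where
      pick : ∀ z → Dec (W (extend V u) z) → Fin q
      pick z (yes (c , _)) = c
      pick z (no _)        = 0#
      coordinate : Fin q → Fin q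
      coordinate z = pick z (W? (extend V u) z)
      open Fibres (W? (extend V u)) coordinate
      pick∈L : ∀ z (d : Dec (W (extend V u) z)) → L (pick z d)
      pick∈L z (yes (_ , c∈ , _)) = c∈
      pick∈L z (no _)             = 0∈L
      coordinate∈L : ∀ z → W (extend V u) z → L (coordinate z)
      coordinate∈L z _ = pick∈L z (W? (extend V u) z)
      unique : ∀ {z c c′} → L c → L c′ → W V (z - c * u) → W V (z - c′ * u) → c ≡ c′
      unique {z} {c} {c′} c∈ c′∈ w w′ = split (c - c′ Fin.≟ 0#)
        where
        split : Dec (c - c′ ≡ 0#) → c ≡ c′
        split (yes e) = x-y≈0⇒x≈y e
        split (no ne) = contradiction (≡.subst (W V) eq (*-W V (inv-L (+-L c∈ (neg-L c′∈)) (proj₂ inverse)) (sub-W V w′ w))) u∉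
          where
          inverse = invert (c - c′) ne
          i = proj₁ inverse
          eq : i * ((z - c′ * u) - (z - c * u)) ≡ u
          eq = ≡.trans (solve 5 (λ i z c c′ u → i :* ((z :- c′ :* u) :- (z :- c :* u)) := ((c :- c′) :* i) :* u) ≡.refl i z c c′ u)
            (≡.trans (≡.cong (_* u) (proj₂ inverse)) (*-identityˡ u))
      pick-unique : ∀ z c → L c → W V (z - c * u) → (d : Dec (W (extend V u) z)) → pick z d ≡ c
      pick-unique z c c∈ w (yes (c′ , c′∈ , w′)) = unique c′∈ c∈ w′ w
      pick-unique z c c∈ w (no nw)               = contradiction (c , c∈ , w) nw
      pick-spec : ∀ z (d : Dec (W (extend V u) z)) → W (extend V u) z → W V (z - pick z d * u)
      pick-spec z (yes (_ , _ , w)) _ = w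
      pick-spec z (no nw)           w = contradiction w nw
      fibre-size : ∀ c → L c → # (fibre? c) ≡ size V
      fibre-size c c∈ = ≡.trans (#-cong (fibre? c) (λ z → W? V (- (c * u) + z))
          (λ z (w , e) → ≡.subst (W V) (≡.trans (≡.cong (λ c → z - c * u) e) (+-comm z _)) (pick-spec z (W? (extend V u) z) w))
          (λ z w → let w′ = ≡.subst (W V) (+-comm _ z) w in (c , c∈ , w′) , pick-unique z c c∈ w′ (W? (extend V u) z)))
        (≡.sym (#-permute (W? V) (translation (- (c * u)))))

    -- Missing vectors are adjoined until the size of `U` is reached; size U is fuel enough, since
    -- each extension is strictly larger. The final space agrees with `U` only pointwise, so its
    -- invariant still has to be carried over.
    chain : (Inv : Subspace → Set) → (∀ V u → ¬ W V u → Inv V → Inv (extend V u)) →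
            ∀ V U → (∀ z → W V z → W U z) → Inv V → ∃[ V′ ] Inv V′ × (∀ z → W V′ z → W U z) × (∀ z → W U z → W V′ z)
    chain Inv step V U V⊂U inv = go (size U) V V⊂U inv (ℕ.m≤n+m (size U) (size V))
      where
      go : ∀ fuel V → (∀ z → W V z → W U z) → Inv V → size U ℕ.≤ size V ℕ.+ fuel →
           ∃[ V′ ] Inv V′ × (∀ z → W V′ z → W U z) × (∀ z → W U z → W V′ z)
      go fuel V V⊂U inv enough = case fuel enough (size V ℕ.<? size U)
        where
        case : ∀ fuel → size U ℕ.≤ size V ℕ.+ fuel → Dec (size V ℕ.< size U) → _
        case _ _ (no nlt) = V , inv , V⊂U , #-full-subset (W? V) (W? U) V⊂U (ℕ.≮⇒≥ nlt)
        case zero enough (yes lt) = contradiction (≡.subst (size U ℕ.≤_) (ℕ.+-identityʳ _) enough) (ℕ.<⇒≱ lt)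
        case (suc fuel) enough (yes lt) = go fuel (extend V u) ext⊂U (step V u u∉ inv)
            (ℕ.≤-trans enough (ℕ.≤-trans (ℕ.≤-reflexive (ℕ.+-suc (size V) fuel)) (ℕ.+-monoˡ-≤ fuel bigger)))
          where
          new = #<⇒∃ (W? V) (W? U) lt
          u = proj₁ new
          u∉ : ¬ W V u
          u∉ = proj₂ (proj₂ new)
          ext⊂U : ∀ z → W (extend V u) z → W U z
          ext⊂U z (c , c∈ , w) = ≡.subst (W U) (solve 3 (λ z c u → (z :- c :* u) :+ c :* u := z) ≡.refl z c u)
            (+-W U (V⊂U _ w) (*-W U c∈ (proj₁ (proj₂ new))))
          bigger : size V ℕ.< size (extend V u)
          bigger = ℕ.≰⇒> λ le → u∉ (#-full-subset (W? V) (W? (extend V u)) (extend-⊃ V u) le u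
            (1# , 1∈L , ≡.subst (W V) (solve 1 (λ u → con (pos 0) := u :- con (pos 1) :* u) ≡.refl u) (0∈W V)))

    size-power : ∀ U → ∃[ j ] size U ≡ # L? ℕ.^ j
    size-power U = finish (chain (λ V → ∃[ j ] size V ≡ # L? ℕ.^ j) step zeroSpace U (λ { _ ≡.refl → 0∈W U })
        (0 , #-unique (W? zeroSpace) 0# ≡.refl (λ _ e → e)))
      where
      step : ∀ V u → ¬ W V u → ∃[ j ] size V ≡ # L? ℕ.^ j → ∃[ j ] size (extend V u) ≡ # L? ℕ.^ j
      step V u u∉ (j , e) = suc j , ≡.trans (size-extend V u u∉) (≡.trans (≡.cong (ℕ._* # L?) e) (ℕ.*-comm _ (# L?)))
      finish : ∃[ V′ ] (∃[ j ] size V′ ≡ # L? ℕ.^ j) × (∀ z → W V′ z → W U z) × (∀ z → W U z → W V′ z) → ∃[ j ] size U ≡ # L? ℕ.^ j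
      finish (V′ , (j , e) , V′⊂U , U⊂V′) = j , ≡.trans (#-cong (W? U) (W? V′) U⊂V′ V′⊂U) e

  -- It may have fewer than p^k elements, as k is not assumed to divide n.
  fixedField : ℕ → Subfield
  fixedField k = record
    { L = Fixed ; L? = Fixed? ; 1∈L = 1^ Pₖ
    ; +-L = λ {x} {y} e e′ → ≡.trans (Frob.frobenius^ k x y) (≡.cong₂ _+_ e e′)
    ; neg-L = λ {x} e → ≡.trans (Frob.frobenius-neg k x) (≡.cong -_ e)
    ; *-L = λ {x} {y} e e′ → ≡.trans (^-distrib-* x y Pₖ) (≡.cong₂ _*_ e e′)
    ; inv-L = λ {x} {y} e xy≡1 → unique {x} {y ^ Pₖ} {y} (≡.trans (≡.cong (_* y ^ Pₖ) (≡.sym e)) (≡.trans (≡.sym (^-distrib-* x y Pₖ)) (≡.trans (^-congˡ Pₖ xy≡1) (1^ Pₖ)))) xy≡1 }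
    where
    open Linearised k
    unique : ∀ {x y z} → x * y ≡ 1# → x * z ≡ 1# → y ≡ z
    unique {x} {y} {z} xy xz = begin
      y            ≡⟨ *-identityʳ y ⟨
      y * 1#       ≡⟨ ≡.cong (y *_) xz ⟨
      y * (x * z)  ≡⟨ solve 3 (λ x y z → y :* (x :* z) := (x :* y) :* z) ≡.refl x y z ⟩
      (x * y) * z  ≡⟨ ≡.trans (≡.cong (_* z) xy) (*-identityˡ z) ⟩
      z            ∎

  -- Power cosets and the binomial case.

  open import Data.Nat.Divisibility using (_∣_; divides; ∣m+n∣m⇒∣n; ∣⇒≤; n∣m*n; m∣m*n)
  open import Data.Nat.GCD using (gcd; gcd-GCD; gcd[m,n]∣m; gcd[m,n]∣n; module Bézout)

  ^-gcd : ∀ {x} a b → x ≢ 0# → x ^ a ≡ 1# → x ^ b ≡ 1# → x ^ gcd a b ≡ 1#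
  ^-gcd {x} a b x≢0 ea eb = case (Bézout.identity (gcd-GCD a b))
    where
    g = gcd a b
    mult : ∀ y a → x ^ a ≡ 1# → x ^ (y ℕ.* a) ≡ 1#
    mult y a e = ≡.trans (≡.cong (x ^_) (ℕ.*-comm y a)) (≡.trans (≡.sym (^-assocʳ x a y)) (≡.trans (^-congˡ y e) (1^ y)))
    descend : ∀ y z a b → g ℕ.+ y ℕ.* b ≡ z ℕ.* a → x ^ a ≡ 1# → x ^ b ≡ 1# → x ^ g ≡ 1#
    descend y z a b e ea eb = begin
      x ^ g                      ≡⟨ *-identityʳ _ ⟨
      x ^ g * 1#                 ≡⟨ ≡.cong (x ^ g *_) (mult y b eb) ⟨
      x ^ g * x ^ (y ℕ.* b)      ≡⟨ ^-homo-* x g (y ℕ.* b) ⟨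
      x ^ (g ℕ.+ y ℕ.* b)        ≡⟨ ≡.cong (x ^_) e ⟩
      x ^ (z ℕ.* a)              ≡⟨ mult z a ea ⟩
      1#                         ∎
    case : Bézout.Identity g a b → x ^ g ≡ 1#
    case (Bézout.+- z y e) = descend y z a b e ea eb
    case (Bézout.-+ z y e) = descend z y b a e eb ea

  -- The exponents of the Frobenius powers fixing x are closed under gcd; a Bézout identity in
  -- natural numbers avoids inverting Frobenius.
  frobenius-gcd : ∀ {x} a b → x ^ (p ℕ.^ a) ≡ x → x ^ (p ℕ.^ b) ≡ x → x ^ (p ℕ.^ gcd a b) ≡ x
  frobenius-gcd {x} a b ea eb = case (Bézout.identity (gcd-GCD a b))
    where
    g = gcd a b
    mult : ∀ y a → x ^ (p ℕ.^ a) ≡ x → x ^ (p ℕ.^ (y ℕ.* a)) ≡ x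
    mult zero    a e = *-identityʳ x
    mult (suc y) a e = ≡.trans (≡.cong (x ^_) (ℕ.^-distribˡ-+-* p a (y ℕ.* a)))
      (≡.trans (≡.sym (^-assocʳ x (p ℕ.^ a) (p ℕ.^ (y ℕ.* a)))) (≡.trans (^-congˡ (p ℕ.^ (y ℕ.* a)) e) (mult y a e)))
    descend : ∀ y z a b → g ℕ.+ y ℕ.* b ≡ z ℕ.* a → x ^ (p ℕ.^ a) ≡ x → x ^ (p ℕ.^ b) ≡ x → x ^ (p ℕ.^ g) ≡ x
    descend y z a b e ea eb = begin
      x ^ (p ℕ.^ g)                               ≡⟨ ^-congˡ (p ℕ.^ g) (mult y b eb) ⟨
      (x ^ (p ℕ.^ (y ℕ.* b))) ^ (p ℕ.^ g)         ≡⟨ ^-swap x (p ℕ.^ (y ℕ.* b)) (p ℕ.^ g) ⟩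
      (x ^ (p ℕ.^ g)) ^ (p ℕ.^ (y ℕ.* b))         ≡⟨ ^-assocʳ x (p ℕ.^ g) (p ℕ.^ (y ℕ.* b)) ⟩
      x ^ (p ℕ.^ g ℕ.* p ℕ.^ (y ℕ.* b))           ≡⟨ ≡.cong (x ^_) (≡.trans (≡.sym (ℕ.^-distribˡ-+-* p g (y ℕ.* b))) (≡.cong (p ℕ.^_) e)) ⟩
      x ^ (p ℕ.^ (z ℕ.* a))                       ≡⟨ mult z a ea ⟩
      x                                           ∎
    case : Bézout.Identity g a b → x ^ (p ℕ.^ g) ≡ x
    case (Bézout.+- z y e) = descend y z a b e ea eb
    case (Bézout.-+ z y e) = descend z y b a e eb ea

  module RootPolynomial {S : Fin q → Set} (S? : Decidable S) where

    private
      factor : ∀ {A : Set} → Dec A → Fin q → Poly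
      factor (yes _) γ = 𝕏 P.- C γ
      factor (no _)  γ = P.1#

      product : ∀ {m} → (Fin m → Fin q) → Poly
      product {zero}  e = P.1#
      product {suc m} e = factor (S? (e Fin.zero)) (e Fin.zero) *ₚ product (λ i → e (Fin.suc i))

      n-factor : ∀ {A : Set} (d : Dec A) γ → factor d γ ≋0̸
      n-factor (yes _) γ = 𝕏-C≋0̸ γ
      n-factor (no _)  γ = 1≋0̸

      n-product : ∀ {m} (e : Fin m → Fin q) → product e ≋0̸
      n-product {zero}  e = 1≋0̸
      n-product {suc m} e = *ₚ-≋0̸ (n-factor (S? (e Fin.zero)) (e Fin.zero)) (n-product (λ i → e (Fin.suc i)))

      deg-factor : ∀ {A : Set} (d : Dec A) γ → deg (factor d γ) ≡ 𝟙 d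
      deg-factor (yes _) γ = deg-𝕏-C γ
      deg-factor (no _)  γ = deg-1

      deg-product : ∀ {m} (e : Fin m → Fin q) → deg (product e) ≡ # (λ i → S? (e i))
      deg-product {zero}  e = deg-1
      deg-product {suc m} e = ≡.trans (deg-* (n-factor (S? (e Fin.zero)) (e Fin.zero)) (n-product (λ i → e (Fin.suc i))))
        (≡.cong₂ ℕ._+_ (deg-factor (S? (e Fin.zero)) (e Fin.zero)) (deg-product (λ i → e (Fin.suc i))))

      factor-root : ∀ {A : Set} (d : Dec A) γ → A → eval (factor d γ) γ ≡ 0#
      factor-root (yes _) γ a = ≡.trans (eval-𝕏-C γ γ) (-‿inverseʳ γ)
      factor-root (no na) γ a = contradiction a na

      root-factor′ : ∀ {A : Set} (d : Dec A) γ y → eval (factor d γ) y ≡ 0# → A × y ≡ γ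
      root-factor′ (yes a) γ y e = a , x-y≈0⇒x≈y (≡.trans (≡.sym (eval-𝕏-C γ y)) e)
      root-factor′ (no na) γ y e = contradiction (≡.trans (≡.sym (eval-C 1# y)) e) 1≢0

      product-root : ∀ {m} (e : Fin m → Fin q) i → S (e i) → eval (product e) (e i) ≡ 0#
      product-root {suc m} e Fin.zero s = ≡.trans (eval-* (factor (S? (e Fin.zero)) (e Fin.zero)) (product (λ i → e (Fin.suc i))) (e Fin.zero))
        (≡.trans (≡.cong (_* eval (product (λ i → e (Fin.suc i))) (e Fin.zero)) (factor-root (S? (e Fin.zero)) (e Fin.zero) s)) (zeroˡ _))
      product-root {suc m} e (Fin.suc i) s = ≡.trans (eval-* (factor (S? (e Fin.zero)) (e Fin.zero)) (product (λ i → e (Fin.suc i))) (e (Fin.suc i)))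
        (≡.trans (≡.cong (eval (factor (S? (e Fin.zero)) (e Fin.zero)) (e (Fin.suc i)) *_) (product-root (λ i → e (Fin.suc i)) i s)) (zeroʳ _))

      root-product : ∀ {m} (e : Fin m → Fin q) y → eval (product e) y ≡ 0# → S y
      root-product {zero}  e y r = contradiction (≡.trans (≡.sym (eval-C 1# y)) r) 1≢0
      root-product {suc m} e y r = split (eval (factor d (e Fin.zero)) y Fin.≟ 0#)
        where
        d = S? (e Fin.zero)
        split : Dec (eval (factor d (e Fin.zero)) y ≡ 0#) → S y
        split (yes z) = ≡.subst S (≡.sym (proj₂ (root-factor′ d (e Fin.zero) y z))) (proj₁ (root-factor′ d (e Fin.zero) y z))
        split (no nz) = root-product (λ i → e (Fin.suc i)) y (*-cancel-0 nz
          (≡.trans (≡.sym (eval-* (factor d (e Fin.zero)) (product (λ i → e (Fin.suc i))) y)) r))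

    rootPoly : Poly
    rootPoly = product (λ i → i)

    deg-rootPoly : deg rootPoly ≡ # S?
    deg-rootPoly = deg-product (λ i → i)

    rootPoly-root : ∀ {y} → S y → eval rootPoly y ≡ 0#
    rootPoly-root {y} = product-root (λ i → i) y

    root-rootPoly : ∀ {y} → eval rootPoly y ≡ 0# → S y
    root-rootPoly {y} = root-product (λ i → i) y

  record PowerCoset (S : Fin q → Set) : Set₁ where
    field
      a b : Fin q
      a≢0 : a ≢ 0#
      k v : ℕ
      1≤k : 1 ℕ.≤ k
      𝕃   : Subfield
      #𝕃  : # (Subfield.L? 𝕃) ≡ p ℕ.^ k
      U   : Subspaces.Subspace 𝕃
      1∈U : Subspaces.Subspace.W U 1#
      1≤v : 1 ℕ.≤ v
      v∣  : v ∣ p ℕ.^ k ℕ.∸ 1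
      to   : ∀ y → S y → ∃[ u ] Subspaces.Subspace.W U u × y ≡ a * u ^ v + b
      from : ∀ u → Subspaces.Subspace.W U u → S (a * u ^ v + b)

  nonzero? : {Z : Fin q → Set} → Decidable Z → Decidable (λ y → Z y × y ≢ 0#)
  nonzero? Z? y = Z? y ×-dec ¬? (y Fin.≟ 0#)

  #-power-fibre : ∀ v → 1 ℕ.≤ v → {A : Fin q → Set} (A? : Decidable A) → ∀ a → a ≢ 0# → ∀ y →
                  # (Fibres.fibre? A? (λ z → a * z ^ v) y) ℕ.≤ v
  #-power-fibre v 1≤v A? a a≢0 y = ℕ.≤-trans (#-mono (Fibres.fibre? A? (λ z → a * z ^ v) y) (λ x → eval f x Fin.≟ 0#)
      (λ x (_ , e) → ≡.trans (eval-f x) (x≈y⇒x-y≈0 e))) (ℕ.≤-trans (#-roots f nf) (ℕ.≤-reflexive deg-f))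
    where
    f : Poly
    f = C a *ₚ 𝕏 P.^ v P.- C y
    eval-f : ∀ x → eval f x ≡ a * x ^ v - y
    eval-f x = ≡.trans (eval-sub (C a *ₚ 𝕏 P.^ v) (C y) x) (≡.cong₂ _-_ (≡.trans (eval-* (C a) (𝕏 P.^ v) x)
      (≡.cong₂ _*_ (eval-C a x) (≡.trans (eval-^ 𝕏 v x) (^-congˡ v (eval-𝕏 x))))) (eval-C y x))
    top : Poly
    top = C a *ₚ 𝕏 P.^ v
    ntop : top ≋0̸
    ntop = *ₚ-≋0̸ (C≋0̸ a≢0) (^ₚ-≋0̸ v 𝕏≋0̸)
    deg-top : deg top ≡ v
    deg-top = ≡.trans (deg-C* a≢0 (^ₚ-≋0̸ v 𝕏≋0̸)) (deg-𝕏^ v)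
    dom : (P.- C y +ₚ top ≋0̸) × deg (P.- C y +ₚ top) ≡ deg top
    dom = +-dominant {P.- C y} {top} (<°-neg {C y} (<°-mono (C y) (≡.subst (1 ℕ.≤_) (≡.sym deg-top) 1≤v) (<°-C y))) ntop
    nf : f ≋0̸
    nf = ≋0̸-cong (P.+-comm (P.- C y) top) (proj₁ dom)
    deg-f : deg f ≡ v
    deg-f = ≡.trans (deg-cong (P.+-comm top (P.- C y))) (≡.trans (proj₂ dom) deg-top)

  module BinomialCase {T : Poly} {Z : Fin q → Set} (Z? : Decidable Z) (Z⇒ : ∀ {y} → Z y → eval T y ≡ 0#)
    (⇒Z : ∀ {y} → eval T y ≡ 0# → Z y) (#Z : # Z? ≡ deg T) (3≤s : 3 ℕ.≤ deg T) (Z0 : Z 0#)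
    (t₁ c : Fin q) (T≋ : T ≋ C t₁ *ₚ 𝕏 +ₚ C c *ₚ 𝕏 P.^ deg T) where

    private
      s = deg T
      e = ℕ.pred s
      s≡ : s ≡ suc e
      s≡ = ≡.sym (ℕ.suc-pred s {{ℕ.>-nonZero (ℕ.≤-trans (s≤s z≤n) 3≤s)}})

      eval-T : ∀ y → eval T y ≡ y * (t₁ + c * y ^ e)
      eval-T y = begin
        eval T y                                     ≡⟨ eval-cong y T≋ ⟩
        eval (C t₁ *ₚ 𝕏 +ₚ C c *ₚ 𝕏 P.^ s) y         ≡⟨ eval-+ (C t₁ *ₚ 𝕏) (C c *ₚ 𝕏 P.^ s) y ⟩
        _                                            ≡⟨ ≡.cong₂ _+_ (≡.trans (eval-* (C t₁) 𝕏 y) (≡.cong₂ _*_ (eval-C t₁ y) (eval-𝕏 y)))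
                                                         (≡.trans (eval-* (C c) (𝕏 P.^ s) y) (≡.cong₂ _*_ (eval-C c y) (≡.trans (eval-^ 𝕏 s y) (≡.trans (^-congˡ s (eval-𝕏 y)) (≡.cong (y ^_) s≡))))) ⟩
        t₁ * y + c * (y * y ^ e)                     ≡⟨ solve 4 (λ t y c w → t :* y :+ c :* (y :* w) := y :* (t :+ c :* w)) ≡.refl t₁ y c (y ^ e) ⟩
        y * (t₁ + c * y ^ e)                         ∎

      #Z* : # (nonzero? Z?) ≡ e
      #Z* = ℕ.suc-injective (≡.trans (≡.sym (#-remove Z? 0# Z0 (nonzero? Z?))) (≡.trans #Z s≡))

      2≤e : 2 ℕ.≤ e
      2≤e = ℕ.≤-pred (≡.subst (3 ℕ.≤_) s≡ 3≤s)

      γ-exists : ∃[ y ] Z y × y ≢ 0#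
      γ-exists = #>0⇒∃ (nonzero? Z?) (ℕ.≤-trans (ℕ.<⇒≤ 2≤e) (ℕ.≤-reflexive (≡.sym #Z*)))

      γ : Fin q
      γ = proj₁ γ-exists

      γ≢0 : γ ≢ 0#
      γ≢0 = proj₂ (proj₂ γ-exists)

      c≢0 : c ≢ 0#
      c≢0 c≡0 = lead≉0 T (deg≥1⇒≋0̸ (ℕ.≤-trans (s≤s z≤n) 3≤s)) (begin
        coeff T s                                     ≡⟨ at T≋ s ⟩
        coeff (C t₁ *ₚ 𝕏 +ₚ C c *ₚ 𝕏 P.^ s) s         ≡⟨ coeff-+ (C t₁ *ₚ 𝕏) (C c *ₚ 𝕏 P.^ s) s ⟩
        _                                             ≡⟨ ≡.cong₂ _+_ (≡.trans (coeff-C* t₁ 𝕏 s) (≡.trans (≡.cong (t₁ *_) (coeff-𝕏-big s 3≤s)) (zeroʳ _)))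
                                                          (≡.trans (coeff-C* c (𝕏 P.^ s) s) (≡.trans (≡.cong (_* coeff (𝕏 P.^ s) s) c≡0) (zeroˡ _))) ⟩
        0# + 0#                                       ≡⟨ +-identityˡ 0# ⟩
        0#                                            ∎)
        where
        coeff-𝕏-big : ∀ s → 3 ℕ.≤ s → coeff 𝕏 s ≡ 0#
        coeff-𝕏-big (suc (suc s)) _ = ≡.refl
        coeff-𝕏-big (suc zero) (s≤s ())

      equation : ∀ {y} → Z y → y ≢ 0# → t₁ + c * y ^ e ≡ 0#
      equation {y} z y≢0 = *-cancel-0 y≢0 (≡.trans (≡.sym (eval-T y)) (Z⇒ z))

      unit? : Decidable (λ x → x ^ e ≡ 1#)
      unit? x = x ^ e Fin.≟ 1#

      unit≢0 : ∀ x → x ^ e ≡ 1# → x ≢ 0#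
      unit≢0 x h ≡.refl = 1≢0 (≡.trans (≡.sym h) (0^ e (ℕ.<⇒≤ 2≤e)))

      γ-units : ∀ x → x ^ e ≡ 1# → Z (γ * x)
      γ-units x h = ⇒Z (≡.trans (eval-T (γ * x)) (≡.trans (≡.cong (γ * x *_) (≡.trans (≡.cong (λ w → t₁ + c * w)
        (≡.trans (^-distrib-* γ x e) (≡.trans (≡.cong (γ ^ e *_) h) (*-identityʳ _)))) (equation (proj₁ (proj₂ γ-exists)) γ≢0))) (zeroʳ _)))

      units : ∀ x → Z (γ * x) → x ≢ 0# → x ^ e ≡ 1#
      units x z x≢0 = x-y≈0⇒x≈y (*-cancel-0 (*-≉0 c≢0 (^-≉0 e γ≢0)) (begin
        (c * γ ^ e) * (x ^ e - 1#)          ≡⟨ solve 4 (λ t c g x → (c :* g) :* (x :- con (pos 1)) := (t :+ c :* (g :* x)) :- (t :+ c :* g)) ≡.refl t₁ c (γ ^ e) (x ^ e) ⟩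
        (t₁ + c * (γ ^ e * x ^ e)) - (t₁ + c * γ ^ e)
          ≡⟨ ≡.cong₂ _-_ (≡.trans (≡.cong (λ w → t₁ + c * w) (≡.sym (^-distrib-* γ x e))) (equation z (*-≉0 γ≢0 x≢0))) (equation (proj₁ (proj₂ γ-exists)) γ≢0) ⟩
        0# - 0#                             ≡⟨ -‿inverseʳ 0# ⟩
        0#                                  ∎))

      #units : # unit? ≡ e
      #units = ≡.trans (#-cong unit? (λ x → nonzero? Z? (γ * x)) (λ x h → γ-units x h , *-≉0 γ≢0 (unit≢0 x h))
          (λ x (z , ne) → units x z (λ x≡0 → ne (≡.trans (≡.cong (γ *_) x≡0) (zeroʳ γ)))))
        (≡.trans (≡.sym (#-permute (nonzero? Z?) (dilation γ γ≢0))) #Z*)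

      q-1 = ℕ.pred q
      q≡ : q ≡ suc q-1
      q≡ = ≡.sym (ℕ.suc-pred q {{ℕ.>-nonZero (ℕ.<⇒≤ q≥2)}})

      x^q-1 : ∀ x → x ≢ 0# → x ^ q-1 ≡ 1#
      x^q-1 x x≢0 = x-y≈0⇒x≈y (*-cancel-0 x≢0 (≡.trans (solve 2 (λ x w → x :* (w :- con (pos 1)) := x :* w :- x) ≡.refl x (x ^ q-1))
        (x≈y⇒x-y≈0 (≡.trans (≡.cong (x ^_) (≡.sym q≡)) (fermat x)))))

      g = gcd e q-1

      1≤g : 1 ℕ.≤ g
      1≤g = ℕ.n≢0⇒n>0 (λ g≡0 → ℕ.<⇒≢ (ℕ.<⇒≤ 2≤e) (≡.sym (0∣⇒≡0 (≡.subst (_∣ e) g≡0 (gcd[m,n]∣m e q-1)))))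
        where open import Data.Nat.Divisibility using (0∣⇒≡0)

      -- All e solutions of x^e = 1 also solve x^gcd(e, q-1) = 1, a polynomial equation of degree
      -- gcd(e, q-1). Hence e divides q - 1.
      e≤g : e ℕ.≤ g
      e≤g = ℕ.≤-trans (ℕ.≤-reflexive (≡.sym #units)) (ℕ.≤-trans (#-mono unit? (Fibres.fibre? (λ (x : Fin q) → x Fin.≟ x) (λ z → 1# * z ^ g) 1#)
        (λ x h → ≡.refl , ≡.trans (*-identityˡ _) (^-gcd e q-1 (unit≢0 x h) h (x^q-1 x (unit≢0 x h)))))
        (#-power-fibre g 1≤g (λ x → x Fin.≟ x) 1# 1≢0 1#))

      e∣q-1 : e ∣ q-1
      e∣q-1 = ≡.subst (_∣ q-1) (ℕ.≤-antisym (∣⇒≤ {{ℕ.>-nonZero (ℕ.<⇒≤ 2≤e)}} (gcd[m,n]∣m e q-1)) e≤g) (gcd[m,n]∣n e q-1)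

      v : ℕ
      v = _∣_.quotient e∣q-1

      q-1≡ : q-1 ≡ v ℕ.* e
      q-1≡ = _∣_.equality e∣q-1

      1≤v : 1 ℕ.≤ v
      1≤v = ℕ.n≢0⇒n>0 (λ v≡0 → ℕ.<⇒≢ (ℕ.≤-pred (≡.subst (2 ℕ.≤_) q≡ q≥2)) (≡.sym (≡.trans q-1≡ (≡.cong (ℕ._* e) v≡0))))

      power? : Decidable (λ y → ∃[ z ] z ≢ 0# × z ^ v ≡ y)
      power? y = Fin.any? (λ z → ¬? (z Fin.≟ 0#) ×-dec (z ^ v Fin.≟ y))

      power⇒unit : ∀ y → ∃[ z ] z ≢ 0# × z ^ v ≡ y → y ^ e ≡ 1#
      power⇒unit y (z , z≢0 , ≡.refl) = ≡.trans (^-assocʳ z v e) (≡.trans (≡.cong (z ^_) (≡.sym q-1≡)) (x^q-1 z z≢0))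

      -- The q - 1 = v e nonzero elements fall into fibres of at most v over their v-th powers. So
      -- there are at least e such powers among the e roots of unity.
      unit⇒power : ∀ y → y ^ e ≡ 1# → ∃[ z ] z ≢ 0# × z ^ v ≡ y
      unit⇒power = #-full-subset power? unit? power⇒unit (ℕ.≤-trans (ℕ.≤-reflexive #units)
        (ℕ.*-cancelˡ-≤ v {{ℕ.>-nonZero 1≤v}} (ℕ.≤-trans (ℕ.≤-reflexive (≡.trans (≡.sym q-1≡) (ℕ.suc-injective (≡.trans (≡.sym q≡) (≡.sym #≢0)))))
          (Fibres.#-fibres-≤ _≢0? (λ z → 1# * z ^ v) power? v (λ z z≢0 → z , z≢0 , ≡.sym (*-identityˡ _)) (λ y _ → #-power-fibre v 1≤v _≢0? 1# 1≢0 y)))))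

      𝕃 : Subfield
      𝕃 = fixedField n

      open Subspaces 𝕃

      whole : Subspace
      whole = record { W = λ x → x ^ q ≡ x ; W? = λ x → x ^ q Fin.≟ x ; 0∈W = fermat 0# ; +-W = λ _ _ → fermat _ ; *-W = λ _ _ → fermat _ }

    result : PowerCoset Z
    result = record
      { a = γ ; b = 0# ; a≢0 = γ≢0 ; k = n ; v = v ; 1≤k = n≥1 ; 𝕃 = 𝕃 ; #𝕃 = #-full (λ x → x ^ q Fin.≟ x) fermat
      ; U = whole ; 1∈U = fermat 1# ; 1≤v = 1≤v ; v∣ = ≡.subst (v ∣_) (≡.sym q-1≡) (m∣m*n e)
      ; to = λ y z → to y z (y Fin.≟ 0#)
      ; from = λ u _ → ≡.subst Z (≡.sym (+-identityʳ _)) (from u (u Fin.≟ 0#)) }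
      where
      to : ∀ y → Z y → Dec (y ≡ 0#) → ∃[ u ] u ^ q ≡ u × y ≡ γ * u ^ v + 0#
      to y z (yes ≡.refl) = 0# , fermat 0# , ≡.sym (≡.trans (+-identityʳ _) (≡.trans (≡.cong (γ *_) (0^ v 1≤v)) (zeroʳ γ)))
      to y z (no y≢0) = proj₁ w , fermat _ , ≡.trans (≡.sym γx≡y) (≡.sym (≡.trans (+-identityʳ _) (≡.cong (γ *_) (proj₂ (proj₂ w)))))
        where
        γ⁻¹ = proj₁ (invert γ γ≢0)
        x = γ⁻¹ * y
        γx≡y : γ * x ≡ y
        γx≡y = ≡.trans (≡.sym (*-assoc γ γ⁻¹ y)) (≡.trans (≡.cong (_* y) (proj₂ (invert γ γ≢0))) (*-identityˡ y))
        w : ∃[ z ] z ≢ 0# × z ^ v ≡ x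
        w = unit⇒power x (units x (≡.subst Z (≡.sym γx≡y) z) (λ x≡0 → y≢0 (≡.trans (≡.sym γx≡y) (≡.trans (≡.cong (γ *_) x≡0) (zeroʳ γ)))))
      from : ∀ u → Dec (u ≡ 0#) → Z (γ * u ^ v)
      from u (yes ≡.refl) = ≡.subst Z (≡.sym (≡.trans (≡.cong (γ *_) (0^ v 1≤v)) (zeroʳ γ))) Z0
      from u (no u≢0) = γ-units (u ^ v) (power⇒unit (u ^ v) (u , u≢0 , ≡.refl))

  -- The additive case.

  open import Data.Nat.Tactic.RingSolver using (solve-∀)

  least : {Q : ℕ → Set} → Decidable Q → ∀ m → Q m → ∃[ k ] Q k × (∀ j → j ℕ.< k → ¬ Q j)
  least {Q} Q? m Qm = go m 0 (≡.subst Q (≡.sym (ℕ.+-identityʳ m)) Qm) (λ _ ())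
    where
    go : ∀ fuel k → Q (fuel ℕ.+ k) → (∀ j → j ℕ.< k → ¬ Q j) → ∃[ k ] Q k × (∀ j → j ℕ.< k → ¬ Q j)
    go fuel k h below = case fuel h (Q? k)
      where
      case : ∀ fuel → Q (fuel ℕ.+ k) → Dec (Q k) → ∃[ k ] Q k × (∀ j → j ℕ.< k → ¬ Q j)
      case _          h (yes Qk) = k , Qk , below
      case zero       h (no ¬Qk) = contradiction h ¬Qk
      case (suc fuel) h (no ¬Qk) = go fuel (suc k) (≡.subst Q (≡.sym (ℕ.+-suc fuel k)) h) below′
        where
        below′ : ∀ j → j ℕ.< suc k → ¬ Q j
        below′ j (s≤s j≤k) = split (ℕ.m≤n⇒m<n∨m≡n j≤k)
          where
          split : _ ⊎ _ → ¬ Q j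
          split (inj₁ j<k)    = below j j<k
          split (inj₂ ≡.refl) = ¬Qk

  record AdditiveData (T : Poly) : Set where
    field
      v K i₀ e₀ : ℕ
      1≤v  : 1 ℕ.≤ v
      supp : ∀ j → coeff T j ≢ 0# → 1 ℕ.≤ j × ∃[ i ] suc (v ℕ.* ℕ.pred j) ≡ p ℕ.^ i
      top  : suc (v ℕ.* ℕ.pred (deg T)) ≡ p ℕ.^ K
      1≤i₀ : 1 ℕ.≤ i₀
      i₀<K : i₀ ℕ.< K
      ve₀  : suc (v ℕ.* e₀) ≡ p ℕ.^ i₀

  -- k is the order of p modulo v.
  module Order {T : Poly} (𝔸 : AdditiveData T) where
    open AdditiveData 𝔸 public

    Congruent : ℕ → Set
    Congruent i = ∃[ u ] suc (v ℕ.* u) ≡ p ℕ.^ i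

    private
      congruent⇒∣ : ∀ i → Congruent i → v ∣ p ℕ.^ i ℕ.∸ 1
      congruent⇒∣ i (u , e) = divides u (≡.trans (≡.cong (ℕ._∸ 1) (≡.sym e)) (ℕ.*-comm v u))

      ∣⇒congruent : ∀ i → v ∣ p ℕ.^ i ℕ.∸ 1 → Congruent i
      ∣⇒congruent i (divides u e) = u , ≡.trans (≡.cong suc (≡.trans (ℕ.*-comm v u) (≡.sym e))) (ℕ.m+[n∸m]≡n (ℕ.m^n>0 p i))

      positive? : Decidable (λ i → 1 ℕ.≤ i × v ∣ p ℕ.^ i ℕ.∸ 1)
      positive? i = (1 ℕ.≤? i) ×-dec (v ∣? (p ℕ.^ i ℕ.∸ 1))
        where open import Data.Nat.Divisibility using (_∣?_)

      order = least positive? i₀ (1≤i₀ , congruent⇒∣ i₀ (e₀ , ve₀))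

    k : ℕ
    k = proj₁ order

    1≤k : 1 ℕ.≤ k
    1≤k = proj₁ (proj₁ (proj₂ order))

    v∣ : v ∣ p ℕ.^ k ℕ.∸ 1
    v∣ = proj₂ (proj₁ (proj₂ order))

    private instance
      k-nonZero : ℕ.NonZero k
      k-nonZero = ℕ.>-nonZero 1≤k

    congruent-* : ∀ a → Congruent (k ℕ.* a)
    congruent-* zero    = 0 , ≡.trans (≡.cong suc (ℕ.*-zeroʳ v)) (≡.cong (p ℕ.^_) (≡.sym (ℕ.*-zeroʳ k)))
    congruent-* (suc a) = combine (∣⇒congruent k v∣) (congruent-* a)
      where
      combine : Congruent k → Congruent (k ℕ.* a) → Congruent (k ℕ.* suc a)
      combine (u , e) (u′ , e′) = u ℕ.+ u′ ℕ.+ u ℕ.* (v ℕ.* u′) , ≡.trans (eq v u u′) (≡.trans (≡.cong₂ ℕ._*_ e e′)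
        (≡.trans (≡.sym (ℕ.^-distribˡ-+-* p k (k ℕ.* a))) (≡.cong (p ℕ.^_) (≡.sym (ℕ.*-suc k a)))))
        where
        eq : ∀ v u u′ → suc (v ℕ.* (u ℕ.+ u′ ℕ.+ u ℕ.* (v ℕ.* u′))) ≡ suc (v ℕ.* u) ℕ.* suc (v ℕ.* u′)
        eq = solve-∀

    -- Write i = k a + r with r < k. As v divides p^i - 1 and p^(ka) - 1, it divides p^r - 1, and
    -- the minimality of k leaves r = 0.
    k∣ : ∀ i → Congruent i → ∃[ a ] i ≡ k ℕ.* a
    k∣ i (u , e) = i / k , ≡.trans (m≡m%n+[m/n]*n i k) (≡.trans (≡.cong (ℕ._+ i / k ℕ.* k) r≡0) (ℕ.*-comm (i / k) k))
      where
      r = i % k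
      W = congruent-* (i / k)
      -- p^r v w + (p^r − 1) = v u
      v∣r : v ∣ p ℕ.^ r ℕ.∸ 1
      v∣r = ∣m+n∣m⇒∣n {v} {p ℕ.^ r ℕ.* (v ℕ.* proj₁ W)} (divides u (ℕ.suc-injective total)) (n∣m*n* (p ℕ.^ r) v (proj₁ W))
        where
        eq : ∀ x y → x ℕ.* y ℕ.+ x ≡ x ℕ.* suc y
        eq = solve-∀
        y = p ℕ.^ r ℕ.* (v ℕ.* proj₁ W)
        total : suc (y ℕ.+ (p ℕ.^ r ℕ.∸ 1)) ≡ suc (u ℕ.* v)
        total = ≤.begin-equality
          suc (y ℕ.+ (p ℕ.^ r ℕ.∸ 1))                     ≤.≡⟨ ℕ.+-suc y _ ⟨
          y ℕ.+ suc (p ℕ.^ r ℕ.∸ 1)                       ≤.≡⟨ ≡.cong (y ℕ.+_) (ℕ.m+[n∸m]≡n (ℕ.m^n>0 p r)) ⟩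
          y ℕ.+ p ℕ.^ r                                   ≤.≡⟨ eq (p ℕ.^ r) (v ℕ.* proj₁ W) ⟩
          p ℕ.^ r ℕ.* suc (v ℕ.* proj₁ W)                 ≤.≡⟨ ≡.cong (p ℕ.^ r ℕ.*_) (proj₂ W) ⟩
          p ℕ.^ r ℕ.* p ℕ.^ (k ℕ.* (i / k))               ≤.≡⟨ ℕ.^-distribˡ-+-* p r (k ℕ.* (i / k)) ⟨
          p ℕ.^ (r ℕ.+ k ℕ.* (i / k))                     ≤.≡⟨ ≡.cong (λ x → p ℕ.^ (r ℕ.+ x)) (ℕ.*-comm k (i / k)) ⟩
          p ℕ.^ (r ℕ.+ i / k ℕ.* k)                       ≤.≡⟨ ≡.cong (p ℕ.^_) (m≡m%n+[m/n]*n i k) ⟨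
          p ℕ.^ i                                         ≤.≡⟨ e ⟨
          suc (v ℕ.* u)                                   ≤.≡⟨ ≡.cong suc (ℕ.*-comm v u) ⟩
          suc (u ℕ.* v)                                   ≤.∎
          where module ≤ = ℕ.≤-Reasoning
        n∣m*n* : ∀ x v w → v ∣ x ℕ.* (v ℕ.* w)
        n∣m*n* x v w = divides (x ℕ.* w) (lem x v w)
          where
          lem : ∀ x v w → x ℕ.* (v ℕ.* w) ≡ x ℕ.* w ℕ.* v
          lem = solve-∀
      r≡0 : r ≡ 0
      r≡0 = split r ≡.refl
        where
        split : ∀ m → r ≡ m → r ≡ 0
        split zero    e = e
        split (suc m) e = contradiction (≡.subst (1 ℕ.≤_) (≡.sym e) (s≤s z≤n) , v∣r) (proj₂ (proj₂ order) r (m%n<n i k))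

    m : ℕ
    m = proj₁ (k∣ K (ℕ.pred (deg T) , top))

    K≡ : K ≡ k ℕ.* m
    K≡ = proj₂ (k∣ K (ℕ.pred (deg T) , top))

    -- k divides i₀, and i₀ < K = k m: this is what the second exponent is recorded for.
    2≤m : 2 ℕ.≤ m
    2≤m = ℕ.*-cancelˡ-< k 1 m (≡.subst₂ ℕ._<_ (≡.sym (ℕ.*-identityʳ k)) K≡ (ℕ.≤-<-trans k≤i₀ i₀<K))
      where
      k≤i₀ : k ℕ.≤ i₀
      k≤i₀ = ∣⇒≤ {{ℕ.>-nonZero 1≤i₀}} (divides (proj₁ a) (≡.trans (proj₂ a) (ℕ.*-comm k (proj₁ a))))
        where a = k∣ i₀ (e₀ , ve₀)

  module Expansion {T : Poly} (𝔸 : AdditiveData T) (3≤s : 3 ℕ.≤ deg T) where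
    open Order 𝔸 public
    open Linearised k public

    s : ℕ
    s = deg T

    Pₖ≥2 : 2 ℕ.≤ Pₖ
    Pₖ≥2 = ℕ.≤-trans p≥2 (≡.subst (ℕ._≤ Pₖ) (ℕ.*-identityʳ p) (ℕ.^-monoʳ-≤ p 1≤k))

    -- The exponents j = e i + 1 with v e i + 1 = P^i.
    e : ℕ → ℕ
    e i = proj₁ (congruent-* i)

    ve : ∀ i → suc (v ℕ.* e i) ≡ Pₖ ℕ.^ i
    ve i = ≡.trans (proj₂ (congruent-* i)) (≡.sym (Pₖ^ i))

    private
      v-cancel : ∀ {a b} → suc (v ℕ.* a) ≡ suc (v ℕ.* b) → a ≡ b
      v-cancel {a} {b} h = ℕ.*-cancelˡ-≡ a b v {{ℕ.>-nonZero 1≤v}} (ℕ.suc-injective h)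

    e-injective : ∀ {i j} → e i ≡ e j → i ≡ j
    e-injective {i} {j} h = split (ℕ.<-cmp i j)
      where
      open import Relation.Binary.Definitions using (tri<; tri≈; tri>; Tri)
      eq : Pₖ ℕ.^ i ≡ Pₖ ℕ.^ j
      eq = ≡.trans (≡.sym (ve i)) (≡.trans (≡.cong (λ x → suc (v ℕ.* x)) h) (ve j))
      split : Tri (i ℕ.< j) (i ≡ j) (j ℕ.< i) → i ≡ j
      split (tri< lt _ _) = contradiction eq (ℕ.<⇒≢ (ℕ.^-monoʳ-< Pₖ Pₖ≥2 lt))
      split (tri≈ _ i≡j _) = i≡j
      split (tri> _ _ gt) = contradiction (≡.sym eq) (ℕ.<⇒≢ (ℕ.^-monoʳ-< Pₖ Pₖ≥2 gt))

    s≡ : suc (e m) ≡ s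
    s≡ = ≡.trans (≡.cong suc (v-cancel (≡.trans (ve m) (≡.trans (Pₖ^ m) (≡.trans (≡.cong (p ℕ.^_) (≡.sym K≡)) (≡.sym top))))))
      (ℕ.suc-pred s {{ℕ.>-nonZero (ℕ.≤-trans (s≤s z≤n) 3≤s)}})

    private
      support : ∀ j → coeff T j ≢ 0# → ∃[ i ] i ℕ.≤ m × j ≡ suc (e i)
      support zero    ne = contradiction (proj₁ (supp 0 ne)) λ ()
      support (suc j) ne = a , a≤m , ≡.cong suc j≡
        where
        E = proj₂ (supp (suc j) ne)
        a = proj₁ (k∣ (proj₁ E) (j , proj₂ E))
        i≡ : proj₁ E ≡ k ℕ.* a
        i≡ = proj₂ (k∣ (proj₁ E) (j , proj₂ E))
        j≡ : j ≡ e a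
        j≡ = v-cancel (≡.trans (proj₂ E) (≡.trans (≡.cong (p ℕ.^_) i≡) (≡.trans (≡.sym (Pₖ^ a)) (≡.sym (ve a)))))
        a≤m : a ℕ.≤ m
        a≤m = ℕ.≮⇒≥ λ m<a → ℕ.<⇒≱ (ℕ.^-monoʳ-< Pₖ Pₖ≥2 m<a) (≡.subst₂ ℕ._≤_ (≡.trans (≡.cong (λ x → suc (v ℕ.* x)) j≡) (ve a)) (ve m)
          (s≤s (ℕ.*-monoʳ-≤ v (ℕ.≤-pred (≡.subst (suc j ℕ.≤_) (≡.sym s≡) (coeff≉0⇒≤deg {T} ne))))))

      term : ℕ → Poly
      term i = C (coeff T (suc (e i))) *ₚ 𝕏 P.^ suc (e i)

      lin : ℕ → Poly
      lin zero    = term 0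
      lin (suc m) = lin m +ₚ term (suc m)

      coeff-term : ∀ i j → coeff (term i) j ≡ coeff T (suc (e i)) * coeff (𝕏 P.^ suc (e i)) j
      coeff-term i j = coeff-C* (coeff T (suc (e i))) (𝕏 P.^ suc (e i)) j

      term-≢ : ∀ i j → j ≢ suc (e i) → coeff (term i) j ≡ 0#
      term-≢ i j ne = ≡.trans (coeff-term i j) (≡.trans (≡.cong (coeff T (suc (e i)) *_) (coeff-𝕏^-≢ (suc (e i)) j ne)) (zeroʳ _))

      term-≡ : ∀ i → coeff (term i) (suc (e i)) ≡ coeff T (suc (e i))
      term-≡ i = ≡.trans (coeff-term i (suc (e i))) (≡.trans (≡.cong (coeff T (suc (e i)) *_) (coeff-𝕏^ (suc (e i)))) (*-identityʳ _))

      term-0 : ∀ i j → coeff T j ≡ 0# → coeff (term i) j ≡ 0#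
      term-0 i j z = split (j ℕ.≟ suc (e i))
        where
        split : Dec (j ≡ suc (e i)) → coeff (term i) j ≡ 0#
        split (yes ≡.refl) = ≡.trans (term-≡ i) z
        split (no ne)      = term-≢ i j ne

      lin-0 : ∀ m j → coeff T j ≡ 0# → coeff (lin m) j ≡ 0#
      lin-0 zero    j z = term-0 0 j z
      lin-0 (suc m) j z = ≡.trans (coeff-+ (lin m) (term (suc m)) j) (≡.trans (≡.cong₂ _+_ (lin-0 m j z) (term-0 (suc m) j z)) (+-identityˡ 0#))

      lin-above : ∀ m i → m ℕ.< i → coeff (lin m) (suc (e i)) ≡ 0#
      lin-above zero    i lt = term-≢ 0 (suc (e i)) (λ h → ℕ.<⇒≢ lt (≡.sym (e-injective (ℕ.suc-injective h))))
      lin-above (suc m) i lt = ≡.trans (coeff-+ (lin m) (term (suc m)) (suc (e i))) (≡.trans (≡.cong₂ _+_ (lin-above m i (ℕ.<-trans (ℕ.n<1+n m) lt))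
        (term-≢ (suc m) (suc (e i)) (λ h → ℕ.<⇒≢ lt (≡.sym (e-injective (ℕ.suc-injective h)))))) (+-identityˡ 0#))

      lin-at : ∀ m i → i ℕ.≤ m → coeff (lin m) (suc (e i)) ≡ coeff T (suc (e i))
      lin-at zero    zero    z≤n = term-≡ 0
      lin-at (suc m) i le = split (ℕ.m≤n⇒m<n∨m≡n le)
        where
        split : i ℕ.< suc m ⊎ i ≡ suc m → coeff (lin (suc m)) (suc (e i)) ≡ coeff T (suc (e i))
        split (inj₁ (s≤s i≤m)) = ≡.trans (coeff-+ (lin m) (term (suc m)) (suc (e i))) (≡.trans (≡.cong₂ _+_ (lin-at m i i≤m)
          (term-≢ (suc m) (suc (e i)) (λ h → ℕ.<⇒≢ (s≤s i≤m) (e-injective (ℕ.suc-injective h))))) (+-identityʳ _))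
        split (inj₂ ≡.refl) = ≡.trans (coeff-+ (lin m) (term (suc m)) (suc (e (suc m)))) (≡.trans (≡.cong₂ _+_ (lin-above m (suc m) (ℕ.n<1+n m)) (term-≡ (suc m))) (+-identityˡ _))

      T≋lin : T ≋ lin m
      T≋lin = mk λ j → split j (coeff T j Fin.≟ 0#)
        where
        split : ∀ j → Dec (coeff T j ≡ 0#) → coeff T j ≡ coeff (lin m) j
        split j (yes z) = ≡.trans z (≡.sym (lin-0 m j z))
        split j (no nz) = located (support j nz)
          where
          located : ∃[ i ] i ℕ.≤ m × j ≡ suc (e i) → coeff T j ≡ coeff (lin m) j
          located (i , i≤m , ≡.refl) = ≡.sym (lin-at m i i≤m)

    coeffs : Fin q → ℕ → Fin q
    coeffs β i = coeff T (suc (e i)) * β ^ suc (e i)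

    -- Term by term: z (z^v)^(e i + 1) = z^v z^(v e i + 1), and v e i + 1 = P^i. The outer factors
    -- avoid division by z.
    linearised : ∀ β z → z * eval T (β * z ^ v) ≡ z ^ v * op m (coeffs β) z
    linearised β z = ≡.trans (≡.cong (z *_) (eval-cong (β * z ^ v) T≋lin)) (go m)
      where
      y = β * z ^ v
      eval-term : ∀ i → z * eval (term i) y ≡ z ^ v * (coeffs β i * z ^ (Pₖ ℕ.^ i))
      eval-term i = begin
        z * eval (term i) y
          ≡⟨ ≡.cong (z *_) (≡.trans (eval-* (C t) (𝕏 P.^ suc (e i)) y) (≡.cong₂ _*_ (eval-C t y) (≡.trans (eval-^ 𝕏 (suc (e i)) y) (^-congˡ (suc (e i)) (eval-𝕏 y))))) ⟩
        z * (t * y ^ suc (e i))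
          ≡⟨ ≡.cong (λ w → z * (t * w)) (^-distrib-* β (z ^ v) (suc (e i))) ⟩
        z * (t * (β ^ suc (e i) * (z ^ v) ^ suc (e i)))
          ≡⟨ solve 5 (λ z t b V E → z :* (t :* (b :* (V :* E))) := V :* ((t :* b) :* (z :* E))) ≡.refl z t (β ^ suc (e i)) (z ^ v) ((z ^ v) ^ e i) ⟩
        z ^ v * (coeffs β i * (z * (z ^ v) ^ e i))
          ≡⟨ ≡.cong (λ w → z ^ v * (coeffs β i * w)) (≡.trans (≡.cong (z *_) (^-assocʳ z v (e i))) (≡.cong (z ^_) (ve i))) ⟩
        z ^ v * (coeffs β i * z ^ (Pₖ ℕ.^ i)) ∎
        where t = coeff T (suc (e i))
      go : ∀ m → z * eval (lin m) y ≡ z ^ v * op m (coeffs β) z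
      go zero    = eval-term 0
      go (suc m) = ≡.trans (≡.cong (z *_) (eval-+ (lin m) (term (suc m)) y)) (≡.trans (distribˡ z _ _)
        (≡.trans (≡.cong₂ _+_ (go m) (eval-term (suc m))) (≡.sym (distribˡ (z ^ v) _ _))))

    top≢0 : ∀ {β} → β ≢ 0# → coeffs β m ≢ 0#
    top≢0 {β} β≢0 = *-≉0 (≡.subst (λ j → coeff T j ≢ 0#) (≡.sym s≡) (lead≉0 T (deg≥1⇒≋0̸ (ℕ.≤-trans (s≤s z≤n) 3≤s)))) (^-≉0 (suc (e m)) β≢0)

    -- P^m = v e m + 1 ≤ v s, while v < P because v divides P - 1.
    s-large : Pₖ ℕ.^ ℕ.pred m ℕ.< s
    s-large = ℕ.≰⇒> λ s≤ → ℕ.<-irrefl ≡.refl (bound s≤)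
      where
      r = ℕ.pred m
      X = Pₖ ℕ.^ r
      m≡ : suc r ≡ m
      m≡ = ℕ.suc-pred m {{ℕ.>-nonZero (ℕ.<⇒≤ 2≤m)}}
      v<P : v ℕ.< Pₖ
      v<P = ℕ.≤-trans (s≤s (∣⇒≤ {{ℕ.>-nonZero (ℕ.m<n⇒0<n∸m Pₖ≥2)}} v∣)) (ℕ.≤-reflexive (ℕ.m+[n∸m]≡n (ℕ.<⇒≤ Pₖ≥2)))
      bound : s ℕ.≤ X → Pₖ ℕ.^ m ℕ.< Pₖ ℕ.^ m
      bound s≤X = ≤.begin-strict
        Pₖ ℕ.^ m                   ≤.≡⟨ ≡.sym (ve m) ⟩
        suc (v ℕ.* e m)            ≤.≤⟨ ℕ.+-monoˡ-≤ (v ℕ.* e m) 1≤v ⟩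
        v ℕ.+ v ℕ.* e m            ≤.≡⟨ ≡.sym (ℕ.*-suc v (e m)) ⟩
        v ℕ.* suc (e m)            ≤.≤⟨ ℕ.*-monoʳ-≤ v (≡.subst (ℕ._≤ X) (≡.sym s≡) s≤X) ⟩
        v ℕ.* X                    ≤.<⟨ ℕ.*-monoˡ-< X {{ℕ.m^n≢0 Pₖ r {{ℕ.>-nonZero (ℕ.<⇒≤ Pₖ≥2)}}}} v<P ⟩
        Pₖ ℕ.* X                   ≤.≡⟨ ≡.cong (Pₖ ℕ.^_) m≡ ⟩
        Pₖ ℕ.^ m                   ≤.∎
        where module ≤ = ℕ.≤-Reasoning

  module AdditiveCase {T : Poly} {Z : Fin q → Set} (Z? : Decidable Z) (Z⇒ : ∀ {y} → Z y → eval T y ≡ 0#)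
    (⇒Z : ∀ {y} → eval T y ≡ 0# → Z y) (#Z : # Z? ≡ deg T) (3≤s : 3 ℕ.≤ deg T) (Z0 : Z 0#) (𝔸 : AdditiveData T) where

    open Expansion 𝔸 3≤s

    private
      s-1 = ℕ.pred s
      s≡s-1 : s ≡ suc s-1
      s≡s-1 = ≡.sym (ℕ.suc-pred s {{ℕ.>-nonZero (ℕ.≤-trans (s≤s z≤n) 3≤s)}})

      #Z* : # (nonzero? Z?) ≡ s-1
      #Z* = ℕ.suc-injective (≡.trans (≡.sym (#-remove Z? 0# Z0 (nonzero? Z?))) (≡.trans #Z s≡s-1))

      U? : ∀ β → Decidable (λ z → Z (β * z ^ v))
      U? β z = Z? (β * z ^ v)

      0∈U : ∀ β → Z (β * 0# ^ v)
      0∈U β = ≡.subst Z (≡.sym (≡.trans (≡.cong (β *_) (0^ v 1≤v)) (zeroʳ β))) Z0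

      op-0 : ∀ a → op m a 0# ≡ 0#
      op-0 a = ≡.trans (≡.cong (op m a) (≡.sym (zeroˡ 0#))) (≡.trans (op-* m a {0#} (0^ Pₖ (ℕ.<⇒≤ Pₖ≥2)) 0#) (zeroˡ _))

      U⇒ker : ∀ β z → Z (β * z ^ v) → op m (coeffs β) z ≡ 0#
      U⇒ker β z h = split (z Fin.≟ 0#)
        where
        split : Dec (z ≡ 0#) → op m (coeffs β) z ≡ 0#
        split (yes ≡.refl) = op-0 (coeffs β)
        split (no z≢0) = *-cancel-0 (^-≉0 v z≢0) (≡.trans (≡.sym (linearised β z)) (≡.trans (≡.cong (z *_) (Z⇒ h)) (zeroʳ z)))

      ker⇒U : ∀ β z → op m (coeffs β) z ≡ 0# → Z (β * z ^ v)
      ker⇒U β z h = split (z Fin.≟ 0#)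
        where
        split : Dec (z ≡ 0#) → Z (β * z ^ v)
        split (yes ≡.refl) = 0∈U β
        split (no z≢0) = ⇒Z (*-cancel-0 z≢0 (≡.trans (linearised β z) (≡.trans (≡.cong (z ^ v *_) h) (zeroʳ _))))

      -- Averaging over β gives a large U_β.
      module Averaging where
        open import Algebra.Properties.CommutativeMonoid.Sum ℕ.+-0-commutativeMonoid using (sum; ∑-comm; sum-cong-≗)
        open import Algebra.Properties.Semiring.Sum ℕ.+-*-semiring using (*-distribˡ-sum)

        pair? : ∀ β z → Dec (z ≢ 0# × β ≢ 0# × Z (β * z ^ v))
        pair? β z = ¬? (z Fin.≟ 0#) ×-dec (¬? (β Fin.≟ 0#) ×-dec Z? (β * z ^ v))

        count : Fin q → ℕ
        count β = # (pair? β)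

        -- For fixed z ≠ 0 the map β ↦ z^v β permutes the nonzero elements, and s - 1 of them go to
        -- nonzero roots of T.
        column : ∀ z → sum (λ β → 𝟙 (pair? β z)) ≡ s-1 ℕ.* 𝟙 (z ≢0?)
        column z = split (z Fin.≟ 0#)
          where
          split : Dec (z ≡ 0#) → sum (λ β → 𝟙 (pair? β z)) ≡ s-1 ℕ.* 𝟙 (z ≢0?)
          split (yes e) = ≡.trans (#-empty (λ β → pair? β z) (λ β (z≢0 , _) → z≢0 e))
            (≡.sym (≡.trans (≡.cong (s-1 ℕ.*_) (𝟙-no (z ≢0?) (λ ne → ne e))) (ℕ.*-zeroʳ s-1)))
          split (no z≢0) = ≡.trans (#-cong (λ β → pair? β z) (λ β → nonzero? Z? (z ^ v * β))
              (λ β (_ , β≢0 , h) → ≡.subst Z (*-comm β (z ^ v)) h , *-≉0 (^-≉0 v z≢0) β≢0)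
              (λ β (h , ne) → z≢0 , (λ β≡0 → ne (≡.trans (≡.cong (z ^ v *_) β≡0) (zeroʳ _))) , ≡.subst Z (*-comm (z ^ v) β) h))
            (≡.trans (≡.sym (#-permute (nonzero? Z?) (dilation (z ^ v) (^-≉0 v z≢0)))) (≡.trans #Z*
              (≡.sym (≡.trans (≡.cong (s-1 ℕ.*_) (𝟙-yes (z ≢0?) z≢0)) (ℕ.*-identityʳ s-1)))))

        total : sum count ≡ s-1 ℕ.* # _≢0?
        total = ≡.trans (∑-comm (λ β z → 𝟙 (pair? β z))) (≡.trans (sum-cong-≗ column) (≡.sym (*-distribˡ-sum s-1 (λ z → 𝟙 (z ≢0?)))))

        -- The average of `count` over the q - 1 nonzero β is s - 1, and some value is not below the
        -- average.
        large : ∃[ β ] s-1 ℕ.≤ count β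
        large = split (Fin.any? (λ β → s-1 ℕ.≤? count β))
          where
          r = ℕ.pred s-1
          1≤s-1 : 1 ℕ.≤ s-1
          1≤s-1 = ℕ.≤-pred (≡.subst (2 ℕ.≤_) s≡s-1 (ℕ.≤-trans (s≤s (s≤s z≤n)) 3≤s))
          s-1≡ : suc r ≡ s-1
          s-1≡ = ℕ.suc-pred s-1 {{ℕ.>-nonZero 1≤s-1}}
          split : Dec _ → ∃[ β ] s-1 ℕ.≤ count β
          split (yes h) = h
          split (no none) = contradiction (ℕ.≤-trans (ℕ.≤-reflexive (≡.sym total)) (ℕ.≤-trans (sum-mono small)
              (ℕ.≤-reflexive (≡.sym (*-distribˡ-sum r (λ β → 𝟙 (β ≢0?))))))) (ℕ.<⇒≱ (ℕ.*-monoˡ-< (# _≢0?) {{ℕ.>-nonZero 1≤#}} (ℕ.≤-reflexive s-1≡)))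
            where
            1≤# : 1 ℕ.≤ # _≢0?
            1≤# = ℕ.≤-pred (≡.subst (2 ℕ.≤_) (≡.sym #≢0) q≥2)
            small : ∀ β → count β ℕ.≤ r ℕ.* 𝟙 (β ≢0?)
            small β = split′ (β Fin.≟ 0#)
              where
              split′ : Dec (β ≡ 0#) → count β ℕ.≤ r ℕ.* 𝟙 (β ≢0?)
              split′ (yes e) = ℕ.≤-trans (ℕ.≤-reflexive (#-empty (pair? β) (λ z (_ , β≢0 , _) → β≢0 e))) z≤n
              split′ (no ne) = ℕ.≤-trans (ℕ.≤-pred (≡.subst (count β ℕ.<_) (≡.sym s-1≡) (ℕ.≰⇒> (λ le → none (β , le)))))
                (ℕ.≤-reflexive (≡.sym (≡.trans (≡.cong (r ℕ.*_) (𝟙-yes (β ≢0?) ne)) (ℕ.*-identityʳ r))))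

        β₀ : Fin q
        β₀ = proj₁ large

        witness : ∃[ u ] u ≢ 0# × β₀ ≢ 0# × Z (β₀ * u ^ v)
        witness = #>0⇒∃ (pair? β₀) (ℕ.≤-trans (ℕ.≤-pred (≡.subst (2 ℕ.≤_) s≡s-1 (ℕ.≤-trans (s≤s (s≤s z≤n)) 3≤s))) (proj₂ large))

        u : Fin q
        u = proj₁ witness

        u≢0 : u ≢ 0#
        u≢0 = proj₁ (proj₂ witness)

        -- Rescaling so that 1 ∈ U_β.
        β : Fin q
        β = β₀ * u ^ v

        β≢0 : β ≢ 0#
        β≢0 = *-≉0 (proj₁ (proj₂ (proj₂ witness))) (^-≉0 v u≢0)

        1∈U : Z (β * 1# ^ v)
        1∈U = ≡.subst Z (≡.sym (≡.trans (≡.cong (β *_) (1^ v)) (*-identityʳ β))) (proj₂ (proj₂ (proj₂ witness)))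

        -- `count` leaves out z = 0, which lies in every U_β and raises s - 1 to s. Division of z by
        -- u carries the set for β₀ to the set for β = β₀ u^v.
        s≤#U : s ℕ.≤ # (U? β)
        s≤#U = ≡.subst₂ ℕ._≤_ (≡.sym s≡s-1) (≡.sym (#-remove (U? β) 0# (0∈U β) (nonzero? (U? β)))) (s≤s (ℕ.≤-trans (proj₂ large)
          (ℕ.≤-trans (ℕ.≤-reflexive (#-permute (pair? β₀) (dilation u u≢0))) (#-mono (λ z → pair? β₀ (u * z)) (nonzero? (U? β)) scale-in))))
          where
          scale-in : ∀ z → _ → Z (β * z ^ v) × z ≢ 0#
          scale-in z (uz≢0 , _ , h) = ≡.subst Z (≡.trans (≡.cong (β₀ *_) (^-distrib-* u z v)) (≡.sym (*-assoc β₀ (u ^ v) (z ^ v)))) h ,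
            λ z≡0 → uz≢0 (≡.trans (≡.cong (u *_) z≡0) (zeroʳ u))

      open Averaging using (β; β≢0; 1∈U; s≤#U)

      N = # Fixed?

      #U≤ : # (U? β) ℕ.≤ N ℕ.^ m
      #U≤ = ℕ.≤-trans (#-mono (U? β) (λ z → op m (coeffs β) z Fin.≟ 0#) (U⇒ker β)) (#-ker m (coeffs β) (top≢0 β≢0))

      m≡ : suc (ℕ.pred m) ≡ m
      m≡ = ℕ.suc-pred m {{ℕ.>-nonZero (ℕ.<⇒≤ 2≤m)}}

      k′ = gcd k n

      -- In a field with p^n elements a point fixed by the k-th power of Frobenius is fixed by the
      -- gcd(k, n)-th, and that is a polynomial equation of degree p^gcd(k, n).
      N≤ : N ℕ.≤ p ℕ.^ k′
      N≤ = ℕ.≤-trans (#-mono Fixed? (λ x → eval f x Fin.≟ 0#) fixed⇒root) (ℕ.≤-trans (#-roots f nf) (ℕ.≤-reflexive deg-f))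
        where
        Q = p ℕ.^ k′
        f : Poly
        f = 𝕏 P.^ Q P.- 𝕏
        1≤k′ : 1 ℕ.≤ k′
        1≤k′ = ℕ.n≢0⇒n>0 (λ e → ℕ.<⇒≢ 1≤k (≡.sym (0∣⇒≡0 (≡.subst (_∣ k) e (gcd[m,n]∣m k n)))))
          where open import Data.Nat.Divisibility using (0∣⇒≡0)
        Q≥2 : 2 ℕ.≤ Q
        Q≥2 = ℕ.≤-trans p≥2 (≡.subst (ℕ._≤ Q) (ℕ.*-identityʳ p) (ℕ.^-monoʳ-≤ p 1≤k′))
        dom : (P.- 𝕏 +ₚ 𝕏 P.^ Q ≋0̸) × deg (P.- 𝕏 +ₚ 𝕏 P.^ Q) ≡ deg (𝕏 P.^ Q)
        dom = +-dominant {P.- 𝕏} {𝕏 P.^ Q} (≡.subst (P.- 𝕏 <°_) (≡.sym (deg-𝕏^ Q)) (<°-neg {𝕏} (<°-mono 𝕏 Q≥2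
          (≡.subst (λ m → 𝕏 <° suc m) deg-𝕏 (<°deg 𝕏))))) (^ₚ-≋0̸ Q 𝕏≋0̸)
        nf : f ≋0̸
        nf = ≋0̸-cong (P.+-comm (P.- 𝕏) (𝕏 P.^ Q)) (proj₁ dom)
        deg-f : deg f ≡ Q
        deg-f = ≡.trans (deg-cong (P.+-comm (𝕏 P.^ Q) (P.- 𝕏))) (≡.trans (proj₂ dom) (deg-𝕏^ Q))
        fixed⇒root : ∀ x → Fixed x → eval f x ≡ 0#
        fixed⇒root x h = ≡.trans (eval-sub (𝕏 P.^ Q) 𝕏 x) (x≈y⇒x-y≈0 (≡.trans (≡.trans (eval-^ 𝕏 Q x) (^-congˡ Q (eval-𝕏 x)))
          (≡.trans (frobenius-gcd k n h (fermat x)) (≡.sym (eval-𝕏 x)))))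

      -- Otherwise k′ ≤ k/2 and U_β has at most p^(k′m) ≤ P^(m−1) elements.
      k∣n : k ∣ n
      k∣n = split (_∣_.quotient k′∣k) (_∣_.equality k′∣k)
        where
        k′∣k : k′ ∣ k
        k′∣k = gcd[m,n]∣m k n
        split : ∀ a → k ≡ a ℕ.* k′ → k ∣ n
        split zero    e = contradiction (≡.subst (1 ℕ.≤_) e 1≤k) λ ()
        split (suc zero) e = ≡.subst (_∣ n) (≡.sym (≡.trans e (ℕ.*-identityˡ k′))) (gcd[m,n]∣n k n)
        split (suc (suc a)) e = contradiction (ℕ.≤-trans s≤#U (ℕ.≤-trans #U≤ (ℕ.≤-trans (ℕ.^-monoˡ-≤ m N≤)
            (ℕ.≤-trans (ℕ.≤-reflexive (ℕ.^-*-assoc p k′ m)) (ℕ.≤-trans (ℕ.^-monoʳ-≤ p k′m≤) (ℕ.≤-reflexive (≡.sym (Pₖ^ (ℕ.pred m))))))))) (ℕ.<⇒≱ s-large)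
          where
          r = ℕ.pred m
          k′m≤ : k′ ℕ.* m ℕ.≤ k ℕ.* r
          k′m≤ = ≤.begin
            k′ ℕ.* m                       ≤.≡⟨ ≡.cong (k′ ℕ.*_) (≡.sym m≡) ⟩
            k′ ℕ.* suc r                   ≤.≤⟨ ℕ.*-monoʳ-≤ k′ (ℕ.+-monoˡ-≤ r (ℕ.pred-mono-≤ 2≤m)) ⟩
            k′ ℕ.* (r ℕ.+ r)               ≤.≡⟨ lem k′ r ⟩
            (2 ℕ.* k′) ℕ.* r               ≤.≤⟨ ℕ.*-monoˡ-≤ r (ℕ.*-monoˡ-≤ k′ (s≤s (s≤s (z≤n {a})))) ⟩
            (suc (suc a) ℕ.* k′) ℕ.* r     ≤.≡⟨ ≡.cong (ℕ._* r) (≡.sym e) ⟩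
            k ℕ.* r                        ≤.∎
            where
            module ≤ = ℕ.≤-Reasoning
            lem : ∀ k r → k ℕ.* (r ℕ.+ r) ≡ (2 ℕ.* k) ℕ.* r
            lem = solve-∀

      h = _∣_.quotient k∣n

      q≡P^h : q ≡ Pₖ ℕ.^ h
      q≡P^h = ≡.trans (≡.cong (p ℕ.^_) (≡.trans (_∣_.equality k∣n) (ℕ.*-comm h k))) (≡.sym (Pₖ^ h))

      1≤h : 1 ℕ.≤ h
      1≤h = ℕ.n≢0⇒n>0 (λ e → ℕ.<⇒≢ n≥1 (≡.sym (≡.trans (_∣_.equality k∣n) (≡.cong (ℕ._* k) e))))

      -- The operator Φ^h − 1 vanishes on the whole field.
      N≡ : N ≡ Pₖ
      N≡ = ℕ.≤-antisym (ℕ.≤-trans N≤ (ℕ.^-monoʳ-≤ p (∣⇒≤ {{ℕ.>-nonZero 1≤k}} (gcd[m,n]∣m k n))))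
          (ℕ.≮⇒≥ λ N<P → ℕ.<⇒≱ (ℕ.^-monoˡ-< h {{ℕ.>-nonZero 1≤h}} N<P) (≡.subst (ℕ._≤ N ℕ.^ h) q≡P^h q≤))
        where
        pick : {A B : Set} → Dec A → Dec B → Fin q
        pick (yes _) _       = 1#
        pick (no _)  (yes _) = - 1#
        pick (no _)  (no _)  = 0#
        a : ℕ → ℕ → Fin q
        a h i = pick (i ℕ.≟ h) (i ℕ.≟ 0)
        pick-1 : {A B : Set} → A → (d : Dec A) (d′ : Dec B) → pick d d′ ≡ 1#
        pick-1 _ (yes _) _  = ≡.refl
        pick-1 x (no ¬x) _  = contradiction x ¬x
        pick--1 : {A B : Set} → ¬ A → B → (d : Dec A) (d′ : Dec B) → pick d d′ ≡ - 1#
        pick--1 ¬x _ (yes x) _       = contradiction x ¬x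
        pick--1 _  _ (no _)  (yes _) = ≡.refl
        pick--1 _  y (no _)  (no ¬y) = contradiction y ¬y
        pick-0 : {A B : Set} → ¬ A → ¬ B → (d : Dec A) (d′ : Dec B) → pick d d′ ≡ 0#
        pick-0 ¬x _  (yes x) _       = contradiction x ¬x
        pick-0 _  ¬y (no _)  (yes y) = contradiction y ¬y
        pick-0 _  _  (no _)  (no _)  = ≡.refl
        a-top : ∀ h → a h h ≡ 1#
        a-top h = pick-1 ≡.refl (h ℕ.≟ h) (h ℕ.≟ 0)
        partial : ∀ h j z → suc j ℕ.≤ h → op j (a h) z ≡ - z
        partial h zero z lt = ≡.trans (≡.cong (_* z ^ 1) (pick--1 (ℕ.<⇒≢ lt) ≡.refl (0 ℕ.≟ h) (0 ℕ.≟ 0)))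
          (≡.trans (≡.sym (-‿distribˡ-* 1# _)) (≡.cong -_ (≡.trans (*-identityˡ _) (*-identityʳ z))))
        partial h (suc j) z lt = ≡.trans (≡.cong₂ _+_ (partial h j z (ℕ.<⇒≤ lt))
          (≡.trans (≡.cong (_* z ^ (Pₖ ℕ.^ suc j)) (pick-0 (ℕ.<⇒≢ lt) (λ ()) (suc j ℕ.≟ h) (suc j ℕ.≟ 0))) (zeroˡ _))) (+-identityʳ _)
        whole : ∀ h z → 1 ℕ.≤ h → op h (a h) z ≡ z ^ (Pₖ ℕ.^ h) - z
        whole (suc j) z _ = ≡.trans (≡.cong₂ _+_ (partial (suc j) j z ℕ.≤-refl) (≡.trans (≡.cong (_* z ^ (Pₖ ℕ.^ suc j)) (a-top (suc j))) (*-identityˡ _))) (+-comm _ _)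
        q≤ : q ℕ.≤ N ℕ.^ h
        q≤ = ℕ.≤-trans (ℕ.≤-reflexive (≡.sym (#-full (λ z → op h (a h) z Fin.≟ 0#) (λ z → ≡.trans (whole h z 1≤h)
          (x≈y⇒x-y≈0 (≡.trans (≡.cong (z ^_) (≡.sym q≡P^h)) (fermat z)))))))
          (#-ker h (a h) (≡.subst (_≢ 0#) (≡.sym (a-top h)) 1≢0))

      𝕃 : Subfield
      𝕃 = fixedField k

      open Subspaces 𝕃

      U : Subspace
      U = record
        { W = λ z → Z (β * z ^ v) ; W? = U? β ; 0∈W = 0∈U β
        ; +-W = λ {x} {y} hx hy → ker⇒U β (x + y) (≡.trans (op-+ m (coeffs β) x y) (≡.trans (≡.cong₂ _+_ (U⇒ker β x hx) (U⇒ker β y hy)) (+-identityˡ 0#)))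
        ; *-W = λ {c} {x} hc hx → ker⇒U β (c * x) (≡.trans (op-* m (coeffs β) hc x) (≡.trans (≡.cong (c *_) (U⇒ker β x hx)) (zeroʳ c))) }

      -- The size of U is a power of P exceeding P^(m−1).
      P^m≤ : Pₖ ℕ.^ m ℕ.≤ size U
      P^m≤ = bound (size-power U)
        where
        bound : ∃[ j ] size U ≡ # L? ℕ.^ j → Pₖ ℕ.^ m ℕ.≤ size U
        bound (j , e) = ≡.subst (Pₖ ℕ.^ m ℕ.≤_) (≡.sym size≡) (ℕ.^-monoʳ-≤ Pₖ {{ℕ.>-nonZero (ℕ.<⇒≤ Pₖ≥2)}} (≡.subst (ℕ._≤ j) m≡ (ℕ.≰⇒> small)))
          where
          size≡ : size U ≡ Pₖ ℕ.^ j
          size≡ = ≡.trans e (≡.cong (ℕ._^ j) N≡)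
          small : ¬ (j ℕ.≤ ℕ.pred m)
          small j≤ = ℕ.<⇒≱ s-large (ℕ.≤-trans s≤#U (ℕ.≤-trans (ℕ.≤-reflexive size≡) (ℕ.^-monoʳ-≤ Pₖ {{ℕ.>-nonZero (ℕ.<⇒≤ Pₖ≥2)}} j≤)))

      image? : Decidable (λ y → ∃[ z ] (Z (β * z ^ v) × z ≢ 0#) × β * z ^ v ≡ y)
      image? y = Fin.any? (λ z → nonzero? (U? β) z ×-dec (β * z ^ v Fin.≟ y))

      -- The nonzero part of U has at least P^m - 1 = v (s - 1) elements, and u ↦ β u^v has fibres
      -- of at most v elements. So its image fills the s - 1 nonzero roots.
      Z*⇒image : ∀ y → Z y × y ≢ 0# → ∃[ z ] (Z (β * z ^ v) × z ≢ 0#) × β * z ^ v ≡ y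
      Z*⇒image = #-full-subset image? (nonzero? Z?) (λ { y (z , (hz , z≢0) , ≡.refl) → hz , *-≉0 β≢0 (^-≉0 v z≢0) }) (ℕ.≤-trans (ℕ.≤-reflexive #Z*) s-1≤)
        where
        s-1≤ : s-1 ℕ.≤ # image?
        s-1≤ = ℕ.*-cancelˡ-≤ v {{ℕ.>-nonZero 1≤v}} (ℕ.≤-trans (ℕ.≤-pred (≡.subst₂ ℕ._≤_ (≡.trans (≡.trans (Pₖ^ m) (≡.cong (p ℕ.^_) (≡.sym K≡))) (≡.sym top)) (#-remove (U? β) 0# (0∈U β) (nonzero? (U? β))) P^m≤))
          (Fibres.#-fibres-≤ (nonzero? (U? β)) (λ z → β * z ^ v) image? v (λ z hz → z , hz , ≡.refl) (λ y _ → #-power-fibre v 1≤v (nonzero? (U? β)) β β≢0 y)))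

    result : PowerCoset Z
    result = record
      { a = β ; b = 0# ; a≢0 = β≢0 ; k = k ; v = v ; 1≤k = 1≤k ; 𝕃 = 𝕃 ; #𝕃 = N≡ ; U = U ; 1∈U = 1∈U ; 1≤v = 1≤v ; v∣ = v∣
      ; to = λ y z → to y z (y Fin.≟ 0#) ; from = λ u hu → ≡.subst Z (≡.sym (+-identityʳ _)) hu }
      where
      to : ∀ y → Z y → Dec (y ≡ 0#) → ∃[ u ] Z (β * u ^ v) × y ≡ β * u ^ v + 0#
      to y z (yes ≡.refl) = 0# , 0∈U β , ≡.sym (≡.trans (+-identityʳ _) (≡.trans (≡.cong (β *_) (0^ v 1≤v)) (zeroʳ β)))
      to y z (no y≢0) = proj₁ I , proj₁ (proj₁ (proj₂ I)) , ≡.sym (≡.trans (+-identityʳ _) (proj₂ (proj₂ I)))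
        where
        I : ∃[ z ] (Z (β * z ^ v) × z ≢ 0#) × β * z ^ v ≡ y
        I = Z*⇒image y (z , y≢0)

  -- From a minimal value set polynomial to a power coset.

  eval-0 : ∀ f → eval f 0# ≡ coeff f 0
  eval-0 []      = ≡.refl
  eval-0 (a ∷ f) = ≡.trans (≡.cong (a +_) (zeroˡ (eval f 0#))) (+-identityʳ a)

  module _ {V : Fin q → Set} (V? : Decidable V) where

    open RootPolynomial V?

    -- F is first translated by δ = -γ with γ in V, so that 0 becomes a root of the translated
    -- polynomial, as `shape` requires. This translation and the one found by `shape` are both
    -- absorbed into the constant b.
    forward : ∀ F → 1 ℕ.≤ deg F → (∀ x → V (eval F x)) → 3 ℕ.≤ # V? → ℕ.pred (# V?) ℕ.* deg F ℕ.< q → PowerCoset V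
    forward F 1≤d values 3≤#V bound = translated (zeroSet (shape F̂ T̂ (≡.subst (1 ℕ.≤_) (≡.sym dF̂) 1≤d) (≡.subst (3 ℕ.≤_) (≡.sym dT̂) 3≤#V)
        (≡.subst₂ (λ s d → ℕ.pred s ℕ.* d ℕ.< q) (≡.sym dT̂) (≡.sym dF̂) bound) vanish T̂0))
      where
      γ : ∃[ y ] V y
      γ = #>0⇒∃ V? (ℕ.≤-trans (s≤s z≤n) 3≤#V)
      δ : Fin q
      δ = - proj₁ γ
      nT : rootPoly ≋0̸
      nT = deg≥1⇒≋0̸ (≡.subst (1 ℕ.≤_) (≡.sym deg-rootPoly) (ℕ.≤-trans (s≤s z≤n) 3≤#V))
      T̂ F̂ : Poly
      T̂ = shift rootPoly δ
      F̂ = F +ₚ C δ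
      dT̂ : deg T̂ ≡ # V?
      dT̂ = ≡.trans (deg-shift rootPoly δ nT) deg-rootPoly
      dF̂ : deg F̂ ≡ deg F
      dF̂ = deg-F+C F δ 1≤d
      vanish : ∀ x → eval T̂ (eval F̂ x) ≡ 0#
      vanish x = ≡.trans (eval-shift rootPoly δ (eval F̂ x)) (rootPoly-root (≡.subst V (≡.sym (≡.trans (≡.cong (_- δ)
        (≡.trans (eval-+ F (C δ) x) (≡.cong (eval F x +_) (eval-C δ x)))) (solve 2 (λ f d → f :+ d :- d := f) ≡.refl (eval F x) δ))) (values x)))
      T̂0 : coeff T̂ 0 ≡ 0#
      T̂0 = ≡.trans (≡.sym (eval-0 T̂)) (≡.trans (eval-shift rootPoly δ 0#) (rootPoly-root (≡.subst V
        (solve 1 (λ g → g := con (pos 0) :- (:- g)) ≡.refl (proj₁ γ)) (proj₂ γ))))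
      Translate : Fin q → Fin q → Set
      Translate lam y = V (y - lam - δ)
      zeroSet : Result T̂ → ∃[ lam ] PowerCoset (Translate lam)
      zeroSet (T′ , lam , S , e , dT′) = lam , by-shape S
        where
        Z = Translate lam
        Z? : Decidable Z
        Z? y = V? (y - lam - δ)
        value : ∀ y → eval T′ y ≡ eval rootPoly (y - lam - δ)
        value y = ≡.trans (e y) (eval-shift rootPoly δ (y - lam))
        Z⇒ : ∀ {y} → Z y → eval T′ y ≡ 0#
        Z⇒ {y} z = ≡.trans (value y) (rootPoly-root z)
        ⇒Z : ∀ {y} → eval T′ y ≡ 0# → Z y
        ⇒Z {y} r = root-rootPoly (≡.trans (≡.sym (value y)) r)
        d≡ : deg T′ ≡ # V?
        d≡ = ≡.trans dT′ dT̂
        #Z : # Z? ≡ deg T′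
        #Z = ≡.trans (#-cong Z? (λ y → V? (- (lam + δ) + y)) (λ y → ≡.subst V (eq y)) (λ y → ≡.subst V (≡.sym (eq y))))
          (≡.trans (≡.sym (#-permute V? (translation (- (lam + δ))))) (≡.sym d≡))
          where
          eq : ∀ y → y - lam - δ ≡ - (lam + δ) + y
          eq y = solve 3 (λ y l d → y :- l :- d := :- (l :+ d) :+ y) ≡.refl y lam δ
        3≤s : 3 ℕ.≤ deg T′
        3≤s = ≡.subst (3 ℕ.≤_) (≡.sym d≡) 3≤#V
        by-shape : Shape T′ → PowerCoset Z
        by-shape (binomial t₁ c T≋) = BinomialCase.result Z? Z⇒ ⇒Z #Z 3≤s (⇒Z T0) t₁ c T≋
          where
          T0 : eval T′ 0# ≡ 0#
          T0 = ≡.trans (eval-cong 0# T≋) (≡.trans (eval-+ (C t₁ *ₚ 𝕏) (C c *ₚ 𝕏 P.^ deg T′) 0#) (≡.trans (≡.cong₂ _+_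
            (≡.trans (eval-* (C t₁) 𝕏 0#) (≡.trans (≡.cong (eval (C t₁) 0# *_) (eval-𝕏 0#)) (zeroʳ _)))
            (≡.trans (eval-* (C c) (𝕏 P.^ deg T′) 0#) (≡.trans (≡.cong (eval (C c) 0# *_) (≡.trans (eval-^ 𝕏 (deg T′) 0#) (≡.trans (^-congˡ (deg T′) (eval-𝕏 0#))
              (0^ (deg T′) (ℕ.≤-trans (s≤s z≤n) 3≤s))))) (zeroʳ _)))) (+-identityˡ 0#)))
        by-shape (additive v K i₀ e₀ 1≤v supp top 1≤i₀ i₀<K ve₀) = AdditiveCase.result Z? Z⇒ ⇒Z #Z 3≤s (⇒Z (T0 (coeff T′ 0 Fin.≟ 0#)))
            (record { v = v ; K = K ; i₀ = i₀ ; e₀ = e₀ ; 1≤v = 1≤v ; supp = supp ; top = top ; 1≤i₀ = 1≤i₀ ; i₀<K = i₀<K ; ve₀ = ve₀ })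
          where
          T0 : Dec (coeff T′ 0 ≡ 0#) → eval T′ 0# ≡ 0#
          T0 (yes z) = ≡.trans (eval-0 T′) z
          T0 (no nz) = contradiction (proj₁ (supp 0 nz)) λ ()
      translated : ∃[ lam ] PowerCoset (Translate lam) → PowerCoset V
      translated (lam , 𝒫) = record
        { a = a ; b = b - lam - δ ; a≢0 = a≢0 ; k = k ; v = v ; 1≤k = 1≤k ; 𝕃 = 𝕃 ; #𝕃 = #𝕃 ; U = U ; 1∈U = 1∈U ; 1≤v = 1≤v ; v∣ = v∣
        ; to = λ y y∈ → move y (to (y + lam + δ) (≡.subst V (solve 3 (λ y l d → y := y :+ l :+ d :- l :- d) ≡.refl y lam δ) y∈))
        ; from = λ u u∈ → ≡.subst V (back (a * u ^ v)) (from u u∈) }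
        where
        open PowerCoset 𝒫
        back : ∀ w → w + b - lam - δ ≡ w + (b - lam - δ)
        back w = solve 4 (λ w b l d → w :+ b :- l :- d := w :+ (b :- l :- d)) ≡.refl w b lam δ
        move : ∀ y → ∃[ u ] Subspaces.Subspace.W U u × y + lam + δ ≡ a * u ^ v + b → ∃[ u ] Subspaces.Subspace.W U u × y ≡ a * u ^ v + (b - lam - δ)
        move y (u , u∈ , e) = u , u∈ , ≡.trans (solve 3 (λ y l d → y := y :+ l :+ d :- l :- d) ≡.refl y lam δ)
          (≡.trans (≡.cong (λ w → w - lam - δ) e) (back (a * u ^ v)))

  -- From a power coset to a minimal value set polynomial.

  open import Data.Nat.DivMod using (m*n/n≡m; m<n⇒m/n≡0; +-distrib-/-∣ʳ) renaming (_/_ to infixl 7 _/_)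

  -- By Fermat's theorem the q-th power fixes the coefficients and acts on X alone.
  comp-𝕏^q : ∀ f → comp f (𝕏 P.^ q) ≋ f P.^ q
  comp-𝕏^q []      = P.sym (P.0^ q (ℕ.<⇒≤ q≥2))
  comp-𝕏^q (a ∷ f) = P.sym (P.begin
    (a ∷ f) P.^ q                        P.≈⟨ P.^-congˡ q (∷≋C+𝕏* a f) ⟩
    (C a +ₚ 𝕏 *ₚ f) P.^ q                P.≈⟨ FrobP.frobenius^ n (C a) (𝕏 *ₚ f) ⟩
    C a P.^ q +ₚ (𝕏 *ₚ f) P.^ q          P.≈⟨ P.+-cong (P.trans (P.sym (C-^ a q)) (C-cong (fermat a))) (P.^-distrib-* 𝕏 f q) ⟩
    C a +ₚ 𝕏 P.^ q *ₚ f P.^ q            P.≈⟨ P.+-congˡ (P.*-congˡ (P.sym (comp-𝕏^q f))) ⟩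
    C a +ₚ 𝕏 P.^ q *ₚ comp f (𝕏 P.^ q)   P.∎)

  module Annihilators (𝕃 : Subfield) (k : ℕ) (1≤k : 1 ℕ.≤ k) (#𝕃 : # (Subfield.L? 𝕃) ≡ p ℕ.^ k) where

    open Subspaces 𝕃 public

    P-1 Q : ℕ
    Q = p ℕ.^ k
    P-1 = ℕ.pred Q

    Q≥2 : 2 ℕ.≤ Q
    Q≥2 = ℕ.≤-trans p≥2 (≡.subst (ℕ._≤ Q) (ℕ.*-identityʳ p) (ℕ.^-monoʳ-≤ p 1≤k))

    Q≡ : Q ≡ suc P-1
    Q≡ = ≡.sym (ℕ.suc-pred Q {{ℕ.>-nonZero (ℕ.<⇒≤ Q≥2)}})

    L*? : Decidable (λ c → L c × c ≢ 0#)
    L*? = nonzero? L?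

    #L* : # L*? ≡ P-1
    #L* = ℕ.suc-injective (≡.trans (≡.sym (#-remove L? 0# 0∈L L*?)) (≡.trans #𝕃 Q≡))

    inverse-L : ∀ {c} → L c → c ≢ 0# → ∃[ i ] L i × c * i ≡ 1#
    inverse-L c∈ c≢0 = proj₁ (invert _ c≢0) , inv-L c∈ (proj₂ (invert _ c≢0)) , proj₂ (invert _ c≢0)

    L*-cancel : ∀ {c} x → L c → c ≢ 0# → L (c * x) → L x
    L*-cancel {c} x c∈ c≢0 cx∈ = ≡.subst L (≡.trans (solve 3 (λ i c x → i :* (c :* x) := (c :* i) :* x) ≡.refl i c x)
        (≡.trans (≡.cong (_* x) (proj₂ (proj₂ I))) (*-identityˡ x))) (*-L (proj₁ (proj₂ I)) cx∈)
      where
      I = inverse-L c∈ c≢0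
      i = proj₁ I

    L^P-1 : ∀ {c} → L c → c ≢ 0# → c ^ P-1 ≡ 1#
    L^P-1 {c} c∈ c≢0 = ≡.trans (≡.cong (c ^_) (≡.sym #L*)) (a^#H≡1 L*? (λ _ → proj₂) c c≢0
      (λ x (x∈ , x≢0) → *-L c∈ x∈ , *-≉0 c≢0 x≢0)
      (λ x (cx∈ , cx≢0) → L*-cancel x c∈ c≢0 cx∈ , λ x≡0 → cx≢0 (≡.trans (≡.cong (c *_) x≡0) (zeroʳ c))))

    L^P : ∀ {c} → L c → c ^ Q ≡ c
    L^P {c} c∈ = split (c Fin.≟ 0#)
      where
      split : Dec (c ≡ 0#) → c ^ Q ≡ c
      split (yes ≡.refl) = 0^ Q (ℕ.<⇒≤ Q≥2)
      split (no c≢0) = ≡.trans (≡.cong (c ^_) Q≡) (≡.trans (≡.cong (c *_) (L^P-1 c∈ c≢0)) (*-identityʳ c))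

    -- L consists of the P − 1 roots of w^(P−1) = 1 and of 0.
    root⇒L : ∀ w → w ^ P-1 ≡ 1# → L w
    root⇒L w e = proj₁ (#-full-subset L*? root? (λ c (c∈ , c≢0) → L^P-1 c∈ c≢0)
        (ℕ.≤-trans #root (ℕ.≤-reflexive (≡.sym #L*))) w e)
      where
      root? : Decidable (λ w → w ^ P-1 ≡ 1#)
      root? w = w ^ P-1 Fin.≟ 1#
      #root : # root? ℕ.≤ P-1
      #root = ℕ.≤-trans (#-mono root? (Fibres.fibre? (λ (x : Fin q) → x Fin.≟ x) (λ z → 1# * z ^ P-1) 1#) (λ x h → ≡.refl , ≡.trans (*-identityˡ _) h))
        (#-power-fibre P-1 (ℕ.≤-pred (≡.subst (2 ℕ.≤_) Q≡ Q≥2)) (λ x → x Fin.≟ x) 1# 1≢0 1#)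

    open Subspace

    -- `factor` writes `A` as B ∘ A₀. Started with A₀ = X at the zero space, the chain ends at `U`;
    -- started again with A₀ the annihilator of `U`, it ends at the whole field and delivers the
    -- cofactor. Additivity is stated for composition, because commuting A with B is an identity of
    -- polynomials and not only of values.
    record Annihilator (A₀ : Poly) (V : Subspace) : Set where
      field
        A B      : Poly
        factor   : comp B A₀ ≋ A
        comp-A-+ : ∀ f g → comp A (f +ₚ g) ≋ comp A f +ₚ comp A g
        linear   : ∀ {c} → L c → ∀ z → eval A (c * z) ≡ c * eval A z
        A≋0̸      : A ≋0̸
        deg-A    : deg A ≡ size V
        root⇒W   : ∀ z → eval A z ≡ 0# → W V z
        W⇒root   : ∀ z → W V z → eval A z ≡ 0#

      eval-+A : ∀ x y → eval A (x + y) ≡ eval A x + eval A y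
      eval-+A x y = ≡.trans (eval-congˡ A (≡.sym (≡.trans (eval-+ (C x) (C y) x) (≡.cong₂ _+_ (eval-C x x) (eval-C y x)))))
        (≡.trans (≡.sym (eval-comp A (C x +ₚ C y) x)) (≡.trans (eval-cong x (comp-A-+ (C x) (C y)))
        (≡.trans (eval-+ (comp A (C x)) (comp A (C y)) x) (≡.cong₂ _+_
          (≡.trans (eval-comp A (C x) x) (eval-congˡ A (eval-C x x))) (≡.trans (eval-comp A (C y) x) (eval-congˡ A (eval-C y x)))))))

    identity : ∀ V → (∀ z → W V z → z ≡ 0#) → Annihilator 𝕏 V
    identity V V⊂0 = record
      { A = 𝕏 ; B = 𝕏 ; factor = comp-𝕏 𝕏
      ; comp-A-+ = λ f g → P.trans (comp-𝕏 (f +ₚ g)) (P.sym (P.+-cong (comp-𝕏 f) (comp-𝕏 g)))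
      ; linear = λ {c} _ z → ≡.trans (eval-𝕏 (c * z)) (≡.cong (c *_) (≡.sym (eval-𝕏 z)))
      ; A≋0̸ = 𝕏≋0̸ ; deg-A = ≡.trans deg-𝕏 (≡.sym (#-unique (W? V) 0# (0∈W V) V⊂0))
      ; root⇒W = λ z e → ≡.subst (W V) (≡.trans (≡.sym e) (eval-𝕏 z)) (0∈W V)
      ; W⇒root = λ z w → ≡.trans (eval-𝕏 z) (V⊂0 z w) }

    based : ∀ {A₀ V} (𝒜 : Annihilator A₀ V) → Annihilator (Annihilator.A 𝒜) V
    based 𝒜 = record
      { A = A ; B = 𝕏 ; factor = comp-𝕏 A ; comp-A-+ = comp-A-+ ; linear = linear ; A≋0̸ = A≋0̸ ; deg-A = deg-A
      ; root⇒W = root⇒W ; W⇒root = W⇒root }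
      where open Annihilator 𝒜

    resize : ∀ {A₀ V V′} → (∀ z → W V z → W V′ z) → (∀ z → W V′ z → W V z) → Annihilator A₀ V → Annihilator A₀ V′
    resize {V = V} {V′} to from 𝒜 = record
      { A = A ; B = B ; factor = factor ; comp-A-+ = comp-A-+ ; linear = linear ; A≋0̸ = A≋0̸
      ; deg-A = ≡.trans deg-A (#-cong (W? V) (W? V′) to from)
      ; root⇒W = λ z e → to z (root⇒W z e) ; W⇒root = λ z w → W⇒root z (from z w) }
      where open Annihilator 𝒜

    -- Adjoining u composes with w ↦ w^P − A(u)^(P−1) w.
    adjoin : ∀ {A₀} V u → ¬ W V u → Annihilator A₀ V → Annihilator A₀ (extend V u)
    adjoin {A₀} V u u∉ 𝒜 = record
      { A = φ A ; B = φ B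
      ; factor = P.trans (comp-φ B A₀) (φ-cong factor)
      ; comp-A-+ = λ f g → P.trans (comp-φ A (f +ₚ g)) (P.trans (φ-cong (comp-A-+ f g)) (P.trans (φ-+ (comp A f) (comp A g))
          (P.sym (P.+-cong (comp-φ A f) (comp-φ A g)))))
      ; linear = λ {c} c∈ z → ≡.trans (eval-φ (c * z)) (≡.trans (≡.cong ψ (linear c∈ z)) (≡.trans (ψ-* c∈ (eval A z)) (≡.cong (c *_) (≡.sym (eval-φ z)))))
      ; A≋0̸ = ≋0̸-cong flipped (proj₁ dom)
      ; deg-A = ≡.trans (deg-cong (P.sym flipped)) (≡.trans (proj₂ dom) (≡.trans deg-A^Q (≡.trans (≡.cong₂ ℕ._*_ (≡.sym #𝕃) deg-A)
          (≡.trans (ℕ.*-comm (# L?) (size V)) (≡.sym (size-extend V u u∉))))))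
      ; root⇒W = λ z e → root⇒W′ z (eval A z Fin.≟ 0#) (≡.trans (≡.sym (eval-φ z)) e)
      ; W⇒root = W⇒root′ }
      where
      open Annihilator 𝒜
      κ κ′ : Fin q
      κ = eval A u
      κ′ = κ ^ P-1
      κ≢0 : κ ≢ 0#
      κ≢0 e = u∉ (root⇒W u e)
      φ : Poly → Poly
      φ f = f P.^ Q P.- C κ′ *ₚ f
      ψ : Fin q → Fin q
      ψ w = w ^ Q - κ′ * w
      φ-cong : ∀ {f g} → f ≋ g → φ f ≋ φ g
      φ-cong e = P.+-cong (P.^-congˡ Q e) (P.-‿cong (P.*-congˡ e))
      comp-φ : ∀ f h → comp (φ f) h ≋ φ (comp f h)
      comp-φ f h = P.trans (comp-sub (f P.^ Q) (C κ′ *ₚ f) h) (P.+-cong (comp-^ f Q h) (P.-‿cong (P.trans (comp-* (C κ′) f h) (P.*-congʳ (comp-C κ′ h)))))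
      φ-+ : ∀ f g → φ (f +ₚ g) ≋ φ f +ₚ φ g
      φ-+ f g = P.trans (P.+-congʳ (FrobP.frobenius^ k f g))
        (P.solve 5 (λ F G c f g → (F P.:+ G) P.:- c P.:* (f P.:+ g) P.:= (F P.:- c P.:* f) P.:+ (G P.:- c P.:* g)) P.refl (f P.^ Q) (g P.^ Q) (C κ′) f g)
      eval-φ : ∀ z → eval (φ A) z ≡ ψ (eval A z)
      eval-φ z = ≡.trans (eval-sub (A P.^ Q) (C κ′ *ₚ A) z) (≡.cong₂ _-_ (eval-^ A Q z) (≡.trans (eval-* (C κ′) A z) (≡.cong (_* eval A z) (eval-C κ′ z))))
      ψ-* : ∀ {c} → L c → ∀ w → ψ (c * w) ≡ c * ψ w
      ψ-* {c} c∈ w = ≡.trans (≡.cong (_- κ′ * (c * w)) (≡.trans (^-distrib-* c w Q) (≡.cong (_* w ^ Q) (L^P c∈))))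
        (solve 4 (λ c W d w → c :* W :- d :* (c :* w) := c :* (W :- d :* w)) ≡.refl c (w ^ Q) κ′ w)
      1≤size : 1 ℕ.≤ size V
      1≤size = ℕ.≤-trans (ℕ.≤-reflexive (≡.sym (#-unique (Fin._≟ 0#) 0# ≡.refl (λ _ e → e)))) (#-mono (Fin._≟ 0#) (W? V) (λ { _ ≡.refl → 0∈W V }))
      deg-A^Q : deg (A P.^ Q) ≡ Q ℕ.* deg A
      deg-A^Q = deg-^ Q A≋0̸
      deg< : deg A ℕ.< Q ℕ.* deg A
      deg< = ≡.subst (ℕ._< Q ℕ.* deg A) (ℕ.*-identityˡ (deg A)) (ℕ.*-monoˡ-< (deg A) {{ℕ.>-nonZero (≡.subst (1 ℕ.≤_) (≡.sym deg-A) 1≤size)}} Q≥2)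
      dom : (P.- (C κ′ *ₚ A) +ₚ A P.^ Q ≋0̸) × deg (P.- (C κ′ *ₚ A) +ₚ A P.^ Q) ≡ deg (A P.^ Q)
      dom = +-dominant {P.- (C κ′ *ₚ A)} {A P.^ Q} (<°-neg {C κ′ *ₚ A} (<°-C* {A} κ′ (deg<⇒<° {A} (≡.subst (deg A ℕ.<_) (≡.sym deg-A^Q) deg<)))) (^ₚ-≋0̸ Q A≋0̸)
      flipped : P.- (C κ′ *ₚ A) +ₚ A P.^ Q ≋ φ A
      flipped = P.+-comm (P.- (C κ′ *ₚ A)) (A P.^ Q)
      root⇒W′ : ∀ z → Dec (eval A z ≡ 0#) → ψ (eval A z) ≡ 0# → W (extend V u) z
      root⇒W′ z (yes e) _ = extend-⊃ V u z (root⇒W z e)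
      root⇒W′ z (no w≢0) e = c , c∈ , root⇒W (z - c * u) (begin
          eval A (z - c * u)            ≡⟨ ≡.cong (eval A) (solve 3 (λ z c u → z :- c :* u := z :+ (:- c) :* u) ≡.refl z c u) ⟩
          eval A (z + (- c) * u)        ≡⟨ ≡.trans (eval-+A z ((- c) * u)) (≡.cong (w +_) (linear (neg-L c∈) u)) ⟩
          w + (- c) * κ                 ≡⟨ solve 3 (λ i w κ → w :+ (:- (i :* w)) :* κ := w :- (κ :* i) :* w) ≡.refl i w κ ⟩
          w - (κ * i) * w               ≡⟨ ≡.trans (≡.cong (λ x → w - x * w) (proj₂ (invert κ κ≢0))) (≡.trans (≡.cong (λ x → w - x) (*-identityˡ w)) (-‿inverseʳ w)) ⟩
          0#                            ∎)
        where
        w = eval A z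
        i = proj₁ (invert κ κ≢0)
        c = i * w
        -- ψ(w) = 0 says w^P = κ^(P-1) w. Cancelling w ≠ 0 shows that w/κ is a (P - 1)-st root of
        -- unity and hence in L.
        w^ : w ^ P-1 ≡ κ ^ P-1
        w^ = x-y≈0⇒x≈y (*-cancel-0 w≢0 (≡.trans (solve 3 (λ w x k → w :* (x :- k) := w :* x :- k :* w) ≡.refl w (w ^ P-1) κ′)
          (≡.trans (≡.cong (λ m → w ^ m - κ′ * w) (≡.sym Q≡)) e)))
        c∈ : L c
        c∈ = root⇒L c (≡.trans (^-distrib-* i w P-1) (≡.trans (≡.cong (i ^ P-1 *_) w^) (≡.trans (≡.sym (^-distrib-* i κ P-1))
          (≡.trans (^-congˡ P-1 (≡.trans (*-comm i κ) (proj₂ (invert κ κ≢0)))) (1^ P-1)))))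
      W⇒root′ : ∀ z → W (extend V u) z → eval (φ A) z ≡ 0#
      W⇒root′ z (c , c∈ , w) = ≡.trans (eval-φ z) (≡.trans (≡.cong ψ Az) (≡.trans (ψ-* c∈ κ) (≡.trans (≡.cong (c *_) ψκ) (zeroʳ c))))
        where
        Az : eval A z ≡ c * κ
        Az = ≡.trans (≡.cong (eval A) (solve 3 (λ z c u → z := (z :- c :* u) :+ c :* u) ≡.refl z c u))
          (≡.trans (eval-+A (z - c * u) (c * u)) (≡.trans (≡.cong₂ _+_ (W⇒root (z - c * u) w) (linear c∈ u)) (+-identityˡ _)))
        ψκ : ψ κ ≡ 0#
        ψκ = x≈y⇒x-y≈0 (≡.trans (≡.cong (κ ^_) Q≡) (*-comm κ κ′))

    module Parametrisation (U : Subspace) where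

      private
        whole : Subspace
        whole = record
          { W = λ x → x ≡ x ; W? = λ x → x Fin.≟ x ; 0∈W = ≡.refl ; +-W = λ _ _ → ≡.refl ; *-W = λ _ _ → ≡.refl }

        𝒜 : Annihilator 𝕏 U
        𝒜 = finish (chain (Annihilator 𝕏) adjoin zeroSpace U (λ { _ ≡.refl → 0∈W U }) (identity zeroSpace (λ _ e → e)))
          where
          finish : ∃[ V ] Annihilator 𝕏 V × (∀ z → W V z → W U z) × (∀ z → W U z → W V z) → Annihilator 𝕏 U
          finish (V , 𝒜 , V⊂U , U⊂V) = resize V⊂U U⊂V 𝒜

        open Annihilator 𝒜 using (A; comp-A-+; A≋0̸; deg-A; root⇒W)

        ℬ : Annihilator A whole
        ℬ = finish (chain (Annihilator A) adjoin U whole (λ _ _ → ≡.refl) (based 𝒜))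
          where
          finish : ∃[ V ] Annihilator A V × (∀ z → W V z → W whole z) × (∀ z → W whole z → W V z) → Annihilator A whole
          finish (V , ℬ , V⊂ , ⊂V) = resize V⊂ ⊂V ℬ

        module ℬ = Annihilator ℬ

        1≤deg-A : 1 ℕ.≤ deg A
        1≤deg-A = ≡.subst (1 ℕ.≤_) (≡.sym deg-A) (ℕ.≤-trans (ℕ.≤-reflexive (≡.sym (#-unique (Fin._≟ 0#) 0# ≡.refl (λ _ e → e))))
          (#-mono (Fin._≟ 0#) (W? U) (λ { _ ≡.refl → 0∈W U })))

        -- The annihilator of the whole field is divisible by X^q - X and has degree q. The constant
        -- need not be computed; its inverse goes into the definition of `parametrisation`.
        scaled : ∃[ c ] c ≢ 0# × ℬ.A ≋ C c *ₚ 𝕏q-𝕏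
        scaled = unit (vanishing⇒𝕏q-𝕏∣ ℬ.A (λ x → ℬ.W⇒root x ≡.refl))
          where
          unit : ∃[ h ] ℬ.A ≋ 𝕏q-𝕏 *ₚ h → ∃[ c ] c ≢ 0# × ℬ.A ≋ C c *ₚ 𝕏q-𝕏
          unit (h , e) = coeff h 0 , (λ z → nh (P.trans h≋ (P.trans (C-cong z) C-0))) , P.trans e (P.trans (P.*-comm 𝕏q-𝕏 h) (P.*-congʳ h≋))
            where
            nh : h ≋0̸
            nh z = ℬ.A≋0̸ (P.trans e (P.trans (P.*-congˡ z) (P.zeroʳ 𝕏q-𝕏)))
            deg-h : deg h ≡ 0
            deg-h = ℕ.+-cancelˡ-≡ q (deg h) 0 (≡.trans (≡.trans (≡.cong (ℕ._+ deg h) (≡.sym deg-𝕏q-𝕏)) (≡.trans (≡.sym (deg-* 𝕏q-𝕏≋0̸ nh)) (deg-cong (P.sym e))))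
              (≡.trans ℬ.deg-A (≡.trans (#-full (W? whole) (λ _ → ≡.refl)) (≡.sym (ℕ.+-identityʳ q)))))
            h≋ : h ≋ C (coeff h 0)
            h≋ = mk λ { zero → ≡.refl ; (suc i) → ≡.subst (λ m → h <° suc m) deg-h (<°deg h) (suc i) (s≤s z≤n) }

      parametrisation : Poly
      parametrisation = C (proj₁ (invert (proj₁ scaled) (proj₁ (proj₂ scaled)))) *ₚ ℬ.B

      private
        B = parametrisation

        B∘A : comp B A ≋ 𝕏q-𝕏
        B∘A = P.trans (comp-* (C _) ℬ.B A) (P.trans (P.*-cong (comp-C _ A) (P.trans ℬ.factor (proj₂ (proj₂ scaled)))) (C-inv (proj₁ (proj₂ scaled)) 𝕏q-𝕏))

        A-neg : ∀ f → comp A (P.- f) ≋ P.- comp A f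
        A-neg f = P.trans (P.solve 2 (λ x y → x P.:= (x P.:+ y) P.:- y) P.refl (comp A (P.- f)) (comp A f)) (P.trans (P.+-congʳ
          (P.trans (P.sym (comp-A-+ (P.- f) f)) (P.trans (comp-congˡ A (P.-‿inverseˡ f)) A∘0))) (P.+-identityˡ _))
          where
          A∘0 : comp A [] ≋ []
          A∘0 = P.trans (P.solve 1 (λ x → x P.:= (x P.:+ x) P.:- x) P.refl (comp A []))
            (P.trans (P.+-congʳ (P.trans (P.sym (comp-A-+ [] [])) (comp-congˡ A (P.+-identityʳ [])))) (P.-‿inverseʳ (comp A [])))

        -- (A ∘ B) ∘ A = A ∘ (X^q − X) = A^q − A = (X^q − X) ∘ A.
        A∘B : comp A B ≋ 𝕏q-𝕏
        A∘B = comp-injective (comp A B) 𝕏q-𝕏 1≤deg-A (P.begin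
          comp (comp A B) A                                P.≈⟨ comp-comp A B A ⟩
          comp A (comp B A)                                P.≈⟨ comp-congˡ A (P.trans B∘A 𝕏q-𝕏≡) ⟩
          comp A (𝕏 P.^ q P.- 𝕏)                           P.≈⟨ comp-A-+ (𝕏 P.^ q) (P.- 𝕏) ⟩
          comp A (𝕏 P.^ q) +ₚ comp A (P.- 𝕏)               P.≈⟨ P.+-cong (comp-𝕏^q A) (P.trans (A-neg 𝕏) (P.-‿cong (A∘𝕏 A))) ⟩
          A P.^ q P.- A                                    P.≈⟨ P.+-cong (P.trans (comp-^ 𝕏 q A) (P.^-congˡ q (comp-𝕏 A))) (P.-‿cong (comp-𝕏 A)) ⟨
          comp (𝕏 P.^ q) A P.- comp 𝕏 A                    P.≈⟨ P.trans (P.sym (comp-sub (𝕏 P.^ q) 𝕏 A)) (comp-cong A (P.sym 𝕏q-𝕏≡)) ⟩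
          comp 𝕏q-𝕏 A                                      P.∎)
          where
          A∘𝕏 : ∀ f → comp f 𝕏 ≋ f
          A∘𝕏 []      = P.refl
          A∘𝕏 (a ∷ f) = P.trans (P.+-congˡ (P.*-congˡ (A∘𝕏 f))) (P.sym (∷≋C+𝕏* a f))

      B≋0̸ : B ≋0̸
      B≋0̸ z = 𝕏q-𝕏≋0̸ (P.trans (P.sym B∘A) (comp-zero B A z))

      deg*size : deg B ℕ.* size U ≡ q
      deg*size = ≡.trans (≡.cong (deg B ℕ.*_) (≡.sym deg-A)) (≡.trans (≡.sym (deg-comp B 1≤deg-A B≋0̸)) (≡.trans (deg-cong B∘A) deg-𝕏q-𝕏))

      1≤deg-B : 1 ℕ.≤ deg B
      1≤deg-B = ℕ.n≢0⇒n>0 λ e → ℕ.<⇒≢ (ℕ.<⇒≤ q≥2) (≡.trans (≡.cong (ℕ._* size U) (≡.sym e)) deg*size)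

      values : ∀ x → W U (eval B x)
      values x = root⇒W (eval B x) (≡.trans (≡.sym (eval-comp A B x)) (≡.trans (eval-cong x A∘B) (eval-𝕏q-𝕏 x)))

      private
        value? : Decidable (λ u → ∃[ x ] eval B x ≡ u)
        value? u = Fin.any? (λ x → eval B x Fin.≟ u)

      -- Each value is taken at most deg B times, and deg B times the size of `U` is q, so no
      -- element of `U` can be missed.
      onto : ∀ u → W U u → ∃[ x ] eval B x ≡ u
      onto = #-full-subset value? (W? U) (λ { _ (x , ≡.refl) → values x })
        (ℕ.*-cancelˡ-≤ (deg B) {{ℕ.>-nonZero 1≤deg-B}} (≡.subst (ℕ._≤ deg B ℕ.* # value?) (≡.sym deg*size)
          (≡.subst (ℕ._≤ deg B ℕ.* # value?) (#-full all? (λ _ → ≡.refl)) (Fibres.#-fibres-≤ all? (eval B) value? (deg B) (λ x _ → x , ≡.refl) fibre))))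
        where
        all? : Decidable (λ (x : Fin q) → x ≡ x)
        all? x = x Fin.≟ x
        fibre : ∀ y → _ → # (Fibres.fibre? all? (eval B) y) ℕ.≤ deg B
        fibre y _ = ℕ.≤-trans (#-mono (Fibres.fibre? all? (eval B) y) (λ x → eval (B +ₚ C (- y)) x Fin.≟ 0#)
            (λ x (_ , e) → ≡.trans (eval-+ B (C (- y)) x) (≡.trans (≡.cong₂ _+_ e (eval-C (- y) x)) (-‿inverseʳ y))))
          (ℕ.≤-trans (#-roots (B +ₚ C (- y)) (deg≥1⇒≋0̸ (≡.subst (1 ℕ.≤_) (≡.sym dB) 1≤deg-B))) (ℕ.≤-reflexive dB))
          where dB = deg-F+C B (- y) 1≤deg-B

    -- c ↦ c^v maps L* to the roots of e^((P−1)/v) = 1, and its fibres are cosets of the group of v-th roots of unity.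
    roots-of-unity : ∀ v → 1 ℕ.≤ v → v ∣ P-1 → v ℕ.≤ # (λ c → L*? c ×-dec (c ^ v Fin.≟ 1#))
    roots-of-unity v 1≤v (divides w P-1≡) = ℕ.*-cancelʳ-≤ v N w {{ℕ.>-nonZero 1≤w}} (≡.subst (ℕ._≤ N ℕ.* w) (≡.trans #L* (≡.trans P-1≡ (ℕ.*-comm w v)))
        (ℕ.≤-trans (Fibres.#-fibres-≤ L*? (_^ v) root? N powers fibre) (ℕ.*-monoʳ-≤ N #root)))
      where
      N = # (λ c → L*? c ×-dec (c ^ v Fin.≟ 1#))
      1≤w : 1 ℕ.≤ w
      1≤w = ℕ.n≢0⇒n>0 λ e → ℕ.<⇒≢ (ℕ.≤-pred (≡.subst (2 ℕ.≤_) Q≡ Q≥2)) (≡.sym (≡.trans P-1≡ (≡.cong (ℕ._* v) e)))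
      root? : Decidable (λ e → e ^ w ≡ 1#)
      root? e = e ^ w Fin.≟ 1#
      #root : # root? ℕ.≤ w
      #root = ℕ.≤-trans (#-mono root? (Fibres.fibre? (λ (x : Fin q) → x Fin.≟ x) (λ z → 1# * z ^ w) 1#) (λ x h → ≡.refl , ≡.trans (*-identityˡ _) h))
        (#-power-fibre w 1≤w (λ x → x Fin.≟ x) 1# 1≢0 1#)
      powers : ∀ c → L c × c ≢ 0# → (c ^ v) ^ w ≡ 1#
      powers c (c∈ , c≢0) = ≡.trans (^-assocʳ c v w) (≡.trans (≡.cong (c ^_) (≡.trans (ℕ.*-comm v w) (≡.sym P-1≡))) (L^P-1 c∈ c≢0))
      fibre : ∀ y → _ → # (Fibres.fibre? L*? (_^ v) y) ℕ.≤ N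
      fibre y _ = split (Fin.any? (Fibres.fibre? L*? (_^ v) y))
        where
        split : Dec (∃[ c ] (L c × c ≢ 0#) × c ^ v ≡ y) → # (Fibres.fibre? L*? (_^ v) y) ℕ.≤ N
        split (no none) = ℕ.≤-trans (ℕ.≤-reflexive (#-empty (Fibres.fibre? L*? (_^ v) y) (λ c h → none (c , h)))) z≤n
        split (yes (z , (z∈ , z≢0) , zv)) = ℕ.≤-trans (ℕ.≤-reflexive (#-permute (Fibres.fibre? L*? (_^ v) y) (dilation z z≢0)))
          (#-mono (λ c → Fibres.fibre? L*? (_^ v) y (z * c)) (λ c → L*? c ×-dec (c ^ v Fin.≟ 1#)) (λ c ((zc∈ , zc≢0) , e) →
            (L*-cancel c z∈ z≢0 zc∈ , λ c≡0 → zc≢0 (≡.trans (≡.cong (z *_) c≡0) (zeroʳ z))) ,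
            x-y≈0⇒x≈y (*-cancel-0 (^-≉0 v z≢0) (≡.trans (solve 2 (λ z c → z :* (c :- con (pos 1)) := z :* c :- z) ≡.refl (z ^ v) (c ^ v))
              (x≈y⇒x-y≈0 (≡.trans (≡.sym (^-distrib-* z c v)) (≡.trans e (≡.sym zv))))))))

  record MinimalValueSet (V : Fin q → Set) (V? : Decidable V) : Set where
    field
      F      : Poly
      1≤deg  : 1 ℕ.≤ deg F
      values : ∀ x → V (eval F x)
      onto   : ∀ y → V y → ∃[ x ] eval F x ≡ y
      size   : .{{_ : ℕ.NonZero (deg F)}} → # V? ≡ (q ℕ.∸ 1) / deg F ℕ.+ 1

  converse : {V : Fin q → Set} (V? : Decidable V) → PowerCoset V → MinimalValueSet V V?
  converse {V} V? 𝒫 = record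
    { F = F ; 1≤deg = ≡.subst (1 ℕ.≤_) (≡.sym deg-F) (ℕ.*-mono-≤ 1≤v 1≤deg-B)
    ; values = λ x → ≡.subst V (≡.sym (eval-F x)) (from (eval B x) (values x))
    ; onto = λ y y∈ → surjective y (to y y∈)
    ; size = ≡.trans #V (≡.trans (ℕ.+-comm 1 w) (≡.cong (ℕ._+ 1) (≡.sym quotient))) }
    where
    open PowerCoset 𝒫
    open Annihilators 𝕃 k 1≤k #𝕃 hiding (module Parametrisation)
    open Annihilators.Parametrisation 𝕃 k 1≤k #𝕃 U renaming (parametrisation to B)
    open Subspace U
    D M w : ℕ
    D = deg B
    M = size U
    G F : Poly
    G = C a *ₚ B P.^ v
    F = G +ₚ C b
    nB^v : B P.^ v ≋0̸
    nB^v = ^ₚ-≋0̸ v B≋0̸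
    deg-G : deg G ≡ v ℕ.* D
    deg-G = ≡.trans (deg-C* a≢0 nB^v) (deg-^ v B≋0̸)
    deg-F : deg F ≡ v ℕ.* D
    deg-F = ≡.trans (deg-F+C G b (≡.subst (1 ℕ.≤_) (≡.sym deg-G) (ℕ.*-mono-≤ 1≤v 1≤deg-B))) deg-G
    eval-F : ∀ x → eval F x ≡ a * eval B x ^ v + b
    eval-F x = ≡.trans (eval-+ G (C b) x) (≡.cong₂ _+_ (≡.trans (eval-* (C a) (B P.^ v) x) (≡.cong₂ _*_ (eval-C a x) (eval-^ B v x))) (eval-C b x))
    surjective : ∀ y → ∃[ u ] W u × y ≡ a * u ^ v + b → ∃[ x ] eval F x ≡ y
    surjective y (u , u∈ , e) = proj₁ X , ≡.trans (eval-F (proj₁ X)) (≡.trans (≡.cong (λ u → a * u ^ v + b) (proj₂ X)) (≡.sym e))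
      where
      X : ∃[ x ] eval B x ≡ u
      X = onto u u∈
    -- The size of U is a power of p^k, and v divides p^k - 1.
    v∣M-1 : v ∣ ℕ.pred M
    v∣M-1 = power (size-power U)
      where
      v∣P^ : ∀ j → v ∣ ℕ.pred (Q ℕ.^ j)
      v∣P^ zero    = divides 0 ≡.refl
      v∣P^ (suc j) = combine v∣ (v∣P^ j)
        where
        combine : v ∣ Q ℕ.∸ 1 → v ∣ ℕ.pred (Q ℕ.^ j) → v ∣ ℕ.pred (Q ℕ.* Q ℕ.^ j)
        combine (divides x e) (divides y e′) = divides (x ℕ.+ y ℕ.+ x ℕ.* v ℕ.* y) (≡.trans (≡.cong₂ (λ A B → ℕ.pred (A ℕ.* B))
            (≡.trans (≡.sym (ℕ.m+[n∸m]≡n (ℕ.<⇒≤ Q≥2))) (≡.cong suc e))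
            (≡.trans (≡.sym (ℕ.suc-pred (Q ℕ.^ j) {{ℕ.m^n≢0 Q j {{ℕ.>-nonZero (ℕ.<⇒≤ Q≥2)}}}})) (≡.cong suc e′)))
            (≡.cong ℕ.pred (eq x y v)))
          where
          open import Data.Nat.Tactic.RingSolver using (solve-∀)
          eq : ∀ x y v → suc (x ℕ.* v) ℕ.* suc (y ℕ.* v) ≡ suc ((x ℕ.+ y ℕ.+ x ℕ.* v ℕ.* y) ℕ.* v)
          eq = solve-∀
      power : ∃[ j ] size U ≡ # L? ℕ.^ j → v ∣ ℕ.pred M
      power (j , e) = ≡.subst (λ m → v ∣ ℕ.pred m) (≡.sym (≡.trans e (≡.cong (ℕ._^ j) #𝕃))) (v∣P^ j)
    w = _∣_.quotient v∣M-1
    M≡ : M ≡ suc (w ℕ.* v)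
    M≡ = ≡.trans (≡.sym (ℕ.suc-pred M {{ℕ.>-nonZero (ℕ.n≢0⇒n>0 λ e → ℕ.<⇒≢ (ℕ.<⇒≤ q≥2) (≡.sym (≡.trans (≡.sym deg*size) (≡.trans (≡.cong (D ℕ.*_) e) (ℕ.*-zeroʳ D)))))}}))
      (≡.cong suc (_∣_.equality v∣M-1))
    U*? : Decidable (λ u → W u × u ≢ 0#)
    U*? = nonzero? W?
    #U* : # U*? ≡ v ℕ.* w
    #U* = ℕ.suc-injective (≡.trans (≡.sym (#-remove W? 0# 0∈W U*?)) (≡.trans M≡ (≡.cong suc (ℕ.*-comm w v))))
    V₀? : Decidable (λ y → V (y + b))
    V₀? y = V? (y + b)
    V*? : Decidable (λ y → V (y + b) × y ≢ 0#)
    V*? = nonzero? V₀?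
    cancel-b : ∀ {x y} → x + b ≡ y + b → x ≡ y
    cancel-b {x} {y} e = ≡.trans (solve 2 (λ x b → x := x :+ b :- b) ≡.refl x b) (≡.trans (≡.cong (_- b) e) (solve 2 (λ y b → y :+ b :- b := y) ≡.refl y b))
    0^v : a * 0# ^ v ≡ 0#
    0^v = ≡.trans (≡.cong (a *_) (0^ v 1≤v)) (zeroʳ a)
    f : Fin q → Fin q
    f u = a * u ^ v
    -- The fibres of u ↦ a u^v over nonzero values have exactly v elements.
    #V* : # V*? ≡ w
    #V* = ℕ.*-cancelˡ-≡ (# V*?) w v {{ℕ.>-nonZero 1≤v}} (≡.trans (ℕ.≤-antisym
        (Fibres.#-fibres-≥ U*? f V*? v fibre-≥)
        (Fibres.#-fibres-≤ U*? f V*? v (λ u (u∈ , u≢0) → from u u∈ , *-≉0 a≢0 (^-≉0 v u≢0)) (λ y _ → #-power-fibre v 1≤v U*? a a≢0 y))) #U*)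
      where
      fibre-≥ : ∀ y → V (y + b) × y ≢ 0# → v ℕ.≤ # (Fibres.fibre? U*? f y)
      fibre-≥ y (y∈ , y≢0) = through (to (y + b) y∈)
        where
        through : ∃[ u ] W u × y + b ≡ a * u ^ v + b → v ℕ.≤ # (Fibres.fibre? U*? f y)
        through (u , u∈ , e) = ℕ.≤-trans (roots-of-unity v 1≤v (≡.subst (v ∣_) (≡.cong (ℕ._∸ 1) Q≡) v∣)) (ℕ.≤-trans
            (#-mono (λ c → L*? c ×-dec (c ^ v Fin.≟ 1#)) (λ c → Fibres.fibre? U*? f y (u * c)) (λ c ((c∈ , c≢0) , cv) →
              (≡.subst W (*-comm c u) (*-W c∈ u∈) , *-≉0 u≢0 c≢0) ,
              ≡.trans (≡.cong (a *_) (≡.trans (^-distrib-* u c v) (≡.trans (≡.cong (u ^ v *_) cv) (*-identityʳ _)))) (≡.sym y≡)))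
            (ℕ.≤-reflexive (≡.sym (#-permute (Fibres.fibre? U*? f y) (dilation u u≢0)))))
          where
          y≡ : y ≡ a * u ^ v
          y≡ = cancel-b e
          u≢0 : u ≢ 0#
          u≢0 u≡0 = y≢0 (≡.trans y≡ (≡.trans (≡.cong (λ u → a * u ^ v) u≡0) 0^v))
    #V : # V? ≡ suc w
    #V = ≡.trans (≡.trans (#-permute V? (translation b)) (#-cong (λ y → V? (b + y)) V₀? (λ y → ≡.subst V (+-comm b y)) (λ y → ≡.subst V (+-comm y b))))
      (≡.trans (#-remove V₀? 0# (≡.subst (λ x → V (x + b)) 0^v (from 0# 0∈W)) V*?) (≡.cong suc #V*))
    -- q − 1 = w v D + (D − 1)
    quotient : .{{_ : ℕ.NonZero (deg F)}} → (q ℕ.∸ 1) / deg F ≡ w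
    quotient = ≡.trans (≡.cong (_/ deg F) q-1≡) (≡.trans (+-distrib-/-∣ʳ (ℕ.pred D) (n∣m*n w))
        (≡.cong₂ ℕ._+_ (m<n⇒m/n≡0 small) (m*n/n≡m w (deg F))))
      where
      D≡ : D ≡ suc (ℕ.pred D)
      D≡ = ≡.sym (ℕ.suc-pred D {{ℕ.>-nonZero 1≤deg-B}})
      small : ℕ.pred D ℕ.< deg F
      small = ≡.subst₂ ℕ._≤_ D≡ (≡.sym deg-F) (ℕ.m≤n*m D v {{ℕ.>-nonZero 1≤v}})
      q-1≡ : q ℕ.∸ 1 ≡ ℕ.pred D ℕ.+ w ℕ.* deg F
      q-1≡ = ≡.trans (≡.cong (ℕ._∸ 1) (≡.sym (≡.trans (≡.sym (≡.trans (≡.cong (D ℕ.*_) M≡) (ℕ.*-suc D (w ℕ.* v)))) deg*size)))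
        (≡.trans (ℕ.+-∸-comm (D ℕ.* (w ℕ.* v)) 1≤deg-B) (≡.cong₂ ℕ._+_ ≡.refl (≡.trans (eq D w v) (≡.cong (w ℕ.*_) (≡.sym deg-F)))))
        where
        open import Data.Nat.Tactic.RingSolver using (solve-∀)
        eq : ∀ D w v → D ℕ.* (w ℕ.* v) ≡ w ℕ.* (v ℕ.* D)
        eq = solve-∀

  -- Passage between the given field and the field on its index set.

  open import Data.Nat.DivMod using (m/n*n≤m)
  import Data.Fin.Subset as Subset
  import Data.Fin.Subset.Properties as Subset
  open import Data.Bool.Base using (true)
  open import Data.Vec.Base using (tabulate)
  open import Data.Vec.Properties using ([]=⇒lookup; lookup⇒[]=; lookup∘tabulate)
  open import Function.Bundles using (module Inverse; mk⇔)
  open import Relation.Nullary.Decidable using (⌊_⌋)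

  module _ {P : Fin q → Set} (P? : Decidable P) where

    private
      sound : {A : Set} (d : Dec A) → ⌊ d ⌋ ≡ true → A
      sound (yes a) _ = a

      complete : {A : Set} (d : Dec A) → A → ⌊ d ⌋ ≡ true
      complete (yes _) _ = ≡.refl
      complete (no ¬a) a = contradiction a ¬a

    toSubset : Subset q
    toSubset = tabulate (λ i → ⌊ P? i ⌋)

    ∈-toSubset⁻ : ∀ {i} → i Subset.∈ toSubset → P i
    ∈-toSubset⁻ {i} i∈ = sound (P? i) (≡.trans (≡.sym (lookup∘tabulate (λ i → ⌊ P? i ⌋) i)) ([]=⇒lookup i∈))

    ∈-toSubset⁺ : ∀ {i} → P i → i Subset.∈ toSubset
    ∈-toSubset⁺ {i} Pi = lookup⇒[]= i toSubset (≡.trans (lookup∘tabulate (λ i → ⌊ P? i ⌋) i) (complete (P? i) Pi))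

    ∣toSubset∣ : ∣ toSubset ∣ ≡ # P?
    ∣toSubset∣ = ≡.trans (∣∣≡# toSubset) (#-cong (Subset._∈? toSubset) P? (λ _ → ∈-toSubset⁻) (λ _ → ∈-toSubset⁺))

  record Compatible {c ℓ} (K : FiniteField c ℓ q) : Set c where
    private module K = FiniteField K
    field
      index-+ : ∀ x y → K.index (x K.+ y) ≡ K.index x + K.index y
      index-* : ∀ x y → K.index (x K.* y) ≡ K.index x * K.index y
      index-neg : ∀ x → K.index (K.- x) ≡ - K.index x
      index-0 : K.index K.0# ≡ 0#
      index-1 : K.index K.1# ≡ 1#

  module Transport {c ℓ} (K : FiniteField c ℓ q) (compatible : Compatible K) where

    open Compatible compatible

    private
      module K = FiniteField K
      module O = Over K
      open import Algebra.Properties.Semiring.Exp K.semiring using () renaming (_^_ to _^ᴷ_)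
      open K using (index; element)
      module E = Inverse K.enumeration

    index-cong : ∀ {x y} → x K.≈ y → index x ≡ index y
    index-cong = E.to-cong

    index-element : ∀ i → index (element i) ≡ i
    index-element = E.strictlyInverseˡ

    element-index : ∀ x → element (index x) K.≈ x
    element-index = E.strictlyInverseʳ

    index-injective : ∀ {x y} → index x ≡ index y → x K.≈ y
    index-injective {x} {y} e = K.trans (K.sym (element-index x)) (K.trans (K.reflexive (≡.cong element e)) (element-index y))

    index-^ : ∀ x m → index (x ^ᴷ m) ≡ index x ^ m
    index-^ x zero    = index-1
    index-^ x (suc m) = ≡.trans (index-* x (x ^ᴷ m)) (≡.cong (index x *_) (index-^ x m))

    index-el+ : ∀ i j → index (element i K.+ element j) ≡ i + j
    index-el+ i j = ≡.trans (index-+ (element i) (element j)) (≡.cong₂ _+_ (index-element i) (index-element j))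

    index-el* : ∀ i j → index (element i K.* element j) ≡ i * j
    index-el* i j = ≡.trans (index-* (element i) (element j)) (≡.cong₂ _*_ (index-element i) (index-element j))

    module _ (F : O.Poly) where

      coeff-index : ∀ i → coeff (map index F) i ≡ index (O.coeff F i)
      coeff-index = go F
        where
        go : ∀ F i → coeff (map index F) i ≡ index (O.coeff F i)
        go []      i       = ≡.sym index-0
        go (a ∷ F) zero    = ≡.refl
        go (a ∷ F) (suc i) = go F i

      eval-index : ∀ x → index (O.eval F x) ≡ eval (map index F) (index x)
      eval-index x = go F
        where
        go : ∀ F → index (O.eval F x) ≡ eval (map index F) (index x)
        go []      = index-0
        go (a ∷ F) = ≡.trans (index-+ a (x K.* O.eval F x)) (≡.cong (index a +_)
          (≡.trans (index-* x (O.eval F x)) (≡.cong (index x *_) (go F))))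

      deg-index : ∀ {d} → O.HasDegree F d → deg (map index F) ≡ d
      deg-index {d} (top , above) = deg-unique {map index F}
        (λ e → top (index-injective (≡.trans (≡.sym (coeff-index d)) (≡.trans e (≡.sym index-0)))))
        (λ i d<i → ≡.trans (coeff-index i) (≡.trans (index-cong (above i d<i)) index-0))

    module _ (f : Poly) where

      coeff-element : ∀ i → index (O.coeff (map element f) i) ≡ coeff f i
      coeff-element = go f
        where
        go : ∀ f i → index (O.coeff (map element f) i) ≡ coeff f i
        go []      i       = index-0
        go (a ∷ f) zero    = index-element a
        go (a ∷ f) (suc i) = go f i

      eval-element : ∀ x → index (O.eval (map element f) x) ≡ eval f (index x)
      eval-element x = go f
        where
        go : ∀ f → index (O.eval (map element f) x) ≡ eval f (index x)
        go []      = index-0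
        go (a ∷ f) = ≡.trans (index-+ (element a) (x K.* O.eval (map element f) x)) (≡.cong₂ _+_ (index-element a)
          (≡.trans (index-* x (O.eval (map element f) x)) (≡.cong (index x *_) (go f))))

      hasDegree : f ≋0̸ → O.HasDegree (map element f) (deg f)
      hasDegree nf = (λ e → lead≉0 f nf (≡.trans (≡.sym (coeff-element (deg f))) (≡.trans (index-cong e) index-0))) ,
        (λ i d<i → index-injective (≡.trans (coeff-element i) (≡.trans (<°deg f i d<i) (≡.sym index-0))))

    module _ (f : K.Carrier → K.Carrier) (U : Subset q) where

      private
        image? : Decidable (λ i → ∃[ j ] j Subset.∈ U × i ≡ index (f (element j)))
        image? i = Fin.any? (λ j → (j Subset.∈? U) ×-dec (i Fin.≟ index (f (element j))))

      image⁻ : ∀ {i} → i Subset.∈ O.image f U → ∃[ j ] j Subset.∈ U × i ≡ index (f (element j))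
      image⁻ = ∈-toSubset⁻ image?

      image⁺ : ∀ j → j Subset.∈ U → index (f (element j)) Subset.∈ O.image f U
      image⁺ j j∈ = ∈-toSubset⁺ image? (j , j∈ , ≡.refl)

    module _ (a b : K.Carrier) (U : Subset q) (v : ℕ) where

      private
        value : ∀ u → index (a K.* element (index (element u ^ᴷ v)) K.+ b) ≡ index a * u ^ v + index b
        value u = ≡.trans (index-+ _ b) (≡.cong (_+ index b) (≡.trans (index-* a _) (≡.cong (index a *_)
          (≡.trans (index-element _) (≡.trans (index-^ (element u) v) (^-congˡ v (index-element u)))))))

      affine-powers⁻ : ∀ {i} → i Subset.∈ O.affine a (O.powers U v) b → ∃[ u ] u Subset.∈ U × i ≡ index a * u ^ v + index b
      affine-powers⁻ i∈ = outer (image⁻ (λ w → a K.* w K.+ b) (O.powers U v) i∈)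
        where
        outer : ∀ {i} → ∃[ j ] j Subset.∈ O.powers U v × i ≡ index (a K.* element j K.+ b) → ∃[ u ] u Subset.∈ U × i ≡ index a * u ^ v + index b
        outer (j , j∈ , ≡.refl) = inner (image⁻ (_^ᴷ v) U j∈)
          where
          inner : ∃[ u ] u Subset.∈ U × j ≡ index (element u ^ᴷ v) → ∃[ u ] u Subset.∈ U × index (a K.* element j K.+ b) ≡ index a * u ^ v + index b
          inner (u , u∈ , ≡.refl) = u , u∈ , value u

      affine-powers⁺ : ∀ u → u Subset.∈ U → index a * u ^ v + index b Subset.∈ O.affine a (O.powers U v) b
      affine-powers⁺ u u∈ = ≡.subst (Subset._∈ O.affine a (O.powers U v) b) (value u)
        (image⁺ (λ w → a K.* w K.+ b) (O.powers U v) _ (image⁺ (_^ᴷ v) U u u∈))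

    subset-≡ : ∀ {S T : Subset q} → (∀ {i} → i Subset.∈ S → i Subset.∈ T) → (∀ {i} → i Subset.∈ T → i Subset.∈ S) → S ≡ T
    subset-≡ S⊂T T⊂S = Subset.⊆-antisym S⊂T T⊂S

    IsPowerCoset : Subset q → Set _
    IsPowerCoset S =
      ∃[ a ] ∃[ b ] ∃[ U ] ∃[ v ] ∃[ k ]
      ¬ (a K.≈ K.0#)
      × (k ℕ.≥ 1 × O.IsSubspaceOver𝔽 (p ℕ.^ k) U × K.1# O.∈ U)
      × (v ℕ.≥ 1 × v ∣ p ℕ.^ k ℕ.∸ 1)
      × S ≡ O.affine a (O.powers U v) b

    module _ (S : Subset q) where

      private
        V : Fin q → Set
        V = Subset._∈ S

        V? : Decidable V
        V? = Subset._∈? S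

      coset⇒ : PowerCoset V → IsPowerCoset S
      coset⇒ 𝒫 = element a , element b , Uˢ , v , k ,
          (λ e → a≢0 (≡.trans (≡.sym (index-element a)) (≡.trans (index-cong e) index-0))) ,
          (1≤k , (Lˢ , isSubfield , ≡.trans (∣toSubset∣ L?) #𝕃 , isSubspace) , ≡.subst (Subset._∈ Uˢ) (≡.sym index-1) (U⁺ 1∈U)) ,
          (1≤v , v∣) , subset-≡ S⊂ ⊂S
        where
        open PowerCoset 𝒫
        open Subfield 𝕃
        open Subspaces 𝕃 using (module Subspace)
        open Subspace U
        Uˢ Lˢ : Subset q
        Uˢ = toSubset W?
        Lˢ = toSubset L?
        U⁻ : ∀ {i} → i Subset.∈ Uˢ → W i
        U⁻ = ∈-toSubset⁻ W?
        U⁺ : ∀ {i} → W i → i Subset.∈ Uˢ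
        U⁺ = ∈-toSubset⁺ W?
        L⁻ : ∀ {i} → i Subset.∈ Lˢ → L i
        L⁻ = ∈-toSubset⁻ L?
        L⁺ : ∀ {i j} → i ≡ j → L j → i Subset.∈ Lˢ
        L⁺ ≡.refl = ∈-toSubset⁺ L?
        W⁺ : ∀ {i j} → i ≡ j → W j → i Subset.∈ Uˢ
        W⁺ ≡.refl = ∈-toSubset⁺ W?
        isSubfield : O.IsSubfield Lˢ
        isSubfield = record
          { 0∈ = L⁺ index-0 0∈L ; 1∈ = L⁺ index-1 1∈L
          ; +-closed = λ {x} {y} x∈ y∈ → L⁺ (index-+ x y) (+-L (L⁻ x∈) (L⁻ y∈))
          ; -‿closed = λ {x} x∈ → L⁺ (index-neg x) (neg-L (L⁻ x∈))
          ; *-closed = λ {x} {y} x∈ y∈ → L⁺ (index-* x y) (*-L (L⁻ x∈) (L⁻ y∈))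
          ; ⁻¹-closed = λ {x} {y} x∈ e → L⁺ ≡.refl (inv-L (L⁻ x∈) (≡.trans (≡.sym (index-* x y)) (≡.trans (index-cong e) index-1))) }
        isSubspace : O.IsSubspace Lˢ Uˢ
        isSubspace = record
          { 0∈ = W⁺ index-0 0∈W
          ; +-closed = λ {x} {y} x∈ y∈ → W⁺ (index-+ x y) (+-W (U⁻ x∈) (U⁻ y∈))
          ; *-closed = λ {x} {y} x∈ y∈ → W⁺ (index-* x y) (*-W (L⁻ x∈) (U⁻ y∈)) }
        index-ab : ∀ u → index (element a) * u ^ v + index (element b) ≡ a * u ^ v + b
        index-ab u = ≡.cong₂ (λ a b → a * u ^ v + b) (index-element a) (index-element b)
        S⊂ : ∀ {i} → i Subset.∈ S → i Subset.∈ O.affine (element a) (O.powers Uˢ v) (element b)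
        S⊂ {i} i∈ = power (to i i∈)
          where
          power : ∃[ u ] W u × i ≡ a * u ^ v + b → i Subset.∈ O.affine (element a) (O.powers Uˢ v) (element b)
          power (u , u∈ , e) = ≡.subst (Subset._∈ O.affine (element a) (O.powers Uˢ v) (element b)) (≡.trans (index-ab u) (≡.sym e))
            (affine-powers⁺ (element a) (element b) Uˢ v u (U⁺ u∈))
        ⊂S : ∀ {i} → i Subset.∈ O.affine (element a) (O.powers Uˢ v) (element b) → i Subset.∈ S
        ⊂S {i} i∈ = power (affine-powers⁻ (element a) (element b) Uˢ v i∈)
          where
          power : ∃[ u ] u Subset.∈ Uˢ × i ≡ index (element a) * u ^ v + index (element b) → i Subset.∈ S
          power (u , u∈ , e) = ≡.subst (Subset._∈ S) (≡.sym (≡.trans e (index-ab u))) (from u (U⁻ u∈))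

      ⇒coset : IsPowerCoset S → PowerCoset V
      ⇒coset (a , b , U , v , k , a≉0 , (1≤k , (Lˢ , isSubfield , ∣L∣ , isSubspace) , 1∈U) , (1≤v , v∣) , S≡) = record
        { a = index a ; b = index b ; a≢0 = λ e → a≉0 (index-injective (≡.trans e (≡.sym index-0)))
        ; k = k ; v = v ; 1≤k = 1≤k ; 𝕃 = 𝕃 ; #𝕃 = ≡.trans (≡.sym (∣∣≡# Lˢ)) ∣L∣
        ; U = record
          { W = Subset._∈ U ; W? = Subset._∈? U ; 0∈W = ≡.subst (Subset._∈ U) index-0 (O.IsSubspace.0∈ isSubspace)
          ; +-W = λ {x} {y} x∈ y∈ → ≡.subst (Subset._∈ U) (index-el+ x y) (O.IsSubspace.+-closed isSubspace (el U x∈) (el U y∈))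
          ; *-W = λ {x} {y} x∈ y∈ → ≡.subst (Subset._∈ U) (index-el* x y) (O.IsSubspace.*-closed isSubspace (el Lˢ x∈) (el U y∈)) }
        ; 1∈U = ≡.subst (Subset._∈ U) index-1 1∈U ; 1≤v = 1≤v ; v∣ = v∣
        ; to = λ y y∈ → affine-powers⁻ a b U v (≡.subst (y Subset.∈_) S≡ y∈)
        ; from = λ u u∈ → ≡.subst (_ Subset.∈_) (≡.sym S≡) (affine-powers⁺ a b U v u u∈) }
        where
        el : ∀ T {i} → i Subset.∈ T → element i O.∈ T
        el T {i} = ≡.subst (Subset._∈ T) (≡.sym (index-element i))
        𝕃 : Subfield
        𝕃 = record
          { L = Subset._∈ Lˢ ; L? = Subset._∈? Lˢ
          ; 1∈L = ≡.subst (Subset._∈ Lˢ) index-1 1∈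
          ; +-L = λ {x} {y} x∈ y∈ → ≡.subst (Subset._∈ Lˢ) (index-el+ x y) (+-closed (el Lˢ x∈) (el Lˢ y∈))
          ; neg-L = λ {x} x∈ → ≡.subst (Subset._∈ Lˢ) (≡.trans (index-neg (element x)) (≡.cong -_ (index-element x))) (-‿closed (el Lˢ x∈))
          ; *-L = λ {x} {y} x∈ y∈ → ≡.subst (Subset._∈ Lˢ) (index-el* x y) (*-closed (el Lˢ x∈) (el Lˢ y∈))
          ; inv-L = λ {x} {y} x∈ e → ≡.subst (Subset._∈ Lˢ) (index-element y) (⁻¹-closed (el Lˢ x∈)
              (index-injective (≡.trans (index-el* x y) (≡.trans e (≡.sym index-1))))) }
          where open O.IsSubfield isSubfield

      mvsp⇒ : ∣ S ∣ ℕ.> 2 → ∃[ F ] O.IsMVSP F × O.valueSet F ≡ S → PowerCoset V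
      mvsp⇒ 2<∣S∣ (F , (d , d≢0 , hasDeg , card) , V≡S) = forward V? (map index F)
          (≡.subst (1 ℕ.≤_) (≡.sym dF) (ℕ.>-nonZero⁻¹ d {{d≢0}}))
          (λ x → ≡.subst₂ Subset._∈_ (≡.trans (eval-index F (element x)) (≡.cong (eval (map index F)) (index-element x))) V≡S (image⁺ (O.eval F) Subset.⊤ x Subset.∈⊤))
          (≡.subst (3 ℕ.≤_) (∣∣≡# S) 2<∣S∣)
          (≡.subst₂ (λ s d → ℕ.pred s ℕ.* d ℕ.< q) (∣∣≡# S) (≡.sym dF)
            (≡.subst (λ s → ℕ.pred s ℕ.* d ℕ.< q) (≡.trans (≡.trans (≡.sym (ℕ.+-comm _ 1)) (≡.sym card)) (≡.cong ∣_∣ V≡S)) bound))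
        where
        dF : deg (map index F) ≡ d
        dF = deg-index F hasDeg
        -- This is how minimality enters: the number of values minus one is the integer part of (q -
        -- 1)/d.
        bound : ((q ℕ.∸ 1) / d) {{d≢0}} ℕ.* d ℕ.< q
        bound = ℕ.≤-<-trans (m/n*n≤m (q ℕ.∸ 1) d {{d≢0}}) (≡.subst (q ℕ.∸ 1 ℕ.<_) (ℕ.m+[n∸m]≡n (ℕ.<⇒≤ q≥2)) (ℕ.n<1+n (q ℕ.∸ 1)))

      ⇒mvsp : MinimalValueSet V V? → ∃[ F ] O.IsMVSP F × O.valueSet F ≡ S
      ⇒mvsp M = map element F , (deg F , ℕ.>-nonZero 1≤deg , hasDegree F (deg≥1⇒≋0̸ 1≤deg) ,
          ≡.trans (≡.cong ∣_∣ V≡S) (≡.trans (∣∣≡# S) (size {{ℕ.>-nonZero 1≤deg}}))) , V≡S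
        where
        open MinimalValueSet M
        value : ∀ x → index (O.eval (map element F) (element x)) ≡ eval F x
        value x = ≡.trans (eval-element F (element x)) (≡.cong (eval F) (index-element x))
        V≡S : O.valueSet (map element F) ≡ S
        V≡S = subset-≡ (λ i∈ → into (image⁻ (O.eval (map element F)) Subset.⊤ i∈)) (λ {i} i∈ → hit (onto i i∈))
          where
          into : ∀ {i} → ∃[ j ] j Subset.∈ Subset.⊤ × i ≡ index (O.eval (map element F) (element j)) → i Subset.∈ S
          into (j , _ , ≡.refl) = ≡.subst (Subset._∈ S) (≡.sym (value j)) (values j)
          hit : ∀ {i} → ∃[ x ] eval F x ≡ i → i Subset.∈ O.valueSet (map element F)
          hit (x , ≡.refl) = ≡.subst (Subset._∈ O.valueSet (map element F)) (value x) (image⁺ (O.eval (map element F)) Subset.⊤ x Subset.∈⊤)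

      characterisation : ∣ S ∣ ℕ.> 2 → (∃[ F ] O.IsMVSP F × O.valueSet F ≡ S) ⇔ IsPowerCoset S
      characterisation 2<∣S∣ = mk⇔ (λ M → coset⇒ (mvsp⇒ 2<∣S∣ M)) (λ C → ⇒mvsp (converse V? (⇒coset C)))

-- The field structure on the indices.

open import Data.Nat.Base using (_^_; _∸_; _≥_; _>_)
open import Data.Nat.Divisibility using (_∣_)
open import Algebra.Morphism.Structures using (IsRingMonomorphism)
open import Function.Bundles using (module Inverse)
import Algebra.Morphism.RingMonomorphism as RingMonomorphism

module Indices {c ℓ} (p n : ℕ) (pr : Prime p) (n≥1 : n ≥ 1) (K : FiniteField c ℓ (p ^ n)) where

  open FiniteField K
  private
    module E = Inverse enumeration

  element-index : ∀ x → element (index x) ≈ x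
  element-index = E.strictlyInverseʳ

  element-cong : ∀ {i j} → i ≡ j → element i ≈ element j
  element-cong e = reflexive (≡.cong element e)

  element-injective : ∀ {i j} → element i ≈ element j → i ≡ j
  element-injective e = ≡.trans (≡.sym (E.strictlyInverseˡ _)) (≡.trans (E.to-cong e) (E.strictlyInverseˡ _))

  infixl 6 _+ᶠ_
  infixl 7 _*ᶠ_
  _+ᶠ_ _*ᶠ_ : Fin (p ^ n) → Fin (p ^ n) → Fin (p ^ n)
  i +ᶠ j = index (element i + element j)
  i *ᶠ j = index (element i * element j)

  -ᶠ_ : Fin (p ^ n) → Fin (p ^ n)
  -ᶠ i = index (- element i)

  -- The operations on indices are defined so that `element` preserves them up to `_≈_`; as
  -- `element` is injective, the ring laws can be pulled back to propositional equality.
  isRingMonomorphism : IsRingMonomorphism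
    (record { _≈_ = _≡_ ; _+_ = _+ᶠ_ ; _*_ = _*ᶠ_ ; -_ = -ᶠ_ ; 0# = index 0# ; 1# = index 1# }) rawRing element
  isRingMonomorphism = record
    { isRingHomomorphism = record
      { isSemiringHomomorphism = record
        { isNearSemiringHomomorphism = record
          { +-isMonoidHomomorphism = record
            { isMagmaHomomorphism = record
              { isRelHomomorphism = record { cong = element-cong } ; homo = λ _ _ → element-index _ }
            ; ε-homo = element-index 0# }
          ; *-homo = λ _ _ → element-index _ }
        ; 1#-homo = element-index 1# }
      ; -‿homo = λ _ → element-index _ }
    ; injective = element-injective }

  galoisData : GaloisData
  galoisData = record
    { p = p ; n = n ; pr = pr ; n≥1 = n≥1
    ; isCommutativeRing = RingMonomorphism.isCommutativeRing isRingMonomorphism isCommutativeRing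
    ; 1≢0 = λ e → 1≉0 (trans (sym (element-index 1#)) (trans (element-cong e) (element-index 0#)))
    ; invert = λ x x≢0 → inverse x (invertible (element x) (λ e → x≢0 (element-injective (trans e (sym (element-index 0#)))))) }
    where
    inverse : ∀ x → ∃[ y ] element x * y ≈ 1# → ∃[ y ] x *ᶠ y ≡ index 1#
    inverse x (y , e) = index y , E.to-cong (trans (*-congˡ (element-index y)) e)

  compatible : GaloisField.Compatible galoisData K
  compatible = record
    { index-+ = λ x y → E.to-cong (+-cong (sym (element-index x)) (sym (element-index y)))
    ; index-* = λ x y → E.to-cong (*-cong (sym (element-index x)) (sym (element-index y)))
    ; index-neg = λ x → E.to-cong (-‿cong (sym (element-index x)))
    ; index-0 = ≡.refl ; index-1 = ≡.refl }

theorem2p2 : ∀ {c ℓ} (p n : ℕ) → Prime p → n ≥ 1 →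
    (K : FiniteField c ℓ (p ^ n)) (S : Subset (p ^ n)) → ∣ S ∣ > 2 →
    (∃[ F ] Over.IsMVSP K F × Over.valueSet K F ≡ S)
    ⇔
    (∃[ a ] ∃[ b ] ∃[ U ] ∃[ v ] ∃[ k ]
    ¬ (FiniteField._≈_ K a (FiniteField.0# K))
    × (k ≥ 1 × Over.IsSubspaceOver𝔽 K (p ^ k) U × Over._∈_ K (FiniteField.1# K) U)
    × (v ≥ 1 × v ∣ p ^ k ∸ 1)
    × S ≡ Over.affine K a (Over.powers K U v) b)
theorem2p2 p n pr n≥1 K S = GaloisField.Transport.characterisation galoisData K compatible S
  where open Indices p n pr n≥1 K
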